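{- Let $0<\varepsilon<0.01$ be any fixed number. There is $q_0(\varepsilon)$ such that if $q\ge q_{0}(\varepsilon)$ is prime, $m$ is an integer with $(m,q)=1$, and $q^{37/38+\varepsilon}\le N\le \tfrac{1}{2}q$, then the congruence \[ p_{1}(p_{1}+p_{2}+p_{3})\equiv m\pmod{q} \] has a solution in primes $p_{1},p_{2},p_{3}$ with $N<p_{1},p_{2},p_{3}\le 2N$. -}

module Defs where

open import Data.Nat using (ℕ; _+_; _*_; _^_; _≤_; _<_)
open import Data.Product using (_×_)

-- ε = a / b (a positive rational) satisfies 0 < ε < 0.01
EpsOK : ℕ → ℕ → Set
EpsOK a b = (0 < a) × (100 * a < b)

-- N = c / d (d > 0), and ε = a / b.
-- q ^ (37/38 + a/b) ≤ c / d   ⇔   q ^ (37 b + 38 a) * d ^ (38 b) ≤ c ^ (38 b)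
-- (raising both nonnegative sides to the power 38 b).
LowerBound : (a b q c d : ℕ) → Set
LowerBound a b q c d = q ^ (37 * b + 38 * a) * d ^ (38 * b) ≤ c ^ (38 * b)

UpperBound : (q c d : ℕ) → Set
UpperBound q c d = 2 * c ≤ q * d

InDyadic : (c d p : ℕ) → Set
InDyadic c d p = (c < p * d) × (p * d ≤ 2 * c)

module Submission where

-- Let χ be the indicator of the primes in (N , 2N], P their number and R = q χ - P, a function on
-- the residues with mean zero.  For z ≠ 0 put V(z) = Σ_t χ(t) R(m/z - z - t).  If the congruence has
-- no solution, then V(p) = -P² at every prime p in (N , 2N], so the sum of V over these primes,
-- smoothed over translates of a window with h ≈ P/2, has size at least P² h².
--
-- Let W be the smoothed V, and Z ≈ √q, D ≈ q^(1/4).  Buchstab's identity splits the sum of W over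
-- the integers without prime factors up to Z into Σ_{d < D} a(d) Σ_y W(d y) and a sum of b(d) W(d y)
-- over D ≤ d ≤ Z and y without prime factors below the least prime factor of d.  The conditions
-- linking d and y there are separated by comparing binary digits.  Both sums are bounded without
-- exponential sums: Cauchy-Schwarz reduces them to the correlations Σ_t R(t) R(t + x), and then to
-- counting coincidences.  In the second sum these are the solutions of 1/d₁ + 1/d₄ = 1/d₂ + 1/d₃
-- modulo q with all dᵢ in a dyadic interval, which are few by Dirichlet approximation and the
-- divisor bound.
--
-- All logarithms and divisor functions are below g, a small power of q, and both sums are small
-- once g^344 q^35 ≤ N^36, which follows from N ≥ q^(37/38).

-- Smoothing makes completion possible: it turns the cutoff on the variable into a convolution.
-- After Cauchy-Schwarz over the translation `k` and the residue `t` the variable runs over the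
-- whole field, so that substitutions such as `l = x k` are bijections and the weights enter only
-- through correlations. Centring `R` does the work of removing the trivial frequency: its
-- correlations sum to zero, so their sum along a line vanishes unless the line is constant.
--
-- The exponent comes from the second sum. For d of size M the decisive condition, up to powers of
-- g, is ν q^9 ≤ M N^9, where ν bounds the number of ways to write a residue as 1/d + 1/e, and
-- Dirichlet approximation gives ν² of order 1 + M³/q. At M = q^(1/4) and at M = q^(1/2) this
-- becomes the same condition q^35 ≤ N^36. Hence `D` is put at q^(1/4), where the first sum, which
-- needs q^27 < N^28, still has room. As 35/36 < 37/38, a power of q is left over, and it pays for
-- g.

-- Opaque integer arithmetic and inequalities.

module Int where

  open import Data.Unit using (⊤; tt)
  open import Data.Nat as ℕ using (ℕ)
  open import Data.Integer using (ℤ; +_; -[1+_]; 0ℤ; 1ℤ; _≤_; +≤+; -≤+; ∣_∣)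
  import Data.Integer as ℤ
  import Data.Integer.Properties as ℤP
  import Data.Nat.Properties as ℕP
  open import Data.Integer.Tactic.RingSolver using (solve-∀)
  open import Relation.Binary.PropositionalEquality

  infixl 6 _+_ _-_
  infixl 7 _*_
  infix 8 -_

  -- The integer operations are made opaque: otherwise they unfold during unification, and
  -- implicit arguments cannot be inferred.
  opaque
    _+_ _*_ : ℤ → ℤ → ℤ
    _+_ = ℤ._+_
    _*_ = ℤ._*_
    -_ : ℤ → ℤ
    -_ = ℤ.-_
    -- A handle for the opaque block: `unfolding arith` elsewhere makes all three operations
    -- transparent, which is how the ring solver is applied to them.
    arith : ⊤
    arith = tt

  _-_ : ℤ → ℤ → ℤ
  a - b = a + (- b)

  opaque
    unfolding arith

    +-def : ∀ a b → a + b ≡ a ℤ.+ b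
    +-def a b = refl

    *-def : ∀ a b → a * b ≡ a ℤ.* b
    *-def a b = refl

    +-comm : ∀ a b → a + b ≡ b + a
    +-comm = ℤP.+-comm

    +-assoc : ∀ a b c → a + b + c ≡ a + (b + c)
    +-assoc = ℤP.+-assoc

    +-identityˡ : ∀ a → 0ℤ + a ≡ a
    +-identityˡ = ℤP.+-identityˡ

    +-identityʳ : ∀ a → a + 0ℤ ≡ a
    +-identityʳ = ℤP.+-identityʳ

    *-comm : ∀ a b → a * b ≡ b * a
    *-comm = ℤP.*-comm

    *-assoc : ∀ a b c → a * b * c ≡ a * (b * c)
    *-assoc = ℤP.*-assoc

    *-identityˡ : ∀ a → 1ℤ * a ≡ a
    *-identityˡ = ℤP.*-identityˡ

    *-identityʳ : ∀ a → a * 1ℤ ≡ a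
    *-identityʳ = ℤP.*-identityʳ

    *-zeroˡ : ∀ a → 0ℤ * a ≡ 0ℤ
    *-zeroˡ = ℤP.*-zeroˡ

    *-zeroʳ : ∀ a → a * 0ℤ ≡ 0ℤ
    *-zeroʳ = ℤP.*-zeroʳ

    *-distribˡ-+ : ∀ a b c → a * (b + c) ≡ a * b + a * c
    *-distribˡ-+ = ℤP.*-distribˡ-+

    *-distribʳ-+ : ∀ a b c → (b + c) * a ≡ b * a + c * a
    *-distribʳ-+ = ℤP.*-distribʳ-+

    neg-distrib-+ : ∀ a b → - (a + b) ≡ - a + - b
    neg-distrib-+ = ℤP.neg-distrib-+

    neg-0 : - 0ℤ ≡ 0ℤ
    neg-0 = refl

    neg-involutive : ∀ a → - - a ≡ a
    neg-involutive = ℤP.neg-involutive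

    a-a : ∀ a → a - a ≡ 0ℤ
    a-a = ℤP.+-inverseʳ

    pos-+ : ∀ m n → + (m ℕ.+ n) ≡ + m + + n
    pos-+ = ℤP.pos-+

    pos-* : ∀ m n → + (m ℕ.* n) ≡ + m * + n
    pos-* = ℤP.pos-*

    +-mono-≤ : ∀ {a b c d} → a ≤ b → c ≤ d → a + c ≤ b + d
    +-mono-≤ = ℤP.+-mono-≤

    neg-mono-≤ : ∀ {a b} → a ≤ b → - b ≤ - a
    neg-mono-≤ = ℤP.neg-mono-≤

    0≤-diff : ∀ {a b} → a ≤ b → 0ℤ ≤ b - a
    0≤-diff = ℤP.i≤j⇒0≤j-i

    ≤-by : ∀ {a b c} → 0ℤ ≤ c → b - a ≡ c → a ≤ b
    ≤-by 0≤c eq = ℤP.0≤i-j⇒j≤i (subst (0ℤ ≤_) (sym eq) 0≤c)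

    0≤sq : ∀ a → 0ℤ ≤ a * a
    0≤sq (+ n) = subst (0ℤ ≤_) (ℤP.pos-* n n) (+≤+ ℕ.z≤n)
    0≤sq -[1+ n ] = +≤+ ℕ.z≤n

    abs : ℤ → ℤ
    abs a = + ∣ a ∣

    abs-def : ∀ a → abs a ≡ + ∣ a ∣
    abs-def a = refl

    0≤abs : ∀ a → 0ℤ ≤ abs a
    0≤abs a = +≤+ ℕ.z≤n

    ≤abs : ∀ a → a ≤ abs a
    ≤abs (+ n) = ℤP.≤-refl
    ≤abs -[1+ n ] = -≤+

    abs-neg : ∀ a → abs (- a) ≡ abs a
    abs-neg a = cong +_ (ℤP.∣-i∣≡∣i∣ a)

    abs-sq : ∀ a → abs a * abs a ≡ a * a
    abs-sq (+ n) = refl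
    abs-sq -[1+ n ] = refl

    abs-+ : ∀ a b → abs (a + b) ≤ abs a + abs b
    abs-+ a b = +≤+ (ℤP.∣i+j∣≤∣i∣+∣j∣ a b)

    abs-* : ∀ a b → abs (a * b) ≡ abs a * abs b
    abs-* a b = trans (cong +_ (ℤP.abs-* a b)) (ℤP.pos-* ∣ a ∣ ∣ b ∣)

    0≤* : ∀ {a b} → 0ℤ ≤ a → 0ℤ ≤ b → 0ℤ ≤ a * b
    0≤* {+ a} {+ b} _ _ = subst (0ℤ ≤_) (ℤP.pos-* a b) (+≤+ ℕ.z≤n)

    *-mono-lem : ∀ a b c d → b * d - a * c ≡ (b - a) * d + a * (d - c)
    *-mono-lem = solve-∀

    *-diff : ∀ a b c → c * b - c * a ≡ c * (b - a)
    *-diff = solve-∀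

  open ℤP public using (≤-refl; ≤-reflexive; ≤-trans)

  0≤+ : ∀ {a b} → 0ℤ ≤ a → 0ℤ ≤ b → 0ℤ ≤ a + b
  0≤+ {a} {b} p q = subst (_≤ a + b) (+-identityˡ 0ℤ) (+-mono-≤ p q)

  *-mono-nonneg : ∀ {a b c d} → 0ℤ ≤ a → a ≤ b → 0ℤ ≤ c → c ≤ d → a * c ≤ b * d
  *-mono-nonneg {a} {b} {c} {d} 0≤a a≤b 0≤c c≤d =
    ≤-by (0≤+ (0≤* (0≤-diff a≤b) (≤-trans 0≤c c≤d)) (0≤* 0≤a (0≤-diff c≤d))) (*-mono-lem a b c d)

  *-monoˡ : ∀ {c a b} → 0ℤ ≤ c → a ≤ b → c * a ≤ c * b
  *-monoˡ {c} {a} {b} 0≤c a≤b = ≤-by (0≤* 0≤c (0≤-diff a≤b)) (*-diff a b c)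

  *-monoʳ : ∀ {c a b} → 0ℤ ≤ c → a ≤ b → a * c ≤ b * c
  *-monoʳ {c} {a} {b} 0≤c a≤b = subst₂ _≤_ (*-comm c a) (*-comm c b) (*-monoˡ 0≤c a≤b)

  sq-mono : ∀ {a b} → 0ℤ ≤ a → a ≤ b → a * a ≤ b * b
  sq-mono 0≤a a≤b = *-mono-nonneg 0≤a a≤b 0≤a a≤b

  -≤abs : ∀ a → - a ≤ abs a
  -≤abs a = subst (- a ≤_) (abs-neg a) (≤abs (- a))

  abs-≤⇒sq-≤ : ∀ {a b} → abs a ≤ b → a * a ≤ b * b
  abs-≤⇒sq-≤ {a} p = ≤-trans (≤-reflexive (sym (abs-sq a))) (sq-mono (0≤abs a) p)

  abs-nonneg : ∀ {a} → 0ℤ ≤ a → abs a ≡ a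
  abs-nonneg {+ n} _ = abs-def (+ n)

  0≤+ₙ : ∀ {n} → 0ℤ ≤ + n
  0≤+ₙ = +≤+ ℕ.z≤n

  pow4 : ℤ → ℤ
  pow4 a = (a * a) * (a * a)

  0≤pow4 : ∀ a → 0ℤ ≤ pow4 a
  0≤pow4 a = 0≤sq (a * a)

  pow4-mono : ∀ {a b} → 0ℤ ≤ a → a ≤ b → pow4 a ≤ pow4 b
  pow4-mono {a} 0≤a a≤b = sq-mono (0≤sq a) (sq-mono 0≤a a≤b)

  +-monoʳ : ∀ {c a b} → a ≤ b → c + a ≤ c + b
  +-monoʳ = +-mono-≤ ≤-refl

  +-monoˡ : ∀ {c a b} → a ≤ b → a + c ≤ b + c
  +-monoˡ p = +-mono-≤ p ≤-refl

  sq-≤⇒abs-≤ : ∀ {a b} → 0ℤ ≤ b → a * a ≤ b * b → abs a ≤ b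
  sq-≤⇒abs-≤ {a} {+ n} _ p = subst (_≤ + n) (sym (abs-def a)) (+≤+ (ℕP.≮⇒≥ λ n<m →
    ℕP.<⇒≱ (ℕP.*-mono-< n<m n<m) (ℤP.drop‿+≤+ (subst₂ _≤_ eqa (sym (pos-* n n)) p))))
    where
    eqa : a * a ≡ + (∣ a ∣ ℕ.* ∣ a ∣)
    eqa = trans (sym (abs-sq a)) (trans (cong₂ _*_ (abs-def a) (abs-def a)) (sym (pos-* ∣ a ∣ ∣ a ∣)))

-- Finite sums over lists, indicators and changes of variables.

module Sums where

  open import Data.Bool using (if_then_else_)
  open import Data.Integer using (ℤ; +_; 0ℤ; 1ℤ; _≤_)
  open Int
  open import Data.Integer.Tactic.RingSolver using (solve-∀)
  open import Data.List using (List; []; _∷_; length; map; _++_; cartesianProduct)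
  open import Data.List.Membership.Propositional using (_∈_)
  open import Data.List.Relation.Unary.Any using (here; there)
  open import Data.Product using (_×_; _,_; proj₁; proj₂; ∃)
  open import Data.Product.Properties using (≡-dec)
  open import Data.Sum using (_⊎_; inj₁; inj₂)
  open import Function using (_∘_)
  open import Relation.Nullary using (Dec; yes; no; does; ¬_; contradiction)
  open import Relation.Binary.Definitions using (DecidableEquality)
  open import Relation.Binary.PropositionalEquality

  private variable
    A B C : Set

  opaque
    unfolding arith
    ring1 : ∀ a b c d → a + b + (c + d) ≡ a + c + (b + d)
    ring1 = solve-∀
    ring2 : ∀ c n → c + n * c ≡ (1ℤ + n) * c
    ring2 = solve-∀
    ring3 : ∀ a b S P Q → (a * a + P) * (b * b + Q) - (a * b + S) * (a * b + S) ≡ P * Q - S * S + (a * a * Q + ((- (a * b + a * b)) * S + b * b * P))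
    ring3 = solve-∀
    ring4 : ∀ a b c d → (a * d - b * c) * (a * d - b * c) ≡ a * a * (d * d) + ((- (a * b + a * b)) * (c * d) + b * b * (c * c))
    ring4 = solve-∀
    ring5 : ∀ n s → (n * s) * (n * s) ≡ (n * n) * (s * s)
    ring5 = solve-∀
    ring6 : ∀ n s → (n * n) * (n * s) ≡ (n * n * n) * s
    ring6 = solve-∀
    ring7 : ∀ a b c → a * (b * c) ≡ c * (a * b)
    ring7 = solve-∀

  ∑ : List A → (A → ℤ) → ℤ
  ∑ [] f = 0ℤ
  ∑ (x ∷ xs) f = f x + ∑ xs f

  ∑-cong : ∀ (xs : List A) {f g : A → ℤ} → (∀ x → f x ≡ g x) → ∑ xs f ≡ ∑ xs g
  ∑-cong [] eq = refl
  ∑-cong (x ∷ xs) eq = cong₂ _+_ (eq x) (∑-cong xs eq)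

  ∑-cong-∈ : ∀ (xs : List A) {f g : A → ℤ} → (∀ x → x ∈ xs → f x ≡ g x) → ∑ xs f ≡ ∑ xs g
  ∑-cong-∈ [] eq = refl
  ∑-cong-∈ (x ∷ xs) eq = cong₂ _+_ (eq x (here refl)) (∑-cong-∈ xs (λ y p → eq y (there p)))

  ∑-mono-∈ : ∀ (xs : List A) {f g : A → ℤ} → (∀ x → x ∈ xs → f x ≤ g x) → ∑ xs f ≤ ∑ xs g
  ∑-mono-∈ [] le = ≤-refl
  ∑-mono-∈ (x ∷ xs) le = +-mono-≤ (le x (here refl)) (∑-mono-∈ xs (λ y p → le y (there p)))

  ∑-mono : ∀ (xs : List A) {f g : A → ℤ} → (∀ x → f x ≤ g x) → ∑ xs f ≤ ∑ xs g
  ∑-mono xs le = ∑-mono-∈ xs (λ x _ → le x)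

  ∑-0 : ∀ (xs : List A) → ∑ xs (λ _ → 0ℤ) ≡ 0ℤ
  ∑-0 [] = refl
  ∑-0 (x ∷ xs) = trans (+-identityˡ _) (∑-0 xs)

  ∑-zero : ∀ (xs : List A) {f : A → ℤ} → (∀ x → f x ≡ 0ℤ) → ∑ xs f ≡ 0ℤ
  ∑-zero xs eq = trans (∑-cong xs eq) (∑-0 xs)

  ∑-nonneg : ∀ (xs : List A) {f : A → ℤ} → (∀ x → 0ℤ ≤ f x) → 0ℤ ≤ ∑ xs f
  ∑-nonneg xs le = subst (_≤ ∑ xs _) (∑-0 xs) (∑-mono xs le)

  ∑-+ : ∀ (xs : List A) (f g : A → ℤ) → ∑ xs (λ x → f x + g x) ≡ ∑ xs f + ∑ xs g
  ∑-+ [] f g = sym (+-identityˡ 0ℤ)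
  ∑-+ (x ∷ xs) f g = trans (cong (_+_ (f x + g x)) (∑-+ xs f g)) (ring1 (f x) (g x) _ _)

  ∑-*ˡ : ∀ (xs : List A) c (f : A → ℤ) → ∑ xs (λ x → c * f x) ≡ c * ∑ xs f
  ∑-*ˡ [] c f = sym (*-zeroʳ c)
  ∑-*ˡ (x ∷ xs) c f = trans (cong (_+_ (c * f x)) (∑-*ˡ xs c f)) (sym (*-distribˡ-+ c (f x) _))

  ∑-*ʳ : ∀ (xs : List A) c (f : A → ℤ) → ∑ xs (λ x → f x * c) ≡ ∑ xs f * c
  ∑-*ʳ xs c f = trans (∑-cong xs (λ x → *-comm (f x) c)) (trans (∑-*ˡ xs c f) (*-comm c _))

  ∑-neg : ∀ (xs : List A) (f : A → ℤ) → ∑ xs (λ x → - f x) ≡ - ∑ xs f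
  ∑-neg [] f = sym neg-0
  ∑-neg (x ∷ xs) f = trans (cong (_+_ (- f x)) (∑-neg xs f)) (sym (neg-distrib-+ (f x) _))

  ∑-- : ∀ (xs : List A) (f g : A → ℤ) → ∑ xs (λ x → f x - g x) ≡ ∑ xs f - ∑ xs g
  ∑-- xs f g = trans (∑-+ xs f (λ x → - g x)) (cong (_+_ (∑ xs f)) (∑-neg xs g))

  ∑-const : ∀ (xs : List A) c → ∑ xs (λ _ → c) ≡ + length xs * c
  ∑-const [] c = sym (*-zeroˡ c)
  ∑-const (x ∷ xs) c = trans (cong (_+_ c) (∑-const xs c))
    (trans (ring2 c (+ length xs)) (cong (_* c) (sym (pos-+ 1 (length xs)))))

  ∑-≤-const : ∀ (xs : List A) c {f : A → ℤ} → (∀ x → x ∈ xs → f x ≤ c) → ∑ xs f ≤ + length xs * c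
  ∑-≤-const xs c le = ≤-trans (∑-mono-∈ xs le) (≤-reflexive (∑-const xs c))

  ∑-swap : ∀ (xs : List A) (ys : List B) (f : A → B → ℤ) →
    ∑ xs (λ x → ∑ ys (f x)) ≡ ∑ ys (λ y → ∑ xs (λ x → f x y))
  ∑-swap [] ys f = sym (∑-0 ys)
  ∑-swap (x ∷ xs) ys f = trans (cong (_+_ (∑ ys (f x))) (∑-swap xs ys f))
    (sym (∑-+ ys (f x) (λ y → ∑ xs (λ x → f x y))))

  ∑-++ : ∀ (xs ys : List A) (f : A → ℤ) → ∑ (xs ++ ys) f ≡ ∑ xs f + ∑ ys f
  ∑-++ [] ys f = sym (+-identityˡ _)
  ∑-++ (x ∷ xs) ys f = trans (cong (_+_ (f x)) (∑-++ xs ys f)) (sym (+-assoc (f x) _ _))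

  ∑-map : ∀ (g : A → B) (xs : List A) (f : B → ℤ) → ∑ (map g xs) f ≡ ∑ xs (f ∘ g)
  ∑-map g [] f = refl
  ∑-map g (x ∷ xs) f = cong (_+_ (f (g x))) (∑-map g xs f)

  ∑-product : ∀ (xs : List A) (ys : List B) (f : A × B → ℤ) →
    ∑ (cartesianProduct xs ys) f ≡ ∑ xs (λ x → ∑ ys (λ y → f (x , y)))
  ∑-product [] ys f = refl
  ∑-product (x ∷ xs) ys f = trans (∑-++ (map (x ,_) ys) (cartesianProduct xs ys) f)
    (cong₂ _+_ (∑-map (x ,_) ys f) (∑-product xs ys f))

  ∑-* : ∀ (xs : List A) (ys : List B) (f : A → ℤ) (g : B → ℤ) →
    ∑ xs f * ∑ ys g ≡ ∑ xs (λ x → ∑ ys (λ y → f x * g y))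
  ∑-* xs ys f g = trans (sym (∑-*ʳ xs (∑ ys g) f)) (∑-cong xs (λ x → sym (∑-*ˡ ys (f x) g)))

  ∑-abs : ∀ (xs : List A) (f : A → ℤ) → abs (∑ xs f) ≤ ∑ xs (λ x → abs (f x))
  ∑-abs [] f = ≤-reflexive (abs-nonneg ≤-refl)
  ∑-abs (x ∷ xs) f = ≤-trans (abs-+ (f x) _) (+-monoʳ (∑-abs xs f))

  -- Lagrange's identity by induction: prepending `x` raises the difference of the two sides by the
  -- sum of the squares of the determinants `f x * g y - g x * f y`, which is `cross`.
  cauchy-schwarz : ∀ (xs : List A) (f g : A → ℤ) →
    ∑ xs (λ x → f x * g x) * ∑ xs (λ x → f x * g x) ≤
    ∑ xs (λ x → f x * f x) * ∑ xs (λ x → g x * g x)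
  cauchy-schwarz [] f g = ≤-refl
  cauchy-schwarz (x ∷ xs) f g =
    ≤-by (0≤+ (0≤-diff (cauchy-schwarz xs f g)) (∑-nonneg xs (λ y → 0≤sq (f x * g y - g x * f y))))
      (trans (ring3 (f x) (g x) S P Q) (cong (_+_ (P * Q - S * S)) (sym cross)))
    where
    S P Q : ℤ
    S = ∑ xs (λ x → f x * g x)
    P = ∑ xs (λ x → f x * f x)
    Q = ∑ xs (λ x → g x * g x)
    cross : ∑ xs (λ y → (f x * g y - g x * f y) * (f x * g y - g x * f y)) ≡
      f x * f x * Q + ((- (f x * g x + f x * g x)) * S + g x * g x * P)
    cross = trans (∑-cong xs (λ y → ring4 (f x) (g x) (f y) (g y)))
      (trans (∑-+ xs _ _) (cong₂ _+_ (∑-*ˡ xs _ _)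
        (trans (∑-+ xs _ _) (cong₂ _+_ (∑-*ˡ xs _ _) (∑-*ˡ xs _ _)))))

  ∑-sq-≤ : ∀ (xs : List A) (f : A → ℤ) → ∑ xs f * ∑ xs f ≤ + length xs * ∑ xs (λ x → f x * f x)
  ∑-sq-≤ xs f = subst₂ (λ u v → u * u ≤ v * ∑ xs (λ x → f x * f x))
    (∑-cong xs (λ x → *-identityˡ (f x)))
    (trans (∑-const xs (1ℤ * 1ℤ)) (trans (cong (+ length xs *_) (*-identityˡ 1ℤ)) (*-identityʳ _)))
    (cauchy-schwarz xs (λ _ → 1ℤ) f)

  -- Hölder's inequality with exponent 4, as Cauchy-Schwarz applied twice.
  ∑-pow4-≤ : ∀ (xs : List A) (f : A → ℤ) →
    pow4 (∑ xs f) ≤ (+ length xs * + length xs * + length xs) * ∑ xs (λ x → pow4 (f x))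
  ∑-pow4-≤ xs f = ≤-trans (sq-mono (0≤sq S) (∑-sq-≤ xs f))
    (≤-trans (≤-reflexive (ring5 n S₂)) (≤-trans (*-monoˡ (0≤sq n) (∑-sq-≤ xs (λ x → f x * f x))) (≤-reflexive (ring6 n _))))
    where
    n S S₂ : ℤ
    n = + length xs
    S = ∑ xs f
    S₂ = ∑ xs (λ x → f x * f x)

  𝟙 : {P : Set} → Dec P → ℤ
  𝟙 d = if does d then 1ℤ else 0ℤ

  𝟙-yes : ∀ {P : Set} (d : Dec P) → P → 𝟙 d ≡ 1ℤ
  𝟙-yes (yes _) _ = refl
  𝟙-yes (no ¬p) p = contradiction p ¬p

  𝟙-no : ∀ {P : Set} (d : Dec P) → ¬ P → 𝟙 d ≡ 0ℤ
  𝟙-no (yes p) ¬p = contradiction p ¬p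
  𝟙-no (no _) _ = refl

  𝟙-cong : ∀ {P Q : Set} (d : Dec P) (e : Dec Q) → (P → Q) → (Q → P) → 𝟙 d ≡ 𝟙 e
  𝟙-cong (yes p) e to from = sym (𝟙-yes e (to p))
  𝟙-cong (no ¬p) e to from = sym (𝟙-no e (¬p ∘ from))

  0≤𝟙 : ∀ {P : Set} (d : Dec P) → 0ℤ ≤ 𝟙 d
  0≤𝟙 (yes _) = 0≤+ₙ
  0≤𝟙 (no _) = ≤-refl

  𝟙≤1 : ∀ {P : Set} (d : Dec P) → 𝟙 d ≤ 1ℤ
  𝟙≤1 (yes _) = ≤-refl
  𝟙≤1 (no _) = 0≤+ₙ

  𝟙-mono : ∀ {P Q : Set} (d : Dec P) (e : Dec Q) → (P → Q) → 𝟙 d ≤ 𝟙 e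
  𝟙-mono (yes p) e to = ≤-reflexive (sym (𝟙-yes e (to p)))
  𝟙-mono (no _) e to = 0≤𝟙 e

  𝟙-sq : ∀ {P : Set} (d : Dec P) → 𝟙 d * 𝟙 d ≡ 𝟙 d
  𝟙-sq (yes _) = *-identityˡ 1ℤ
  𝟙-sq (no _) = *-zeroˡ 0ℤ

  𝟙-× : ∀ {P Q S : Set} (d : Dec P) (e : Dec Q) (f : Dec S) → (P → Q × S) → (Q → S → P) → 𝟙 d ≡ 𝟙 e * 𝟙 f
  𝟙-× d (yes x) (yes y) to from = trans (𝟙-yes d (from x y)) (sym (*-identityˡ 1ℤ))
  𝟙-× d (yes x) (no ¬y) to from = trans (𝟙-no d (λ p → ¬y (proj₂ (to p)))) (sym (*-zeroʳ 1ℤ))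
  𝟙-× d (no ¬x) f to from = trans (𝟙-no d (λ p → ¬x (proj₁ (to p)))) (sym (*-zeroˡ (𝟙 f)))

  find : {P : A → Set} → (∀ x → Dec (P x)) → ∀ ys → (∃ λ y → y ∈ ys × P y) ⊎ (∀ y → y ∈ ys → ¬ P y)
  find P? [] = inj₂ (λ _ ())
  find P? (y ∷ ys) with P? y | find P? ys
  ... | yes p | _ = inj₁ (y , here refl , p)
  ... | no ¬p | inj₁ (z , z∈ , pz) = inj₁ (z , there z∈ , pz)
  ... | no ¬p | inj₂ none = inj₂ λ { z (here refl) → ¬p ; z (there z∈) → none z z∈ }

  module Multiplicity {A : Set} (_≟_ : DecidableEquality A) where

    -- Counting occurrences by an integer sum lets the fact that an element is listed once be
    -- rewritten inside other sums.
    mult : List A → A → ℤ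
    mult xs a = ∑ xs (λ x → 𝟙 (x ≟ a))

    ∑-δ : ∀ xs a (f : A → ℤ) → ∑ xs (λ x → 𝟙 (x ≟ a) * f x) ≡ mult xs a * f a
    ∑-δ xs a f = trans (∑-cong xs at) (∑-*ʳ xs (f a) (λ x → 𝟙 (x ≟ a)))
      where
      at : ∀ x → 𝟙 (x ≟ a) * f x ≡ 𝟙 (x ≟ a) * f a
      at x with x ≟ a
      ... | yes refl = refl
      ... | no _ = trans (*-zeroˡ (f x)) (sym (*-zeroˡ (f a)))

    mult-∉ : ∀ xs a → (∀ x → x ∈ xs → x ≢ a) → mult xs a ≡ 0ℤ
    mult-∉ xs a ne = trans (∑-cong-∈ xs (λ x p → 𝟙-no (x ≟ a) (ne x p))) (∑-0 xs)

    Enumeration Simple : List A → Set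
    Enumeration xs = ∀ a → mult xs a ≡ 1ℤ
    Simple xs = ∀ a → mult xs a ≤ 1ℤ

    -- A change of variables in which `φ` need not be injective. The hypothesis says that `φ x`
    -- occurs exactly once in `ys` whenever `w x` is nonzero, so inserting the indicator of
    -- `y = φ x` and interchanging the sums loses nothing.
    ∑-fibre : ∀ {X : Set} (xs : List X) (w : X → ℤ) (φ : X → A) (ys : List A) (f : A → ℤ) →
      (∀ x → x ∈ xs → w x * mult ys (φ x) ≡ w x) →
      ∑ xs (λ x → w x * f (φ x)) ≡ ∑ ys (λ y → f y * ∑ xs (λ x → w x * 𝟙 (y ≟ φ x)))
    ∑-fibre xs w φ ys f hit =
      trans (∑-cong-∈ xs spread) (trans (∑-swap xs ys _) (∑-cong ys collect))
      where
      spread : ∀ x → x ∈ xs → w x * f (φ x) ≡ ∑ ys (λ y → w x * (𝟙 (y ≟ φ x) * f y))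
      spread x p = sym (trans (∑-*ˡ ys (w x) _) (trans (cong (w x *_) (∑-δ ys (φ x) f))
        (trans (sym (*-assoc (w x) _ _)) (cong (_* f (φ x)) (hit x p)))))
      collect : ∀ y → ∑ xs (λ x → w x * (𝟙 (y ≟ φ x) * f y)) ≡ f y * ∑ xs (λ x → w x * 𝟙 (y ≟ φ x))
      collect y = trans (∑-cong xs (λ x → ring7 (w x) (𝟙 (y ≟ φ x)) (f y))) (∑-*ˡ xs (f y) _)

    ∑-fibre-≤ : ∀ {X : Set} (xs : List X) (w : X → ℤ) (φ : X → A) (ys : List A) (f : A → ℤ) c →
      (∀ y → 0ℤ ≤ f y) →
      (∀ x → x ∈ xs → w x * mult ys (φ x) ≡ w x) →
      (∀ y → ∑ xs (λ x → w x * 𝟙 (y ≟ φ x)) ≤ c) →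
      ∑ xs (λ x → w x * f (φ x)) ≤ c * ∑ ys f
    ∑-fibre-≤ xs w φ ys f c 0≤f hit fib = subst (_≤ c * ∑ ys f) (sym (∑-fibre xs w φ ys f hit))
      (≤-trans (∑-mono ys (λ y → *-monoˡ (0≤f y) (fib y)))
        (≤-reflexive (trans (∑-*ʳ ys c f) (*-comm _ c))))

    ∑-bijection : ∀ xs → Enumeration xs → (φ φ⁻¹ : A → A) →
      (∀ x → φ⁻¹ (φ x) ≡ x) → (∀ x → φ (φ⁻¹ x) ≡ x) →
      (f : A → ℤ) → ∑ xs (f ∘ φ) ≡ ∑ xs f
    ∑-bijection xs enum φ φ⁻¹ l r f =
      trans (∑-cong xs (λ x → sym (*-identityˡ _)))
        (trans (∑-fibre xs (λ _ → 1ℤ) φ xs f (λ x _ → trans (*-identityˡ _) (enum (φ x))))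
          (∑-cong xs (λ y → trans (cong (f y *_) (fib y)) (*-identityʳ _))))
      where
      fib : ∀ y → ∑ xs (λ x → 1ℤ * 𝟙 (y ≟ φ x)) ≡ 1ℤ
      fib y = trans (∑-cong xs (λ x → trans (*-identityˡ _)
        (𝟙-cong (y ≟ φ x) (x ≟ φ⁻¹ y) (λ e → trans (sym (l x)) (cong φ⁻¹ (sym e)))
                                       (λ e → trans (sym (r y)) (cong φ (sym e)))))) (enum (φ⁻¹ y))

    ∑-unique : ∀ xs → Simple xs → {P : A → Set} (P? : ∀ x → Dec (P x)) →
      (∀ x y → x ∈ xs → y ∈ xs → P x → P y → x ≡ y) → ∑ xs (λ x → 𝟙 (P? x)) ≤ 1ℤ
    ∑-unique xs simple {P} P? uniq with find P? xs
    ... | inj₁ (y , y∈ , py) = ≤-trans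
      (∑-mono-∈ xs (λ x x∈ → 𝟙-mono (P? x) (x ≟ y) (λ px → uniq x y x∈ y∈ px py))) (simple y)
    ... | inj₂ none = ≤-trans (≤-reflexive (trans (∑-cong-∈ xs (λ x x∈ → 𝟙-no (P? x) (none x x∈))) (∑-0 xs)))
      0≤+ₙ

  mult-cartesian : ∀ {A B : Set} (_≟A_ : DecidableEquality A) (_≟B_ : DecidableEquality B) xs ys x y →
    Multiplicity.mult (≡-dec _≟A_ _≟B_) (cartesianProduct xs ys) (x , y) ≡ Multiplicity.mult _≟A_ xs x * Multiplicity.mult _≟B_ ys y
  mult-cartesian _≟A_ _≟B_ xs ys x y = trans (∑-product xs ys _)
    (trans (∑-cong xs (λ x′ → ∑-cong ys (λ y′ →
      𝟙-× (≡-dec _≟A_ _≟B_ (x′ , y′) (x , y)) (x′ ≟A x) (y′ ≟B y) (λ { refl → refl , refl }) (λ { refl refl → refl }))))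
    (sym (∑-* xs ys _ _)))

  simple-cartesian : ∀ {A B : Set} (_≟A_ : DecidableEquality A) (_≟B_ : DecidableEquality B) xs ys →
    Multiplicity.Simple _≟A_ xs → Multiplicity.Simple _≟B_ ys → Multiplicity.Simple (≡-dec _≟A_ _≟B_) (cartesianProduct xs ys)
  simple-cartesian _≟A_ _≟B_ xs ys sx sy (x , y) = ≤-trans (≤-reflexive (mult-cartesian _≟A_ _≟B_ xs ys x y))
    (≤-trans (*-mono-nonneg (∑-nonneg xs (λ _ → 0≤𝟙 (_ ≟A x))) (sx x) (∑-nonneg ys (λ _ → 0≤𝟙 (_ ≟B y))) (sy y)) (≤-reflexive (*-identityˡ 1ℤ)))

-- Finite fields, their enumeration and a ring solver with integer coefficients.

module Field where

  open import Level using (0ℓ)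
  open import Data.Integer using (ℤ; +_; 0ℤ; 1ℤ)
  import Data.Integer as ℤ
  import Data.Integer.Properties as ℤP
  open import Data.List using (List; length)
  open import Data.Maybe using (just; nothing)
  open import Data.Sum using (_⊎_; inj₁; inj₂)
  open import Algebra.Bundles using (CommutativeRing; RawRing)
  open import Algebra.Structures using (IsCommutativeRing)
  import Algebra.Solver.Ring
  open import Algebra.Solver.Ring.AlmostCommutativeRing using (AlmostCommutativeRing; fromCommutativeRing; _-Raw-AlmostCommutative⟶_)
  open import Relation.Nullary using (yes; no)
  open import Relation.Binary.Definitions using (DecidableEquality)
  open import Relation.Binary.PropositionalEquality
  open Int
  open Sums

  -- The estimates see only this interface. The homomorphism `ι` belongs to it because the ring
  -- solver takes its coefficients from the integers and because congruences enter through it. The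
  -- inverse of zero is left unspecified.
  record FiniteField : Set₁ where
    infix 4 _≟_
    infixl 6 _⊕_
    infixl 7 _⊗_
    infix 8 ⊝_
    field
      F : Set
      _≟_ : DecidableEquality F
      _⊕_ _⊗_ : F → F → F
      ⊝_ _⁻¹ : F → F
      𝟎 𝟏 : F
      isCommutativeRing : IsCommutativeRing _≡_ _⊕_ _⊗_ ⊝_ 𝟎 𝟏
      ⊗-inverseʳ : ∀ x → x ≢ 𝟎 → x ⊗ x ⁻¹ ≡ 𝟏
      𝟏≢𝟎 : 𝟏 ≢ 𝟎
      ι : ℤ → F
      ι-+ : ∀ a b → ι (a ℤ.+ b) ≡ ι a ⊕ ι b
      ι-* : ∀ a b → ι (a ℤ.* b) ≡ ι a ⊗ ι b
      ι-neg : ∀ a → ι (ℤ.- a) ≡ ⊝ ι a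
      ι-0 : ι 0ℤ ≡ 𝟎
      ι-1 : ι 1ℤ ≡ 𝟏
      elems : List F
      enum : Multiplicity.Enumeration _≟_ elems

  module FieldTheory (𝔽 : FiniteField) where
    open FiniteField 𝔽 public
    open Multiplicity _≟_ public

    infixl 6 _⊖_
    _⊖_ : F → F → F
    a ⊖ b = a ⊕ (⊝ b)

    private
      commutativeRing : CommutativeRing 0ℓ 0ℓ
      commutativeRing = record { isCommutativeRing = isCommutativeRing }

      almostRing : AlmostCommutativeRing 0ℓ 0ℓ
      almostRing = fromCommutativeRing commutativeRing

      coefficients : RawRing 0ℓ 0ℓ
      coefficients = CommutativeRing.rawRing ℤP.+-*-commutativeRing

      morphism : coefficients -Raw-AlmostCommutative⟶ almostRing
      morphism = record
        { ⟦_⟧ = ι ; +-homo = ι-+ ; *-homo = ι-* ; -‿homo = ι-neg ; 0-homo = ι-0 ; 1-homo = ι-1 }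

      weak≟ : ∀ a b → Data.Maybe.Maybe (ι a ≡ ι b)
      weak≟ a b with a ℤP.≟ b
      ... | yes eq = just (cong ι eq)
      ... | no _ = nothing

    open Algebra.Solver.Ring coefficients almostRing morphism weak≟ public
      using (Polynomial; solve; _:=_; _:+_; _:*_; :-_; _:-_; con)

    open IsCommutativeRing isCommutativeRing public
      using ()
      renaming ( +-comm to ⊕-comm ; +-assoc to ⊕-assoc ; +-identityˡ to ⊕-identityˡ ; +-identityʳ to ⊕-identityʳ
               ; *-comm to ⊗-comm ; *-assoc to ⊗-assoc ; *-identityˡ to ⊗-identityˡ ; *-identityʳ to ⊗-identityʳ
               ; -‿inverseʳ to ⊝-inverseʳ ; zeroˡ to ⊗-zeroˡ ; zeroʳ to ⊗-zeroʳ )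

    a⊖b⊕b : ∀ a b → a ⊖ b ⊕ b ≡ a
    a⊖b⊕b = solve 2 (λ a b → a :- b :+ b := a) refl

    a⊕b⊖b : ∀ a b → a ⊕ b ⊖ b ≡ a
    a⊕b⊖b = solve 2 (λ a b → a :+ b :- b := a) refl

    ⊖≡0⇒≡ : ∀ {a b} → a ⊖ b ≡ 𝟎 → a ≡ b
    ⊖≡0⇒≡ {a} {b} eq = trans (sym (a⊖b⊕b a b)) (trans (cong (_⊕ b) eq) (⊕-identityˡ b))

    ⊗-cancelˡ : ∀ {a b c} → a ≢ 𝟎 → a ⊗ b ≡ a ⊗ c → b ≡ c
    ⊗-cancelˡ {a} {b} {c} a≢0 eq = trans (sym (undo b)) (trans (cong (a ⁻¹ ⊗_) eq) (undo c))
      where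
      undo : ∀ x → a ⁻¹ ⊗ (a ⊗ x) ≡ x
      undo x = trans (solve 3 (λ i a x → i :* (a :* x) := (a :* i) :* x) refl (a ⁻¹) a x)
        (trans (cong (_⊗ x) (⊗-inverseʳ a a≢0)) (⊗-identityˡ x))

    ⊗-≢0 : ∀ {a b} → a ≢ 𝟎 → b ≢ 𝟎 → a ⊗ b ≢ 𝟎
    ⊗-≢0 {a} {b} a≢0 b≢0 eq = b≢0 (⊗-cancelˡ a≢0 (trans eq (sym (⊗-zeroʳ a))))

    ⊗≡0 : ∀ {a b} → a ⊗ b ≡ 𝟎 → a ≡ 𝟎 ⊎ b ≡ 𝟎
    ⊗≡0 {a} {b} eq with a ≟ 𝟎
    ... | yes a≡0 = inj₁ a≡0
    ... | no a≢0 = inj₂ (⊗-cancelˡ a≢0 (trans eq (sym (⊗-zeroʳ a))))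

    ⁻¹-≢0 : ∀ {a} → a ≢ 𝟎 → a ⁻¹ ≢ 𝟎
    ⁻¹-≢0 {a} a≢0 eq = 𝟏≢𝟎 (trans (sym (⊗-inverseʳ a a≢0)) (trans (cong (a ⊗_) eq) (⊗-zeroʳ a)))

    ⁻¹-unique : ∀ {a b} → a ≢ 𝟎 → a ⊗ b ≡ 𝟏 → b ≡ a ⁻¹
    ⁻¹-unique a≢0 eq = ⊗-cancelˡ a≢0 (trans eq (sym (⊗-inverseʳ _ a≢0)))

    ⊝-𝟎 : ⊝ 𝟎 ≡ 𝟎
    ⊝-𝟎 = trans (sym (⊕-identityˡ _)) (⊝-inverseʳ 𝟎)

    ⊝-≢0 : ∀ {a} → a ≢ 𝟎 → ⊝ a ≢ 𝟎
    ⊝-≢0 {a} a≢0 eq = a≢0 (trans (solve 1 (λ a → a := :- (:- a)) refl a) (trans (cong ⊝_ eq) ⊝-𝟎))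

    ⊗-inverseˡ : ∀ {a} b → a ≢ 𝟎 → a ⊗ (a ⁻¹ ⊗ b) ≡ b
    ⊗-inverseˡ {a} b a≢0 = trans (sym (⊗-assoc a (a ⁻¹) b))
      (trans (cong (_⊗ b) (⊗-inverseʳ a a≢0)) (⊗-identityˡ b))

    ⁻¹-⊗ : ∀ {a b} → a ≢ 𝟎 → b ≢ 𝟎 → (a ⊗ b) ⁻¹ ≡ a ⁻¹ ⊗ b ⁻¹
    ⁻¹-⊗ {a} {b} a≢0 b≢0 = sym (⁻¹-unique (⊗-≢0 a≢0 b≢0)
      (trans (solve 4 (λ a b i j → (a :* b) :* (i :* j) := (a :* i) :* (b :* j)) refl a b (a ⁻¹) (b ⁻¹))
        (trans (cong₂ _⊗_ (⊗-inverseʳ a a≢0) (⊗-inverseʳ b b≢0)) (⊗-identityˡ 𝟏))))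

    ∑F : (F → ℤ) → ℤ
    ∑F = ∑ elems

    q : ℤ
    q = + length elems

    ∑F-const : ∀ c → ∑F (λ _ → c) ≡ q * c
    ∑F-const = ∑-const elems

    ∑F-⊕ : ∀ a f → ∑F (λ t → f (t ⊕ a)) ≡ ∑F f
    ∑F-⊕ a f = ∑-bijection elems enum (_⊕ a) (_⊖ a) (λ x → a⊕b⊖b x a) (λ x → a⊖b⊕b x a) f

    ∑F-reflect : ∀ a f → ∑F (λ t → f (a ⊖ t)) ≡ ∑F f
    ∑F-reflect a f = ∑-bijection elems enum (a ⊖_) (a ⊖_) inv inv f
      where
      inv : ∀ x → a ⊖ (a ⊖ x) ≡ x
      inv = solve 2 (λ a x → a :- (a :- x) := x) refl a

    ∑F-⊗ : ∀ {a} → a ≢ 𝟎 → ∀ f → ∑F (λ t → f (a ⊗ t)) ≡ ∑F f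
    ∑F-⊗ {a} a≢0 f = ∑-bijection elems enum (a ⊗_) (a ⁻¹ ⊗_) l (λ x → ⊗-inverseˡ x a≢0) f
      where
      l : ∀ x → a ⁻¹ ⊗ (a ⊗ x) ≡ x
      l x = ⊗-cancelˡ a≢0 (⊗-inverseˡ (a ⊗ x) a≢0)

    ∑F-δ : ∀ a f → ∑F (λ x → 𝟙 (x ≟ a) * f x) ≡ f a
    ∑F-δ a f = trans (∑-δ elems a f) (trans (cong (_* f a) (enum a)) (*-identityˡ _))

-- Correlations of functions on the field.

module Correlation where

  open import Data.Integer using (ℤ; 0ℤ; _≤_)
  open import Data.Integer.Tactic.RingSolver using (solve-∀)
  open import Data.List using (List)
  open import Relation.Binary.PropositionalEquality
  open Int
  open Sums
  open Field

  opaque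
    unfolding arith
    sq-factor : ∀ a b c d → (a * b) * (c * d) ≡ a * c * (b * d)
    sq-factor = solve-∀
    swap-middle : ∀ a b c → a * (b * c) ≡ b * (a * c)
    swap-middle = solve-∀

  ∑-sq : ∀ {A : Set} (xs : List A) (f : A → ℤ) → ∑ xs f * ∑ xs f ≡ ∑ xs (λ x → ∑ xs (λ y → f x * f y))
  ∑-sq xs f = ∑-* xs xs f f

  module Correlations (𝔽 : FiniteField) where
    open FieldTheory 𝔽

    -- The autocorrelation of `R`, whose Fourier transform is the squared absolute value of that of
    -- `R`. Working with it keeps every quantity an integer.
    ψ : (F → ℤ) → F → ℤ
    ψ R x = ∑F (λ t → R t * R (t ⊕ x))

    norm² : (F → ℤ) → ℤ
    norm² R = ψ R 𝟎

    norm²-def : ∀ R → norm² R ≡ ∑F (λ t → R t * R t)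
    norm²-def R = ∑-cong elems (λ t → cong (λ u → R t * R u) (⊕-identityʳ t))

    0≤norm² : ∀ R → 0ℤ ≤ norm² R
    0≤norm² R = subst (0ℤ ≤_) (sym (norm²-def R)) (∑-nonneg elems (λ t → 0≤sq (R t)))

    ψ-shift : ∀ R a b → ∑F (λ t → R (t ⊕ a) * R (t ⊕ b)) ≡ ψ R (b ⊖ a)
    ψ-shift R a b = trans (∑-cong elems (λ t → cong (λ u → R (t ⊕ a) * R u) (eq t)))
      (∑F-⊕ a (λ t → R t * R (t ⊕ (b ⊖ a))))
      where
      eq : ∀ t → t ⊕ b ≡ t ⊕ a ⊕ (b ⊖ a)
      eq t = solve 3 (λ a b t → t :+ b := t :+ a :+ (b :- a)) refl a b t

    ψ-reflect : ∀ R a b → ∑F (λ t → R (a ⊖ t) * R (b ⊖ t)) ≡ ψ R (b ⊖ a)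
    ψ-reflect R a b = trans (∑-cong elems (λ t → cong (λ u → R (a ⊖ t) * R u) (eq t)))
      (∑F-reflect a (λ t → R t * R (t ⊕ (b ⊖ a))))
      where
      eq : ∀ t → b ⊖ t ≡ a ⊖ t ⊕ (b ⊖ a)
      eq t = solve 3 (λ a b t → b :- t := a :- t :+ (b :- a)) refl a b t

    ψ-bound : ∀ R x → abs (ψ R x) ≤ norm² R
    ψ-bound R x = sq-≤⇒abs-≤ (0≤norm² R) (≤-trans (cauchy-schwarz elems R (λ t → R (t ⊕ x)))
      (≤-reflexive (cong₂ _*_ (sym (norm²-def R))
        (trans (∑F-⊕ x (λ t → R t * R t)) (sym (norm²-def R))))))

    ψ≤norm² : ∀ R x → ψ R x ≤ norm² R
    ψ≤norm² R x = ≤-trans (≤abs _) (ψ-bound R x)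

    ∑ψ : ∀ R → ∑F (ψ R) ≡ ∑F R * ∑F R
    ∑ψ R = trans (∑-swap elems elems _) (trans (∑-cong elems inner) (∑-*ʳ elems (∑F R) R))
      where
      inner : ∀ t → ∑F (λ x → R t * R (t ⊕ x)) ≡ R t * ∑F R
      inner t = trans (∑-*ˡ elems (R t) _) (cong (R t *_)
        (trans (∑-cong elems (λ x → cong R (⊕-comm t x))) (∑F-⊕ t R)))

    ∑ψ≡0 : ∀ R → ∑F R ≡ 0ℤ → ∑F (ψ R) ≡ 0ℤ
    ∑ψ≡0 R mean = trans (∑ψ R) (trans (cong (_* ∑F R) mean) (*-zeroˡ _))

    module _ {I : Set} (is : List I) (α : I → ℤ) (x : I → F) (R : F → ℤ) where

      -- The squared norm of the combination of the shifts of `R` by `x i` with coefficients `α i`,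
      -- hence nonnegative. It is again a sum of correlations, now over pairs of indices, so
      -- `ψ-cauchy` can be iterated.
      gram : ℤ
      gram = ∑ is (λ i → ∑ is (λ j → α i * α j * ψ R (x j ⊖ x i)))

      ∑-sq-shifts : ∑F (λ t → ∑ is (λ i → α i * R (t ⊕ x i)) * ∑ is (λ i → α i * R (t ⊕ x i))) ≡ gram
      ∑-sq-shifts = trans (∑-cong elems (λ t → ∑-sq is _))
        (trans (∑-swap elems is _) (∑-cong is (λ i → trans (∑-swap elems is _) (∑-cong is (λ j →
          trans (∑-cong elems (λ t → sq-factor (α i) (R (t ⊕ x i)) (α j) (R (t ⊕ x j))))
            (trans (∑-*ˡ elems (α i * α j) _) (cong (α i * α j *_) (ψ-shift R (x i) (x j)))))))))

      0≤gram : 0ℤ ≤ gram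
      0≤gram = subst (0ℤ ≤_) ∑-sq-shifts (∑-nonneg elems (λ t → 0≤sq _))

      -- The left side is the squared inner product of `R` with the function whose squared norm is
      -- `gram`.
      ψ-cauchy : ∑ is (λ i → α i * ψ R (x i)) * ∑ is (λ i → α i * ψ R (x i)) ≤ norm² R * gram
      ψ-cauchy = subst₂ _≤_ (cong₂ _*_ (sym eq) (sym eq)) (cong₂ _*_ (sym (norm²-def R)) ∑-sq-shifts)
        (cauchy-schwarz elems R (λ t → ∑ is (λ i → α i * R (t ⊕ x i))))
        where
        eq : ∑ is (λ i → α i * ψ R (x i)) ≡ ∑F (λ t → R t * ∑ is (λ i → α i * R (t ⊕ x i)))
        eq = trans (∑-cong is (λ i → sym (∑-*ˡ elems (α i) _))) (trans (∑-swap is elems _)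
          (∑-cong elems (λ t → trans (∑-cong is (λ i → swap-middle (α i) (R t) (R (t ⊕ x i)))) (∑-*ˡ is (R t) _))))

    module _ {I : Set} (is : List I) (w : I → ℤ) (a b : I → F) (χ R : F → ℤ) where

      -- Opening the square leaves two copies of each shifted function; as `k` and `t` run over the
      -- whole field, their sums decouple into two correlations.
      ∑-sq-two-shifts :
        ∑F (λ k → ∑F (λ t → ∑ is (λ i → w i * (χ (a i ⊖ k) * R (b i ⊖ t))) * ∑ is (λ i → w i * (χ (a i ⊖ k) * R (b i ⊖ t))))) ≡
        ∑ is (λ i → ∑ is (λ j → w i * w j * (ψ χ (a j ⊖ a i) * ψ R (b j ⊖ b i))))
      ∑-sq-two-shifts = trans (∑-cong elems (λ k → trans (∑-cong elems (λ t → ∑-sq is _))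
          (trans (∑-swap elems is _) (∑-cong is (λ i → ∑-swap elems is _)))))
        (trans (∑-swap elems is _) (∑-cong is (λ i → trans (∑-swap elems is _) (∑-cong is (λ j → pair i j)))))
        where
        pair : ∀ i j → ∑F (λ k → ∑F (λ t → (w i * (χ (a i ⊖ k) * R (b i ⊖ t))) * (w j * (χ (a j ⊖ k) * R (b j ⊖ t))))) ≡
          w i * w j * (ψ χ (a j ⊖ a i) * ψ R (b j ⊖ b i))
        pair i j = trans (∑-cong elems (λ k → trans (∑-cong elems (λ t →
              trans (sq-factor (w i) (χ (a i ⊖ k) * R (b i ⊖ t)) (w j) (χ (a j ⊖ k) * R (b j ⊖ t))) (cong (w i * w j *_) (sq-factor (χ (a i ⊖ k)) (R (b i ⊖ t)) (χ (a j ⊖ k)) (R (b j ⊖ t))))))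
              (∑-*ˡ elems (w i * w j) _)))
          (trans (∑-*ˡ elems (w i * w j) _) (cong (w i * w j *_)
            (trans (sym (∑-* elems elems _ _)) (cong₂ _*_ (ψ-reflect χ (a i) (a j)) (ψ-reflect R (b i) (b j))))))

-- Complete sums over one variable (type I) and dilated correlations.

module TypeI where

  open import Data.Nat using (zero; suc; s≤s; z≤n)
  open import Data.Integer using (ℤ; +_; 0ℤ; 1ℤ; _≤_; +≤+)
  open import Data.Integer.Tactic.RingSolver using (solve-∀)
  open import Data.List using (cartesianProduct)
  open import Data.Product using (_×_; _,_)
  open import Data.Sum using (_⊎_; inj₁; inj₂) renaming (map to map⊎)
  open import Relation.Nullary using (Dec; yes; no; ¬?)
  open import Relation.Nullary.Decidable using (_×-dec_)
  open import Relation.Binary.PropositionalEquality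
  open Int
  open Sums
  open Field
  open Correlation

  opaque
    unfolding arith
    r-theta′ : ∀ a b c d e → a * b * (c * d) * e ≡ c * d * (a * b * e)
    r-theta′ = solve-∀
    r-kappa : ∀ a b → (a * b) * (a * b) ≡ (a * a) * (b * b)
    r-kappa = solve-∀
    r-cube : ∀ n Ψ q → n * (n * n) * (q * (Ψ * Ψ)) ≡ q * (n * n * n) * (Ψ * Ψ)
    r-cube = solve-∀
    r-sum : ∀ Ψ q p i → p * (i * (q * Ψ) - Ψ) ≡ (q * Ψ) * (i * p) - Ψ * p
    r-sum = solve-∀
    r-sum′ : ∀ Ψ q → (q * Ψ) * Ψ - Ψ * 0ℤ ≡ q * (Ψ * Ψ)
    r-sum′ = solve-∀
    r-two : ∀ a b → (a * a + a * a) + (b * b + b * b) - (a + b) * (a + b) ≡ (a - b) * (a - b)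
    r-two = solve-∀
    r-final : ∀ q i Ψ → (q * i * Ψ) * (q * i * Ψ) + (q * i * Ψ) * (q * i * Ψ) + ((q * (+ 2 * (q * (i * i * i) * (Ψ * Ψ)))) + (q * (+ 2 * (q * (i * i * i) * (Ψ * Ψ))))) ≡ + 2 * (q * q * (Ψ * Ψ)) * (i * i) + + 4 * (q * q * (Ψ * Ψ)) * (i * i * i)
    r-final = solve-∀
    r-final′ : ∀ c i → + 2 * c * (i * i * i) + + 4 * c * (i * i * i) ≡ + 6 * c * (i * i * i)
    r-final′ = solve-∀

  -- True because `i` is an integer: it is zero or at least one.
  i²≤i³ : ∀ {i} → 0ℤ ≤ i → i * i ≤ i * i * i
  i²≤i³ {+ zero} _ = ≤-reflexive (trans (*-zeroʳ 0ℤ) (sym (*-zeroʳ (0ℤ * 0ℤ))))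
  i²≤i³ {+ (suc n)} _ = subst (_≤ (i * i) * i) (*-identityʳ (i * i)) (*-monoˡ (0≤sq i) (+≤+ (s≤s z≤n)))
    where
    i : ℤ
    i = + suc n

  sq-+-≤ : ∀ a b → (a + b) * (a + b) ≤ (a * a + a * a) + (b * b + b * b)
  sq-+-≤ a b = ≤-by (0≤sq (a - b)) (r-two a b)

  module TypeISums (𝔽 : FiniteField) where
    open FieldTheory 𝔽
    open Correlations 𝔽

    nz : F → ℤ
    nz x = 𝟙 (¬? (x ≟ 𝟎))

    nz-1 : ∀ {x} → x ≢ 𝟎 → nz x ≡ 1ℤ
    nz-1 {x} ne = 𝟙-yes (¬? (x ≟ 𝟎)) ne

    nz-cong : ∀ {x y} → (x ≡ 𝟎 → y ≡ 𝟎) → (y ≡ 𝟎 → x ≡ 𝟎) → nz x ≡ nz y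
    nz-cong {x} {y} to from = 𝟙-cong (¬? (x ≟ 𝟎)) (¬? (y ≟ 𝟎)) (λ n e → n (from e)) (λ n e → n (to e))

    nz-⊗ : ∀ {a} → a ≢ 𝟎 → ∀ x → nz (a ⊗ x) ≡ nz x
    nz-⊗ {a} a≢0 x = nz-cong (λ e → ⊗-cancelˡ a≢0 (trans e (sym (⊗-zeroʳ a)))) (λ e → trans (cong (a ⊗_) e) (⊗-zeroʳ a))

    0≤nz : ∀ x → 0ℤ ≤ nz x
    0≤nz x = 0≤𝟙 (¬? (x ≟ 𝟎))

    nz≤1 : ∀ x → nz x ≤ 1ℤ
    nz≤1 x = 𝟙≤1 (¬? (x ≟ 𝟎))

    nz* : ∀ x {a b} → (x ≢ 𝟎 → a ≡ b) → nz x * a ≡ nz x * b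
    nz* x {a} {b} eq with x ≟ 𝟎
    ... | yes _ = trans (*-zeroˡ a) (sym (*-zeroˡ b))
    ... | no ne = cong (1ℤ *_) (eq ne)

    split-0 : ∀ (f : F → ℤ) → ∑F f ≡ f 𝟎 + ∑F (λ x → nz x * f x)
    split-0 f = trans (∑-cong elems at) (trans (∑-+ elems _ _) (cong (_+ ∑F (λ x → nz x * f x)) (∑F-δ 𝟎 f)))
      where
      at : ∀ x → f x ≡ 𝟙 (x ≟ 𝟎) * f x + nz x * f x
      at x with x ≟ 𝟎
      ... | yes _ = sym (trans (cong₂ _+_ (*-identityˡ (f x)) (*-zeroˡ (f x))) (+-identityʳ _))
      ... | no _ = sym (trans (cong₂ _+_ (*-zeroˡ (f x)) (*-identityˡ (f x))) (+-identityˡ _))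

    module Dilation (R : F → ℤ) (mean : ∑F R ≡ 0ℤ) where

      Ψ : ℤ
      Ψ = norm² R

      dilate : F → ℤ
      dilate ρ = ∑F (λ y → ψ R y * ψ R (ρ ⊗ y))

      -- A dilated correlation: pairs of arguments `s`, `s′` with `s′ - ρ s = v`, weighted by `R`.
      -- Its squared norm over `v` is `dilate ρ`.
      diff : F → F → ℤ
      diff ρ v = ∑F (λ s → R s * R (ρ ⊗ s ⊕ v))

      -- Both sides count quadruples of arguments of R, hence a shift can only decrease the sum.
      ∑-diff : ∀ ρ a b → ∑F (λ y → ψ R (y ⊕ a) * ψ R (ρ ⊗ y ⊕ b)) ≡ ∑F (λ v → diff ρ v * diff ρ (v ⊕ (b ⊖ ρ ⊗ a)))
      ∑-diff ρ a b = trans (∑-cong elems (λ y → trans (∑-* elems elems _ _) (∑-cong elems (λ s →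
            trans (sym (∑F-⊕ (ρ ⊗ s) _)) (∑-cong elems (λ v → quad y s v))))))
        (trans (∑-swap elems elems _) (trans (∑-cong elems (λ s → trans (∑-swap elems elems _)
            (∑-cong elems (λ v → inner s v))))
          (trans (∑-swap elems elems _) (∑-cong elems (λ v → trans (∑-cong elems (λ s → refl)) (∑-*ʳ elems _ _))))))
        where
        β : F
        β = b ⊖ ρ ⊗ a
        h : F → F → F → ℤ
        h s v s′ = (R s * R (ρ ⊗ s ⊕ v)) * (R s′ * R (ρ ⊗ s′ ⊕ (v ⊕ β)))
        quad : ∀ y s v → R s * R (s ⊕ (y ⊕ a)) * (R (v ⊕ ρ ⊗ s) * R (v ⊕ ρ ⊗ s ⊕ (ρ ⊗ y ⊕ b))) ≡ h s v (y ⊕ (s ⊕ a))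
        quad y s v = trans (sq-factor (R s) (R (s ⊕ (y ⊕ a))) (R (v ⊕ ρ ⊗ s)) (R (v ⊕ ρ ⊗ s ⊕ (ρ ⊗ y ⊕ b))))
          (cong₂ _*_ (cong (λ u → R s * R u) (⊕-comm v (ρ ⊗ s)))
            (cong₂ (λ u w → R u * R w)
              (solve 3 (λ a s y → s :+ (y :+ a) := y :+ (s :+ a)) refl a s y)
              (solve 6 (λ ρ a b y s v → v :+ ρ :* s :+ (ρ :* y :+ b) := ρ :* (y :+ (s :+ a)) :+ (v :+ (b :- ρ :* a))) refl ρ a b y s v)))
        inner : ∀ s v → ∑F (λ y → h s v (y ⊕ (s ⊕ a))) ≡ (R s * R (ρ ⊗ s ⊕ v)) * diff ρ (v ⊕ β)
        inner s v = trans (∑F-⊕ (s ⊕ a) (h s v)) (∑-*ˡ elems _ _)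

      dilate-def : ∀ ρ → dilate ρ ≡ ∑F (λ v → diff ρ v * diff ρ v)
      dilate-def ρ = trans (∑-cong elems (λ y → cong₂ (λ u v → ψ R u * ψ R v) (sym (⊕-identityʳ y)) (sym (⊕-identityʳ (ρ ⊗ y)))))
        (trans (∑-diff ρ 𝟎 𝟎) (∑-cong elems (λ v → cong (λ u → diff ρ v * diff ρ u)
          (solve 3 (λ v z ρ → v :+ (z :- ρ :* z) := v :+ z :* (con 1ℤ :- ρ)) refl v 𝟎 ρ ∙ cong (v ⊕_) (⊗-zeroˡ _) ∙ ⊕-identityʳ v))))
        where
        infixr 4 _∙_
        _∙_ : ∀ {A : Set} {x y z : A} → x ≡ y → y ≡ z → x ≡ z
        _∙_ = trans

      0≤dilate : ∀ ρ → 0ℤ ≤ dilate ρ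
      0≤dilate ρ = subst (0ℤ ≤_) (sym (dilate-def ρ)) (∑-nonneg elems (λ v → 0≤sq _))

      -- The shifts `a` and `b` only translate one of the two factors in `∑-diff`, so Cauchy-Schwarz
      -- bounds the sum by the one without shifts.
      affine-≤ : ∀ ρ a b → ∑F (λ y → ψ R (y ⊕ a) * ψ R (ρ ⊗ y ⊕ b)) ≤ dilate ρ
      affine-≤ ρ a b = ≤-trans (≤abs _) (sq-≤⇒abs-≤ (0≤dilate ρ)
        (subst₂ (λ u v → u * u ≤ v) (sym (∑-diff ρ a b))
          (cong₂ _*_ (sym (dilate-def ρ)) (trans (∑F-⊕ _ (λ v → diff ρ v * diff ρ v)) (sym (dilate-def ρ))))
          (cauchy-schwarz elems (diff ρ) (λ v → diff ρ (v ⊕ (b ⊖ ρ ⊗ a))))))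

      -- For `y ≠ 0` the products `ρ y` run over the field and the full sum vanishes; the `Ψ`
      -- subtracted is the term at `ρ = 0`.
      ∑nz-ψ-dilated : ∀ y → ∑F (λ ρ → nz ρ * ψ R (ρ ⊗ y)) ≡ 𝟙 (y ≟ 𝟎) * (q * Ψ) - Ψ
      ∑nz-ψ-dilated y = trans (move _ _ (trans (split-0 (λ ρ → ψ R (ρ ⊗ y))) refl))
        (cong₂ _-_ full (cong (ψ R) (⊗-zeroˡ y)))
        where
        move : ∀ {s} a b → s ≡ a + b → b ≡ s - a
        move a b refl = lem a b
          where
          opaque
            unfolding arith
            lem : ∀ a b → b ≡ a + b - a
            lem = solve-∀
        full : ∑F (λ ρ → ψ R (ρ ⊗ y)) ≡ 𝟙 (y ≟ 𝟎) * (q * Ψ)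
        full with y ≟ 𝟎
        ... | yes refl = trans (∑-cong elems (λ ρ → cong (ψ R) (⊗-zeroʳ ρ))) (trans (∑F-const Ψ) (sym (*-identityˡ _)))
        ... | no ne = trans (∑-cong elems (λ ρ → cong (ψ R) (⊗-comm ρ y))) (trans (∑F-⊗ ne (ψ R))
          (trans (∑ψ≡0 R mean) (sym (*-zeroˡ _))))

      -- Everything except `y = 0` cancels because the correlations sum to zero. So `dilate` is on
      -- average about `Ψ * Ψ`, a factor `q` below the trivial bound.
      ∑-dilate : ∑F (λ ρ → nz ρ * dilate ρ) ≡ q * (Ψ * Ψ)
      ∑-dilate = trans (∑-cong elems (λ ρ → sym (∑-*ˡ elems (nz ρ) _))) (trans (∑-swap elems elems _)
        (trans (∑-cong elems (λ y → trans (∑-cong elems (λ ρ → swap-middle (nz ρ) (ψ R y) _))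
            (trans (∑-*ˡ elems (ψ R y) _) (trans (cong (ψ R y *_) (∑nz-ψ-dilated y)) (r-sum Ψ q (ψ R y) (𝟙 (y ≟ 𝟎)))))))
          (trans (∑-- elems _ _) (trans (cong₂ _-_ (trans (∑-*ˡ elems _ _) (cong (q * Ψ *_) (∑F-δ 𝟎 (ψ R))))
              (trans (∑-*ˡ elems Ψ _) (cong (Ψ *_) (∑ψ≡0 R mean)))) (r-sum′ Ψ q)))))

    module _ (χ₁ χₐ χ₂ R : F → ℤ) (mean : ∑F R ≡ 0ℤ)
      (idem₁ : ∀ x → χ₁ x * χ₁ x ≡ χ₁ x) (idemₐ : ∀ x → χₐ x * χₐ x ≡ χₐ x) (idem₂ : ∀ x → χ₂ x * χ₂ x ≡ χ₂ x)
      (c e : F) (c≢0 : c ≢ 𝟎) where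

      open Dilation R mean

      private
        i : ℤ
        i = ∑F χ₂

        0≤χ₂ : ∀ x → 0ℤ ≤ χ₂ x
        0≤χ₂ x = subst (0ℤ ≤_) (idem₂ x) (0≤sq (χ₂ x))

        0≤i : 0ℤ ≤ i
        0≤i = ∑-nonneg elems 0≤χ₂

        norm²χ₂ : norm² χ₂ ≡ i
        norm²χ₂ = trans (norm²-def χ₂) (∑-cong elems idem₂)

        0≤ψ₂ : ∀ x → 0ℤ ≤ ψ χ₂ x
        0≤ψ₂ x = ∑-nonneg elems (λ t → 0≤* (0≤χ₂ t) (0≤χ₂ (t ⊕ x)))

        ψ₂≤i : ∀ x → ψ χ₂ x ≤ i
        ψ₂≤i x = subst (ψ χ₂ x ≤_) norm²χ₂ (ψ≤norm² χ₂ x)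

        g : F → F
        g l = c ⊗ l ⁻¹ ⊖ e ⊗ l

        X : F → F → ℤ
        X k t = ∑F (λ l → nz l * (χ₂ (l ⊖ k) * R (g l ⊖ t)))

        T : ℤ
        T = ∑F (λ k → ∑F (λ t → X k t * X k t))

        κ : F → ℤ
        κ k = nz k * nz (k ⊕ 𝟏)

        w : F → F
        w k = ⊝ (k ⁻¹ ⊗ (k ⊕ 𝟏) ⁻¹)

        θ : F → F → F
        θ y x = c ⊗ y ⊗ x ⁻¹ ⊖ e ⊗ x

        Θ : F → ℤ
        Θ y = ∑F (λ x → nz x * ψ χ₂ x * ψ R (θ y x))

        K : F → ℤ
        K x = ψ χ₂ x * ∑F (λ l → nz l * nz (x ⊕ l) * ψ R (g (x ⊕ l) ⊖ g l))

        -- Once the squares are opened, the pairs of `l` are grouped by their difference: `K x` is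
        -- the part with difference `x`, and `x = 0` is set aside.
        T-expand : T ≡ K 𝟎 + ∑F (λ x → nz x * K x)
        T-expand = trans (∑-sq-two-shifts elems nz (λ l → l) g χ₂ R)
          (trans (∑-cong elems (λ l → trans (sym (∑F-⊕ l _)) (∑-cong elems (λ x →
              trans (cong (λ u → nz l * nz (x ⊕ l) * (ψ χ₂ u * ψ R (g (x ⊕ l) ⊖ g l))) (a⊕b⊖b x l))
                (swap-middle (nz l * nz (x ⊕ l)) (ψ χ₂ x) _)))))
            (trans (∑-swap elems elems _) (trans (∑-cong elems (λ x → ∑-*ˡ elems (ψ χ₂ x) _)) (split-0 K))))

        abs-nz : ∀ x → abs (nz x) ≤ 1ℤ
        abs-nz x = subst (_≤ 1ℤ) (sym (abs-nonneg (0≤nz x))) (nz≤1 x)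

        abs-nz-* : ∀ x a → abs (nz x * a) ≤ abs a
        abs-nz-* x a = ≤-trans (≤-reflexive (abs-* (nz x) a))
          (≤-trans (*-monoʳ (0≤abs a) (abs-nz x)) (≤-reflexive (*-identityˡ _)))

        abs-K0 : abs (K 𝟎) ≤ q * i * Ψ
        abs-K0 = ≤-trans (≤-reflexive (abs-* _ _)) (≤-trans (*-mono-nonneg (0≤abs _)
            (≤-trans (≤-reflexive (abs-nonneg (0≤ψ₂ 𝟎))) (ψ₂≤i 𝟎)) (0≤abs _)
            (≤-trans (∑-abs elems _) (≤-trans (∑-mono elems (λ l →
              ≤-trans (≤-reflexive (cong abs (*-assoc (nz l) (nz (𝟎 ⊕ l)) _)))
                (≤-trans (abs-nz-* l _) (≤-trans (abs-nz-* (𝟎 ⊕ l) _) (ψ-bound R _)))))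
              (≤-reflexive (∑F-const Ψ)))))
          (≤-reflexive (trans (swap-middle i q Ψ) (sym (*-assoc q i Ψ)))))

        inverse-step : ∀ {k} → k ≢ 𝟎 → k ⊕ 𝟏 ≢ 𝟎 → (k ⊕ 𝟏) ⁻¹ ⊖ k ⁻¹ ≡ w k
        inverse-step {k} k≢0 k+1≢0 = trans (cong₂ _⊖_ (sym (trans (cong (_⊗ j) (⊗-inverseʳ k k≢0)) (⊗-identityˡ j)))
              (sym (trans (cong (_⊗ (k ⁻¹)) (⊗-inverseʳ (k ⊕ 𝟏) k+1≢0)) (⊗-identityˡ (k ⁻¹)))))
            (trans (solve 4 (λ k i j u → k :* i :* j :- (k :+ u) :* j :* i := :- (u :* (i :* j))) refl k (k ⁻¹) j 𝟏)
              (cong ⊝_ (⊗-identityˡ _)))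
          where
          j : F
          j = (k ⊕ 𝟏) ⁻¹

        x⊕xk : ∀ x k → x ⊕ x ⊗ k ≡ x ⊗ (k ⊕ 𝟏)
        x⊕xk x k = trans (cong (_⊕ x ⊗ k) (sym (⊗-identityʳ x)))
          (solve 3 (λ x k u → x :* u :+ x :* k := x :* (k :+ u)) refl x k 𝟏)

        -- The reason for substituting `l = x k`: the difference of the reciprocals factors as `w k`
        -- over `x`, and the linear part no longer involves `k`.
        g-step : ∀ {x k} → x ≢ 𝟎 → k ≢ 𝟎 → k ⊕ 𝟏 ≢ 𝟎 → g (x ⊕ x ⊗ k) ⊖ g (x ⊗ k) ≡ θ (w k) x
        g-step {x} {k} x≢0 k≢0 k+1≢0 = trans (cong (λ u → g u ⊖ g (x ⊗ k)) (x⊕xk x k))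
          (trans (cong₂ (λ u v → c ⊗ u ⊖ e ⊗ (x ⊗ (k ⊕ 𝟏)) ⊖ (c ⊗ v ⊖ e ⊗ (x ⊗ k))) (⁻¹-⊗ x≢0 k+1≢0) (⁻¹-⊗ x≢0 k≢0))
            (trans (solve 8 (λ c e x k u xi ki kj → c :* (xi :* kj) :- e :* (x :* (k :+ u)) :- (c :* (xi :* ki) :- e :* (x :* k)) :=
                c :* (kj :- ki) :* xi :- e :* (x :* u)) refl c e x k 𝟏 (x ⁻¹) (k ⁻¹) ((k ⊕ 𝟏) ⁻¹))
              (cong₂ (λ u v → c ⊗ u ⊗ x ⁻¹ ⊖ e ⊗ v) (inverse-step k≢0 k+1≢0) (⊗-identityʳ x))))

        K-expand : ∀ {x} → x ≢ 𝟎 → K x ≡ ψ χ₂ x * ∑F (λ k → κ k * ψ R (θ (w k) x))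
        K-expand {x} x≢0 = cong (ψ χ₂ x *_) (trans (sym (∑F-⊗ x≢0 _)) (∑-cong elems (λ k →
          trans (cong₂ (λ u v → u * v * ψ R (g (x ⊕ x ⊗ k) ⊖ g (x ⊗ k))) (nz-⊗ x≢0 k)
              (trans (cong nz (x⊕xk x k)) (nz-⊗ x≢0 (k ⊕ 𝟏))))
            (trans (*-assoc (nz k) _ _) (trans (nz* k (λ k≢0 → nz* (k ⊕ 𝟏) (λ k+1≢0 → cong (ψ R) (g-step x≢0 k≢0 k+1≢0))))
              (sym (*-assoc (nz k) _ _)))))))

        off : ℤ
        off = ∑F (λ k → κ k * Θ (w k))

        off-expand : ∑F (λ x → nz x * K x) ≡ off
        off-expand = trans (∑-cong elems (λ x → trans (nz* x K-expand) (trans (sym (*-assoc (nz x) _ _))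
            (sym (∑-*ˡ elems (nz x * ψ χ₂ x) _))))) (trans (∑-swap elems elems _)
          (∑-cong elems (λ k → trans (∑-cong elems (λ x → swap-middle (nz x * ψ χ₂ x) (κ k) _)) (∑-*ˡ elems (κ k) _))))

        κ-sq : ∀ k → κ k * κ k ≡ κ k
        κ-sq k = trans (r-kappa (nz k) (nz (k ⊕ 𝟏))) (cong₂ _*_ (𝟙-sq (¬? (k ≟ 𝟎))) (𝟙-sq (¬? (k ⊕ 𝟏 ≟ 𝟎))))

        Hits : F → F → Set
        Hits y k = (k ≢ 𝟎 × k ⊕ 𝟏 ≢ 𝟎) × y ≡ w k

        hits? : ∀ y k → Dec (Hits y k)
        hits? y k = (¬? (k ≟ 𝟎) ×-dec ¬? (k ⊕ 𝟏 ≟ 𝟎)) ×-dec (y ≟ w k)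

        κ-hits : ∀ y k → κ k * 𝟙 (y ≟ w k) ≡ 𝟙 (hits? y k)
        κ-hits y k with k ≟ 𝟎 | k ⊕ 𝟏 ≟ 𝟎 | y ≟ w k
        ... | yes _ | u | v = trans (cong (_* 𝟙 v) (*-zeroˡ _)) (*-zeroˡ _)
        ... | no _ | yes _ | v = trans (cong (_* 𝟙 v) (*-zeroʳ _)) (*-zeroˡ _)
        ... | no _ | no _ | yes _ = trans (*-identityʳ _) (*-identityʳ _)
        ... | no _ | no _ | no _ = *-zeroʳ _

        -- k (k + 1) = m (m + 1) forces m = k or m = - k - 1.
        same-hit : ∀ {y k m} → Hits y k → Hits y m → m ≡ k ⊎ m ≡ ⊝ k ⊖ 𝟏
        same-hit {y} {k} {m} ((k≢0 , k+1≢0) , yk) ((m≢0 , m+1≢0) , ym) = map⊎ ⊖≡0⇒≡ ⊖≡0⇒≡ (⊗≡0 vanish)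
          where
          inv : ∀ {u} → u ≢ 𝟎 → u ⊕ 𝟏 ≢ 𝟎 → u ⊗ (u ⊕ 𝟏) ⊗ w u ≡ ⊝ 𝟏
          inv {u} a b = trans (solve 4 (λ u v i j → u :* v :* (:- (i :* j)) := :- (u :* i :* (v :* j))) refl u (u ⊕ 𝟏) (u ⁻¹) ((u ⊕ 𝟏) ⁻¹))
            (cong ⊝_ (trans (cong₂ _⊗_ (⊗-inverseʳ u a) (⊗-inverseʳ _ b)) (⊗-identityˡ 𝟏)))
          wk≢0 : w k ≢ 𝟎
          wk≢0 = ⊝-≢0 (⊗-≢0 (⁻¹-≢0 k≢0) (⁻¹-≢0 k+1≢0))
          prods : m ⊗ (m ⊕ 𝟏) ≡ k ⊗ (k ⊕ 𝟏)
          prods = ⊗-cancelˡ wk≢0 (trans (⊗-comm (w k) _) (trans (cong (m ⊗ (m ⊕ 𝟏) ⊗_) (trans (sym yk) ym))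
            (trans (inv m≢0 m+1≢0) (trans (sym (inv k≢0 k+1≢0)) (⊗-comm _ (w k))))))
          vanish : (m ⊖ k) ⊗ (m ⊖ (⊝ k ⊖ 𝟏)) ≡ 𝟎
          vanish = trans (solve 3 (λ m k u → (m :- k) :* (m :- (:- k :- u)) := m :* (m :+ u) :- k :* (k :+ u)) refl m k 𝟏)
            (trans (cong (_⊖ k ⊗ (k ⊕ 𝟏)) prods) (⊝-inverseʳ _))

        fibre≤2 : ∀ y → ∑F (λ k → κ k * 𝟙 (y ≟ w k)) ≤ + 2
        fibre≤2 y with find (hits? y) elems
        ... | inj₂ none = ≤-trans (≤-reflexive (trans (∑-cong-∈ elems (λ k k∈ → trans (κ-hits y k) (𝟙-no (hits? y k) (none k k∈)))) (∑-0 elems))) 0≤+ₙ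
        ... | inj₁ (k₀ , _ , h₀) = ≤-trans (∑-mono elems at) (≤-reflexive (trans (∑-+ elems _ _)
            (trans (cong₂ _+_ (enum k₀) (enum (⊝ k₀ ⊖ 𝟏))) (sym (pos-+ 1 1)))))
          where
          at : ∀ k → κ k * 𝟙 (y ≟ w k) ≤ 𝟙 (k ≟ k₀) + 𝟙 (k ≟ ⊝ k₀ ⊖ 𝟏)
          at k = by-cases (hits? y k)
            where
            one : Hits y k → κ k * 𝟙 (y ≟ w k) ≡ 1ℤ
            one h = trans (κ-hits y k) (𝟙-yes (hits? y k) h)
            hit : Hits y k → k ≡ k₀ ⊎ k ≡ ⊝ k₀ ⊖ 𝟏 → κ k * 𝟙 (y ≟ w k) ≤ 𝟙 (k ≟ k₀) + 𝟙 (k ≟ ⊝ k₀ ⊖ 𝟏)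
            hit h (inj₁ eq) = ≤-trans (≤-reflexive (trans (one h) (sym (trans (+-identityʳ _) (𝟙-yes (k ≟ k₀) eq)))))
              (+-monoʳ (0≤𝟙 (k ≟ _)))
            hit h (inj₂ eq) = ≤-trans (≤-reflexive (trans (one h) (sym (trans (+-identityˡ _) (𝟙-yes (k ≟ _) eq)))))
              (+-monoˡ (0≤𝟙 (k ≟ k₀)))
            by-cases : Dec (Hits y k) → κ k * 𝟙 (y ≟ w k) ≤ 𝟙 (k ≟ k₀) + 𝟙 (k ≟ ⊝ k₀ ⊖ 𝟏)
            by-cases (no ¬h) = ≤-trans (≤-reflexive (trans (κ-hits y k) (𝟙-no (hits? y k) ¬h))) (0≤+ (0≤𝟙 (k ≟ k₀)) (0≤𝟙 (k ≟ _)))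
            by-cases (yes h) = hit h (same-hit h₀ h)

        -- With `z = c y / x` both arguments become affine in `z`, of slopes 1 and `x / x′`.
        θ-product : ∀ {x x′} → x ≢ 𝟎 → x′ ≢ 𝟎 →
          ∑F (λ y → ψ R (θ y x) * ψ R (θ y x′)) ≤ dilate (x ⊗ x′ ⁻¹)
        θ-product {x} {x′} x≢0 x′≢0 = ≤-trans (≤-reflexive (trans (∑-cong elems (λ y → cong₂ (λ u v → ψ R u * ψ R v) (eq₁ y) (eq₂ y)))
            (∑F-⊗ (⊗-≢0 c≢0 (⁻¹-≢0 x≢0)) (λ z → ψ R (z ⊕ ⊝ (e ⊗ x)) * ψ R (x ⊗ x′ ⁻¹ ⊗ z ⊕ ⊝ (e ⊗ x′))))))
          (affine-≤ (x ⊗ x′ ⁻¹) (⊝ (e ⊗ x)) (⊝ (e ⊗ x′)))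
          where
          eq₁ : ∀ y → θ y x ≡ c ⊗ x ⁻¹ ⊗ y ⊕ ⊝ (e ⊗ x)
          eq₁ y = cong (_⊖ e ⊗ x) (solve 3 (λ c y i → c :* y :* i := c :* i :* y) refl c y (x ⁻¹))
          eq₂ : ∀ y → θ y x′ ≡ x ⊗ x′ ⁻¹ ⊗ (c ⊗ x ⁻¹ ⊗ y) ⊕ ⊝ (e ⊗ x′)
          eq₂ y = cong (_⊖ e ⊗ x′) (sym (trans (solve 5 (λ x i c j y → x :* i :* (c :* j :* y) := x :* j :* (c :* y :* i)) refl x (x′ ⁻¹) c (x ⁻¹) y)
            (trans (cong (_⊗ (c ⊗ y ⊗ x′ ⁻¹)) (⊗-inverseʳ x x≢0)) (⊗-identityˡ _))))

        ∑ψ₂ : ∑F (ψ χ₂) ≡ i * i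
        ∑ψ₂ = ∑ψ χ₂

        -- Pairs `x`, `x′` are grouped by their ratio `ρ`. As `dilate` is nonnegative, the weight of
        -- each ratio may be replaced by the bound `i³`: one correlation of `χ₂` is at most `i` and
        -- the other sums to `i²`. The average of `dilate` does the rest.
        ∑Θ² : ∑F (λ y → Θ y * Θ y) ≤ q * (i * i * i) * (Ψ * Ψ)
        ∑Θ² = ≤-trans (≤-reflexive (trans (∑-cong elems (λ y → ∑-sq elems _)) (trans (∑-swap elems elems _)
              (∑-cong elems (λ x → trans (∑-swap elems elems _) (∑-cong elems (λ x′ →
                trans (∑-cong elems (λ y → sq-factor (nz x * ψ χ₂ x) (ψ R (θ y x)) (nz x′ * ψ χ₂ x′) (ψ R (θ y x′)))) (∑-*ˡ elems _ _))))))))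
            (≤-trans (∑-mono elems (λ x → ∑-mono elems (λ x′ → bound x x′)))
              (≤-trans (≤-reflexive (trans (∑-swap elems elems _) (trans (∑-cong elems regroup) (trans (∑-swap elems elems _) (∑-cong elems collect)))))
                (≤-trans (∑-mono elems multiplicity) (≤-reflexive (trans (∑-*ˡ elems (i * (i * i)) _)
                  (trans (cong (i * (i * i) *_) ∑-dilate) (r-cube i Ψ q)))))))
          where
          bound : ∀ x x′ → nz x * ψ χ₂ x * (nz x′ * ψ χ₂ x′) * ∑F (λ y → ψ R (θ y x) * ψ R (θ y x′)) ≤
            nz x * ψ χ₂ x * (nz x′ * ψ χ₂ x′) * dilate (x ⊗ x′ ⁻¹)
          bound x x′ with x ≟ 𝟎 | x′ ≟ 𝟎
          ... | yes _ | _ = ≤-reflexive (trans (vanish _ _) (sym (vanish _ _)))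
            where
            vanish : ∀ a b → 0ℤ * ψ χ₂ x * a * b ≡ 0ℤ
            vanish a b = trans (cong (λ u → u * a * b) (*-zeroˡ _)) (trans (cong (_* b) (*-zeroˡ a)) (*-zeroˡ b))
          ... | no _ | yes _ = ≤-reflexive (trans (vanish _ _) (sym (vanish _ _)))
            where
            vanish : ∀ a b → a * (0ℤ * ψ χ₂ x′) * b ≡ 0ℤ
            vanish a b = trans (cong (λ u → a * u * b) (*-zeroˡ _)) (trans (cong (_* b) (*-zeroʳ a)) (*-zeroˡ b))
          ... | no x≢0 | no x′≢0 = *-monoˡ (0≤* (0≤* 0≤+ₙ (0≤ψ₂ x)) (0≤* 0≤+ₙ (0≤ψ₂ x′))) (θ-product x≢0 x′≢0)
          regroup : ∀ x′ → ∑F (λ x → nz x * ψ χ₂ x * (nz x′ * ψ χ₂ x′) * dilate (x ⊗ x′ ⁻¹)) ≡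
            ∑F (λ ρ → nz x′ * ψ χ₂ x′ * (nz ρ * ψ χ₂ (x′ ⊗ ρ) * dilate ρ))
          regroup x′ = trans (trans (∑-cong elems (λ x → r-theta′ (nz x) (ψ χ₂ x) (nz x′) (ψ χ₂ x′) _))
              (trans (∑-*ˡ elems (nz x′ * ψ χ₂ x′) _) (*-assoc (nz x′) _ _)))
            (trans (nz* x′ (λ x′≢0 → cong (ψ χ₂ x′ *_) (trans (sym (∑F-⊗ x′≢0 _)) (∑-cong elems (λ ρ →
                cong₂ (λ u v → u * ψ χ₂ (x′ ⊗ ρ) * dilate v) (nz-⊗ x′≢0 ρ)
                  (trans (⊗-comm _ _) (trans (solve 3 (λ i x ρ → i :* (x :* ρ) := x :* i :* ρ) refl (x′ ⁻¹) x′ ρ)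
                    (trans (cong (_⊗ ρ) (⊗-inverseʳ x′ x′≢0)) (⊗-identityˡ ρ)))))))))
              (trans (sym (*-assoc (nz x′) _ _)) (sym (∑-*ˡ elems (nz x′ * ψ χ₂ x′) _))))
          collect : ∀ ρ → ∑F (λ x′ → nz x′ * ψ χ₂ x′ * (nz ρ * ψ χ₂ (x′ ⊗ ρ) * dilate ρ)) ≡
            ∑F (λ x′ → nz x′ * ψ χ₂ x′ * ψ χ₂ (x′ ⊗ ρ)) * (nz ρ * dilate ρ)
          collect ρ = trans (∑-cong elems (λ x′ → r-regroup (nz x′ * ψ χ₂ x′) (nz ρ) (ψ χ₂ (x′ ⊗ ρ)) (dilate ρ))) (∑-*ʳ elems _ _)
            where
            opaque
              unfolding arith
              r-regroup : ∀ a b c d → a * (b * c * d) ≡ a * c * (b * d)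
              r-regroup = solve-∀
          multiplicity : ∀ ρ → ∑F (λ x′ → nz x′ * ψ χ₂ x′ * ψ χ₂ (x′ ⊗ ρ)) * (nz ρ * dilate ρ) ≤ i * (i * i) * (nz ρ * dilate ρ)
          multiplicity ρ = *-monoʳ (0≤* (0≤nz ρ) (0≤dilate ρ)) (≤-trans (∑-mono elems (λ x′ →
              ≤-trans (*-mono-nonneg (0≤* (0≤nz x′) (0≤ψ₂ x′)) (≤-trans (*-monoʳ (0≤ψ₂ x′) (nz≤1 x′)) (≤-reflexive (*-identityˡ _)))
                (0≤ψ₂ _) (ψ₂≤i _)) (≤-reflexive (*-comm _ i))))
            (≤-reflexive (trans (∑-*ˡ elems i _) (cong (i *_) ∑ψ₂))))

        -- Cauchy-Schwarz in `k`; then the sum over `k` becomes one over all `y`, since each value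
        -- of `w` is taken at most twice.
        off² : off * off ≤ q * (+ 2 * (q * (i * i * i) * (Ψ * Ψ)))
        off² = ≤-trans (∑-sq-≤ elems _) (*-monoˡ 0≤+ₙ (≤-trans (≤-reflexive (∑-cong elems (λ k →
            trans (r-kappa (κ k) (Θ (w k))) (cong (_* (Θ (w k) * Θ (w k))) (κ-sq k)))))
          (≤-trans (∑-fibre-≤ elems κ w elems (λ y → Θ y * Θ y) (+ 2) (λ y → 0≤sq (Θ y))
              (λ k _ → trans (cong (κ k *_) (enum (w k))) (*-identityʳ _)) fibre≤2)
            (*-monoˡ 0≤+ₙ ∑Θ²))))

        -- The 6 consists of 2 from `K 𝟎`, using `i² ≤ i³`, and of 2 · 2 from `off²`; one factor 2
        -- comes from `(a + b)² ≤ 2 a² + 2 b²`.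
        T² : T * T ≤ + 6 * (q * q * (Ψ * Ψ)) * (i * i * i)
        T² = ≤-trans (≤-reflexive (cong (λ u → u * u) (trans T-expand (cong (λ v → K 𝟎 + v) off-expand))))
          (≤-trans (sq-+-≤ (K 𝟎) off) (≤-trans (+-mono-≤ (+-mono-≤ K0² K0²) (+-mono-≤ off² off²))
            (≤-trans (≤-reflexive (r-final q i Ψ)) (≤-trans (+-monoˡ (*-monoˡ (0≤* 0≤+ₙ (0≤* (0≤* 0≤+ₙ 0≤+ₙ) (0≤sq Ψ))) (i²≤i³ 0≤i)))
              (≤-reflexive (r-final′ (q * q * (Ψ * Ψ)) i))))))
          where
          K0² : K 𝟎 * K 𝟎 ≤ (q * i * Ψ) * (q * i * Ψ)
          K0² = abs-≤⇒sq-≤ abs-K0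

      hyperbolaSum : ℤ
      hyperbolaSum = ∑F (λ k → ∑F (λ t → (χ₁ k * χₐ t) * ∑F (λ l → nz l * (χ₂ (l ⊖ k) * R (c ⊗ l ⁻¹ ⊖ e ⊗ l ⊖ t)))))

      private
        CS : hyperbolaSum * hyperbolaSum ≤ (∑F χ₁ * ∑F χₐ) * T
        CS = subst₂ _≤_ (cong (λ u → u * u) (∑-product elems elems _))
          (cong₂ _*_ (trans (∑-product elems elems _) (trans (∑-cong elems (λ k → ∑-cong elems (λ t →
              trans (r-kappa (χ₁ k) (χₐ t)) (cong₂ _*_ (idem₁ k) (idemₐ t))))) (sym (∑-* elems elems χ₁ χₐ))))
            (∑-product elems elems _))
          (cauchy-schwarz (cartesianProduct elems elems) (λ (k , t) → χ₁ k * χₐ t) (λ (k , t) → X k t))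

      hyperbolaSum-bound : pow4 hyperbolaSum ≤ (∑F χ₁ * ∑F χₐ) * (∑F χ₁ * ∑F χₐ) * (+ 6 * (q * q * (Ψ * Ψ)) * (i * i * i))
      hyperbolaSum-bound = ≤-trans (sq-mono (0≤sq hyperbolaSum) CS) (≤-trans (≤-reflexive (r-kappa (∑F χ₁ * ∑F χₐ) T)) (*-monoˡ (0≤sq _) T²))

-- Bilinear sums (type II), reduced to coincidences among reciprocals.

module TypeII where

  open import Data.Integer using (ℤ; +_; 0ℤ; 1ℤ; _≤_)
  open import Data.Integer.Tactic.RingSolver using (solve-∀)
  open import Data.List using (List; length; cartesianProduct)
  open import Data.List.Membership.Propositional using (_∈_)
  open import Data.List.Membership.Propositional.Properties using (∈-cartesianProduct⁻)
  open import Data.Product using (_×_; _,_; proj₁; proj₂)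
  open import Data.Product.Properties using (≡-dec)
  open import Data.Sum using (_⊎_; inj₁; inj₂)
  open import Data.Empty using (⊥-elim)
  open import Relation.Nullary using (Dec; yes; no; ¬_; ¬?)
  open import Relation.Nullary.Decidable using (_×-dec_)
  open import Relation.Binary.Definitions using (DecidableEquality)
  open import Relation.Binary.PropositionalEquality
  open Int
  open Sums
  open Field
  open Correlation

  opaque
    unfolding arith
    t-pull : ∀ x y b c i r → b * c * i * (x * y * r) ≡ (x * y * b) * ((c * i) * r)
    t-pull = solve-∀
    t-sq3 : ∀ x y b → (x * y * b) * (x * y * b) ≡ (x * x) * (y * y) * (b * b)
    t-sq3 = solve-∀
    t-sq2 : ∀ a b → (a * b) * (a * b) ≡ (a * a) * (b * b)
    t-sq2 = solve-∀
    t-labels : ∀ a i b j r → (a * i) * (b * j) * r ≡ (a * b) * (i * j * r)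
    t-labels = solve-∀
    t-Ψ3 : ∀ Ψ g → Ψ * Ψ * (Ψ * g) ≡ Ψ * Ψ * Ψ * g
    t-Ψ3 = solve-∀

  module TypeIISums (𝔽 : FiniteField) where
    open FieldTheory 𝔽
    open Correlations 𝔽

    -- The condition linking `d` and `n` is equality of the labels `λd d` and `κ n`. Differences of
    -- the `n` have an index type `V` of their own, so that they are later summed over the short
    -- list `vs` and not over the field.
    module Bilinear (χ₁ χₐ χ₂ R : F → ℤ) (mean : ∑F R ≡ 0ℤ)
      (idem₁ : ∀ x → χ₁ x * χ₁ x ≡ χ₁ x) (idemₐ : ∀ x → χₐ x * χₐ x ≡ χₐ x) (idem₂ : ∀ x → χ₂ x * χ₂ x ≡ χ₂ x)
      (c : F) (c≢0 : c ≢ 𝟎)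
      {D N V Λ : Set} (_≟N_ : DecidableEquality N) (_≟V_ : DecidableEquality V) (_≟Λ_ : DecidableEquality Λ)
      (ds : List D) (ns : List N) (vs : List V) (ls : List Λ)
      (d↑ : D → F) (n↑ : N → F) (v↑ : V → F)
      (d≢0 : ∀ d → d ∈ ds → d↑ d ≢ 𝟎) (n≢0 : ∀ n → n ∈ ns → n↑ n ≢ 𝟎)
      (ns-simple : Multiplicity.Simple _≟N_ ns)
      (n-inj : ∀ m n → m ∈ ns → n ∈ ns → n↑ m ≡ n↑ n → m ≡ n)
      (n+n≢0 : ∀ m n → m ∈ ns → n ∈ ns → n↑ m ⊕ n↑ n ≢ 𝟎)
      (gap : N → N → V) (gap-↑ : ∀ m n → m ∈ ns → n ∈ ns → v↑ (gap m n) ≡ n↑ n ⊖ n↑ m)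
      (gap-mult : ∀ m n → m ∈ ns → n ∈ ns → Multiplicity.mult _≟V_ vs (gap m n) ≡ 1ℤ)
      (λd : D → Λ) (κ : N → Λ)
      (κ-mult : ∀ n → n ∈ ns → Multiplicity.mult _≟Λ_ ls (κ n) ≡ 1ℤ)
      (ls-simple : Multiplicity.Simple _≟Λ_ ls)
      (b : D → ℤ) (a : N → ℤ) (b-bound : ∀ d → abs (b d) ≤ 1ℤ) (a-bound : ∀ n → abs (a n) ≤ 1ℤ)
      where

      private
        Ψ i : ℤ
        Ψ = norm² R
        i = ∑F χ₂

        0≤Ψ : 0ℤ ≤ Ψ
        0≤Ψ = 0≤norm² R

        0≤χ₂ : ∀ x → 0ℤ ≤ χ₂ x
        0≤χ₂ x = subst (0ℤ ≤_) (idem₂ x) (0≤sq (χ₂ x))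

        0≤i : 0ℤ ≤ i
        0≤i = ∑-nonneg elems 0≤χ₂

        0≤ψ₂ : ∀ x → 0ℤ ≤ ψ χ₂ x
        0≤ψ₂ x = ∑-nonneg elems (λ t → 0≤* (0≤χ₂ t) (0≤χ₂ (t ⊕ x)))

        ψ₂≤i : ∀ x → ψ χ₂ x ≤ i
        ψ₂≤i x = subst (ψ χ₂ x ≤_) (trans (norm²-def χ₂) (∑-cong elems idem₂)) (ψ≤norm² χ₂ x)

        g : F → F
        g z = c ⊗ z ⁻¹ ⊖ z

        I : D → N → ℤ
        I d n = 𝟙 (λd d ≟Λ κ n)

        pt : D → N → F
        pt d n = d↑ d ⊗ n↑ n

      weight : F → ℤ
      weight z = ∑F (λ k → ∑F (λ t → χ₁ k * χₐ t * (χ₂ (z ⊖ k) * R (c ⊗ z ⁻¹ ⊖ z ⊖ t))))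

      bilinear : ℤ
      bilinear = ∑ ds (λ d → ∑ ns (λ n → b d * a n * 𝟙 (λd d ≟Λ κ n) * weight (d↑ d ⊗ n↑ n)))

      private
        X : D → F → F → ℤ
        X d k t = ∑ ns (λ n → (a n * I d n) * (χ₂ (pt d n ⊖ k) * R (g (pt d n) ⊖ t)))

        bilinear-X : bilinear ≡ ∑ ds (λ d → ∑F (λ k → ∑F (λ t → (χ₁ k * χₐ t * b d) * X d k t)))
        bilinear-X = ∑-cong ds (λ d → trans (∑-cong ns (λ n → trans (sym (∑-*ˡ elems _ _)) (∑-cong elems (λ k →
              trans (sym (∑-*ˡ elems _ _)) (∑-cong elems (λ t → t-pull (χ₁ k) (χₐ t) (b d) (a n) (I d n) _))))))
            (trans (∑-swap ns elems _) (∑-cong elems (λ k → trans (∑-swap ns elems _) (∑-cong elems (λ t → ∑-*ˡ ns _ _))))))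

        Q : ℤ
        Q = ∑ ds (λ d → ∑F (λ k → ∑F (λ t → X d k t * X d k t)))

        triple : (D → F → F → ℤ) → D × (F × F) → ℤ
        triple f (d , (k , t)) = f d k t

        ∑-triple : ∀ f → ∑ (cartesianProduct ds (cartesianProduct elems elems)) (triple f) ≡ ∑ ds (λ d → ∑F (λ k → ∑F (λ t → f d k t)))
        ∑-triple f = trans (∑-product ds _ (triple f)) (∑-cong ds (λ d → ∑-product elems elems _))

        b² : ∀ d → b d * b d ≤ 1ℤ
        b² d = ≤-trans (abs-≤⇒sq-≤ (b-bound d)) (≤-reflexive (*-identityˡ 1ℤ))

        ∣χ₁∣ ∣χₐ∣ ∣ds∣ ∣ns∣ : ℤ
        ∣χ₁∣ = ∑F χ₁
        ∣χₐ∣ = ∑F χₐ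
        ∣ds∣ = + length ds
        ∣ns∣ = + length ns

        -- Cauchy-Schwarz over the triples `d`, `k`, `t`; the coefficients `b` disappear because
        -- they are at most 1 in absolute value.
        CS : bilinear * bilinear ≤ ∣ds∣ * (∣χ₁∣ * ∣χₐ∣) * Q
        CS = ≤-trans (subst₂ _≤_ (cong (λ u → u * u) (trans (∑-triple _) (sym bilinear-X)))
              (cong₂ _*_ (∑-triple _) (∑-triple _))
              (cauchy-schwarz (cartesianProduct ds (cartesianProduct elems elems)) (triple (λ d k t → χ₁ k * χₐ t * b d)) (triple X)))
            (*-monoʳ (∑-nonneg ds (λ d → ∑-nonneg elems (λ k → ∑-nonneg elems (λ t → 0≤sq (X d k t)))))
              (≤-trans (∑-mono ds {g = λ _ → ∣χ₁∣ * ∣χₐ∣} at) (≤-reflexive (∑-const ds _))))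
          where
          at : ∀ d → ∑F (λ k → ∑F (λ t → (χ₁ k * χₐ t * b d) * (χ₁ k * χₐ t * b d))) ≤ ∣χ₁∣ * ∣χₐ∣
          at d = ≤-trans (∑-mono elems (λ k → ∑-mono elems (λ t → ≤-trans (≤-reflexive (trans (t-sq3 (χ₁ k) (χₐ t) (b d))
                (cong₂ (λ u v → u * v * (b d * b d)) (idem₁ k) (idemₐ t))))
              (≤-trans (*-monoˡ (0≤* (subst (0ℤ ≤_) (idem₁ k) (0≤sq _)) (subst (0ℤ ≤_) (idemₐ t) (0≤sq _))) (b² d)) (≤-reflexive (*-identityʳ _))))))
            (≤-reflexive (sym (∑-* elems elems χ₁ χₐ)))

        term : N → N → D → ℤ
        term n n′ d = I d n * I d n′ * (ψ χ₂ (pt d n′ ⊖ pt d n) * ψ R (g (pt d n′) ⊖ g (pt d n)))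

        G : N → N → ℤ
        G n n′ = ∑ ds (term n n′)

        Q-expand : Q ≡ ∑ ns (λ n → ∑ ns (λ n′ → a n * a n′ * G n n′))
        Q-expand = trans (∑-cong ds (λ d → ∑-sq-two-shifts ns (λ n → a n * I d n) (pt d) (λ n → g (pt d n)) χ₂ R))
          (trans (∑-swap ds ns _) (∑-cong ns (λ n → trans (∑-swap ds ns _) (∑-cong ns (λ n′ →
            trans (∑-cong ds (λ d → t-labels (a n) (I d n) (a n′) (I d n′) _)) (∑-*ˡ ds (a n * a n′) (term n n′)))))))

        abs-aa : ∀ n n′ x → abs (a n * a n′ * x) ≤ abs x
        abs-aa n n′ x = ≤-trans (≤-reflexive (trans (abs-* (a n * a n′) x) (cong (_* abs x) (abs-* (a n) (a n′)))))
          (≤-trans (*-monoʳ (0≤abs x) (≤-trans (*-mono-nonneg (0≤abs _) (a-bound n) (0≤abs _) (a-bound n′)) (≤-reflexive (*-identityˡ 1ℤ))))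
            (≤-reflexive (*-identityˡ _)))

        same apart : N → N → ℤ
        same n n′ = 𝟙 (n ≟N n′)
        apart n n′ = 𝟙 (¬? (n ≟N n′))

        same+apart : ∀ n n′ x → x ≡ same n n′ * x + apart n n′ * x
        same+apart n n′ x with n ≟N n′
        ... | yes _ = sym (trans (cong₂ _+_ (*-identityˡ x) (*-zeroˡ x)) (+-identityʳ x))
        ... | no _ = sym (trans (cong₂ _+_ (*-zeroˡ x) (*-identityˡ x)) (+-identityˡ x))

        0≤I : ∀ d n → 0ℤ ≤ I d n
        0≤I d n = 0≤𝟙 (λd d ≟Λ κ n)

        I≤1 : ∀ d n → I d n ≤ 1ℤ
        I≤1 d n = 𝟙≤1 (λd d ≟Λ κ n)

        abs-G : ∀ n n′ → abs (G n n′) ≤ ∣ds∣ * (i * Ψ)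
        abs-G n n′ = ≤-trans (∑-abs ds _) (∑-≤-const ds (i * Ψ) (λ d _ →
          ≤-trans (≤-reflexive (trans (abs-* (I d n * I d n′) _) (cong₂ _*_ (abs-nonneg (0≤* (0≤I d n) (0≤I d n′)))
              (trans (abs-* (ψ χ₂ (pt d n′ ⊖ pt d n)) _) (cong (_* abs (ψ R (g (pt d n′) ⊖ g (pt d n)))) (abs-nonneg (0≤ψ₂ _)))))))
            (≤-trans (*-mono-nonneg (0≤* (0≤I d n) (0≤I d n′))
                (≤-trans (*-mono-nonneg (0≤I d n) (I≤1 d n) (0≤I d n′) (I≤1 d n′)) (≤-reflexive (*-identityˡ 1ℤ)))
                (0≤* (0≤ψ₂ _) (0≤abs _))
                (*-mono-nonneg (0≤ψ₂ _) (ψ₂≤i _) (0≤abs _) (ψ-bound R _)))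
              (≤-reflexive (*-identityˡ _)))))

      diagonal offDiagonal : ℤ
      diagonal = ∣ns∣ * (∣ds∣ * (i * Ψ))
      offDiagonal = ∑ ns (λ n → ∑ ns (λ n′ → apart n n′ * abs (G n n′)))

      private
        Q-bound : Q ≤ diagonal + offDiagonal
        Q-bound = ≤-trans (≤-reflexive Q-expand) (≤-trans (∑-mono ns (λ n → ∑-mono ns (λ n′ → ≤-trans (≤abs _) (abs-aa n n′ (G n n′)))))
          (≤-trans (≤-reflexive (trans (∑-cong ns (λ n → trans (∑-cong ns (λ n′ → same+apart n n′ (abs (G n n′)))) (∑-+ ns _ _))) (∑-+ ns _ _)))
            (+-monoˡ (∑-≤-const ns _ (λ n _ → ≤-trans (∑-mono ns (λ n′ → *-monoˡ (0≤𝟙 (n ≟N n′)) (abs-G n n′)))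
              (≤-trans (≤-reflexive (∑-*ʳ ns _ _)) (≤-trans (*-monoʳ (0≤* 0≤+ₙ (0≤* 0≤i 0≤Ψ))
                (≤-trans (≤-reflexive (∑-cong ns (λ n′ → 𝟙-cong (n ≟N n′) (n′ ≟N n) sym sym))) (ns-simple n))) (≤-reflexive (*-identityˡ _)))))))))

      bilinear² : bilinear * bilinear ≤ ∣ds∣ * (∣χ₁∣ * ∣χₐ∣) * (diagonal + offDiagonal)
      bilinear² = ≤-trans CS (*-monoˡ (0≤* 0≤+ₙ (0≤* (∑-nonneg elems (λ k → subst (0ℤ ≤_) (idem₁ k) (0≤sq _)))
        (∑-nonneg elems (λ k → subst (0ℤ ≤_) (idemₐ k) (0≤sq _))))) Q-bound)

      private
        α : Λ → F → D → ℤ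
        α ℓ v d = 𝟙 (λd d ≟Λ ℓ) * ψ χ₂ (d↑ d ⊗ v)

        x : F → F → D → F
        x v u d = u ⊗ d↑ d ⁻¹ ⊖ d↑ d ⊗ v

        -- The sum over `d` as seen from a pair of `n`: it depends on the pair only through the
        -- label, the difference `v`, and `u`, which is `c` times the difference of the reciprocals.
        H : Λ → F → F → ℤ
        H ℓ v u = ∑ ds (λ d → α ℓ v d * ψ R (x v u d))

        dds : List (D × D)
        dds = cartesianProduct ds ds

        α₂ : Λ → F → D × D → ℤ
        α₂ ℓ v (d , e) = α ℓ v d * α ℓ v e

        x₂ : F → F → D × D → F
        x₂ v u (d , e) = x v u e ⊖ x v u d

        gram₄ : Λ → F → F → ℤ
        gram₄ ℓ v u = gram dds (α₂ ℓ v) (x₂ v u) R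

        -- `ψ-cauchy` twice, first over `ds` and then over the pairs in the resulting Gram sum.
        H⁴ : ∀ ℓ v u → pow4 (H ℓ v u) ≤ Ψ * Ψ * Ψ * gram₄ ℓ v u
        H⁴ ℓ v u = ≤-trans (sq-mono (0≤sq (H ℓ v u)) (ψ-cauchy ds (α ℓ v) (x v u) R))
          (≤-trans (≤-reflexive (t-sq2 Ψ g₂)) (≤-trans (*-monoˡ (0≤sq Ψ)
              (subst (λ s → s * s ≤ Ψ * gram₄ ℓ v u) (∑-product ds ds _) (ψ-cauchy dds (α₂ ℓ v) (x₂ v u) R)))
            (≤-reflexive (t-Ψ3 Ψ _))))
          where
          g₂ : ℤ
          g₂ = gram ds (α ℓ v) (x v u) R

        u[_,_] : N → N → F
        u[ n , n′ ] = c ⊗ (n↑ n′ ⁻¹ ⊖ n↑ n ⁻¹)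

        -- With equal labels `G` is `H` at the data of the pair; with different labels no `d`
        -- matches both, and `G` is zero.
        abs-G≤ : ∀ n n′ → n ∈ ns → n′ ∈ ns → abs (G n n′) ≤ abs (H (κ n) (v↑ (gap n n′)) u[ n , n′ ])
        abs-G≤ n n′ n∈ n′∈ = go (κ n′ ≟Λ κ n)
          where
          arg₁ : ∀ d → pt d n′ ⊖ pt d n ≡ d↑ d ⊗ v↑ (gap n n′)
          arg₁ d = trans (solve 3 (λ d m n → d :* m :- d :* n := d :* (m :- n)) refl (d↑ d) (n↑ n′) (n↑ n))
            (cong (d↑ d ⊗_) (sym (gap-↑ n n′ n∈ n′∈)))
          arg₂ : ∀ d → d ∈ ds → g (pt d n′) ⊖ g (pt d n) ≡ x (v↑ (gap n n′)) u[ n , n′ ] d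
          arg₂ d d∈ = trans (cong₂ (λ u v → c ⊗ u ⊖ pt d n′ ⊖ (c ⊗ v ⊖ pt d n)) (⁻¹-⊗ (d≢0 d d∈) (n≢0 n′ n′∈)) (⁻¹-⊗ (d≢0 d d∈) (n≢0 n n∈)))
            (trans (solve 7 (λ c d m n i j k → c :* (i :* j) :- d :* m :- (c :* (i :* k) :- d :* n) := c :* (j :- k) :* i :- d :* (m :- n))
                refl c (d↑ d) (n↑ n′) (n↑ n) (d↑ d ⁻¹) (n↑ n′ ⁻¹) (n↑ n ⁻¹))
              (cong (λ w → u[ n , n′ ] ⊗ d↑ d ⁻¹ ⊖ d↑ d ⊗ w) (sym (gap-↑ n n′ n∈ n′∈))))
          labels : κ n′ ≡ κ n → ∀ d → I d n * I d n′ ≡ I d n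
          labels eq d = trans (cong (λ ℓ → I d n * 𝟙 (λd d ≟Λ ℓ)) eq) (𝟙-sq (λd d ≟Λ κ n))
          go : Dec (κ n′ ≡ κ n) → abs (G n n′) ≤ abs (H (κ n) (v↑ (gap n n′)) u[ n , n′ ])
          go (yes eq) = ≤-reflexive (cong abs (∑-cong-∈ ds (λ d d∈ → trans (cong₂ _*_ (labels eq d)
              (cong₂ (λ s t → ψ χ₂ s * ψ R t) (arg₁ d) (arg₂ d d∈))) (sym (*-assoc _ _ _)))))
          go (no ne) = ≤-trans (≤-reflexive (trans (cong abs (trans (∑-cong ds vanish) (∑-0 ds))) (abs-nonneg ≤-refl))) (0≤abs _)
            where
            product0 : ∀ d → Dec (λd d ≡ κ n) → I d n * I d n′ ≡ 0ℤ
            product0 d (yes e) = trans (cong (I d n *_) (𝟙-no (λd d ≟Λ κ n′) (λ e′ → ne (trans (sym e′) e)))) (*-zeroʳ _)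
            product0 d (no e) = trans (cong (_* I d n′) (𝟙-no (λd d ≟Λ κ n) e)) (*-zeroˡ _)
            vanish : ∀ d → term n n′ d ≡ 0ℤ
            vanish d = trans (cong (_* (ψ χ₂ (pt d n′ ⊖ pt d n) * ψ R (g (pt d n′) ⊖ g (pt d n)))) (product0 d (λd d ≟Λ κ n))) (*-zeroˡ _)

        nns : List (N × N)
        nns = cartesianProduct ns ns

        _≟K_ : DecidableEquality (Λ × (V × F))
        _≟K_ = ≡-dec _≟Λ_ (≡-dec _≟V_ _≟_)

        module K = Multiplicity _≟K_

        keys : List (Λ × (V × F))
        keys = cartesianProduct ls (cartesianProduct vs elems)

        key : N × N → Λ × (V × F)
        key (n , n′) = κ n , (gap n n′ , u[ n , n′ ])

        gram₃ : Λ × (V × F) → ℤ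
        gram₃ (ℓ , (v , u)) = gram₄ ℓ (v↑ v) u

        apart₂ : N × N → ℤ
        apart₂ (n , n′) = apart n n′

        key-mult : ∀ p → p ∈ nns → apart₂ p * K.mult keys (key p) ≡ apart₂ p
        key-mult (n , n′) p∈ = trans (cong (apart n n′ *_) (trans (mult-cartesian _≟Λ_ (≡-dec _≟V_ _≟_) ls _ _ _)
            (trans (cong₂ _*_ (κ-mult n n∈) (trans (mult-cartesian _≟V_ _≟_ vs elems _ _) (cong₂ _*_ (gap-mult n n′ n∈ n′∈) (enum _))))
              (trans (*-identityˡ _) (*-identityˡ 1ℤ))))) (*-identityʳ _)
          where
          n∈ : n ∈ ns
          n∈ = proj₁ (∈-cartesianProduct⁻ ns ns p∈)
          n′∈ : n′ ∈ ns
          n′∈ = proj₂ (∈-cartesianProduct⁻ ns ns p∈)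

        Hits : Λ × (V × F) → N × N → Set
        Hits k p = ¬ (proj₁ p ≡ proj₂ p) × k ≡ key p

        hits? : ∀ k p → Dec (Hits k p)
        hits? k p = ¬? (proj₁ p ≟N proj₂ p) ×-dec (k ≟K key p)

        hits-𝟙 : ∀ k p → apart₂ p * 𝟙 (k ≟K key p) ≡ 𝟙 (hits? k p)
        hits-𝟙 k p = go (proj₁ p ≟N proj₂ p) (k ≟K key p)
          where
          go : ∀ {A B : Set} (d : Dec A) (e : Dec B) → 𝟙 (¬? d) * 𝟙 e ≡ 𝟙 (¬? d ×-dec e)
          go (yes _) e = *-zeroˡ _
          go (no _) (yes _) = *-identityˡ _
          go (no _) (no _) = *-zeroʳ _

        -- Two pairs with the same nonzero difference v and the same difference of reciprocals have the same product.
        hits-unique : ∀ k p p′ → p ∈ nns → p′ ∈ nns → Hits k p → Hits k p′ → p ≡ p′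
        hits-unique k (m , m′) (n , n′) p∈ p′∈ (m≢m′ , km) (n≢n′ , kn) = by-cases (⊗≡0 vanish)
          where
          m∈ : m ∈ ns
          m∈ = proj₁ (∈-cartesianProduct⁻ ns ns p∈)
          m′∈ : m′ ∈ ns
          m′∈ = proj₂ (∈-cartesianProduct⁻ ns ns p∈)
          n∈ : n ∈ ns
          n∈ = proj₁ (∈-cartesianProduct⁻ ns ns p′∈)
          n′∈ : n′ ∈ ns
          n′∈ = proj₂ (∈-cartesianProduct⁻ ns ns p′∈)
          keys≡ : key (m , m′) ≡ key (n , n′)
          keys≡ = trans (sym km) kn
          M M′ P P′ v : F
          M = n↑ m
          M′ = n↑ m′
          P = n↑ n
          P′ = n↑ n′
          v = M′ ⊖ M
          v≡ : v ≡ P′ ⊖ P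
          v≡ = trans (sym (gap-↑ m m′ m∈ m′∈)) (trans (cong v↑ (cong (λ k → proj₁ (proj₂ k)) keys≡)) (gap-↑ n n′ n∈ n′∈))
          w : F
          w = M′ ⁻¹ ⊖ M ⁻¹
          w≡ : w ≡ P′ ⁻¹ ⊖ P ⁻¹
          w≡ = ⊗-cancelˡ c≢0 (cong (λ k → proj₂ (proj₂ k)) keys≡)
          v≢0 : v ≢ 𝟎
          v≢0 eq = m≢m′ (sym (n-inj m′ m m′∈ m∈ (⊖≡0⇒≡ eq)))
          recip : ∀ {a a′} → a ≢ 𝟎 → a′ ≢ 𝟎 → a ⊗ a′ ⊗ (a′ ⁻¹ ⊖ a ⁻¹) ≡ ⊝ (a′ ⊖ a)
          recip {a} {a′} a≢0 a′≢0 = trans (solve 4 (λ a a′ i i′ → a :* a′ :* (i′ :- i) := a :* (a′ :* i′) :- a′ :* (a :* i)) refl a a′ (a ⁻¹) (a′ ⁻¹))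
            (trans (cong₂ (λ s t → a ⊗ s ⊖ a′ ⊗ t) (⊗-inverseʳ a′ a′≢0) (⊗-inverseʳ a a≢0))
              (trans (cong₂ _⊖_ (⊗-identityʳ a) (⊗-identityʳ a′)) (solve 2 (λ a a′ → a :- a′ := :- (a′ :- a)) refl a a′)))
          MM : M ⊗ M′ ⊗ w ≡ ⊝ v
          MM = recip (n≢0 m m∈) (n≢0 m′ m′∈)
          PP : P ⊗ P′ ⊗ w ≡ ⊝ v
          PP = trans (cong (P ⊗ P′ ⊗_) w≡) (trans (recip (n≢0 n n∈) (n≢0 n′ n′∈)) (cong ⊝_ (sym v≡)))
          w≢0 : w ≢ 𝟎
          w≢0 eq = ⊝-≢0 v≢0 (trans (sym MM) (trans (cong (M ⊗ M′ ⊗_) eq) (⊗-zeroʳ _)))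
          products : M ⊗ M′ ≡ P ⊗ P′
          products = ⊗-cancelˡ w≢0 (trans (⊗-comm w _) (trans MM (trans (sym PP) (⊗-comm _ w))))
          M′≡ : M′ ≡ v ⊕ M
          M′≡ = sym (a⊖b⊕b M′ M)
          P′≡ : P′ ≡ v ⊕ P
          P′≡ = trans (sym (a⊖b⊕b P′ P)) (cong (_⊕ P) (sym v≡))
          vanish : (M ⊖ P) ⊗ (M′ ⊕ P) ≡ 𝟎
          vanish = trans (cong (λ t → (M ⊖ P) ⊗ (t ⊕ P)) M′≡)
            (trans (solve 3 (λ M P v → (M :- P) :* (v :+ M :+ P) := M :* (v :+ M) :- P :* (v :+ P)) refl M P v)
              (trans (cong₂ (λ s t → M ⊗ s ⊖ P ⊗ t) (sym M′≡) (sym P′≡)) (trans (cong (_⊖ P ⊗ P′) products) (⊝-inverseʳ _))))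
          by-cases : M ⊖ P ≡ 𝟎 ⊎ M′ ⊕ P ≡ 𝟎 → (m , m′) ≡ (n , n′)
          by-cases (inj₂ eq) = ⊥-elim (n+n≢0 m′ n m′∈ n∈ eq)
          by-cases (inj₁ eq) = cong₂ _,_ (n-inj m n m∈ n∈ M≡P) (n-inj m′ n′ m′∈ n′∈ (trans M′≡ (trans (cong (v ⊕_) M≡P) (sym P′≡))))
            where
            M≡P : M ≡ P
            M≡P = ⊖≡0⇒≡ eq

        nns-simple : Multiplicity.Simple (≡-dec _≟N_ _≟N_) nns
        nns-simple = simple-cartesian _≟N_ _≟N_ ns ns ns-simple ns-simple

        -- Each key comes from at most one pair of distinct `n`, and Gram sums are nonnegative. So
        -- the sum may be enlarged to all labels, all differences and all `u` in the field; only
        -- this makes `u` a free variable.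
        ∑-gram≤ : ∑ nns (λ p → apart₂ p * gram₃ (key p)) ≤ ∑ ls (λ ℓ → ∑ vs (λ v → ∑F (λ u → gram₄ ℓ (v↑ v) u)))
        ∑-gram≤ = ≤-trans (K.∑-fibre-≤ nns apart₂ key keys gram₃ 1ℤ (λ { (ℓ , (v , u)) → 0≤gram dds (α₂ ℓ (v↑ v)) (x₂ (v↑ v) u) R }) key-mult
            (λ k → ≤-trans (≤-reflexive (∑-cong nns (hits-𝟙 k)))
              (Multiplicity.∑-unique (≡-dec _≟N_ _≟N_) nns nns-simple (hits? k) (hits-unique k))))
          (≤-reflexive (trans (*-identityˡ _) (trans (∑-product ls _ gram₃) (∑-cong ls (λ ℓ → ∑-product vs elems _)))))

        s : D × D → D × D → F
        s (d₁ , d₂) (d₃ , d₄) = (d↑ d₄ ⁻¹ ⊖ d↑ d₃ ⁻¹) ⊖ (d↑ d₂ ⁻¹ ⊖ d↑ d₁ ⁻¹)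

        -- For `s ≠ 0` the argument runs once over the field and the correlations cancel.
        ∑ψ-line : ∀ s w → ∑F (λ u → ψ R (u ⊗ s ⊕ w)) ≤ 𝟙 (s ≟ 𝟎) * (q * Ψ)
        ∑ψ-line s w = go (s ≟ 𝟎)
          where
          go : (d : Dec (s ≡ 𝟎)) → ∑F (λ u → ψ R (u ⊗ s ⊕ w)) ≤ 𝟙 d * (q * Ψ)
          go (yes _) = ≤-trans (∑-mono elems (λ u → ψ≤norm² R _)) (≤-reflexive (trans (∑F-const Ψ) (sym (*-identityˡ _))))
          go (no s≢0) = ≤-reflexive (trans (∑-cong elems (λ u → cong (λ t → ψ R (t ⊕ w)) (⊗-comm u s)))
            (trans (∑F-⊗ s≢0 (λ t → ψ R (t ⊕ w))) (trans (∑F-⊕ w (ψ R)) (trans (∑ψ≡0 R mean) (sym (*-zeroˡ _))))))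

        x₂-line : ∀ v u p p′ → x₂ v u p′ ⊖ x₂ v u p ≡ u ⊗ s p p′ ⊕ (x₂ v 𝟎 p′ ⊖ x₂ v 𝟎 p)
        x₂-line v u (d₁ , d₂) (d₃ , d₄) = trans
          (solve 10 (λ v u d₁ d₂ d₃ d₄ i₁ i₂ i₃ i₄ →
              u :* i₄ :- d₄ :* v :- (u :* i₃ :- d₃ :* v) :- (u :* i₂ :- d₂ :* v :- (u :* i₁ :- d₁ :* v)) :=
              u :* (i₄ :- i₃ :- (i₂ :- i₁)) :+ ((:- (d₄ :* v)) :- (:- (d₃ :* v)) :- (:- (d₂ :* v) :- (:- (d₁ :* v)))))
            refl v u (d↑ d₁) (d↑ d₂) (d↑ d₃) (d↑ d₄) (d↑ d₁ ⁻¹) (d↑ d₂ ⁻¹) (d↑ d₃ ⁻¹) (d↑ d₄ ⁻¹))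
          (cong (u ⊗ s (d₁ , d₂) (d₃ , d₄) ⊕_) (cong₂ _⊖_ (cong₂ _⊖_ (drop d₄) (drop d₃)) (cong₂ _⊖_ (drop d₂) (drop d₁))))
          where
          drop : ∀ d → ⊝ (d↑ d ⊗ v) ≡ x v 𝟎 d
          drop d = sym (trans (cong (_⊖ d↑ d ⊗ v) (⊗-zeroˡ _)) (⊕-identityˡ _))

      -- The additive energy of the reciprocals of `ds`.
      energy : ℤ
      energy = ∑ ds (λ d₁ → ∑ ds (λ d₂ → ∑ ds (λ d₃ → ∑ ds (λ d₄ →
        𝟙 ((d↑ d₄ ⁻¹ ⊖ d↑ d₃ ⁻¹) ⊖ (d↑ d₂ ⁻¹ ⊖ d↑ d₁ ⁻¹) ≟ 𝟎)))))

      private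
        lab : Λ → D → ℤ
        lab ℓ d = 𝟙 (λd d ≟Λ ℓ)

        0≤α : ∀ ℓ v d → 0ℤ ≤ α ℓ v d
        0≤α ℓ v d = 0≤* (0≤𝟙 (λd d ≟Λ ℓ)) (0≤ψ₂ _)

        α≤lab*i : ∀ ℓ v d → α ℓ v d ≤ lab ℓ d * i
        α≤lab*i ℓ v d = *-monoˡ (0≤𝟙 (λd d ≟Λ ℓ)) (ψ₂≤i _)

        α≤i : ∀ ℓ v d → α ℓ v d ≤ i
        α≤i ℓ v d = ≤-trans (*-monoʳ (0≤ψ₂ _) (𝟙≤1 (λd d ≟Λ ℓ))) (≤-trans (≤-reflexive (*-identityˡ _)) (ψ₂≤i _))

        -- Only the label of the first index is kept. Summed over all labels it contributes at most
        -- 1, so the number of labels does not enter the final bound.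
        α₂α₂≤ : ∀ ℓ v p p′ → α₂ ℓ v p * α₂ ℓ v p′ ≤ lab ℓ (proj₁ p) * (i * i * (i * i))
        α₂α₂≤ ℓ v (d₁ , d₂) (d₃ , d₄) = ≤-trans
          (*-mono-nonneg (0≤* (0≤α ℓ v d₁) (0≤α ℓ v d₂)) (*-mono-nonneg (0≤α ℓ v d₁) (α≤lab*i ℓ v d₁) (0≤α ℓ v d₂) (α≤i ℓ v d₂))
            (0≤* (0≤α ℓ v d₃) (0≤α ℓ v d₄)) (*-mono-nonneg (0≤α ℓ v d₃) (α≤i ℓ v d₃) (0≤α ℓ v d₄) (α≤i ℓ v d₄)))
          (≤-reflexive (t-lab (lab ℓ d₁) i))
          where
          opaque
            unfolding arith
            t-lab : ∀ l i → l * i * i * (i * i) ≡ l * (i * i * (i * i))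
            t-lab = solve-∀

        0≤α₂α₂ : ∀ ℓ v p p′ → 0ℤ ≤ α₂ ℓ v p * α₂ ℓ v p′
        0≤α₂α₂ ℓ v p p′ = 0≤* (0≤* (0≤α ℓ v _) (0≤α ℓ v _)) (0≤* (0≤α ℓ v _) (0≤α ℓ v _))

        B : ℤ
        B = i * i * (i * i) * (q * Ψ)

        0≤B : 0ℤ ≤ B
        0≤B = 0≤* (0≤sq (i * i)) (0≤* 0≤+ₙ 0≤Ψ)

        S : D × D → D × D → ℤ
        S p p′ = 𝟙 (s p p′ ≟ 𝟎)

        ∑u-gram : ∀ ℓ v → ∑F (λ u → gram₄ ℓ v u) ≤ ∑ dds (λ p → ∑ dds (λ p′ → lab ℓ (proj₁ p) * (S p p′ * B)))
        ∑u-gram ℓ v = ≤-trans (≤-reflexive (trans (∑-swap elems dds _) (∑-cong dds (λ p → trans (∑-swap elems dds _) (∑-cong dds (λ p′ →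
            trans (∑-*ˡ elems (α₂ ℓ v p * α₂ ℓ v p′) _) (cong (α₂ ℓ v p * α₂ ℓ v p′ *_)
              (∑-cong elems (λ u → cong (ψ R) (x₂-line v u p p′))))))))))
          (∑-mono dds (λ p → ∑-mono dds (λ p′ → ≤-trans (*-monoˡ (0≤α₂α₂ ℓ v p p′) (∑ψ-line (s p p′) _))
            (≤-trans (*-monoʳ (0≤* (0≤𝟙 (s p p′ ≟ 𝟎)) (0≤* 0≤+ₙ 0≤Ψ)) (α₂α₂≤ ℓ v p p′))
              (≤-reflexive (t-B (lab ℓ (proj₁ p)) (i * i * (i * i)) (S p p′) (q * Ψ)))))))
          where
          opaque
            unfolding arith
            t-B : ∀ l j s k → l * j * (s * k) ≡ l * (s * (j * k))
            t-B = solve-∀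

        ∑-all : ∑ ls (λ ℓ → ∑ vs (λ v → ∑F (λ u → gram₄ ℓ (v↑ v) u))) ≤ + length vs * (energy * B)
        ∑-all = ≤-trans (∑-mono ls (λ ℓ → ∑-mono vs (λ v → ∑u-gram ℓ (v↑ v)))) (≤-trans (≤-reflexive
            (trans (∑-swap ls vs _) (trans (∑-const vs _) (cong (+ length vs *_) (trans (∑-swap ls dds _)
              (∑-cong dds (λ p → trans (∑-swap ls dds _) (∑-cong dds (λ p′ → ∑-*ʳ ls _ (λ ℓ → lab ℓ (proj₁ p)))))))))))
          (*-monoˡ 0≤+ₙ (≤-trans (∑-mono dds (λ p → ∑-mono dds (λ p′ → ≤-trans (*-monoʳ (0≤* (0≤𝟙 (s p p′ ≟ 𝟎)) 0≤B)
              (≤-trans (≤-reflexive (∑-cong ls (λ ℓ → 𝟙-cong (λd (proj₁ p) ≟Λ ℓ) (ℓ ≟Λ λd (proj₁ p)) sym sym))) (ls-simple _)))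
              (≤-reflexive (*-identityˡ _)))))
            (≤-reflexive (trans (∑-cong dds (λ p → ∑-*ʳ dds B _)) (trans (∑-*ʳ dds B _) (cong (_* B)
              (trans (∑-product ds ds _) (∑-cong ds (λ d₁ → ∑-cong ds (λ d₂ → ∑-product ds ds _)))))))))))

        pow4-apart : ∀ p h → pow4 (apart₂ p * h) ≡ apart₂ p * pow4 h
        pow4-apart p h = trans (t-p4 (apart₂ p) h) (cong (_* pow4 h) (trans (cong₂ _*_ sq sq) sq))
          where
          sq : apart₂ p * apart₂ p ≡ apart₂ p
          sq = 𝟙-sq (¬? (proj₁ p ≟N proj₂ p))
          opaque
            unfolding arith
            t-p4 : ∀ a h → a * h * (a * h) * (a * h * (a * h)) ≡ a * a * (a * a) * (h * h * (h * h))
            t-p4 = solve-∀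

      -- Hölder over the pairs gives the sixth power of the number of `n`; the fourth powers of `H`
      -- are bounded by Gram sums, and these add up to the energy.
      offDiagonal⁴ : pow4 offDiagonal ≤ (∣ns∣ * ∣ns∣) * (∣ns∣ * ∣ns∣) * (∣ns∣ * ∣ns∣) * (Ψ * Ψ * Ψ * (+ length vs * (energy * B)))
      offDiagonal⁴ = ≤-trans (pow4-mono (∑-nonneg ns (λ n → ∑-nonneg ns (λ n′ → 0≤* (0≤𝟙 (¬? (n ≟N n′))) (0≤abs _))))
            (≤-trans (≤-reflexive (sym (∑-product ns ns _))) (∑-mono-∈ nns (λ { (n , n′) p∈ →
              *-monoˡ (0≤𝟙 (¬? (n ≟N n′))) (abs-G≤ n n′ (proj₁ (∈-cartesianProduct⁻ ns ns p∈)) (proj₂ (∈-cartesianProduct⁻ ns ns p∈))) }))))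
          (≤-trans (∑-pow4-≤ nns _) (≤-trans (≤-reflexive (cong (λ l → l * l * l * ∑ nns fourth) length-nns))
            (*-monoˡ (0≤* (0≤* (0≤sq ∣ns∣) (0≤sq ∣ns∣)) (0≤sq ∣ns∣))
              (≤-trans (∑-mono nns {f = fourth} at) (≤-trans (≤-reflexive (∑-*ˡ nns (Ψ * Ψ * Ψ) _))
                (*-monoˡ (0≤* (0≤sq Ψ) 0≤Ψ) (≤-trans ∑-gram≤ ∑-all)))))))
        where
        length-nns : + length nns ≡ ∣ns∣ * ∣ns∣
        length-nns = trans (sym (trans (∑-const nns 1ℤ) (*-identityʳ _))) (trans (∑-product ns ns (λ _ → 1ℤ))
          (trans (∑-cong ns (λ _ → trans (∑-const ns 1ℤ) (*-identityʳ _))) (∑-const ns ∣ns∣)))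
        fourth : N × N → ℤ
        fourth p = pow4 (apart₂ p * abs (H (κ (proj₁ p)) (v↑ (gap (proj₁ p) (proj₂ p))) u[ proj₁ p , proj₂ p ]))
        at : ∀ p → fourth p ≤ Ψ * Ψ * Ψ * (apart₂ p * gram₃ (key p))
        at p@(n , n′) = ≤-trans (≤-reflexive (trans (pow4-apart p _) (cong (λ h → apart n n′ * (h * h)) (abs-sq _))))
          (≤-trans (*-monoˡ (0≤𝟙 (¬? (n ≟N n′))) (H⁴ (κ n) (v↑ (gap n n′)) u[ n , n′ ]))
            (≤-reflexive (swap-middle (apart n n′) (Ψ * Ψ * Ψ) _)))

-- The residues modulo a prime as a finite field.

module PrimeField where

  open import Data.Nat as ℕ using (ℕ; zero; suc)
  import Data.Nat.Properties as ℕP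
  import Data.Nat.DivMod as ℕD
  open import Data.Nat.Divisibility using (divides; ∣⇒≤) renaming (_∣_ to _∣ℕ_)
  open import Data.Nat.Primality using (Prime; prime⇒nonZero; prime⇒nonTrivial)
  open import Data.Nat.Coprimality using (prime⇒coprime; coprime-Bézout)
  open import Data.Nat.GCD using (module Bézout)
  open import Data.Integer using (ℤ; +_; 0ℤ; 1ℤ; ∣_∣; _+_; _*_; -_; _-_)
  import Data.Integer.Properties as ℤP
  open import Data.Integer.Divisibility using (_∣_)
  open import Data.Integer.Divisibility.Signed as Signed using (∣ᵤ⇒∣; ∣⇒∣ᵤ)
  open import Data.Integer.DivMod using (_%ℕ_; _/ℕ_; n%ℕd<d; a≡a%ℕn+[a/ℕn]*n)
  open import Data.Integer.Tactic.RingSolver using (solve-∀)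
  open import Data.Fin using (Fin; zero; suc; toℕ; fromℕ<)
  import Data.Fin.Properties as FP
  open import Data.List using (length; allFin)
  open import Data.List.Properties using (length-tabulate; map-tabulate)
  open import Data.Product using (∃; _×_; _,_; proj₁; proj₂)
  open import Data.Empty using (⊥-elim)
  open import Function using (id)
  open import Algebra.Structures using (IsCommutativeRing)
  open import Relation.Nullary using (yes; no; contradiction)
  open import Relation.Binary.PropositionalEquality
  open Sums
  open Field

  mult-allFin : ∀ n → Multiplicity.Enumeration FP._≟_ (allFin n)
  mult-allFin (suc n) a = trans (cong (λ s → 𝟙 (zero FP.≟ a) Int.+ s) (trans (cong (λ l → ∑ l (λ x → 𝟙 (x FP.≟ a))) (sym (map-tabulate id suc))) (∑-map suc (allFin n) _))) (go a)
    where
    go : ∀ a → 𝟙 (zero FP.≟ a) Int.+ ∑ (allFin n) (λ x → 𝟙 (suc x FP.≟ a)) ≡ 1ℤ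
    go zero = trans (cong (Int._+_ 1ℤ) (∑-zero (allFin n) (λ x → refl))) (Int.+-identityʳ 1ℤ)
    go (suc b) = trans (Int.+-identityˡ _) (trans (∑-cong (allFin n) (λ x → 𝟙-cong (suc x FP.≟ suc b) (x FP.≟ b) FP.suc-injective (cong suc))) (mult-allFin n b))

  record ResidueField (q : ℕ) : Set₁ where
    field
      field′ : FiniteField
    open FiniteField field′
    field
      size : length elems ≡ q
      ι-≡⇒∣ : ∀ a b → ι a ≡ ι b → + q ∣ a - b
      ι-∣⇒≡ : ∀ a b → + q ∣ a - b → ι a ≡ ι b
      ι-surj : ∀ x → ∃ λ r → r ℕ.< q × x ≡ ι (+ r)

  module _ (q : ℕ) (q-prime : Prime q) where
    private instance
      q≢0 : ℕ.NonZero q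
      q≢0 = prime⇒nonZero q-prime

    private
      F : Set
      F = Fin q

      ι : ℤ → F
      ι a = fromℕ< (n%ℕd<d a q)

      rep : F → ℤ
      rep x = + toℕ x

      rep-ι : ∀ a → rep (ι a) ≡ + (a %ℕ q)
      rep-ι a = cong +_ (FP.toℕ-fromℕ< (n%ℕd<d a q))

      quot : ∀ a → a ≡ rep (ι a) + (a /ℕ q) * + q
      quot a = trans (a≡a%ℕn+[a/ℕn]*n a q) (cong (_+ (a /ℕ q) * + q) (sym (rep-ι a)))

      -- Representatives lie in [0, q), so their difference is below `q` in absolute value; being a
      -- multiple of `q`, it is zero.
      small : ∀ x y k → rep x ≡ rep y + k * + q → x ≡ y
      small x y k eq = FP.toℕ-injective (ℤP.+-injective (ℤP.i-j≡0⇒i≡j (rep x) (rep y) (ℤP.∣i∣≡0⇒i≡0 (vanish ∣ rep x - rep y ∣ refl))))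
        where
        lem : ∀ a b c → a ≡ b + c → a - b ≡ c
        lem a b c refl = l₂ b c
          where
          l₂ : ∀ b c → b + c - b ≡ c
          l₂ = solve-∀
        q∣ : q ∣ℕ ∣ rep x - rep y ∣
        q∣ = divides ∣ k ∣ (trans (cong ∣_∣ (lem (rep x) (rep y) (k * + q) eq)) (ℤP.abs-* k (+ q)))
        bound : ∣ rep x - rep y ∣ ℕ.< q
        bound = ℕP.≤-<-trans (subst (ℕ._≤ toℕ x ℕ.⊔ toℕ y) (cong ∣_∣ (sym (ℤP.m-n≡m⊖n (toℕ x) (toℕ y)))) (ℤP.∣m⊝n∣≤m⊔n (toℕ x) (toℕ y)))
          (ℕP.⊔-lub (FP.toℕ<n x) (FP.toℕ<n y))
        vanish : ∀ d → d ≡ ∣ rep x - rep y ∣ → ∣ rep x - rep y ∣ ≡ 0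
        vanish zero e = sym e
        vanish (suc d) e = ⊥-elim (ℕP.<⇒≱ bound (∣⇒≤ {{subst ℕ.NonZero e _}} q∣))

      ι-eq : ∀ a b k → a ≡ b + k * + q → ι a ≡ ι b
      ι-eq a b k eq = small (ι a) (ι b) (k + (b /ℕ q) - (a /ℕ q))
        (trans (l₁ a (rep (ι a)) ((a /ℕ q) * + q) (quot a)) (trans (cong (_- (a /ℕ q) * + q) (trans eq (cong (_+ k * + q) (quot b))))
          (l₂ (rep (ι b)) (b /ℕ q) (+ q) k (a /ℕ q))))
        where
        l₁ : ∀ a r s → a ≡ r + s → r ≡ a - s
        l₁ a r s refl = l₃ r s
          where
          l₃ : ∀ r s → r ≡ r + s - s
          l₃ = solve-∀
        l₂ : ∀ r B q k A → r + B * q + k * q - A * q ≡ r + (k + B - A) * q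
        l₂ = solve-∀

      ι-rep : ∀ x → ι (rep x) ≡ x
      ι-rep x = FP.toℕ-injective (trans (FP.toℕ-fromℕ< _) (ℕD.m<n⇒m%n≡m (FP.toℕ<n x)))

      surj : ∀ x → ∃ λ a → ι a ≡ x
      surj x = rep x , ι-rep x

      infixl 6 _⊕_
      infixl 7 _⊗_
      _⊕_ _⊗_ : F → F → F
      x ⊕ y = ι (rep x + rep y)
      x ⊗ y = ι (rep x * rep y)
      ⊝_ : F → F
      ⊝ x = ι (- rep x)

      ι-+ : ∀ a b → ι (a + b) ≡ ι a ⊕ ι b
      ι-+ a b = ι-eq (a + b) (rep (ι a) + rep (ι b)) ((a /ℕ q) + (b /ℕ q)) (trans (cong₂ _+_ (quot a) (quot b)) (l (rep (ι a)) (a /ℕ q) (+ q) (rep (ι b)) (b /ℕ q)))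
        where
        l : ∀ r A q s B → r + A * q + (s + B * q) ≡ r + s + (A + B) * q
        l = solve-∀

      ι-* : ∀ a b → ι (a * b) ≡ ι a ⊗ ι b
      ι-* a b = ι-eq (a * b) (rep (ι a) * rep (ι b)) (rep (ι a) * (b /ℕ q) + (a /ℕ q) * b)
        (trans (cong₂ _*_ (quot a) (quot b)) (trans (l (rep (ι a)) (a /ℕ q) (+ q) (rep (ι b)) (b /ℕ q))
          (cong (λ c → rep (ι a) * rep (ι b) + (rep (ι a) * (b /ℕ q) + (a /ℕ q) * c) * + q) (sym (quot b)))))
        where
        l : ∀ r A q s B → (r + A * q) * (s + B * q) ≡ r * s + (r * B + A * (s + B * q)) * q
        l = solve-∀

      ι-neg : ∀ a → ι (- a) ≡ ⊝ ι a
      ι-neg a = ι-eq (- a) (- rep (ι a)) (- (a /ℕ q)) (trans (cong -_ (quot a)) (l (rep (ι a)) (a /ℕ q) (+ q)))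
        where
        l : ∀ r A q → - (r + A * q) ≡ - r + (- A) * q
        l = solve-∀

      ring : IsCommutativeRing _≡_ _⊕_ _⊗_ ⊝_ (ι 0ℤ) (ι 1ℤ)
      ring = record
        { isRing = record
          { +-isAbelianGroup = record
            { isGroup = record
              { isMonoid = record
                { isSemigroup = record
                  { isMagma = record { isEquivalence = isEquivalence ; ∙-cong = cong₂ _⊕_ }
                  ; assoc = λ x y z → assoc x y z (surj x) (surj y) (surj z) }
                ; identity = (λ x → idˡ x (surj x)) , (λ x → trans (cong ι (ℤP.+-comm (rep x) (rep (ι 0ℤ)))) (idˡ x (surj x))) }
              ; inverse = (λ x → invˡ x (surj x)) , (λ x → trans (cong ι (ℤP.+-comm (rep x) (rep (⊝ x)))) (invˡ x (surj x)))
              ; ⁻¹-cong = cong ⊝_ }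
            ; comm = λ x y → cong ι (ℤP.+-comm (rep x) (rep y)) }
          ; *-cong = cong₂ _⊗_
          ; *-assoc = λ x y z → *assoc x y z (surj x) (surj y) (surj z)
          ; *-identity = (λ x → *idˡ x (surj x)) , (λ x → trans (cong ι (ℤP.*-comm (rep x) (rep (ι 1ℤ)))) (*idˡ x (surj x)))
          ; distrib = (λ x y z → distribˡ x y z (surj x) (surj y) (surj z)) ,
              (λ x y z → trans (cong ι (ℤP.*-comm (rep (y ⊕ z)) (rep x))) (trans (distribˡ x y z (surj x) (surj y) (surj z))
                (cong₂ _⊕_ (cong ι (ℤP.*-comm (rep x) (rep y))) (cong ι (ℤP.*-comm (rep x) (rep z)))))) }
        ; *-comm = λ x y → cong ι (ℤP.*-comm (rep x) (rep y)) }
        where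
        R : F → Set
        R x = ∃ λ a → ι a ≡ x
        assoc : ∀ x y z → R x → R y → R z → (x ⊕ y) ⊕ z ≡ x ⊕ (y ⊕ z)
        assoc _ _ _ (a , refl) (b , refl) (c , refl) = trans (cong (_⊕ ι c) (sym (ι-+ a b))) (trans (sym (ι-+ (a + b) c))
          (trans (cong ι (ℤP.+-assoc a b c)) (trans (ι-+ a (b + c)) (cong (ι a ⊕_) (ι-+ b c)))))
        idˡ : ∀ x → R x → ι 0ℤ ⊕ x ≡ x
        idˡ _ (a , refl) = trans (sym (ι-+ 0ℤ a)) (cong ι (ℤP.+-identityˡ a))
        invˡ : ∀ x → R x → ⊝ x ⊕ x ≡ ι 0ℤ
        invˡ _ (a , refl) = trans (cong (_⊕ ι a) (sym (ι-neg a))) (trans (sym (ι-+ (- a) a)) (cong ι (ℤP.+-inverseˡ a)))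
        *assoc : ∀ x y z → R x → R y → R z → (x ⊗ y) ⊗ z ≡ x ⊗ (y ⊗ z)
        *assoc _ _ _ (a , refl) (b , refl) (c , refl) = trans (cong (_⊗ ι c) (sym (ι-* a b))) (trans (sym (ι-* (a * b) c))
          (trans (cong ι (ℤP.*-assoc a b c)) (trans (ι-* a (b * c)) (cong (ι a ⊗_) (ι-* b c)))))
        *idˡ : ∀ x → R x → ι 1ℤ ⊗ x ≡ x
        *idˡ _ (a , refl) = trans (sym (ι-* 1ℤ a)) (cong ι (ℤP.*-identityˡ a))
        distribˡ : ∀ x y z → R x → R y → R z → x ⊗ (y ⊕ z) ≡ x ⊗ y ⊕ x ⊗ z
        distribˡ _ _ _ (a , refl) (b , refl) (c , refl) = trans (cong (ι a ⊗_) (sym (ι-+ b c))) (trans (sym (ι-* a (b + c)))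
          (trans (cong ι (ℤP.*-distribˡ-+ a b c)) (trans (ι-+ (a * b) (a * c)) (cong₂ _⊕_ (ι-* a b) (ι-* a c)))))

      inverse : ∀ x → x ≢ ι 0ℤ → ∃ λ y → x ⊗ y ≡ ι 1ℤ
      inverse x x≢0 = go (coprime-Bézout (prime⇒coprime q-prime {{ℕ.≢-nonZero r≢0}} (FP.toℕ<n x)))
        where
        r : ℕ
        r = toℕ x
        r≢0 : r ≢ 0
        r≢0 e = x≢0 (trans (sym (ι-rep x)) (cong (λ n → ι (+ n)) e))
        times : ∀ s → x ⊗ ι s ≡ ι (+ r * s)
        times s = trans (cong (_⊗ ι s) (sym (ι-rep x))) (sym (ι-* (+ r) s))
        go : Bézout.Identity.Identity 1 q r → ∃ λ y → x ⊗ y ≡ ι 1ℤ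
        go (Bézout.+- u v eq) = ι (- + v) , trans (times (- + v)) (ι-eq (+ r * - + v) 1ℤ (- + u) (trans
            (l (+ r) (+ v)) (trans (cong (λ t → 1ℤ - t) (trans (cong (_+_ 1ℤ) (sym (ℤP.pos-* v r))) (trans (cong +_ eq) (ℤP.pos-* u q)))) (l₂ (+ u) (+ q)))))
          where
          l : ∀ r v → r * (- v) ≡ 1ℤ - (1ℤ + v * r)
          l = solve-∀
          l₂ : ∀ u q → 1ℤ - u * q ≡ 1ℤ + (- u) * q
          l₂ = solve-∀
        go (Bézout.-+ u v eq) = ι (+ v) , trans (times (+ v)) (ι-eq (+ r * + v) 1ℤ (+ u) (trans (ℤP.*-comm (+ r) (+ v))
          (trans (sym (ℤP.pos-* v r)) (trans (cong +_ (sym eq)) (cong (_+_ 1ℤ) (ℤP.pos-* u q))))))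

      inv : F → F
      inv x with x FP.≟ ι 0ℤ
      ... | yes _ = ι 0ℤ
      ... | no x≢0 = proj₁ (inverse x x≢0)

      inv-spec : ∀ x → x ≢ ι 0ℤ → x ⊗ inv x ≡ ι 1ℤ
      inv-spec x x≢0 with x FP.≟ ι 0ℤ
      ... | yes e = contradiction e x≢0
      ... | no ne = proj₂ (inverse x ne)

      ≡⇒∣ : ∀ a b → ι a ≡ ι b → + q ∣ a - b
      ≡⇒∣ a b eq = ∣⇒∣ᵤ (Signed.divides ((a /ℕ q) - (b /ℕ q)) (trans (cong₂ _-_ (trans (quot a) (cong (λ x → rep x + (a /ℕ q) * + q) eq)) (quot b)) (l (rep (ι b)) (a /ℕ q) (b /ℕ q) (+ q))))
        where
        l : ∀ r A B q → r + A * q - (r + B * q) ≡ (A - B) * q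
        l = solve-∀

      ∣⇒≡ : ∀ a b → + q ∣ a - b → ι a ≡ ι b
      ∣⇒≡ a b q∣ = go (∣ᵤ⇒∣ q∣)
        where
        l : ∀ a b → a ≡ b + (a - b)
        l = solve-∀
        go : + q Signed.∣ a - b → ι a ≡ ι b
        go (Signed.divides k eq) = ι-eq a b k (trans (l a b) (cong (λ t → b + t) eq))

      1≢0 : ι 1ℤ ≢ ι 0ℤ
      1≢0 eq = ℕP.<⇒≱ (ℕ.nonTrivial⇒n>1 q {{prime⇒nonTrivial q-prime}}) (∣⇒≤ (≡⇒∣ 1ℤ 0ℤ eq))

    opaque
      -- Opaque, so that nothing later unfolds into arithmetic of `Fin q`.
      residueField : ResidueField q
      residueField = record
        { field′ = record
          { F = F ; _≟_ = FP._≟_ ; _⊕_ = _⊕_ ; _⊗_ = _⊗_ ; ⊝_ = ⊝_ ; _⁻¹ = inv ; 𝟎 = ι 0ℤ ; 𝟏 = ι 1ℤ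
          ; isCommutativeRing = ring ; ⊗-inverseʳ = inv-spec ; 𝟏≢𝟎 = 1≢0
          ; ι = ι ; ι-+ = ι-+ ; ι-* = ι-* ; ι-neg = ι-neg ; ι-0 = refl ; ι-1 = refl
          ; elems = allFin q ; enum = mult-allFin q }
        ; size = length-tabulate id
        ; ι-≡⇒∣ = ≡⇒∣ ; ι-∣⇒≡ = ∣⇒≡
        ; ι-surj = λ x → toℕ x , (FP.toℕ<n x , sym (ι-rep x)) }

-- Powers of natural numbers.

module NatPow where

  open import Data.Nat
  open import Data.Nat.Properties
  open import Data.Nat.Tactic.RingSolver using (solve-∀)
  open import Relation.Binary.PropositionalEquality

  *-^ : ∀ m n k → (m * n) ^ k ≡ m ^ k * n ^ k
  *-^ m n zero = refl
  *-^ m n (suc k) = trans (cong (m * n *_) (*-^ m n k)) (lem m n (m ^ k) (n ^ k))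
    where
    lem : ∀ m n a b → m * n * (a * b) ≡ m * a * (n * b)
    lem = solve-∀

  ^-cancelˡ-≤ : ∀ k .{{_ : NonZero k}} {m n} → m ^ k ≤ n ^ k → m ≤ n
  ^-cancelˡ-≤ k {m} {n} p = ≮⇒≥ λ n<m → <⇒≱ (^-monoˡ-< k n<m) p

  ^-cancelˡ-< : ∀ k {m n} → m ^ k < n ^ k → m < n
  ^-cancelˡ-< k {m} {n} p = ≰⇒> λ n≤m → <⇒≱ p (^-monoˡ-≤ k n≤m)

  n<2^n : ∀ n → n < 2 ^ n
  n<2^n zero = s≤s z≤n
  n<2^n (suc n) = ≤-trans (+-mono-≤ (m^n>0 2 n) (n<2^n n)) (≤-reflexive (cong (2 ^ n +_) (sym (+-identityʳ (2 ^ n)))))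

-- The divisor bound.

module Divisors where

  open import Data.Nat
  open import Data.Nat.Properties
  open import Data.Nat.Divisibility
  open import Data.Nat.Primality
  open import Data.Nat.Primality.Factorisation using (factorise; PrimeFactorisation)
  open import Data.Nat.Coprimality using (Coprime; coprime-divisor)
  open import Data.Nat.Tactic.RingSolver using (solve-∀)
  open import Data.Nat.ListAction using (product)
  open import Data.List using (List; []; _∷_; _++_; map; length)
  open import Data.List.Properties using (length-++; length-map)
  open import Data.List.Membership.Propositional using (_∈_)
  open import Data.List.Membership.Propositional.Properties using (∈-++⁺ˡ; ∈-++⁺ʳ; ∈-map⁺)
  open import Data.List.Relation.Unary.Any using (here; there)
  open import Data.List.Relation.Unary.All using (All; []; _∷_)
  open import Data.Product using (∃; _×_; _,_)
  open import Data.Sum using (_⊎_; inj₁; inj₂)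
  open import Data.Empty using (⊥-elim)
  open import Relation.Nullary using (yes; no; ¬_)
  open import Relation.Binary.PropositionalEquality
  open NatPow

  CoversDivisors : ℕ → List ℕ → Set
  CoversDivisors n xs = ∀ {d} → d ∣ n → d ∈ xs

  divides-prime-* : ∀ {p m d} → Prime p → d ∣ p * m → d ∣ m ⊎ ∃ λ d′ → d ≡ p * d′ × d′ ∣ m
  divides-prime-* {p} {m} {d} pp d∣pm with p ∣? d
  ... | yes (divides d′ eq) = inj₂ (d′ , trans eq (*-comm d′ p) ,
          *-cancelˡ-∣ p {{prime⇒nonZero pp}} (subst (_∣ p * m) (trans eq (*-comm d′ p)) d∣pm))
  ... | no p∤d = inj₁ (coprime-divisor coprime d∣pm)
    where
    coprime : Coprime d p
    coprime {e} (e∣d , e∣p) with prime⇒irreducible pp e∣p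
    ... | inj₁ e≡1 = e≡1
    ... | inj₂ refl = ⊥-elim (p∤d e∣d)

  -- The products `p ^ i * x` with `i ≤ e` and `x` in `xs`. Only an upper bound for the number of
  -- divisors is wanted, so repetitions are harmless.
  layers : ℕ → ℕ → List ℕ → List ℕ
  layers p zero xs = xs
  layers p (suc e) xs = xs ++ map (p *_) (layers p e xs)

  length-layers : ∀ p e xs → length (layers p e xs) ≡ suc e * length xs
  length-layers p zero xs = sym (+-identityʳ _)
  length-layers p (suc e) xs = trans (length-++ xs) (cong (length xs +_) (trans (length-map (p *_) (layers p e xs)) (length-layers p e xs)))

  covers-layers : ∀ {p m xs} → Prime p → CoversDivisors m xs → ∀ e → CoversDivisors (p ^ e * m) (layers p e xs)
  covers-layers pp cov zero d∣ = cov (subst (_ ∣_) (+-identityʳ _) d∣)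
  covers-layers {p} {m} {xs} pp cov (suc e) {d} d∣ with divides-prime-* pp (subst (d ∣_) (*-assoc p (p ^ e) m) d∣)
  ... | inj₂ (d′ , refl , d′∣) = ∈-++⁺ʳ xs (∈-map⁺ (p *_) (covers-layers pp cov e d′∣))
  ... | inj₁ d∣′ = weaken e (covers-layers pp cov e d∣′)
    where
    weaken : ∀ e {d} → d ∈ layers p e xs → d ∈ layers p (suc e) xs
    weaken zero d∈ = ∈-++⁺ˡ d∈
    weaken (suc e) d∈ with ∈-++⁻ xs d∈
      where open import Data.List.Membership.Propositional.Properties using (∈-++⁻)
    ... | inj₁ d∈xs = ∈-++⁺ˡ d∈xs
    ... | inj₂ d∈map with ∈-map⁻ (p *_) d∈map
      where open import Data.List.Membership.Propositional.Properties using (∈-map⁻)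
    ...   | (d′ , d′∈ , refl) = ∈-++⁺ʳ xs (∈-map⁺ (p *_) (weaken e d′∈))

  split-power : ∀ fuel i n → 2 ≤ i → .{{_ : NonZero n}} → n ≤ fuel → ∃ λ e → ∃ λ m → n ≡ i ^ e * m × ¬ (i ∣ m)
  split-power zero i n 2≤i n≤0 = ⊥-elim (<⇒≱ (>-nonZero⁻¹ n) n≤0)
  split-power (suc fuel) i n 2≤i n≤ with i ∣? n
  ... | no i∤n = 0 , n , sym (+-identityʳ n) , i∤n
  ... | yes (divides m eq) with split-power fuel i m 2≤i {{m≢0}} (s≤s⁻¹ (≤-trans m<n n≤))
    where
    m≢0 : NonZero m
    m≢0 = ≢-nonZero λ { refl → ≢-nonZero⁻¹ n eq }
    m<n : m < n
    m<n = subst (m <_) (sym eq) (subst (_< m * i) (*-identityʳ m) (*-monoʳ-< m {{m≢0}} 2≤i))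
  ...   | e , m′ , eq′ , i∤ = suc e , m′ , trans eq (trans (cong (_* i) eq′) (lem i (i ^ e) m′)) , i∤
    where
    lem : ∀ i a m → a * m * i ≡ i * a * m
    lem = solve-∀

  -- Numbers without prime factors below 2 ^ k have at most n ^ (1/k) divisors, because every prime
  -- factor doubles the number of divisors; each prime below 2 ^ k costs a factor log n only.
  module _ (k : ℕ) where

    private
      Y : ℕ
      Y = 2 ^ k

    -- A prime factor `p` doubles the list, which multiplies the `k`-th power of its length by
    -- `2 ^ k ≤ p`.
    rough-divisors : ∀ ps → All Prime ps → All (Y ≤_) ps →
      ∃ λ xs → CoversDivisors (product ps) xs × length xs ^ k ≤ product ps
    rough-divisors [] _ _ = 1 ∷ [] , (λ d∣1 → here (∣1⇒≡1 d∣1)) , ≤-reflexive (^-zeroˡ k)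
    rough-divisors (p ∷ ps) (pp ∷ primes) (Y≤p ∷ large) with rough-divisors ps primes large
    ... | xs , cov , len = layers p 1 xs , (λ d∣ → covers-layers pp cov 1 (subst (λ u → _ ∣ u * product ps) (sym (*-identityʳ p)) d∣)) ,
      ≤-trans (≤-reflexive (trans (cong (_^ k) (length-layers p 1 xs)) (*-^ 2 (length xs) k))) (*-mono-≤ Y≤p len)

    prime∣product : ∀ {p} ps → p ∈ ps → p ∣ product ps
    prime∣product (p ∷ ps) (here refl) = m∣m*n (product ps)
    prime∣product (q ∷ ps) (there p∈) = ∣n⇒∣m*n q (prime∣product ps p∈)

    Bounded : ℕ → ℕ → ℕ → Set
    Bounded L j n = ∃ λ xs → CoversDivisors n xs × length xs ^ k ≤ suc L ^ (k * j) * n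

    -- Induction on the number `j` of integers `i` still below `2 ^ k`. If `i` divides the `i`-rough
    -- `n`, it is prime, and its power `i ^ e` lengthens the list by the factor `e + 1 ≤ L + 1`. The
    -- second alternative covers the start at 2 when `2 ^ k` is at most 2.
    divisor-bound-rough : ∀ L j i → 2 ≤ i → i + j ≡ Y ⊎ (j ≡ 0 × Y ≤ i) → ∀ n → .{{_ : NonZero n}} → n ≤ 2 ^ L → i Rough n → Bounded L j n
    divisor-bound-rough L zero i 2≤i i≥ n n≤ rough = base (factorise n)
      where
      reached : i + 0 ≡ Y ⊎ (0 ≡ 0 × Y ≤ i) → Y ≤ i
      reached (inj₁ eq) = ≤-reflexive (sym (trans (sym (+-identityʳ i)) eq))
      reached (inj₂ (_ , le)) = le
      Y≤i : Y ≤ i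
      Y≤i = reached i≥
      base : PrimeFactorisation n → Bounded L zero n
      base record { factors = ps ; isFactorisation = refl ; factorsPrime = primes } =
        let xs , cov , len = rough-divisors ps primes (large ps primes (λ p∈ → prime∣product ps p∈)) in
        xs , cov , ≤-trans len (≤-reflexive (sym (trans (cong (λ t → suc L ^ t * product ps) (*-zeroʳ k)) (+-identityʳ _))))
        where
        large : ∀ qs → All Prime qs → (∀ {p} → p ∈ qs → p ∣ product ps) → All (Y ≤_) qs
        large [] _ _ = []
        large (q ∷ qs) (pq ∷ rest) div = ≤-trans Y≤i (≮⇒≥ (λ q<i → rough (hasNonTrivialDivisor {{prime⇒nonTrivial pq}} q<i (div (here refl))))) ∷ large qs rest (λ p∈ → div (there p∈))
    divisor-bound-rough L (suc j) i 2≤i (inj₁ i+j) n n≤ rough with split-power n i n 2≤i ≤-refl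
    ... | e , m , eq , i∤m = go e eq e≤L (divisor-bound-rough L j (suc i) (m≤n⇒m≤1+n 2≤i) (inj₁ (trans (sym (+-suc i j)) i+j)) m {{m≢0}} (≤-trans m≤n n≤) (∤⇒rough-suc i∤m (rough∧∣⇒rough rough m∣n)))
      where
      m≢0 : NonZero m
      m≢0 = ≢-nonZero λ { refl → ≢-nonZero⁻¹ n (trans eq (*-zeroʳ (i ^ e))) }
      instance
        i-nonTrivial : NonTrivial i
        i-nonTrivial = n>1⇒nonTrivial 2≤i
        i-nonZero : NonZero i
        i-nonZero = nonTrivial⇒nonZero i
      m∣n : m ∣ n
      m∣n = divides (i ^ e) eq
      m≤n : m ≤ n
      m≤n = ∣⇒≤ m∣n
      e≤L : e ≤ L
      e≤L = ≮⇒≥ λ L<e → <⇒≱ (≤-<-trans n≤ (^-monoʳ-< 2 (s≤s (s≤s z≤n)) L<e))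
        (≤-trans (^-monoˡ-≤ e 2≤i) (subst (i ^ e ≤_) (sym eq) (m≤m*n (i ^ e) m {{m≢0}})))
      go : ∀ e → n ≡ i ^ e * m → e ≤ L → Bounded L j m → Bounded L (suc j) n
      go zero eq _ (xs , cov , len) = xs , (λ {d} d∣ → cov (subst (d ∣_) (trans eq (+-identityʳ m)) d∣)) ,
              ≤-trans len (*-mono-≤ (^-monoʳ-≤ (suc L) (*-monoʳ-≤ k (n≤1+n j))) m≤n)
      go (suc e′) eq e≤L (xs , cov , len) = layers i (suc e′) xs , (λ {d} d∣ → covers-layers (rough∧∣⇒prime rough (divides (i ^ e′ * m) (trans eq (lem i (i ^ e′) m)))) cov (suc e′) (subst (d ∣_) eq d∣)) ,
              ≤-trans (≤-reflexive (trans (cong (_^ k) (length-layers i (suc e′) xs)) (*-^ (suc (suc e′)) (length xs) k)))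
                (≤-trans (*-mono-≤ (^-monoˡ-≤ k (s≤s e≤L)) len)
                  (≤-trans (≤-reflexive (trans (sym (*-assoc (suc L ^ k) _ m)) (cong (_* m) (trans (sym (^-distribˡ-+-* (suc L) k (k * j))) (cong (suc L ^_) (sym (*-suc k j)))))))
                    (*-monoʳ-≤ (suc L ^ (k * suc j)) m≤n)))
        where
        lem : ∀ i a m → i * a * m ≡ a * m * i
        lem = solve-∀

    divisor-bound : ∀ L n → .{{_ : NonZero n}} → n ≤ 2 ^ L → ∃ λ xs → CoversDivisors n xs × length xs ^ k ≤ suc L ^ (k * Y) * n
    divisor-bound L n n≤ with ≤-total 2 Y
    ... | inj₁ 2≤Y = let xs , cov , len = divisor-bound-rough L (Y ∸ 2) 2 ≤-refl (inj₁ (m+[n∸m]≡n 2≤Y)) n n≤ 2-rough in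
          xs , cov , ≤-trans len (*-monoˡ-≤ n (^-monoʳ-≤ (suc L) (*-monoʳ-≤ k (m∸n≤m Y 2))))
    ... | inj₂ Y≤2 = let xs , cov , len = divisor-bound-rough L 0 2 ≤-refl (inj₂ (refl , Y≤2)) n n≤ 2-rough in
          xs , cov , ≤-trans len (*-monoˡ-≤ n (^-monoʳ-≤ (suc L) (*-monoʳ-≤ k z≤n)))

-- Coincidences among reciprocals: Dirichlet approximation and divisors.

module Energy where

  open import Data.Nat as ℕ using (ℕ; zero; suc; NonZero; z≤n)
  import Data.Nat.Properties as ℕP
  import Data.Nat.DivMod as ℕD
  import Data.Nat.Divisibility as ℕ∣
  open import Data.Integer using (ℤ; +_; -[1+_]; 0ℤ; 1ℤ; ∣_∣; _≤_; +≤+; _⊖_)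
  import Data.Integer as ℤ
  import Data.Integer.Properties as ℤP
  open import Data.Integer.Divisibility using (_∣_)
  open import Data.Integer.Divisibility.Signed as Signed using (∣ᵤ⇒∣)
  open import Data.Integer.Tactic.RingSolver using (solve-∀)
  open import Data.Fin using (Fin; toℕ; fromℕ<)
  import Data.Fin.Properties as FP
  open import Data.List using (List; []; _∷_; _++_; length; map; cartesianProduct)
  open import Data.List.Properties using (length-++; length-map)
  open import Data.List.Membership.Propositional using (_∈_)
  open import Data.List.Membership.Propositional.Properties using (∈-cartesianProduct⁻; ∈-++⁺ˡ; ∈-++⁺ʳ; ∈-map⁺)
  open import Data.List.Relation.Unary.Any using (here; there)
  open import Data.Product using (∃; _×_; _,_; proj₁; proj₂)
  open import Data.Product.Properties using (≡-dec)
  open import Data.Sum using (inj₁; inj₂; [_,_]′)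
  open import Data.Empty using (⊥-elim)
  open import Relation.Nullary using (Dec; yes; no)
  open import Relation.Nullary.Decidable using (_×-dec_)
  open import Relation.Binary.PropositionalEquality
  open Int using (≤-trans; ≤-reflexive)
  open Sums
  open Field
  open PrimeField
  open Divisors using (CoversDivisors)

  ∑-one≤ : ∀ {A : Set} (_≟_ : ∀ (x y : A) → Dec (x ≡ y)) (xs : List A) a → a ∈ xs → 1ℤ ≤ ∑ xs (λ x → 𝟙 (a ≟ x))
  ∑-one≤ _≟_ (x ∷ xs) a (here refl) = ≤-trans (≤-reflexive (sym (Int.+-identityʳ 1ℤ)))
    (Int.+-mono-≤ (≤-reflexive (sym (𝟙-yes (a ≟ x) refl))) (∑-nonneg xs (λ y → 0≤𝟙 (a ≟ y))))
  ∑-one≤ _≟_ (x ∷ xs) a (there a∈) = ≤-trans (≤-reflexive (sym (Int.+-identityˡ 1ℤ)))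
    (Int.+-mono-≤ (0≤𝟙 (a ≟ x)) (∑-one≤ _≟_ xs a a∈))

  ∑-cover-≤ : ∀ {A B : Set} (_≟_ : ∀ (x y : B) → Dec (x ≡ y)) (xs : List A) (ys : List B) {P : A → Set} (P? : ∀ x → Dec (P x)) (φ : A → B) →
    (∀ x → x ∈ xs → P x → φ x ∈ ys) → (∀ y → ∑ xs (λ x → 𝟙 (P? x ×-dec (φ x ≟ y))) ≤ 1ℤ) →
    ∑ xs (λ x → 𝟙 (P? x)) ≤ + length ys
  ∑-cover-≤ _≟_ xs ys P? φ cover unique = ≤-trans (∑-mono-∈ xs at)
    (≤-trans (≤-reflexive (∑-swap xs ys _)) (≤-trans (∑-≤-const ys 1ℤ (λ y _ → unique y)) (≤-reflexive (Int.*-identityʳ _))))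
    where
    at : ∀ x → x ∈ xs → 𝟙 (P? x) ≤ ∑ ys (λ y → 𝟙 (P? x ×-dec (φ x ≟ y)))
    at x x∈ = go (P? x) refl
      where
      go : ∀ d → P? x ≡ d → 𝟙 d ≤ ∑ ys (λ y → 𝟙 (P? x ×-dec (φ x ≟ y)))
      go (no _) _ = ∑-nonneg ys (λ y → 0≤𝟙 (P? x ×-dec (φ x ≟ y)))
      go (yes p) _ = ≤-trans (∑-one≤ _≟_ ys (φ x) (cover x x∈ p)) (∑-mono ys (λ y → 𝟙-mono (φ x ≟ y) (P? x ×-dec (φ x ≟ y)) (λ e → p , e)))

  ∣i-j∣-close : ∀ r s w .{{_ : NonZero w}} → r ℕ./ w ≡ s ℕ./ w → ∣ r ⊖ s ∣ ℕ.< w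
  ∣i-j∣-close r s w eq = subst (ℕ._< w) (sym same) (ℕP.≤-<-trans (ℤP.∣m⊝n∣≤m⊔n (r ℕ.% w) (s ℕ.% w)) (ℕP.⊔-lub (ℕD.m%n<n r w) (ℕD.m%n<n s w)))
    where
    l : ∀ a b c → a ℤ.+ c ℤ.- (b ℤ.+ c) ≡ a ℤ.- b
    l = solve-∀
    same : ∣ r ⊖ s ∣ ≡ ∣ (r ℕ.% w) ⊖ (s ℕ.% w) ∣
    same = cong ∣_∣ (trans (sym (ℤP.m-n≡m⊖n r s)) (trans (cong₂ (λ a b → + a ℤ.- + b) (ℕD.m≡m%n+[m/n]*n r w)
        (trans (ℕD.m≡m%n+[m/n]*n s w) (cong (λ t → s ℕ.% w ℕ.+ t ℕ.* w) (sym eq))))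
      (trans (cong₂ ℤ._-_ (ℤP.pos-+ (r ℕ.% w) _) (ℤP.pos-+ (s ℕ.% w) _)) (trans (l (+ (r ℕ.% w)) (+ (s ℕ.% w)) (+ (r ℕ./ w ℕ.* w))) (ℤP.m-n≡m⊖n (r ℕ.% w) (s ℕ.% w))))))

  module EnergyBound {q : ℕ} (𝔽 : ResidueField q) where
    open ResidueField 𝔽
    open FieldTheory field′ hiding (q) renaming (_⊖_ to _⊝⊝_)

    ↑ : ℕ → F
    ↑ n = ι (+ n)

    ↑≢0 : ∀ n → 0 ℕ.< n → n ℕ.< q → ↑ n ≢ 𝟎
    ↑≢0 n 0<n n<q eq = ℕP.<⇒≱ n<q (ℕ∣.∣⇒≤ {{ℕ.>-nonZero 0<n}} (subst (q ℕ∣.∣_) (cong ∣_∣ (ℤP.+-identityʳ (+ n))) (ι-≡⇒∣ (+ n) 0ℤ (trans eq (sym ι-0)))))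

    ↑-+ : ∀ m n → ↑ (m ℕ.+ n) ≡ ↑ m ⊕ ↑ n
    ↑-+ m n = trans (cong ι (ℤP.pos-+ m n)) (ι-+ (+ m) (+ n))

    ↑-* : ∀ m n → ↑ (m ℕ.* n) ≡ ↑ m ⊗ ↑ n
    ↑-* m n = trans (cong ι (ℤP.pos-* m n)) (ι-* (+ m) (+ n))

    ι-- : ∀ a b → ι (a ℤ.- b) ≡ ι a ⊝⊝ ι b
    ι-- a b = trans (ι-+ a (ℤ.- b)) (cong (ι a ⊕_) (ι-neg b))

    ↑-inj : ∀ m n → m ℕ.< q → n ℕ.< q → ↑ m ≡ ↑ n → m ≡ n
    ↑-inj m n m<q n<q eq = ℤP.+-injective (ℤP.i-j≡0⇒i≡j (+ m) (+ n) (ℤP.∣i∣≡0⇒i≡0 (vanish ∣ + m ℤ.- + n ∣ refl)))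
      where
      q∣ : q ℕ∣.∣ ∣ + m ℤ.- + n ∣
      q∣ = ι-≡⇒∣ (+ m) (+ n) eq
      bound : ∣ + m ℤ.- + n ∣ ℕ.< q
      bound = ℕP.≤-<-trans (subst (ℕ._≤ m ℕ.⊔ n) (cong ∣_∣ (sym (ℤP.m-n≡m⊖n m n))) (ℤP.∣m⊝n∣≤m⊔n m n)) (ℕP.⊔-lub m<q n<q)
      vanish : ∀ d → d ≡ ∣ + m ℤ.- + n ∣ → ∣ + m ℤ.- + n ∣ ≡ 0
      vanish zero e = sym e
      vanish (suc d) e = ⊥-elim (ℕP.<⇒≱ bound (ℕ∣.∣⇒≤ {{subst NonZero e _}} q∣))

    -- Dirichlet's theorem by pigeonhole: among the multiples `j x` with `0 ≤ j ≤ V`, two lie in the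
    -- same one of the `V` boxes, and their difference is taken.
    approximate : ∀ (V : ℕ) .{{_ : NonZero V}} → (x : F) → ∃ λ v → ∃ λ u → 0 ℕ.< v × v ℕ.≤ V × ∣ u ∣ ℕ.≤ q ℕ./ V × ι u ≡ ↑ v ⊗ x
    approximate V x = finish (FP.pigeonhole (ℕP.n<1+n V) box)
      where
      w : ℕ
      -- One more than the quotient: `V` boxes of this width cover [0, q), while a difference below
      -- `w` is still at most `q / V`.
      w = suc (q ℕ./ V)
      r : ℕ → ℕ
      r j = proj₁ (ι-surj (↑ j ⊗ x))
      r<q : ∀ j → r j ℕ.< q
      r<q j = proj₁ (proj₂ (ι-surj (↑ j ⊗ x)))
      r≡ : ∀ j → ↑ j ⊗ x ≡ ↑ (r j)
      r≡ j = proj₂ (proj₂ (ι-surj (↑ j ⊗ x)))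
      q<Vw : q ℕ.< V ℕ.* w
      q<Vw = subst (ℕ._< V ℕ.* w) (sym (ℕD.m≡m%n+[m/n]*n q V)) (ℕP.<-≤-trans (ℕP.+-monoˡ-< _ (ℕD.m%n<n q V))
        (ℕP.≤-reflexive (trans (cong (V ℕ.+_) (ℕP.*-comm (q ℕ./ V) V)) (sym (ℕP.*-suc V (q ℕ./ V))))))
      r/w<V : ∀ j → r j ℕ./ w ℕ.< V
      r/w<V j = ℕD.m<n*o⇒m/o<n (ℕP.<-trans (r<q j) q<Vw)
      box : Fin (suc V) → Fin V
      box j = fromℕ< (r/w<V (toℕ j))
      finish : (∃ λ i → ∃ λ j → toℕ i ℕ.< toℕ j × box i ≡ box j) → ∃ λ v → ∃ λ u → 0 ℕ.< v × v ℕ.≤ V × ∣ u ∣ ℕ.≤ q ℕ./ V × ι u ≡ ↑ v ⊗ x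
      finish (i , j , i<j , same) = b ℕ.∸ a , r b ⊖ r a , ℕP.m<n⇒0<n∸m i<j ,
          ℕP.≤-trans (ℕP.m∸n≤m b a) (ℕP.≤-pred (FP.toℕ<n j)) ,
          ℕP.≤-pred (∣i-j∣-close (r b) (r a) w (sym (trans (sym (FP.toℕ-fromℕ< (r/w<V a))) (trans (cong toℕ same) (FP.toℕ-fromℕ< (r/w<V b)))))) ,
          trans (cong ι (sym (ℤP.m-n≡m⊖n (r b) (r a)))) (trans (ι-- (+ r b) (+ r a)) (trans (cong₂ _⊝⊝_ (sym (r≡ b)) (sym (r≡ a)))
            (trans (solve 3 (λ b a x → b :* x :- a :* x := (b :- a) :* x) refl (↑ b) (↑ a) x)
              (cong (_⊗ x) (trans (sym (ι-- (+ b) (+ a))) (cong ι (trans (ℤP.m-n≡m⊖n b a) (ℤP.⊖-≥ (ℕP.<⇒≤ i<j)))))))))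
        where
        a b : ℕ
        a = toℕ i
        b = toℕ j

    module _ (V B T τ : ℕ) .{{_ : NonZero V}} (V<q : V ℕ.< q) (2B<q : B ℕ.+ B ℕ.< q)
      (T-large : (q ℕ./ V) ℕ.* (B ℕ.* B) ℕ.+ V ℕ.* (B ℕ.+ B) ℕ.≤ T ℕ.* q)
      (cover : ∀ n → NonZero n → n ℕ.≤ q ℕ.* (T ℕ.* q) ℕ.+ V ℕ.* V → ∃ λ xs → CoversDivisors n xs × length xs ℕ.≤ τ)
      (ds : List ℕ) (ds-simple : Multiplicity.Simple ℕP._≟_ ds) (ds-range : ∀ d → d ∈ ds → 0 ℕ.< d × d ℕ.≤ B)
      where

      private
        q≢0 : NonZero q
        q≢0 = ℕ.>-nonZero (ℕP.≤-<-trans z≤n V<q)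

        d<q : ∀ d → d ∈ ds → d ℕ.< q
        d<q d d∈ = ℕP.≤-<-trans (proj₂ (ds-range d d∈)) (ℕP.≤-<-trans (ℕP.m≤m+n B B) 2B<q)

        d≢0 : ∀ d → d ∈ ds → ↑ d ≢ 𝟎
        d≢0 d d∈ = ↑≢0 d (proj₁ (ds-range d d∈)) (d<q d d∈)

      -- There are `T + suc T` integers `t` with `|t| ≤ T`, and each allows at most `τ` divisors
      -- with two signs.
      ν : ℕ
      ν = (T ℕ.+ suc T) ℕ.* (τ ℕ.+ τ)

      module _ (x : F) where
        private
          Sol : ℕ × ℕ → Set
          Sol (d , e) = ↑ d ⁻¹ ⊕ ↑ e ⁻¹ ≡ x

          sol? : ∀ p → Dec (Sol p)
          sol? (d , e) = ↑ d ⁻¹ ⊕ ↑ e ⁻¹ ≟ x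

          dds : List (ℕ × ℕ)
          dds = cartesianProduct ds ds

          ap : ∃ λ v → ∃ λ u → 0 ℕ.< v × v ℕ.≤ V × ∣ u ∣ ℕ.≤ q ℕ./ V × ι u ≡ ↑ v ⊗ x
          ap = approximate V x
          v : ℕ
          v = proj₁ ap
          u : ℤ
          u = proj₁ (proj₂ ap)
          v≤V : v ℕ.≤ V
          v≤V = proj₁ (proj₂ (proj₂ (proj₂ ap)))
          u≤ : ∣ u ∣ ℕ.≤ q ℕ./ V
          u≤ = proj₁ (proj₂ (proj₂ (proj₂ (proj₂ ap))))
          u≡ : ι u ≡ ↑ v ⊗ x
          u≡ = proj₂ (proj₂ (proj₂ (proj₂ (proj₂ ap))))
          v≢0 : ↑ v ≢ 𝟎
          v≢0 = ↑≢0 v (proj₁ (proj₂ (proj₂ ap))) (ℕP.≤-<-trans v≤V V<q)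

          -- If `u d e - v (d + e) = t q`, then `(u d - v) (u e - v) = u t q + v²`, which is this
          -- number. So `u d - v` divides one of few known integers.
          value : ℤ → ℤ
          value t = u ℤ.* (t ℤ.* + q) ℤ.+ + v ℤ.* + v

          signs : List ℕ → List ℤ
          signs xs = map +_ xs ++ map (λ n → ℤ.- + n) xs

          ∈-signs : ∀ a xs → ∣ a ∣ ∈ xs → a ∈ signs xs
          ∈-signs (+ n) xs n∈ = ∈-++⁺ˡ (∈-map⁺ +_ n∈)
          ∈-signs -[1+ n ] xs n∈ = ∈-++⁺ʳ (map +_ xs) (∈-map⁺ (λ n → ℤ.- + n) n∈)

          length-signs : ∀ xs → length (signs xs) ≡ length xs ℕ.+ length xs
          length-signs xs = trans (length-++ (map +_ xs)) (cong₂ ℕ._+_ (length-map +_ xs) (length-map (λ n → ℤ.- + n) xs))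

          value-bound : ∀ t → ∣ t ∣ ℕ.≤ T → ∣ value t ∣ ℕ.≤ q ℕ.* (T ℕ.* q) ℕ.+ V ℕ.* V
          value-bound t t≤ = ℕP.≤-trans (ℤP.∣i+j∣≤∣i∣+∣j∣ (u ℤ.* (t ℤ.* + q)) (+ v ℤ.* + v)) (ℕP.+-mono-≤
            (ℕP.≤-trans (ℕP.≤-reflexive (trans (ℤP.abs-* u (t ℤ.* + q)) (cong (∣ u ∣ ℕ.*_) (ℤP.abs-* t (+ q)))))
              (ℕP.*-mono-≤ (ℕP.≤-trans u≤ (ℕD.m/n≤m q V)) (ℕP.*-monoˡ-≤ q t≤)))
            (ℕP.≤-trans (ℕP.≤-reflexive (ℤP.abs-* (+ v) (+ v))) (ℕP.*-mono-≤ v≤V v≤V)))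

          block : (t : ℤ) → Dec (∣ value t ∣ ≡ 0) → Dec (∣ t ∣ ℕ.≤ T) → List ℤ
          block t (no ne) (yes t≤) = signs (proj₁ (cover ∣ value t ∣ (ℕ.≢-nonZero ne) (value-bound t t≤)))
          block t _ _ = []

          block-length : ∀ t d e → length (block t d e) ℕ.≤ τ ℕ.+ τ
          block-length t (no ne) (yes t≤) = ℕP.≤-trans (ℕP.≤-reflexive (length-signs (proj₁ (cover ∣ value t ∣ (ℕ.≢-nonZero ne) (value-bound t t≤))))) (ℕP.+-mono-≤ len len)
            where
            len : length (proj₁ (cover ∣ value t ∣ (ℕ.≢-nonZero ne) (value-bound t t≤))) ℕ.≤ τ
            len = proj₂ (proj₂ (cover ∣ value t ∣ (ℕ.≢-nonZero ne) (value-bound t t≤)))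
          block-length t (no _) (no _) = z≤n
          block-length t (yes _) (yes _) = z≤n
          block-length t (yes _) (no _) = z≤n

          ∈-block : ∀ t a d e → ∣ value t ∣ ≢ 0 → ∣ t ∣ ℕ.≤ T → ∣ a ∣ ℕ∣.∣ ∣ value t ∣ → a ∈ block t d e
          ∈-block t a (yes e) _ ne _ _ = ⊥-elim (ne e)
          ∈-block t a (no _) (no ¬t≤) _ t≤ _ = ⊥-elim (¬t≤ t≤)
          ∈-block t a (no ne) (yes t≤) _ _ a∣ = ∈-signs a _ (proj₁ (proj₂ (cover ∣ value t ∣ (ℕ.≢-nonZero ne) (value-bound t t≤))) a∣)

          -- Index `k` stands for `t = k - T`, so the indices below `T + suc T` are exactly the `t`
          -- with `|t| ≤ T`.
          blockAt : ℕ → List ℤ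
          blockAt k = block (k ⊖ T) (∣ value (k ⊖ T) ∣ ℕP.≟ 0) (∣ k ⊖ T ∣ ℕP.≤? T)

          blocks : ℕ → List ℤ
          blocks zero = []
          blocks (suc k) = blocks k ++ blockAt k

          blocks-length : ∀ k → length (blocks k) ℕ.≤ k ℕ.* (τ ℕ.+ τ)
          blocks-length zero = z≤n
          blocks-length (suc k) = ℕP.≤-trans (ℕP.≤-reflexive (trans (length-++ (blocks k)) (ℕP.+-comm (length (blocks k)) _)))
            (ℕP.+-mono-≤ (block-length (k ⊖ T) (∣ value (k ⊖ T) ∣ ℕP.≟ 0) (∣ k ⊖ T ∣ ℕP.≤? T)) (blocks-length k))

          ∈-blocks : ∀ {a} k n → k ℕ.< n → a ∈ blockAt k → a ∈ blocks n
          ∈-blocks k (suc n) k<n a∈ with ℕP.m<1+n⇒m<n∨m≡n k<n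
          ... | inj₁ k<n′ = ∈-++⁺ˡ (∈-blocks k n k<n′ a∈)
          ... | inj₂ refl = ∈-++⁺ʳ (blocks k) a∈

          φ : ℕ × ℕ → ℤ
          φ (d , e) = u ℤ.* + d ℤ.- + v

          ι-φ : ∀ d → ι (u ℤ.* + d ℤ.- + v) ≡ ↑ v ⊗ (x ⊗ ↑ d ⊝⊝ 𝟏)
          ι-φ d = trans (ι-- (u ℤ.* + d) (+ v)) (trans (cong (_⊝⊝ ↑ v) (trans (ι-* u (+ d)) (cong (_⊗ ↑ d) u≡)))
            (trans (cong (↑ v ⊗ x ⊗ ↑ d ⊝⊝_) (sym (⊗-identityʳ (↑ v)))) (solve 4 (λ v x d o → v :* x :* d :- v :* o := v :* (x :* d :- o)) refl (↑ v) x (↑ d) 𝟏)))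

          module _ (d e : ℕ) (d∈ : d ∈ ds) (e∈ : e ∈ ds) (sol : ↑ d ⁻¹ ⊕ ↑ e ⁻¹ ≡ x) where
            de : x ⊗ ↑ d ⊝⊝ 𝟏 ≡ ↑ e ⁻¹ ⊗ ↑ d
            de = trans (cong (λ y → y ⊗ ↑ d ⊝⊝ 𝟏) (sym sol)) (trans (solve 4 (λ i j d o → (i :+ j) :* d :- o := j :* d :+ (d :* i :- o)) refl (↑ d ⁻¹) (↑ e ⁻¹) (↑ d) 𝟏)
              (trans (cong (λ s → ↑ e ⁻¹ ⊗ ↑ d ⊕ (s ⊝⊝ 𝟏)) (⊗-inverseʳ _ (d≢0 d d∈))) (trans (cong (↑ e ⁻¹ ⊗ ↑ d ⊕_) (⊝-inverseʳ 𝟏)) (⊕-identityʳ _))))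

            -- In the field `u d - v = v (x d - 1) = v d / e`, a product of nonzero elements. Hence
            -- `value t` is nonzero and has few divisors.
            φ-nonzero : u ℤ.* + d ℤ.- + v ≢ 0ℤ
            φ-nonzero eq = ⊗-≢0 v≢0 (subst (_≢ 𝟎) (sym de) (⊗-≢0 (⁻¹-≢0 (d≢0 e e∈)) (d≢0 d d∈)))
              (trans (sym (ι-φ d)) (trans (cong ι eq) ι-0))

            x·de : x ⊗ (↑ d ⊗ ↑ e) ≡ ↑ d ⊕ ↑ e
            x·de = trans (cong (_⊗ (↑ d ⊗ ↑ e)) (sym sol)) (trans (solve 4 (λ i j d e → (i :+ j) :* (d :* e) := d :* i :* e :+ e :* j :* d) refl (↑ d ⁻¹) (↑ e ⁻¹) (↑ d) (↑ e))
              (trans (cong₂ (λ s t → s ⊗ ↑ e ⊕ t ⊗ ↑ d) (⊗-inverseʳ _ (d≢0 d d∈)) (⊗-inverseʳ _ (d≢0 e e∈)))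
                (trans (cong₂ _⊕_ (⊗-identityˡ _) (⊗-identityˡ _)) (⊕-comm _ _))))

            congruence : + q ∣ u ℤ.* (+ d ℤ.* + e) ℤ.- + v ℤ.* (+ d ℤ.+ + e)
            congruence = ι-≡⇒∣ (u ℤ.* (+ d ℤ.* + e)) (+ v ℤ.* (+ d ℤ.+ + e)) (trans (ι-* u (+ d ℤ.* + e)) (trans (cong₂ _⊗_ u≡ (ι-* (+ d) (+ e))) (trans (⊗-assoc (↑ v) x (↑ d ⊗ ↑ e))
              (trans (cong (↑ v ⊗_) (trans x·de (sym (ι-+ (+ d) (+ e))))) (sym (ι-* (+ v) (+ d ℤ.+ + e)))))))

            x≢0 : x ≢ 𝟎
            x≢0 eq = ↑≢0 (d ℕ.+ e) (ℕP.≤-trans (proj₁ (ds-range d d∈)) (ℕP.m≤m+n d e))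
                (ℕP.≤-<-trans (ℕP.+-mono-≤ (proj₂ (ds-range d d∈)) (proj₂ (ds-range e e∈))) 2B<q)
              (trans (↑-+ d e) (trans (sym x·de) (trans (cong (_⊗ (↑ d ⊗ ↑ e)) eq) (⊗-zeroˡ _))))

          product-value : ∀ d e t → u ℤ.* (+ d ℤ.* + e) ℤ.- + v ℤ.* (+ d ℤ.+ + e) ≡ t ℤ.* + q →
            (u ℤ.* + d ℤ.- + v) ℤ.* (u ℤ.* + e ℤ.- + v) ≡ value t
          product-value d e t eq = trans (l u (+ d) (+ e) (+ v)) (cong (λ s → u ℤ.* s ℤ.+ + v ℤ.* + v) eq)
            where
            l : ∀ u d e v → (u ℤ.* d ℤ.- v) ℤ.* (u ℤ.* e ℤ.- v) ≡ u ℤ.* (u ℤ.* (d ℤ.* e) ℤ.- v ℤ.* (d ℤ.+ e)) ℤ.+ v ℤ.* v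
            l = solve-∀

          covered : ∀ p → p ∈ dds → Sol p → φ p ∈ blocks (T ℕ.+ suc T)
          covered (d , e) p∈ sol = go (∣ᵤ⇒∣ (congruence d e d∈ e∈ sol))
            where
            d∈ : d ∈ ds
            d∈ = proj₁ (∈-cartesianProduct⁻ ds ds p∈)
            e∈ : e ∈ ds
            e∈ = proj₂ (∈-cartesianProduct⁻ ds ds p∈)
            sol′ : ↑ e ⁻¹ ⊕ ↑ d ⁻¹ ≡ x
            sol′ = trans (⊕-comm _ _) sol
            go : + q Signed.∣ u ℤ.* (+ d ℤ.* + e) ℤ.- + v ℤ.* (+ d ℤ.+ + e) → φ (d , e) ∈ blocks (T ℕ.+ suc T)
            go (Signed.divides t eq) = finish t eq
              where
              finish : ∀ t → u ℤ.* (+ d ℤ.* + e) ℤ.- + v ℤ.* (+ d ℤ.+ + e) ≡ t ℤ.* + q → φ (d , e) ∈ blocks (T ℕ.+ suc T)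
              finish t eq = ∈-blocks ∣ t ℤ.+ + T ∣ (T ℕ.+ suc T) index<
                  (subst (λ s → φ (d , e) ∈ block s (∣ value s ∣ ℕP.≟ 0) (∣ s ∣ ℕP.≤? T)) (sym index≡)
                    (∈-block t (φ (d , e)) (∣ value t ∣ ℕP.≟ 0) (∣ t ∣ ℕP.≤? T) nonzero t≤T (ℕ∣.divides ∣ u ℤ.* + e ℤ.- + v ∣ (trans (cong ∣_∣ (sym (product-value d e t eq)))
                      (trans (ℤP.abs-* (u ℤ.* + d ℤ.- + v) (u ℤ.* + e ℤ.- + v)) (ℕP.*-comm ∣ u ℤ.* + d ℤ.- + v ∣ ∣ u ℤ.* + e ℤ.- + v ∣))))))
                where
                nonzero : ∣ value t ∣ ≢ 0
                nonzero eq₀ = [ φ-nonzero d e d∈ e∈ sol , φ-nonzero e d e∈ d∈ sol′ ]′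
                  (ℤP.i*j≡0⇒i≡0∨j≡0 (u ℤ.* + d ℤ.- + v) {u ℤ.* + e ℤ.- + v} (trans (product-value d e t eq) (ℤP.∣i∣≡0⇒i≡0 eq₀)))
                t≤T : ∣ t ∣ ℕ.≤ T
                t≤T = ℕP.*-cancelʳ-≤ ∣ t ∣ T q {{q≢0}} (ℕP.≤-trans (ℕP.≤-reflexive (trans (sym (ℤP.abs-* t (+ q))) (cong ∣_∣ (sym eq))))
                  (ℕP.≤-trans (ℤP.∣i-j∣≤∣i∣+∣j∣ (u ℤ.* (+ d ℤ.* + e)) (+ v ℤ.* (+ d ℤ.+ + e))) (ℕP.≤-trans (ℕP.+-mono-≤
                    (ℕP.≤-trans (ℕP.≤-reflexive (trans (ℤP.abs-* u (+ d ℤ.* + e)) (cong (∣ u ∣ ℕ.*_) (ℤP.abs-* (+ d) (+ e)))))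
                      (ℕP.*-mono-≤ u≤ (ℕP.*-mono-≤ (proj₂ (ds-range d d∈)) (proj₂ (ds-range e e∈)))))
                    (ℕP.≤-trans (ℕP.≤-reflexive (ℤP.abs-* (+ v) (+ d ℤ.+ + e)))
                      (ℕP.*-mono-≤ v≤V (ℕP.+-mono-≤ (proj₂ (ds-range d d∈)) (proj₂ (ds-range e e∈)))))) T-large)))
                -T≤t : 0ℤ ≤ t ℤ.+ + T
                -T≤t = subst (_≤ t ℤ.+ + T) (ℤP.+-inverseʳ t) (ℤP.+-monoʳ-≤ t (ℤP.≤-trans (subst (ℤ.- t ≤_) (cong +_ (ℤP.∣-i∣≡∣i∣ t)) (i≤∣i∣ (ℤ.- t))) (+≤+ t≤T)))
                  where
                  i≤∣i∣ : ∀ i → i ≤ + ∣ i ∣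
                  i≤∣i∣ (+ n) = ℤP.≤-refl
                  i≤∣i∣ -[1+ n ] = ℤ.-≤+
                index< : ∣ t ℤ.+ + T ∣ ℕ.< T ℕ.+ suc T
                index< = ℕP.≤-<-trans (ℤP.∣i+j∣≤∣i∣+∣j∣ t (+ T)) (ℕP.≤-<-trans (ℕP.+-monoˡ-≤ T t≤T) (ℕP.+-monoʳ-< T (ℕP.n<1+n T)))
                index≡ : ∣ t ℤ.+ + T ∣ ⊖ T ≡ t
                index≡ = trans (sym (ℤP.m-n≡m⊖n ∣ t ℤ.+ + T ∣ T)) (trans (cong (ℤ._- + T) (ℤP.0≤i⇒+∣i∣≡i -T≤t)) (l t (+ T)))
                  where
                  l : ∀ t T → t ℤ.+ T ℤ.- T ≡ t
                  l = solve-∀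

          -- In the field `u d - v` is `v (x d - 1)` with `v` and `x` nonzero, so it determines `d`;
          -- then `1 / e = x - 1 / d` determines `e`.
          uniqueness : ∀ y p p′ → p ∈ dds → p′ ∈ dds → Sol p × φ p ≡ y → Sol p′ × φ p′ ≡ y → p ≡ p′
          uniqueness y (d , e) (d′ , e′) p∈ p′∈ (s , eq) (s′ , eq′) = cong₂ _,_ d≡ e≡
            where
            d∈ : d ∈ ds
            d∈ = proj₁ (∈-cartesianProduct⁻ ds ds p∈)
            e∈ : e ∈ ds
            e∈ = proj₂ (∈-cartesianProduct⁻ ds ds p∈)
            d′∈ : d′ ∈ ds
            d′∈ = proj₁ (∈-cartesianProduct⁻ ds ds p′∈)
            e′∈ : e′ ∈ ds
            e′∈ = proj₂ (∈-cartesianProduct⁻ ds ds p′∈)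
            ↑d≡ : ↑ d ≡ ↑ d′
            ↑d≡ = ⊗-cancelˡ (x≢0 d e d∈ e∈ s) (trans (sym (a⊖b⊕b _ 𝟏)) (trans (cong (_⊕ 𝟏) (⊗-cancelˡ v≢0
              (trans (sym (ι-φ d)) (trans (cong ι (trans eq (sym eq′))) (ι-φ d′))))) (a⊖b⊕b _ 𝟏)))
            d≡ : d ≡ d′
            d≡ = ↑-inj d d′ (d<q d d∈) (d<q d′ d′∈) ↑d≡
            recip≡ : ↑ e ⁻¹ ≡ ↑ e′ ⁻¹
            recip≡ = trans (sym (l (↑ d ⁻¹) (↑ e ⁻¹))) (trans (cong₂ _⊝⊝_ (trans s (sym s′)) (cong _⁻¹ ↑d≡)) (l (↑ d′ ⁻¹) (↑ e′ ⁻¹)))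
              where
              l : ∀ a b → a ⊕ b ⊝⊝ a ≡ b
              l = solve 2 (λ a b → a :+ b :- a := b) refl
            e≡ : e ≡ e′
            e≡ = ↑-inj e e′ (d<q e e∈) (d<q e′ e′∈) (⊗-cancelˡ (⁻¹-≢0 (d≢0 e e∈)) (trans (trans (⊗-comm _ _) (⊗-inverseʳ _ (d≢0 e e∈)))
              (trans (sym (⊗-inverseʳ _ (d≢0 e′ e′∈))) (trans (⊗-comm _ _) (cong (_⊗ ↑ e′) (sym recip≡))))))

          dds-simple : Multiplicity.Simple (≡-dec ℕP._≟_ ℕP._≟_) dds
          dds-simple = simple-cartesian ℕP._≟_ ℕP._≟_ ds ds ds-simple ds-simple

        ∑-reciprocals≤ν : ∑ ds (λ d → ∑ ds (λ e → 𝟙 (↑ d ⁻¹ ⊕ ↑ e ⁻¹ ≟ x))) ≤ + ν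
        ∑-reciprocals≤ν = ≤-trans (≤-reflexive (sym (∑-product ds ds (λ p → 𝟙 (sol? p)))))
          (≤-trans (∑-cover-≤ ℤP._≟_ dds (blocks (T ℕ.+ suc T)) sol? φ covered
              (λ y → Multiplicity.∑-unique (≡-dec ℕP._≟_ ℕP._≟_) dds dds-simple (λ p → sol? p ×-dec (φ p ℤP.≟ y)) (uniqueness y)))
            (+≤+ (blocks-length (T ℕ.+ suc T))))

      -- Fixing `d₂` and `d₃` leaves the representations of a single residue as `1 / d₁ + 1 / d₄`.
      energy-bound : ∑ ds (λ d₁ → ∑ ds (λ d₂ → ∑ ds (λ d₃ → ∑ ds (λ d₄ →
        𝟙 ((↑ d₄ ⁻¹ ⊝⊝ ↑ d₃ ⁻¹) ⊝⊝ (↑ d₂ ⁻¹ ⊝⊝ ↑ d₁ ⁻¹) ≟ 𝟎))))) ≤ + (length ds ℕ.* (length ds ℕ.* ν))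
      energy-bound = ≤-trans (≤-reflexive (trans (∑-swap ds ds _) (∑-cong ds (λ d₂ → ∑-swap ds ds _))))
        (≤-trans (∑-≤-const ds _ (λ d₂ _ → ∑-≤-const ds (+ ν) (λ d₃ _ → ≤-trans (∑-mono ds (λ d₁ → ∑-mono ds (λ d₄ →
            𝟙-mono ((↑ d₄ ⁻¹ ⊝⊝ ↑ d₃ ⁻¹) ⊝⊝ (↑ d₂ ⁻¹ ⊝⊝ ↑ d₁ ⁻¹) ≟ 𝟎) (↑ d₁ ⁻¹ ⊕ ↑ d₄ ⁻¹ ≟ ↑ d₂ ⁻¹ ⊕ ↑ d₃ ⁻¹) (move (↑ d₁ ⁻¹) (↑ d₂ ⁻¹) (↑ d₃ ⁻¹) (↑ d₄ ⁻¹))))) (∑-reciprocals≤ν _))))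
          (≤-reflexive (trans (cong (+ length ds Int.*_) (sym (Int.pos-* (length ds) ν))) (sym (Int.pos-* (length ds) _)))))
        where
        move : ∀ a b c d → (d ⊝⊝ c) ⊝⊝ (b ⊝⊝ a) ≡ 𝟎 → a ⊕ d ≡ b ⊕ c
        move a b c d eq = ⊖≡0⇒≡ (trans (solve 4 (λ a b c d → a :+ d :- (b :+ c) := (d :- c) :- (b :- a)) refl a b c d) eq)

-- Buchstab's identity and the decomposition of the sifted sum.

module Sieve where

  open import Data.Nat as ℕ using (ℕ; zero; suc; NonZero; NonTrivial; s≤s; z≤n; _≤_; _<_)
  import Data.Nat.Properties as ℕP
  open import Data.Nat.Divisibility
  open import Data.Nat.Primality
  open import Data.Nat.Coprimality using (coprime-divisor; prime⇒coprime) renaming (sym to coprime-sym)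
  open import Data.Integer using (ℤ; +_; 0ℤ; 1ℤ)
  import Data.Integer as ℤ
  open import Data.Integer.Tactic.RingSolver using (solve-∀)
  open import Data.List using (List; upTo; applyUpTo; length)
  open import Data.List.Properties using (length-applyUpTo)
  open import Data.List.Membership.Propositional using (_∈_)
  open import Data.List.Membership.Propositional.Properties using (∈-applyUpTo⁻)
  open import Data.Product using (_×_; _,_; proj₁; proj₂)
  open import Data.Sum using (_⊎_; inj₁; inj₂)
  open import Data.Empty using (⊥-elim)
  open import Function using (_∘_)
  open import Relation.Nullary using (Dec; yes; no; ¬_)
  open import Relation.Nullary.Decidable using (_×-dec_)
  open import Relation.Binary.PropositionalEquality
  open Int using (_+_; _*_; _-_; -_; arith; abs)
  open Sums

  private module Mult = Multiplicity ℕP._≟_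

  range : ℕ → List ℕ
  range = applyUpTo suc

  length-range : ∀ n → length (range n) ≡ n
  length-range = length-applyUpTo suc

  ∈-range⁻ : ∀ {n x} → x ∈ range n → 1 ≤ x × x ≤ n
  ∈-range⁻ {n} x∈ with ∈-applyUpTo⁻ suc x∈
  ... | i , i<n , refl = s≤s z≤n , i<n

  mult-shifted : ∀ (f : ℕ → ℕ) → (∀ {i j} → f i ≡ f j → i ≡ j) → ∀ n i → i < n → Mult.mult (applyUpTo f n) (f i) ≡ 1ℤ
  mult-shifted f inj (suc n) zero _ = trans (cong₂ _+_ (𝟙-yes (f 0 ℕP.≟ f 0) refl)
    (Mult.mult-∉ (applyUpTo (f ∘ suc) n) (f 0) (λ x x∈ eq → ne x x∈ eq))) (Int.+-identityʳ 1ℤ)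
    where
    ne : ∀ x → x ∈ applyUpTo (f ∘ suc) n → x ≢ f 0
    ne x x∈ eq with ∈-applyUpTo⁻ (f ∘ suc) x∈
    ... | i , _ , refl = ℕP.1+n≢0 (inj eq)
  mult-shifted f inj (suc n) (suc i) (s≤s i<n) = trans (cong₂ _+_ (𝟙-no (f 0 ℕP.≟ f (suc i)) (λ eq → ℕP.1+n≢0 (sym (inj eq))))
    (mult-shifted (f ∘ suc) (λ eq → ℕP.suc-injective (inj eq)) n i i<n)) (Int.+-identityˡ 1ℤ)

  mult-range : ∀ n x → 1 ≤ x → x ≤ n → Mult.mult (range n) x ≡ 1ℤ
  mult-range n (suc x) _ x<n = mult-shifted suc ℕP.suc-injective n x x<n

  mult-upTo : ∀ n x → x < n → Mult.mult (upTo n) x ≡ 1ℤ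
  mult-upTo n x = mult-shifted (λ i → i) (λ eq → eq) n x

  mult-range-∉ : ∀ n x → ¬ (1 ≤ x × x ≤ n) → Mult.mult (range n) x ≡ 0ℤ
  mult-range-∉ n x x∉ = Mult.mult-∉ (range n) x (λ y y∈ eq → x∉ (subst (λ u → 1 ≤ u × u ≤ n) eq (∈-range⁻ y∈)))

  range-simple : ∀ n → Mult.Simple (range n)
  range-simple n x = go (1 ℕP.≤? x) (x ℕP.≤? n)
    where
    go : Dec (1 ≤ x) → Dec (x ≤ n) → Mult.mult (range n) x ℤ.≤ 1ℤ
    go (yes a) (yes b) = Int.≤-reflexive (mult-range n x a b)
    go (no a) _ = subst (ℤ._≤ 1ℤ) (sym (mult-range-∉ n x (λ (p , _) → a p))) Int.0≤+ₙ
    go (yes _) (no b) = subst (ℤ._≤ 1ℤ) (sym (mult-range-∉ n x (λ (_ , p) → b p))) Int.0≤+ₙ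

  ∑-spread : ∀ n (f : ℕ → ℤ) x → (¬ (1 ≤ x × x ≤ n) → f x ≡ 0ℤ) → f x ≡ ∑ (range n) (λ y → 𝟙 (y ℕP.≟ x) * f y)
  ∑-spread n f x out = go (1 ℕP.≤? x) (x ℕP.≤? n)
    where
    outside : ¬ (1 ≤ x × x ≤ n) → f x ≡ ∑ (range n) (λ y → 𝟙 (y ℕP.≟ x) * f y)
    outside x∉ = trans (out x∉) (sym (trans (Mult.∑-δ (range n) x f) (trans (cong (_* f x) (mult-range-∉ n x x∉)) (Int.*-zeroˡ _))))
    go : Dec (1 ≤ x) → Dec (x ≤ n) → f x ≡ ∑ (range n) (λ y → 𝟙 (y ℕP.≟ x) * f y)
    go (yes a) (yes b) = sym (trans (Mult.∑-δ (range n) x f) (trans (cong (_* f x) (mult-range n x a b)) (Int.*-identityˡ _)))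
    go (no a) _ = outside (λ (p , _) → a p)
    go (yes _) (no b) = outside (λ (_ , p) → b p)

  rough? : ∀ m n → Dec (m Rough n)
  rough? 0 n = yes 0-rough
  rough? 1 n = yes 1-rough
  rough? 2 n = yes 2-rough
  rough? (suc (suc (suc m))) n with suc (suc m) ∣? n | rough? (suc (suc m)) n
  ... | yes m∣n | _ = no λ r → r (hasNonTrivialDivisor (ℕP.n<1+n (suc (suc m))) m∣n)
  ... | no m∤n | yes r = yes (∤⇒rough-suc m∤n r)
  ... | no _ | no ¬r = no λ r → ¬r λ { (hasNonTrivialDivisor d<m d∣n) → r (hasNonTrivialDivisor (ℕP.m<n⇒m<1+n d<m) d∣n) }

  rough-≤ : ∀ {l m n} → l ≤ m → m Rough n → l Rough n
  rough-≤ l≤m r (hasNonTrivialDivisor d<l d∣n) = r (hasNonTrivialDivisor (ℕP.<-≤-trans d<l l≤m) d∣n)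

  rough-* : ∀ {p y} → Prime p → p Rough y → p Rough (p ℕ.* y)
  rough-* {p} {y} pp r (hasNonTrivialDivisor {divisor = d} d<p d∣py) =
    r (hasNonTrivialDivisor d<p (coprime-divisor (coprime-sym (prime⇒coprime pp {{ℕ.nonTrivial⇒nonZero d}} d<p)) d∣py))

  leastFrom : ℕ → ℕ → ℕ → ℕ
  leastFrom n zero z = z
  leastFrom n (suc fuel) z with z ∣? n
  ... | yes _ = z
  ... | no _ = leastFrom n fuel (suc z)

  -- The least prime factor when `n ≥ 2`. At 1 the search runs out of fuel and returns 3.
  leastFactor : ℕ → ℕ
  leastFactor n = leastFrom n n 2

  rough∣⇒leastFactor : ∀ {z n} → .{{NonZero n}} → 2 ≤ z → z ∣ n → z Rough n → leastFactor n ≡ z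
  rough∣⇒leastFactor {z} {n} 2≤z z∣n r = search n 2 ℕP.≤-refl 2≤z (ℕP.≤-trans (∣⇒≤ z∣n) (ℕP.m≤m+n n 2))
    where
    search : ∀ fuel i → 2 ≤ i → i ≤ z → z ≤ fuel ℕ.+ i → leastFrom n fuel i ≡ z
    search zero i 2≤i i≤z z≤i = ℕP.≤-antisym i≤z z≤i
    search (suc fuel) i 2≤i i≤z z≤ with i ∣? n
    ... | yes i∣n = ℕP.≤-antisym i≤z (ℕP.≮⇒≥ λ i<z → r (hasNonTrivialDivisor {{ℕ.n>1⇒nonTrivial 2≤i}} i<z i∣n))
    ... | no i∤n = search fuel (suc i) (ℕP.m≤n⇒m≤1+n 2≤i) (ℕP.≤∧≢⇒< i≤z (λ { refl → i∤n z∣n })) (subst (z ≤_) (sym (ℕP.+-suc fuel i)) z≤)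

  leastFactor-spec : ∀ n → 2 ≤ n → 2 ≤ leastFactor n × leastFactor n ∣ n × leastFactor n Rough n × leastFactor n ≤ n
  leastFactor-spec n 2≤n = search n 2 ℕP.≤-refl 2≤n 2-rough (ℕP.m≤m+n n 2)
    where
    search : ∀ fuel i → 2 ≤ i → i ≤ n → i Rough n → n ≤ fuel ℕ.+ i → 2 ≤ leastFrom n fuel i × leastFrom n fuel i ∣ n × leastFrom n fuel i Rough n × leastFrom n fuel i ≤ n
    search zero i 2≤i i≤n r n≤i = 2≤i , subst (_∣ n) (ℕP.≤-antisym n≤i i≤n) ∣-refl , r , i≤n
    search (suc fuel) i 2≤i i≤n r n≤ with i ∣? n
    ... | yes i∣n = 2≤i , i∣n , r , i≤n
    ... | no i∤n = search fuel (suc i) (ℕP.m≤n⇒m≤1+n 2≤i) (ℕP.≤∧≢⇒< i≤n (λ { refl → i∤n ∣-refl })) (∤⇒rough-suc i∤n r) (subst (n ≤_) (sym (ℕP.+-suc fuel i)) n≤)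

  rough⇔≤leastFactor : ∀ z n → 2 ≤ n → 𝟙 (rough? z n) ≡ 𝟙 (z ℕP.≤? leastFactor n)
  rough⇔≤leastFactor z n 2≤n = 𝟙-cong (rough? z n) (z ℕP.≤? leastFactor n)
    (λ r → ℕP.≮⇒≥ λ l<z → r (hasNonTrivialDivisor {{ℕ.n>1⇒nonTrivial 2≤l}} l<z l∣n))
    (λ z≤l → rough-≤ z≤l l-rough)
    where
    2≤l : 2 ≤ leastFactor n
    2≤l = proj₁ (leastFactor-spec n 2≤n)
    l∣n : leastFactor n ∣ n
    l∣n = proj₁ (proj₂ (leastFactor-spec n 2≤n))
    l-rough : leastFactor n Rough n
    l-rough = proj₁ (proj₂ (proj₂ (leastFactor-spec n 2≤n)))

  -- Buchstab's identity 1[z < least factor of y] = 1[z ≤ least factor of y] - 1[z is the least factor of y],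
  -- iterated over z = Z, Z - 1, ..., 2.  A divisor d < D is split further, a divisor d ≥ D is kept.
  module _ (X D Z : ℕ) (1<D : 1 < D) (D²≤Z : D ℕ.* D ≤ Z) (W : ℕ → ℤ) (W-0 : ∀ x → ¬ (1 ≤ x × x ≤ X) → W x ≡ 0ℤ) where

    sifted : ℕ → ℕ → ℤ
    sifted d z = ∑ (range X) (λ y → 𝟙 (rough? z y) * W (d ℕ.* y))

    private
      pr : ℕ → ℤ
      pr z = 𝟙 (prime? z)

      W-big : ∀ d y → 1 ≤ d → ¬ (1 ≤ y × y ≤ X) → W (d ℕ.* y) ≡ 0ℤ
      W-big (suc d) zero 1≤d _ = W-0 _ (λ (p , _) → ℕP.<⇒≱ p (ℕP.≤-reflexive (ℕP.*-zeroʳ d)))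
      W-big (suc d) (suc y) 1≤d y∉ = W-0 _ (λ (_ , p) → y∉ (s≤s z≤n , ℕP.≤-trans (ℕP.m≤m+n (suc y) (d ℕ.* suc y)) p))

      buchstab-pointwise : ∀ z → 2 ≤ z → ∀ y → 𝟙 (rough? (suc z) y) ≡ 𝟙 (rough? z y) - 𝟙 (z ∣? y) * 𝟙 (rough? z y)
      buchstab-pointwise z 2≤z y = go (z ∣? y)
        where
        l₁ : ∀ a → a - 1ℤ * a ≡ 0ℤ
        l₁ a = trans (cong (λ s → a - s) (Int.*-identityˡ a)) (Int.a-a a)
        l₀ : ∀ a → a - 0ℤ * a ≡ a
        l₀ a = trans (cong (λ s → a - s) (Int.*-zeroˡ a)) (trans (cong (_+_ a) Int.neg-0) (Int.+-identityʳ a))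
        go : (d : Dec (z ∣ y)) → 𝟙 (rough? (suc z) y) ≡ 𝟙 (rough? z y) - 𝟙 d * 𝟙 (rough? z y)
        go (yes z∣y) = trans (𝟙-no (rough? (suc z) y) (λ r → r (hasNonTrivialDivisor {{ℕ.n>1⇒nonTrivial 2≤z}} (ℕP.n<1+n z) z∣y))) (sym (l₁ (𝟙 (rough? z y))))
        go (no z∤y) = trans (𝟙-cong (rough? (suc z) y) (rough? z y) (rough-≤ (ℕP.n≤1+n z)) (∤⇒rough-suc z∤y)) (sym (l₀ (𝟙 (rough? z y))))

      -- A `z`-rough number divisible by `z ≥ 2` forces `z` to be prime; then `y = z y′`, and `y` is
      -- `z`-rough exactly when `y′` is.
      divisible : ∀ z → 2 ≤ z → ∀ d → 1 ≤ d →
        ∑ (range X) (λ y → 𝟙 (z ∣? y) * 𝟙 (rough? z y) * W (d ℕ.* y)) ≡ pr z * sifted (d ℕ.* z) z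
      divisible z 2≤z d 1≤d = go (prime? z)
        where
        instance
          z-nonTrivial : NonTrivial z
          z-nonTrivial = ℕ.n>1⇒nonTrivial 2≤z
          z-nonZero : NonZero z
          z-nonZero = ℕ.nonTrivial⇒nonZero z
        go : (p : Dec (Prime z)) → ∑ (range X) (λ y → 𝟙 (z ∣? y) * 𝟙 (rough? z y) * W (d ℕ.* y)) ≡ 𝟙 p * sifted (d ℕ.* z) z
        go (no ¬p) = trans (∑-zero (range X) (λ y → trans (cong (_* W (d ℕ.* y)) (trans (sym (𝟙-× (z ∣? y ×-dec rough? z y) (z ∣? y) (rough? z y) (λ p → p) _,_))
            (𝟙-no (z ∣? y ×-dec rough? z y) (λ (z∣y , r) → ¬p (rough∧∣⇒prime r z∣y))))) (Int.*-zeroˡ _))) (sym (Int.*-zeroˡ _))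
        go (yes p) = sym (trans (Int.*-identityˡ _) (trans (∑-cong (range X) spread) (trans (∑-swap (range X) (range X) _) (∑-cong-∈ (range X) collect))))
          where
          spread : ∀ y′ → 𝟙 (rough? z y′) * W (d ℕ.* z ℕ.* y′) ≡ ∑ (range X) (λ y → 𝟙 (rough? z y′) * (𝟙 (y ℕP.≟ z ℕ.* y′) * W (d ℕ.* y)))
          spread y′ = trans (cong (λ t → 𝟙 (rough? z y′) * W t) (ℕP.*-assoc d z y′))
            (trans (cong (𝟙 (rough? z y′) *_) (∑-spread X (λ y → W (d ℕ.* y)) (z ℕ.* y′) (W-big d (z ℕ.* y′) 1≤d))) (sym (∑-*ˡ (range X) _ _)))
          collect : ∀ y → y ∈ range X → ∑ (range X) (λ y′ → 𝟙 (rough? z y′) * (𝟙 (y ℕP.≟ z ℕ.* y′) * W (d ℕ.* y))) ≡ 𝟙 (z ∣? y) * 𝟙 (rough? z y) * W (d ℕ.* y)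
          collect y y∈ = trans (∑-cong (range X) (λ y′ → sym (Int.*-assoc _ _ _))) (trans (∑-*ʳ (range X) (W (d ℕ.* y)) _) (cong (_* W (d ℕ.* y)) (count (z ∣? y))))
            where
            count : (e : Dec (z ∣ y)) → ∑ (range X) (λ y′ → 𝟙 (rough? z y′) * 𝟙 (y ℕP.≟ z ℕ.* y′)) ≡ 𝟙 e * 𝟙 (rough? z y)
            count (no z∤y) = trans (∑-zero (range X) (λ y′ → trans (cong (𝟙 (rough? z y′) *_) (𝟙-no (y ℕP.≟ z ℕ.* y′) (λ eq → z∤y (divides y′ (trans eq (ℕP.*-comm z y′)))))) (Int.*-zeroʳ _))) (sym (Int.*-zeroˡ _))
            count (yes (divides e eq)) = trans (∑-cong (range X) (λ y′ → trans (Int.*-comm _ _) (cong (_* 𝟙 (rough? z y′)) (𝟙-cong (y ℕP.≟ z ℕ.* y′) (y′ ℕP.≟ e)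
                (λ h → ℕP.*-cancelˡ-≡ y′ e z (trans (sym h) (trans eq (ℕP.*-comm e z)))) (λ { refl → trans eq (ℕP.*-comm e z) })))))
              (trans (Mult.∑-δ (range X) e (λ y′ → 𝟙 (rough? z y′))) (trans (cong (_* 𝟙 (rough? z e)) (mult-range X e 1≤e e≤X)) (cong (1ℤ *_)
                (𝟙-cong (rough? z e) (rough? z y) (λ r → subst (z Rough_) (trans (ℕP.*-comm z e) (sym eq)) (rough-* p r)) (λ r → rough∧∣⇒rough r (divides z (trans eq (ℕP.*-comm e z))))))))
              where
              1≤e : 1 ≤ e
              1≤e = ℕP.n≢0⇒n>0 λ { refl → ℕP.<⇒≱ (proj₁ (∈-range⁻ y∈)) (ℕP.≤-reflexive eq) }
              e≤X : e ≤ X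
              e≤X = ℕP.≤-trans (ℕP.m≤m*n e z) (subst (_≤ X) eq (proj₂ (∈-range⁻ y∈)))

      buchstab : ∀ z → 2 ≤ z → ∀ d → 1 ≤ d → sifted d (suc z) ≡ sifted d z - pr z * sifted (d ℕ.* z) z
      buchstab z 2≤z d 1≤d = trans (∑-cong (range X) (λ y → trans (cong (_* W (d ℕ.* y)) (buchstab-pointwise z 2≤z y)) (l (𝟙 (rough? z y)) (𝟙 (z ∣? y) * 𝟙 (rough? z y)) (W (d ℕ.* y)))))
        (trans (∑-- (range X) _ _) (cong (λ s → sifted d z - s) (divisible z 2≤z d 1≤d)))
        where
        opaque
          unfolding arith
          l : ∀ a b w → (a - b) * w ≡ a * w - b * w
          l = solve-∀

    -- The state of the iteration at level `z`. When `d = e z` is moved to the second sum, `z` is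
    -- its least factor, so the level of its sifting condition can be read off from `d` and the
    -- coefficients `b` need no second index.
    record Decomposition (z : ℕ) : Set where
      field
        a b : ℕ → ℤ
        a-ok : ∀ d → a d ≡ 0ℤ ⊎ (abs (a d) ℤ.≤ 1ℤ × 1 ≤ d × d < D × z Rough d)
        b-ok : ∀ d → b d ≡ 0ℤ ⊎ (abs (b d) ℤ.≤ 1ℤ × D ≤ d × d ≤ Z × z Rough d)
        identity : sifted 1 (suc Z) ≡ ∑ (range Z) (λ d → a d * sifted d z) + ∑ (range Z) (λ d → b d * sifted d (leastFactor d))

    private
      start : Decomposition (suc Z)
      start = record
        { a = λ d → 𝟙 (d ℕP.≟ 1) ; b = λ _ → 0ℤ
        ; a-ok = λ d → a-ok d (d ℕP.≟ 1)
        ; b-ok = λ _ → inj₁ refl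
        ; identity = sym (trans (cong₂ _+_ (trans (Mult.∑-δ (range Z) 1 (λ d → sifted d (suc Z))) (cong (_* sifted 1 (suc Z)) (mult-range Z 1 (s≤s z≤n) 1≤Z)))
            (∑-zero (range Z) (λ d → Int.*-zeroˡ _))) (trans (Int.+-identityʳ _) (Int.*-identityˡ _))) }
        where
        1≤Z : 1 ≤ Z
        1≤Z = ℕP.≤-trans (ℕP.*-mono-≤ (ℕP.<⇒≤ 1<D) (ℕP.<⇒≤ 1<D)) D²≤Z
        a-ok : ∀ d (e : Dec (d ≡ 1)) → 𝟙 e ≡ 0ℤ ⊎ (abs (𝟙 e) ℤ.≤ 1ℤ × 1 ≤ d × d < D × suc Z Rough d)
        a-ok d (no _) = inj₁ refl
        a-ok .1 (yes refl) = inj₂ (Int.≤-reflexive (Int.abs-nonneg Int.0≤+ₙ) , s≤s z≤n , 1<D , rough-1 (suc Z))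

      module Step (z : ℕ) (2≤z : 2 ≤ z) (z≤Z : z ≤ Z) (dec : Decomposition (suc z)) where
        open Decomposition dec

        instance
          z-nonTrivial : NonTrivial z
          z-nonTrivial = ℕ.n>1⇒nonTrivial 2≤z
          z-nonZero : NonZero z
          z-nonZero = ℕ.nonTrivial⇒nonZero z

        shift : ℕ → ℤ
        shift d with z ∣? d
        ... | yes (divides e _) = - (pr z * a e)
        ... | no _ = 0ℤ

        Good : ℕ → Set
        Good e = abs (a e) ℤ.≤ 1ℤ × 1 ≤ e × e < D × suc z Rough e

        -- If `e > 1`, then `e` has no divisor in [2, z], so `z < e < D` and the product stays below
        -- `D² ≤ Z`.
        e*z≤Z : ∀ e → Good e → e ℕ.* z ≤ Z
        e*z≤Z (suc zero) _ = subst (_≤ Z) (sym (ℕP.+-identityʳ z)) z≤Z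
        e*z≤Z e@(suc (suc _)) (_ , _ , e<D , r) = ℕP.≤-trans (ℕP.*-mono-≤ (ℕP.<⇒≤ e<D) (ℕP.≤-trans (ℕP.<⇒≤ (rough⇒≤ r)) (ℕP.<⇒≤ e<D))) D²≤Z
        e*z≤Z zero (_ , () , _)

        rough-at : ∀ d → z ∣ d → ¬ (suc z Rough d)
        rough-at d z∣d r = r (hasNonTrivialDivisor (ℕP.n<1+n z) z∣d)

        Shift : ℕ → Set
        Shift d = shift d ≡ 0ℤ ⊎ (abs (shift d) ℤ.≤ 1ℤ × 1 ≤ d × d ≤ Z × z ∣ d × z Rough d)

        shift-ok : ∀ d → Shift d
        shift-ok d with z ∣? d
        ... | no _ = inj₁ refl
        ... | yes (divides e eq) = go (prime? z) (a-ok e)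
          where
          go : (p : Dec (Prime z)) → a e ≡ 0ℤ ⊎ Good e → - (𝟙 p * a e) ≡ 0ℤ ⊎ (abs (- (𝟙 p * a e)) ℤ.≤ 1ℤ × 1 ≤ d × d ≤ Z × z ∣ d × z Rough d)
          go (no _) _ = inj₁ (trans (cong -_ (Int.*-zeroˡ (a e))) Int.neg-0)
          go (yes _) (inj₁ a≡0) = inj₁ (trans (cong -_ (trans (cong (1ℤ *_) a≡0) (Int.*-zeroʳ 1ℤ))) Int.neg-0)
          go (yes p) (inj₂ good@(le , 1≤e , _ , r)) = inj₂ (Int.≤-trans (Int.≤-reflexive (trans (Int.abs-neg _) (cong abs (Int.*-identityˡ _)))) le ,
              subst (1 ≤_) (sym eq) (ℕP.*-mono-≤ 1≤e (ℕP.<⇒≤ 2≤z)) , subst (_≤ Z) (sym eq) (e*z≤Z e good) , divides e eq ,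
              subst (z Rough_) (trans (ℕP.*-comm z e) (sym eq)) (rough-* p (rough-≤ (ℕP.n≤1+n z) r)))

        a′ b′ : ℕ → ℤ
        a′ d = a d + 𝟙 (d ℕP.<? D) * shift d
        b′ d = b d + 𝟙 (D ℕP.≤? d) * shift d

        a+0 : ∀ (x y : ℤ) {s} → s ≡ 0ℤ → x + y * s ≡ x
        a+0 x y refl = trans (cong (_+_ x) (Int.*-zeroʳ y)) (Int.+-identityʳ x)

        -- The two terms are never both nonzero: `a d ≠ 0` needs `d` free of factors up to `z`, and
        -- `shift d ≠ 0` needs `z` to divide `d`. So the bound 1 survives every step.
        a′-ok : ∀ d → a′ d ≡ 0ℤ ⊎ (abs (a′ d) ℤ.≤ 1ℤ × 1 ≤ d × d < D × z Rough d)
        a′-ok d = go (a-ok d) (shift-ok d) (d ℕP.<? D)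
          where
          go : a d ≡ 0ℤ ⊎ Good d → Shift d → (l : Dec (d < D)) → a d + 𝟙 l * shift d ≡ 0ℤ ⊎ (abs (a d + 𝟙 l * shift d) ℤ.≤ 1ℤ × 1 ≤ d × d < D × z Rough d)
          go (inj₁ a≡0) (inj₁ s≡0) l = inj₁ (trans (a+0 (a d) (𝟙 l) s≡0) a≡0)
          go (inj₂ (le , p , q , r)) (inj₁ s≡0) l = inj₂ (subst (λ t → abs t ℤ.≤ 1ℤ) (sym (a+0 (a d) (𝟙 l) s≡0)) le , p , q , rough-≤ (ℕP.n≤1+n z) r)
          go (inj₂ (_ , _ , _ , r)) (inj₂ (_ , _ , _ , z∣d , _)) l = ⊥-elim (rough-at d z∣d r)
          go (inj₁ a≡0) (inj₂ (le , p , _ , z∣d , r)) (yes d<D) = inj₂ (subst (λ t → abs t ℤ.≤ 1ℤ) (sym (trans (cong₂ _+_ a≡0 (Int.*-identityˡ _)) (Int.+-identityˡ _))) le , p , d<D , r)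
          go (inj₁ a≡0) (inj₂ _) (no _) = inj₁ (trans (cong₂ _+_ a≡0 (Int.*-zeroˡ _)) (Int.+-identityˡ 0ℤ))

        b′-ok : ∀ d → b′ d ≡ 0ℤ ⊎ (abs (b′ d) ℤ.≤ 1ℤ × D ≤ d × d ≤ Z × z Rough d)
        b′-ok d = go (b-ok d) (shift-ok d) (D ℕP.≤? d)
          where
          go : b d ≡ 0ℤ ⊎ (abs (b d) ℤ.≤ 1ℤ × D ≤ d × d ≤ Z × suc z Rough d) → Shift d → (l : Dec (D ≤ d)) → b d + 𝟙 l * shift d ≡ 0ℤ ⊎ (abs (b d + 𝟙 l * shift d) ℤ.≤ 1ℤ × D ≤ d × d ≤ Z × z Rough d)
          go (inj₁ b≡0) (inj₁ s≡0) l = inj₁ (trans (a+0 (b d) (𝟙 l) s≡0) b≡0)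
          go (inj₂ (le , p , q , r)) (inj₁ s≡0) l = inj₂ (subst (λ t → abs t ℤ.≤ 1ℤ) (sym (a+0 (b d) (𝟙 l) s≡0)) le , p , q , rough-≤ (ℕP.n≤1+n z) r)
          go (inj₂ (_ , _ , _ , r)) (inj₂ (_ , _ , _ , z∣d , _)) l = ⊥-elim (rough-at d z∣d r)
          go (inj₁ b≡0) (inj₂ (le , p , d≤Z , z∣d , r)) (yes D≤d) = inj₂ (subst (λ t → abs t ℤ.≤ 1ℤ) (sym (trans (cong₂ _+_ b≡0 (Int.*-identityˡ _)) (Int.+-identityˡ _))) le , D≤d , d≤Z , r)
          go (inj₁ b≡0) (inj₂ _) (no _) = inj₁ (trans (cong₂ _+_ b≡0 (Int.*-zeroˡ _)) (Int.+-identityˡ 0ℤ))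

        reindex : ∑ (range Z) (λ d → - (pr z * a d) * sifted (d ℕ.* z) z) ≡ ∑ (range Z) (λ d → shift d * sifted d z)
        reindex = trans (∑-cong (range Z) (λ d → spread d (a-ok d))) (trans (∑-swap (range Z) (range Z) _) (∑-cong-∈ (range Z) collect))
          where
          spread : ∀ d → a d ≡ 0ℤ ⊎ Good d → - (pr z * a d) * sifted (d ℕ.* z) z ≡ ∑ (range Z) (λ d′ → - (pr z * a d) * (𝟙 (d′ ℕP.≟ d ℕ.* z) * sifted d′ z))
          spread d (inj₁ a≡0) = trans (zero* _) (sym (∑-zero (range Z) (λ d′ → zero* _)))
            where
            zero* : ∀ x → - (pr z * a d) * x ≡ 0ℤ
            zero* x = trans (cong (λ t → - t * x) (trans (cong (pr z *_) a≡0) (Int.*-zeroʳ _))) (trans (cong (_* x) Int.neg-0) (Int.*-zeroˡ x))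
          spread d (inj₂ good@(_ , 1≤d , _ , _)) = trans (cong (- (pr z * a d) *_) (∑-spread Z (λ d′ → sifted d′ z) (d ℕ.* z)
            (λ out → ⊥-elim (out (ℕP.*-mono-≤ 1≤d (ℕP.<⇒≤ 2≤z) , e*z≤Z d good))))) (sym (∑-*ˡ (range Z) _ _))
          collect : ∀ d′ → d′ ∈ range Z → ∑ (range Z) (λ d → - (pr z * a d) * (𝟙 (d′ ℕP.≟ d ℕ.* z) * sifted d′ z)) ≡ shift d′ * sifted d′ z
          collect d′ d′∈ = trans (∑-cong (range Z) (λ d → sym (Int.*-assoc _ _ _))) (trans (∑-*ʳ (range Z) (sifted d′ z) _) (cong (_* sifted d′ z) count))
            where
            count : ∑ (range Z) (λ d → - (pr z * a d) * 𝟙 (d′ ℕP.≟ d ℕ.* z)) ≡ shift d′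
            count with z ∣? d′
            ... | no z∤ = ∑-zero (range Z) (λ d → trans (cong (- (pr z * a d) *_) (𝟙-no (d′ ℕP.≟ d ℕ.* z) (λ eq → z∤ (divides d eq)))) (Int.*-zeroʳ _))
            ... | yes (divides e eq) = trans (∑-cong (range Z) (λ d → trans (Int.*-comm _ _) (cong (_* - (pr z * a d)) (𝟙-cong (d′ ℕP.≟ d ℕ.* z) (d ℕP.≟ e)
                  (λ h → ℕP.*-cancelʳ-≡ d e z (trans (sym h) eq)) (λ { refl → eq })))))
                (trans (Mult.∑-δ (range Z) e (λ d → - (pr z * a d))) (trans (cong (_* - (pr z * a e)) (mult-range Z e 1≤e e≤Z)) (Int.*-identityˡ _)))
              where
              1≤e : 1 ≤ e
              1≤e = ℕP.n≢0⇒n>0 λ { refl → ℕP.<⇒≱ (proj₁ (∈-range⁻ d′∈)) (ℕP.≤-reflexive eq) }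
              e≤Z : e ≤ Z
              e≤Z = ℕP.≤-trans (ℕP.m≤m*n e z) (subst (_≤ Z) eq (proj₂ (∈-range⁻ d′∈)))

        opaque
          unfolding arith
          l₁ : ∀ a s t p → a * (s - p * t) ≡ a * s + - (p * a) * t
          l₁ = solve-∀
          l₂ : ∀ a i s x → (a + i * s) * x ≡ a * x + i * (s * x)
          l₂ = solve-∀
          l₃ : ∀ A I B J → A + I + (B + J) ≡ A + (I + J) + B
          l₃ = solve-∀

        split : ∀ d (x : ℤ) → x ≡ 𝟙 (d ℕP.<? D) * x + 𝟙 (D ℕP.≤? d) * x
        split d x = go (d ℕP.<? D)
          where
          go : (l : Dec (d < D)) → x ≡ 𝟙 l * x + 𝟙 (D ℕP.≤? d) * x
          go (yes d<D) = sym (trans (cong₂ _+_ (Int.*-identityˡ x) (trans (cong (_* x) (𝟙-no (D ℕP.≤? d) (ℕP.<⇒≱ d<D))) (Int.*-zeroˡ x))) (Int.+-identityʳ x))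
          go (no ¬d<D) = sym (trans (cong₂ _+_ (Int.*-zeroˡ x) (trans (cong (_* x) (𝟙-yes (D ℕP.≤? d) (ℕP.≮⇒≥ ¬d<D))) (Int.*-identityˡ x))) (Int.+-identityˡ x))

        settled : ∀ d → shift d * sifted d z ≡ shift d * sifted d (leastFactor d)
        settled d = go (shift-ok d)
          where
          go : Shift d → shift d * sifted d z ≡ shift d * sifted d (leastFactor d)
          go (inj₁ s≡0) = trans (cong (_* sifted d z) s≡0) (trans (Int.*-zeroˡ _) (sym (trans (cong (_* sifted d (leastFactor d)) s≡0) (Int.*-zeroˡ _))))
          go (inj₂ (_ , 1≤d , _ , z∣d , r)) = cong (λ t → shift d * sifted d t) (sym (rough∣⇒leastFactor {{ℕ.>-nonZero 1≤d}} 2≤z z∣d r))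

        identity′ : sifted 1 (suc Z) ≡ ∑ (range Z) (λ d → a′ d * sifted d z) + ∑ (range Z) (λ d → b′ d * sifted d (leastFactor d))
        identity′ = trans identity (trans (cong (_+ B) (trans (∑-cong (range Z) expand) (trans (∑-+ (range Z) _ _) (cong (_+_ A) (trans reindex
              (trans (∑-cong (range Z) (λ d → split d _)) (∑-+ (range Z) _ _)))))))
            (trans (sym (l₃ A I B I′)) (cong₂ _+_ (trans (sym (∑-+ (range Z) _ _)) (∑-cong (range Z) (λ d → sym (l₂ (a d) (𝟙 (d ℕP.<? D)) (shift d) (sifted d z)))))
              (trans (cong (_+_ B) (∑-cong (range Z) (λ d → cong (𝟙 (D ℕP.≤? d) *_) (settled d)))) (trans (sym (∑-+ (range Z) _ _)) (∑-cong (range Z) (λ d → sym (l₂ (b d) (𝟙 (D ℕP.≤? d)) (shift d) (sifted d (leastFactor d))))))))))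
          where
          A B I I′ : ℤ
          A = ∑ (range Z) (λ d → a d * sifted d z)
          B = ∑ (range Z) (λ d → b d * sifted d (leastFactor d))
          I = ∑ (range Z) (λ d → 𝟙 (d ℕP.<? D) * (shift d * sifted d z))
          I′ = ∑ (range Z) (λ d → 𝟙 (D ℕP.≤? d) * (shift d * sifted d z))
          expand : ∀ d → a d * sifted d (suc z) ≡ a d * sifted d z + - (pr z * a d) * sifted (d ℕ.* z) z
          expand d = go (a-ok d)
            where
            go : a d ≡ 0ℤ ⊎ Good d → a d * sifted d (suc z) ≡ a d * sifted d z + - (pr z * a d) * sifted (d ℕ.* z) z
            go (inj₂ (_ , 1≤d , _)) = trans (cong (a d *_) (buchstab z 2≤z d 1≤d)) (l₁ (a d) _ _ (pr z))
            go (inj₁ a≡0) = trans (cong (_* sifted d (suc z)) a≡0) (trans (Int.*-zeroˡ _) (sym (trans (cong₂ _+_ (trans (cong (_* sifted d z) a≡0) (Int.*-zeroˡ _))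
              (trans (cong (λ t → - t * sifted (d ℕ.* z) z) (trans (cong (pr z *_) a≡0) (Int.*-zeroʳ _))) (trans (cong (_* sifted (d ℕ.* z) z) Int.neg-0) (Int.*-zeroˡ _)))) (Int.+-identityˡ 0ℤ))))

        next : Decomposition z
        next = record { a = a′ ; b = b′ ; a-ok = a′-ok ; b-ok = b′-ok ; identity = identity′ }

    -- At level 2 every integer is rough, so the first sum carries no sifting condition any more.
    sieve-decomposition : Decomposition 2
    sieve-decomposition = subst Decomposition (ℕP.m∸[m∸n]≡n {suc Z} {2} (s≤s 1≤Z)) (descend (suc Z ℕ.∸ 2) ℕP.≤-refl)
      where
      1≤Z : 1 ≤ Z
      1≤Z = ℕP.≤-trans (ℕP.*-mono-≤ (ℕP.<⇒≤ 1<D) (ℕP.<⇒≤ 1<D)) D²≤Z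
      descend : ∀ k → k ≤ suc Z ℕ.∸ 2 → Decomposition (suc Z ℕ.∸ k)
      descend zero _ = start
      descend (suc k) k<Z-1 = Step.next (Z ℕ.∸ k) (ℕP.m+n≤o⇒m≤o∸n 2 (subst (_≤ Z) (ℕP.+-comm k 2) k+2≤Z)) (ℕP.m∸n≤m Z k)
        (subst Decomposition (ℕP.+-∸-assoc 1 k≤Z) (descend k (ℕP.<⇒≤ k<Z-1)))
        where
        k+2≤Z : k ℕ.+ 2 ≤ Z
        k+2≤Z = subst (_≤ Z) (ℕP.+-comm 2 k) (ℕP.≤-trans (s≤s k<Z-1) (ℕP.≤-reflexive (ℕP.m+[n∸m]≡n 1≤Z)))
        k≤Z : k ≤ Z
        k≤Z = ℕP.≤-trans (ℕP.m≤m+n k 2) k+2≤Z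

-- Many primes between n and 2n, by Erdős's argument with central binomial coefficients.

module Chebyshev where

  open import Data.Nat
  open import Data.Nat.Properties
  open import Data.Nat.DivMod using (m≡m%n+[m/n]*n; m%n<n; m/n*n≤m)
  open import Data.Nat.Divisibility
  open import Data.Nat.Primality
  open import Data.Nat.Tactic.RingSolver using (solve-∀)
  open import Data.Nat.Induction using (<-rec)
  open import Data.Product using (∃; _×_; _,_)
  open import Data.Sum using (_⊎_; inj₁; inj₂)
  open import Data.Empty using (⊥-elim)
  open import Relation.Nullary using (Dec; yes; no; ¬_)
  open import Relation.Nullary.Decidable using (_×-dec_)
  open import Relation.Binary.PropositionalEquality
  open NatPow
  open Divisors using (split-power)
  open Sieve using (leastFactor; leastFactor-spec)

  binom : ℕ → ℕ → ℕ
  binom n zero = 1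
  binom zero (suc k) = 0
  binom (suc n) (suc k) = binom n k + binom n (suc k)

  absorption : ∀ n k → suc k * binom (suc n) (suc k) ≡ suc n * binom n k
  absorption zero zero = refl
  absorption zero (suc k) = *-zeroʳ (suc (suc k))
  absorption (suc n) zero = trans (cong (λ b → 1 * (1 + b)) (trans (sym (*-identityˡ (binom (suc n) 1))) (absorption n zero))) (lem n)
    where
    lem : ∀ n → 1 * (1 + suc n * 1) ≡ suc (suc n) * 1
    lem = solve-∀
  absorption (suc n) (suc k) = trans (lem k (binom (suc n) (suc k)) (binom (suc n) (suc (suc k))))
    (trans (cong₂ (λ s t → s + binom (suc n) (suc k) + t) (absorption n k) (absorption n (suc k))) (lem₂ n (binom n k) (binom n (suc k))))
    where
    lem : ∀ k x y → suc (suc k) * (x + y) ≡ suc k * x + x + suc (suc k) * y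
    lem = solve-∀
    lem₂ : ∀ n x y → suc n * x + (x + y) + suc n * y ≡ suc (suc n) * (x + y)
    lem₂ = solve-∀

  binom-! : ∀ a b → binom (a + b) a * (a ! * b !) ≡ (a + b) !
  binom-! zero b = trans (*-identityˡ _) (*-identityˡ _)
  binom-! (suc a) b = trans (lem (binom (suc a + b) (suc a)) (suc a) (a !) (b !)) (trans (cong (_* (a ! * b !)) (absorption (a + b) a))
    (trans (*-assoc (suc (a + b)) (binom (a + b) a) (a ! * b !)) (cong (suc (a + b) *_) (binom-! a b))))
    where
    lem : ∀ x s f g → x * (s * f * g) ≡ s * x * (f * g)
    lem = solve-∀

  central : ℕ → ℕ
  central n = binom (n + n) n

  central-step : ∀ n → suc n * central (suc n) ≡ 2 * (suc (n + n) * central n)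
  central-step n = *-cancelˡ-≡ _ _ (suc n) (trans (cong (suc n *_) (absorption (n + suc n) n))
    (trans (lem n (binom (n + suc n) n)) (trans (cong (2 *_ ) (cong (suc n *_) mid)) (lem₂ n (suc (n + n) * central n)))))
    where
    lem : ∀ n b → suc n * (suc (n + suc n) * b) ≡ 2 * (suc n * (b * suc n))
    lem = solve-∀
    lem₂ : ∀ n x → 2 * (suc n * x) ≡ suc n * (2 * x)
    lem₂ = solve-∀
    lem₃ : ∀ b s f → b * s * (f * f) ≡ b * (f * (s * f))
    lem₃ = solve-∀
    mid : binom (n + suc n) n * suc n ≡ suc (n + n) * central n
    mid = *-cancelʳ-≡ _ _ (n ! * n !) {{m*n≢0 (n !) (n !) {{n !≢0}} {{n !≢0}}}} (trans (lem₃ (binom (n + suc n) n) (suc n) (n !))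
      (trans (binom-! n (suc n)) (trans (cong _! (+-suc n n)) (trans (cong (suc (n + n) *_) (sym (binom-! n n))) (sym (*-assoc (suc (n + n)) (central n) _))))))

  4^n≤central : ∀ n → 1 ≤ n → 4 ^ n ≤ (n + n) * central n
  4^n≤central (suc zero) _ = ≤-refl
  4^n≤central (suc (suc n)) _ = ≤-trans (*-monoʳ-≤ 4 (4^n≤central (suc n) (s≤s z≤n)))
    (≤-trans (m≤n+m _ (4 * central m)) (≤-reflexive (trans (lem m (central m)) (trans (cong (2 *_) (sym (central-step m))) (lem₂ m (central (suc m)))))))
    where
    m : ℕ
    m = suc n
    lem : ∀ m c → 4 * c + 4 * ((m + m) * c) ≡ 2 * (2 * (suc (m + m) * c))
    lem = solve-∀
    lem₂ : ∀ m c → 2 * (suc m * c) ≡ (suc m + suc m) * c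
    lem₂ = solve-∀

  -- The factor `(2n + 1) / (n + 1)` makes the induction close, and by `absorption` it is exactly
  -- what turns the central coefficient into a middle coefficient of `2n + 1`.
  central-upper : ∀ n → suc (n + n) * central n ≤ 4 ^ n * suc n
  central-upper zero = ≤-refl
  central-upper (suc n) = *-cancelˡ-≤ (suc n) (≤-trans (≤-reflexive (trans (lem n (central (suc n))) (cong (suc (suc n + suc n) *_) (central-step n))))
    (≤-trans (*-monoʳ-≤ (suc (suc n + suc n)) (*-monoʳ-≤ 2 (central-upper n))) (≤-trans (m≤n+m _ (2 * (4 ^ n * suc n))) (≤-reflexive (lem₂ n (4 ^ n))))))
    where
    lem : ∀ n c → suc n * (suc (suc n + suc n) * c) ≡ suc (suc n + suc n) * (suc n * c)
    lem = solve-∀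
    lem₂ : ∀ n x → 2 * (x * suc n) + suc (suc n + suc n) * (2 * (x * suc n)) ≡ suc n * (4 * x * suc (suc n))
    lem₂ = solve-∀

  odd-binom : ℕ → ℕ
  odd-binom m = binom (suc m + m) (suc m)

  odd-binom-upper : ∀ m → odd-binom m ≤ 4 ^ m
  odd-binom-upper m = *-cancelˡ-≤ (suc m) (≤-trans (≤-reflexive (absorption (m + m) m)) (≤-trans (central-upper m) (≤-reflexive (*-comm (4 ^ m) (suc m)))))

  pp : ℕ → ℕ
  pp i with prime? i
  ... | yes _ = i
  ... | no _ = 1

  pp-yes : ∀ {p} → Prime p → pp p ≡ p
  pp-yes {p} pr with prime? p
  ... | yes _ = refl
  ... | no ¬p = ⊥-elim (¬p pr)

  pp-no : ∀ {p} → ¬ Prime p → pp p ≡ 1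
  pp-no {p} ¬p with prime? p
  ... | yes p = ⊥-elim (¬p p)
  ... | no _ = refl

  1≤pp : ∀ i → 1 ≤ pp i
  1≤pp i with prime? i
  ... | yes p = >-nonZero⁻¹ i {{prime⇒nonZero p}}
  ... | no _ = ≤-refl

  -- The interval is (a , a + k].
  primeProduct : ℕ → ℕ → ℕ
  primeProduct a zero = 1
  primeProduct a (suc k) = primeProduct a k * pp (a + suc k)

  primeProduct-+ : ∀ a k l → primeProduct a (k + l) ≡ primeProduct a k * primeProduct (a + k) l
  primeProduct-+ a k zero = trans (cong (primeProduct a) (+-identityʳ k)) (sym (*-identityʳ _))
  primeProduct-+ a k (suc l) = trans (cong (primeProduct a) (+-suc k l)) (trans (cong₂ _*_ (primeProduct-+ a k l)
    (cong pp (trans (cong (a +_) (sym (+-suc k l))) (sym (+-assoc a k (suc l)))))) (*-assoc (primeProduct a k) _ _))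

  prime∣1 : ∀ {p} → Prime p → ¬ p ∣ 1
  prime∣1 pr p∣1 = ¬prime[1] (subst Prime (∣1⇒≡1 p∣1) pr)

  prime∣primeProduct : ∀ {p} a k → Prime p → p ∣ primeProduct a k → p ≤ a + k
  prime∣primeProduct a zero pr p∣ = ⊥-elim (prime∣1 pr p∣)
  prime∣primeProduct {p} a (suc k) pr p∣ with euclidsLemma (primeProduct a k) (pp (a + suc k)) pr p∣ | prime? (a + suc k)
  ... | inj₁ p∣′ | _ = ≤-trans (prime∣primeProduct a k pr p∣′) (+-monoʳ-≤ a (n≤1+n k))
  ... | inj₂ p∣′ | yes q = ∣⇒≤ {{prime⇒nonZero q}} (subst (p ∣_) (pp-yes q) p∣′)
  ... | inj₂ p∣′ | no ¬q = ⊥-elim (prime∣1 pr (subst (p ∣_) (pp-no ¬q) p∣′))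

  primeProduct∣ : ∀ x a k → (∀ p → Prime p → a < p → p ≤ a + k → p ∣ x) → primeProduct a k ∣ x
  primeProduct∣ x a zero _ = 1∣ x
  primeProduct∣ x a (suc k) div with primeProduct∣ x a k (λ p pr a<p p≤ → div p pr a<p (≤-trans p≤ (+-monoʳ-≤ a (n≤1+n k)))) | prime? (a + suc k)
  ... | Π∣x | no ¬q = subst (_∣ x) (sym (*-identityʳ _)) Π∣x
  ... | divides y eq | yes q with euclidsLemma y (primeProduct a k) q (subst (a + suc k ∣_) eq (div (a + suc k) q (m<m+n a (s≤s z≤n)) ≤-refl))
  ...   | inj₂ q∣Π = ⊥-elim (<⇒≱ (+-monoʳ-< a (n<1+n k)) (prime∣primeProduct a k q q∣Π))
  ...   | inj₁ (divides z eq′) = divides z (trans eq (trans (cong (_* primeProduct a k) eq′) (lem z (a + suc k) (primeProduct a k))))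
    where
    lem : ∀ z p Π → z * p * Π ≡ z * (Π * p)
    lem = solve-∀

  ∣! : ∀ {p} n → 1 ≤ p → p ≤ n → p ∣ n !
  ∣! zero 1≤p p≤0 = ⊥-elim (<⇒≱ 1≤p p≤0)
  ∣! {p} (suc n) 1≤p p≤ with m≤n⇒m<n∨m≡n p≤
  ... | inj₁ (s≤s p≤n) = ∣n⇒∣m*n (suc n) (∣! n 1≤p p≤n)
  ... | inj₂ refl = m∣m*n (n !)

  ∤! : ∀ {p} n → Prime p → n < p → ¬ p ∣ n !
  ∤! zero pr _ p∣ = prime∣1 pr p∣
  ∤! (suc n) pr n<p p∣ with euclidsLemma (suc n) (n !) pr p∣
  ... | inj₁ p∣n = <⇒≱ n<p (∣⇒≤ p∣n)
  ... | inj₂ p∣! = ∤! n pr (<-trans (n<1+n n) n<p) p∣!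

  -- The primes in (m + 1, 2m + 1] divide `(2m + 1)!` but neither `(m + 1)!` nor `m!`, hence they
  -- divide the binomial coefficient.
  primeProduct-upper : ∀ m → primeProduct (suc m) m ≤ 4 ^ m
  primeProduct-upper m = ≤-trans (∣⇒≤ {{odd≢0}} (primeProduct∣ (odd-binom m) (suc m) m div)) (odd-binom-upper m)
    where
    odd≢0 : NonZero (odd-binom m)
    odd≢0 = ≢-nonZero λ eq → ≢-nonZero⁻¹ ((suc m + m) !) {{(suc m + m) !≢0}} (trans (sym (binom-! (suc m) m)) (cong (_* ((suc m) ! * m !)) eq))
    div : ∀ p → Prime p → suc m < p → p ≤ suc m + m → p ∣ odd-binom m
    div p pr m<p p≤ with euclidsLemma (odd-binom m) ((suc m) ! * m !) pr (subst (p ∣_) (sym (binom-! (suc m) m)) (∣! (suc m + m) (>-nonZero⁻¹ p {{prime⇒nonZero pr}}) p≤))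
    ... | inj₁ p∣ = p∣
    ... | inj₂ p∣ with euclidsLemma ((suc m) !) (m !) pr p∣
    ...   | inj₁ p∣₁ = ⊥-elim (∤! (suc m) pr m<p p∣₁)
    ...   | inj₂ p∣₂ = ⊥-elim (∤! m pr (<-trans (n<1+n m) m<p) p∣₂)

  halve : ∀ k → (∃ λ m → k ≡ m + m) ⊎ (∃ λ m → k ≡ suc (m + m))
  halve zero = inj₁ (0 , refl)
  halve (suc k) with halve k
  ... | inj₁ (m , refl) = inj₂ (m , refl)
  ... | inj₂ (m , refl) = inj₁ (suc m , cong suc (sym (+-suc m m)))

  even-not-prime : ∀ m → 2 ≤ m → ¬ Prime (m + m)
  even-not-prime m 2≤m pr with prime⇒irreducible pr {2} (divides m (trans (cong (m +_) (sym (+-identityʳ m))) (*-comm 2 m)))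
  ... | inj₂ eq = <⇒≢ (≤-trans (s≤s (s≤s (s≤s z≤n))) (+-mono-≤ 2≤m 2≤m)) eq

  -- An even `k > 2` is not prime and adds nothing; an odd `k = 2m + 1` splits into the primes up to
  -- `m + 1`, treated by induction, and those above.
  primorial≤ : ∀ k → primeProduct 0 k ≤ 4 ^ k
  primorial≤ = <-rec _ go
    where
    go : ∀ k → (∀ {j} → j < k → primeProduct 0 j ≤ 4 ^ j) → primeProduct 0 k ≤ 4 ^ k
    go 0 _ = ≤-refl
    go 1 _ = s≤s z≤n
    go 2 _ = s≤s (s≤s z≤n)
    go k@(suc k′@(suc (suc _))) rec with halve k
    ... | inj₁ (m , eq) = ≤-trans (≤-reflexive (trans (cong (primeProduct 0 k′ *_) (pp-no (subst (λ t → ¬ Prime t) (sym eq) (even-not-prime m (2≤m m eq))))) (*-identityʳ _)))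
            (≤-trans (rec (n<1+n k′)) (m≤n*m (4 ^ k′) 4))
      where
      2≤m : ∀ m → k ≡ m + m → 2 ≤ m
      2≤m (suc zero) ()
      2≤m (suc (suc m)) _ = s≤s (s≤s z≤n)
    ... | inj₂ (m , eq) = subst (λ t → primeProduct 0 t ≤ 4 ^ t) (sym eq) (≤-trans (≤-reflexive (primeProduct-+ 0 (suc m) m))
            (≤-trans (*-mono-≤ (rec (subst (suc m <_) (sym eq) (s≤s (m<m+n m (m>0 m eq))))) (primeProduct-upper m)) (≤-reflexive (sym (^-distribˡ-+-* 4 (suc m) m)))))
      where
      m>0 : ∀ m → k ≡ suc (m + m) → 0 < m
      m>0 (suc m) _ = s≤s z≤n

  -- Leibniz' harmonic triangle: 1 / ((n+1) C(n,k+1)) = 1 / (n C(n-1,k)) - 1 / ((n+1) C(n,k)), with denominators cleared.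
  leibniz : ∀ m k → k ≤ m → let L = suc (suc m) * binom (suc m) k; L′ = suc m * binom m k; x = suc (suc m) * binom (suc m) (suc k) in
    x * L ≡ L * L′ + x * L′
  leibniz m k k≤m = *-cancelˡ-≡ _ _ (suc k) (trans (l₁ (suc k) M (binom (suc m) (suc k)) (binom (suc m) k)) (trans
      (cong (λ t → M * M * t * binom (suc m) k) (absorption m k))
      (trans (l₂ M (suc m) (binom m k) (binom (suc m) k)) (trans (cong (λ t → M * (suc m * binom m k) * t) (sym (absorption (suc m) k)))
        (l₃ M (suc m) (binom m k) (suc k) (binom (suc m) k) (binom (suc m) (suc k)))))))
    where
    M : ℕ
    M = suc (suc m)
    l₁ : ∀ k M x b → k * (M * x * (M * b)) ≡ M * M * (k * x) * b
    l₁ = solve-∀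
    l₂ : ∀ M s c b → M * M * (s * c) * b ≡ M * (s * c) * (M * b)
    l₂ = solve-∀
    l₃ : ∀ M s c k b x → M * (s * c) * (k * (b + x)) ≡ k * (M * b * (s * c) + M * x * (s * c))
    l₃ = solve-∀

  binom≢0 : ∀ n k → k ≤ n → NonZero (binom n k)
  binom≢0 n zero _ = _
  binom≢0 (suc n) (suc k) (s≤s k≤n) = >-nonZero (≤-trans (>-nonZero⁻¹ _ {{binom≢0 n k k≤n}}) (m≤m+n _ _))

  -- In the harmonic triangle `1/x = 1/L′ - 1/L`, so `M/x` is an integer once `M/L′` and `M/L` are.
  leibniz-∣ : ∀ M .{{_ : NonZero M}} n → (∀ i → 1 ≤ i → i ≤ suc n → i ∣ M) → ∀ k → k ≤ n → suc n * binom n k ∣ M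
  leibniz-∣ M n div zero _ = subst (_∣ M) (sym (*-identityʳ (suc n))) (div (suc n) (s≤s z≤n) ≤-refl)
  leibniz-∣ M (suc m) div (suc k) (s≤s k≤m) with leibniz-∣ M (suc m) div k (m≤n⇒m≤1+n k≤m) | leibniz-∣ M m (λ i 1≤i i≤ → div i 1≤i (m≤n⇒m≤1+n i≤)) k k≤m
  ... | divides b eqb | divides a eqa = ∣m+n∣m⇒∣n (subst (x ∣_) (trans key (+-comm M (b * x))) (n∣m*n a)) (n∣m*n b)
    where
    L L′ x : ℕ
    L = suc (suc m) * binom (suc m) k
    L′ = suc m * binom m k
    x = suc (suc m) * binom (suc m) (suc k)
    instance
      L≢0 : NonZero L
      L≢0 = m*n≢0 (suc (suc m)) (binom (suc m) k) {{_}} {{binom≢0 (suc m) k (m≤n⇒m≤1+n k≤m)}}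
      L′≢0 : NonZero L′
      L′≢0 = m*n≢0 (suc m) (binom m k) {{_}} {{binom≢0 m k k≤m}}
    l₁ : ∀ a x L L′ → a * x * (L * L′) ≡ a * L′ * (x * L)
    l₁ = solve-∀
    l₂ : ∀ M L L′ x → M * (L * L′ + x * L′) ≡ M * (L * L′) + M * (x * L′)
    l₂ = solve-∀
    l₃ : ∀ M b L L′ x → M * (L * L′) + b * L * (x * L′) ≡ (M + b * x) * (L * L′)
    l₃ = solve-∀
    key : a * x ≡ M + b * x
    key = *-cancelʳ-≡ (a * x) (M + b * x) (L * L′) {{m*n≢0 L L′}} (trans (l₁ a x L L′) (trans (cong₂ _*_ (sym eqa) (leibniz m k k≤m))
      (trans (l₂ M L L′ x) (trans (cong (λ t → M * (L * L′) + t * (x * L′)) eqb) (l₃ M b L L′ x)))))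

  log-bound : ∀ p N → 2 ≤ p → 1 ≤ N → ∃ λ K → p ^ K ≤ N × (∀ e → p ^ e ≤ N → e ≤ K)
  log-bound p N 2≤p 1≤N = search N (λ e le → ≮⇒≥ λ N<e → <⇒≱ (<-≤-trans (<-trans N<e (n<2^n e)) (^-monoˡ-≤ e 2≤p)) le)
    where
    search : ∀ f → (∀ e → p ^ e ≤ N → e ≤ f) → ∃ λ K → p ^ K ≤ N × (∀ e → p ^ e ≤ N → e ≤ K)
    search f top with p ^ f ≤? N
    ... | yes le = f , le , top
    search zero top | no ¬le = ⊥-elim (¬le 1≤N)
    search (suc f) top | no ¬le = search f (λ e le → ≤-pred (≤∧≢⇒< (top e le) (λ { refl → ¬le le })))

  prime-power∣*⇒ : ∀ {p} → Prime p → ∀ e K u → ¬ p ∣ u → p ^ e ∣ p ^ K * u → e ≤ K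
  prime-power∣*⇒ pr zero K u _ _ = z≤n
  prime-power∣*⇒ {p} pr (suc e) zero u p∤u div = ⊥-elim (p∤u (∣-trans (m∣m*n (p ^ e)) (subst (p ^ suc e ∣_) (+-identityʳ u) div)))
  prime-power∣*⇒ {p} pr (suc e) (suc K) u p∤u div = s≤s (prime-power∣*⇒ pr e K u p∤u (*-cancelˡ-∣ p {{prime⇒nonZero pr}} (subst (p ^ suc e ∣_) (*-assoc p (p ^ K) u) div)))

  -- Replaces the least common multiple of 1, ..., N: `u` collects the parts prime to `p`, so for
  -- the largest `K` with `p ^ K ≤ N` the number `p ^ K * u` is a common multiple whose exact power
  -- of `p` is known.
  common-multiple : ∀ {p} → Prime p → ∀ N → ∃ λ u → ¬ p ∣ u × NonZero u × (∀ i → 1 ≤ i → i ≤ N → ∃ λ e → i ∣ p ^ e * u × p ^ e ≤ i)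
  common-multiple pr zero = 1 , prime∣1 pr , _ , λ i 1≤i i≤0 → ⊥-elim (<⇒≱ 1≤i i≤0)
  common-multiple {p} pr (suc N) with common-multiple pr N | split-power (suc N) p (suc N) (nonTrivial⇒n>1 p {{prime⇒nonTrivial pr}}) ≤-refl
  ... | u , p∤u , u≢0 , mult | e , m , eq , p∤m = u * m , ∤prod , m*n≢0 u m {{u≢0}} {{m≢0}} , all
    where
    m≢0 : NonZero m
    m≢0 = ≢-nonZero λ { refl → 1+n≢0 (trans eq (*-zeroʳ (p ^ e))) }
    ∤prod : ¬ p ∣ u * m
    ∤prod p∣ with euclidsLemma u m pr p∣
    ... | inj₁ x = p∤u x
    ... | inj₂ x = p∤m x
    all : ∀ i → 1 ≤ i → i ≤ suc N → ∃ λ e → i ∣ p ^ e * (u * m) × p ^ e ≤ i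
    all i 1≤i i≤ with m≤n⇒m<n∨m≡n i≤
    ... | inj₁ (s≤s i≤N) = let e , i∣ , le = mult i 1≤i i≤N in e , ∣-trans i∣ (subst (p ^ e * u ∣_) (*-assoc (p ^ e) u m) (m∣m*n m)) , le
    ... | inj₂ refl = e , subst (_∣ p ^ e * (u * m)) (sym eq) (subst (p ^ e * m ∣_) (l (p ^ e) u m) (n∣m*n u)) , subst (p ^ e ≤_) (sym eq) (m≤m*n (p ^ e) m {{m≢0}})
      where
      l : ∀ a u m → u * (a * m) ≡ a * (u * m)
      l = solve-∀

  -- By the harmonic triangle `(n + 1) C(n, k)` divides every common multiple of 1, ..., n + 1, in
  -- particular one whose power of `p` is `p ^ K ≤ n + 1`. This takes the place of Legendre's
  -- formula.
  prime-power∣binom : ∀ {p e} n k → Prime p → k ≤ n → p ^ e ∣ binom (suc n) (suc k) → p ^ e ≤ suc n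
  prime-power∣binom {p} {e} n k pr k≤n div with common-multiple pr (suc n) | log-bound p (suc n) (nonTrivial⇒n>1 p {{prime⇒nonTrivial pr}}) (s≤s z≤n)
  ... | u , p∤u , u≢0 , mult | K , pK≤ , top = ≤-trans (^-monoʳ-≤ p {{prime⇒nonZero pr}} e≤K) pK≤
    where
    p^K≢0 : NonZero (p ^ K)
    p^K≢0 = m^n≢0 p K {{prime⇒nonZero pr}}
    all : ∀ i → 1 ≤ i → i ≤ suc n → i ∣ p ^ K * u
    all i 1≤i i≤ = let e , i∣ , le = mult i 1≤i i≤ ; e≤K = top e (≤-trans le i≤) in
      ∣-trans i∣ (*-monoˡ-∣ u (subst (p ^ e ∣_) (trans (sym (^-distribˡ-+-* p e (K ∸ e))) (cong (p ^_) (m+[n∸m]≡n e≤K))) (m∣m*n (p ^ (K ∸ e)))))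
    e≤K : e ≤ K
    e≤K = prime-power∣*⇒ pr e K u p∤u (∣-trans div (∣-trans (subst (binom (suc n) (suc k) ∣_) (absorption n k) (n∣m*n (suc k))) (leibniz-∣ (p ^ K * u) {{m*n≢0 (p ^ K) u {{p^K≢0}} {{u≢0}}}} n all k k≤n)))

  module _ {p : ℕ} (pr : Prime p) (2<p : 2 < p) where

    private
      ∤-between : ∀ c j → 0 < j → j < p → ¬ p ∣ c * p + j
      ∤-between c j 0<j j<p p∣ = <⇒≱ j<p (∣⇒≤ {{>-nonZero 0<j}} (∣m+n∣m⇒∣n p∣ (n∣m*n c)))

      first : ∀ j → j < p → ∃ λ x → (1 * p + j) ! ≡ p * x × ¬ p ∣ x
      first zero _ = step p refl
        where
        step : ∀ p′ → p′ ≡ p → ∃ λ x → (1 * p + 0) ! ≡ p * x × ¬ p ∣ x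
        step zero refl = ⊥-elim (<⇒≱ 2<p z≤n)
        step (suc r) eq = r ! , trans (cong _! (trans (+-identityʳ (1 * p)) (trans (*-identityˡ p) (sym eq)))) (cong (_* r !) eq) , ∤! r pr (subst (r <_) eq (n<1+n r))
      first (suc j) j<p with first j (<-trans (n<1+n j) j<p)
      ... | x , eq , p∤x = (1 * p + suc j) * x , trans (cong _! (+-suc (1 * p) j)) (trans (cong (suc (1 * p + j) *_) eq) (trans (cong (_* (p * x)) (sym (+-suc (1 * p) j))) (l (1 * p + suc j) p x))) , ∤
        where
        l : ∀ a p x → a * (p * x) ≡ p * (a * x)
        l = solve-∀
        ∤ : ¬ p ∣ (1 * p + suc j) * x
        ∤ p∣ with euclidsLemma (1 * p + suc j) x pr p∣
        ... | inj₁ y = ∤-between 1 (suc j) (s≤s z≤n) j<p y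
        ... | inj₂ y = p∤x y

    -- The only multiples of `p` up to `2p + j` are `p` and `2p`, and `p > 2` does not divide the
    -- cofactor 2.
    two-factors : ∀ j → j < p → ∃ λ x → (2 * p + j) ! ≡ p * p * x × ¬ p ∣ x
    two-factors zero _ = step p refl
      where
      step : ∀ p′ → p′ ≡ p → ∃ λ x → (2 * p + 0) ! ≡ p * p * x × ¬ p ∣ x
      step zero refl = ⊥-elim (<⇒≱ 2<p z≤n)
      step (suc r) eq with first r (subst (r <_) eq (n<1+n r))
      ... | x , fact , p∤x = 2 * x , trans (cong _! (trans (l₁ p) (trans (cong (1 * p +_) (sym eq)) (+-suc (1 * p) r)))) (trans (cong₂ _*_ (trans (sym (+-suc (1 * p) r)) (cong (1 * p +_) eq)) fact) (l₂ p x)) , ∤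
        where
        l₁ : ∀ p → 2 * p + 0 ≡ 1 * p + p
        l₁ = solve-∀
        l₂ : ∀ p x → (1 * p + p) * (p * x) ≡ p * p * (2 * x)
        l₂ = solve-∀
        ∤ : ¬ p ∣ 2 * x
        ∤ p∣ with euclidsLemma 2 x pr p∣
        ... | inj₁ y = <⇒≱ 2<p (∣⇒≤ y)
        ... | inj₂ y = p∤x y
    two-factors (suc j) j<p with two-factors j (<-trans (n<1+n j) j<p)
    ... | x , eq , p∤x = (2 * p + suc j) * x , trans (cong _! (+-suc (2 * p) j)) (trans (cong (suc (2 * p + j) *_) eq) (trans (cong (_* (p * p * x)) (sym (+-suc (2 * p) j))) (l (2 * p + suc j) p x))) , ∤
      where
      l : ∀ a p x → a * (p * p * x) ≡ p * p * (a * x)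
      l = solve-∀
      ∤ : ¬ p ∣ (2 * p + suc j) * x
      ∤ p∣ with euclidsLemma (2 * p + suc j) x pr p∣
      ... | inj₁ y = ∤-between 2 (suc j) (s≤s z≤n) j<p y
      ... | inj₂ y = p∤x y

    -- `(2n)!` contains `p` exactly twice and `(n!)²` at least twice, so nothing is left for the
    -- quotient.
    ∤central : ∀ n → p ≤ n → n + n < 3 * p → ¬ p ∣ central n
    ∤central n p≤n 2n<3p p∣ with two-factors (n + n ∸ 2 * p) (+-cancelˡ-< (2 * p) _ _ (subst₂ _<_ (sym (m+[n∸m]≡n 2p≤2n)) (l p) 2n<3p)) | ∣! n (≤-trans (s≤s z≤n) (<⇒≤ 2<p)) p≤n
      where
      2p≤2n : 2 * p ≤ n + n
      2p≤2n = ≤-trans (≤-reflexive (cong (p +_) (+-identityʳ p))) (+-mono-≤ p≤n p≤n)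
      l : ∀ p → 3 * p ≡ 2 * p + p
      l = solve-∀
    ... | x , eq , p∤x | divides y eqy = p∤x (∣-trans p∣ (divides (y * y) (*-cancelˡ-≡ x (y * y * central n) (p * p) {{m*n≢0 p p {{prime⇒nonZero pr}} {{prime⇒nonZero pr}}}}
        (trans (sym eq) (trans (cong _! (m+[n∸m]≡n (≤-trans (≤-reflexive (cong (p +_) (+-identityʳ p))) (+-mono-≤ p≤n p≤n)))) (trans (sym (binom-! n n)) (trans (cong₂ (λ s t → central n * (s * t)) eqy eqy) (l₂ (central n) y p))))))))
      where
      l₂ : ∀ c y p → c * (y * p * (y * p)) ≡ p * p * (y * y * c)
      l₂ = solve-∀

  product-from : (ℕ → ℕ) → ℕ → ℕ → ℕ
  product-from w i zero = 1
  product-from w i (suc j) = w i * product-from w (suc i) j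

  -- x ≤ the product of the prime powers dividing it exactly.
  strip : ∀ (w : ℕ → ℕ) → (∀ i → 1 ≤ w i) → ∀ B j i x → .{{_ : NonZero x}} → 2 ≤ i → i + j ≡ suc B → i Rough x →
    (∀ p → Prime p → p ∣ x → p ≤ B) → (∀ p e → Prime p → p ^ e ∣ x → p ^ e ≤ w p) → x ≤ product-from w i j
  strip w 1≤w B zero i x 2≤i i+j rough below powers = ≮⇒≥ λ 1<x →
    let 2≤l , l∣x , l-rough , _ = leastFactor-spec x 1<x
        l-prime = rough∧∣⇒prime {{n>1⇒nonTrivial 2≤l}} l-rough l∣x
    in rough (hasNonTrivialDivisor {{n>1⇒nonTrivial 2≤l}} (subst (leastFactor x <_) (sym (trans (sym (+-identityʳ i)) i+j)) (s≤s (below _ l-prime l∣x))) l∣x)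
  strip w 1≤w B (suc j) i x 2≤i i+j rough below powers with split-power x i x 2≤i ≤-refl
  ... | e , m , eq , i∤m = ≤-trans (≤-reflexive eq) (*-mono-≤ (head e eq) (strip w 1≤w B j (suc i) m {{m≢0}} (m≤n⇒m≤1+n 2≤i) (trans (sym (+-suc i j)) i+j)
      (∤⇒rough-suc i∤m (rough∧∣⇒rough rough m∣x)) (λ p pr p∣m → below p pr (∣-trans p∣m m∣x)) (λ p f pr p∣m → powers p f pr (∣-trans p∣m m∣x))))
    where
    m≢0 : NonZero m
    m≢0 = ≢-nonZero λ { refl → ≢-nonZero⁻¹ x (trans eq (*-zeroʳ (i ^ e))) }
    m∣x : m ∣ x
    m∣x = divides (i ^ e) eq
    head : ∀ e → x ≡ i ^ e * m → i ^ e ≤ w i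
    head zero _ = 1≤w i
    head (suc e) eq = powers i (suc e) (rough∧∣⇒prime {{n>1⇒nonTrivial 2≤i}} rough (∣-trans (m∣m*n (i ^ e)) pow∣)) pow∣
      where
      pow∣ : i ^ suc e ∣ x
      pow∣ = divides m (trans eq (*-comm (i ^ suc e) m))

  count : {Q : ℕ → Set} → (∀ i → Dec (Q i)) → ℕ → ℕ → ℕ
  count Q? i zero = 0
  count Q? i (suc j) with Q? i
  ... | yes _ = suc (count Q? (suc i) j)
  ... | no _ = count Q? (suc i) j

  InUpperHalf : ℕ → ℕ → Set
  InUpperHalf n p = n < p × Prime p

  inUpperHalf? : ∀ n p → Dec (InUpperHalf n p)
  inUpperHalf? n p = (n <? p) ×-dec prime? p

  product-from-* : ∀ f g i j → product-from (λ t → f t * g t) i j ≡ product-from f i j * product-from g i j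
  product-from-* f g i zero = refl
  product-from-* f g i (suc j) = trans (cong (f i * g i *_) (product-from-* f g (suc i) j)) (lem (f i) (g i) _ _)
    where
    lem : ∀ a b c d → a * b * (c * d) ≡ a * c * (b * d)
    lem = solve-∀

  choose : {P : Set} → Dec P → ℕ → ℕ
  choose (yes _) a = a
  choose (no _) a = 1

  1≤choose : ∀ {P : Set} (d : Dec P) {a} → 1 ≤ a → 1 ≤ choose d a
  1≤choose (yes _) 1≤a = 1≤a
  1≤choose (no _) 1≤a = ≤-refl

  choose-yes : ∀ {P : Set} (d : Dec P) {a} → P → choose d a ≡ a
  choose-yes (yes _) p = refl
  choose-yes (no ¬p) p = ⊥-elim (¬p p)

  module _ (n s κ : ℕ) (3≤n : 3 ≤ n) (s² : s * s ≤ n + n) (s²< : n + n < suc s * suc s) (κ-large : n + n ≤ 2 ^ κ) where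

    private
      N t : ℕ
      N = n + n
      t = N / 3

      1≤N : 1 ≤ N
      1≤N = ≤-trans (s≤s z≤n) (≤-trans 3≤n (m≤m+n n n))

      -- Bounds for the power of a prime `i` in `central n`: `2n` up to the square root of `2n`, `i`
      -- itself up to `2n/3`, and `2n` above `n`; primes in (2n/3, n] above the root do not occur.
      -- Where ranges overlap the weights multiply, which only weakens the bound.
      w₁ w₂ w₃ w : ℕ → ℕ
      w₁ i = choose (i ≤? s) N
      w₂ i = choose (i ≤? t) (pp i)
      w₃ i = choose (inUpperHalf? n i) N
      w i = w₁ i * (w₂ i * w₃ i)

      1≤w₁ : ∀ i → 1 ≤ w₁ i
      1≤w₁ i = 1≤choose (i ≤? s) 1≤N
      1≤w₂ : ∀ i → 1 ≤ w₂ i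
      1≤w₂ i = 1≤choose (i ≤? t) (1≤pp i)
      1≤w₃ : ∀ i → 1 ≤ w₃ i
      1≤w₃ i = 1≤choose (inUpperHalf? n i) 1≤N

      1≤w : ∀ i → 1 ≤ w i
      1≤w i = *-mono-≤ (1≤w₁ i) (*-mono-≤ (1≤w₂ i) (1≤w₃ i))

      N^ : ∀ {a b} → a ≤ b → N ^ a ≤ N ^ b
      N^ = ^-monoʳ-≤ N {{>-nonZero 1≤N}}

      small-product : ∀ i j → product-from w₁ i j ≤ N ^ (suc s ∸ i)
      small-product i zero = m^n>0 N {{>-nonZero 1≤N}} (suc s ∸ i)
      small-product i (suc j) with i ≤? s
      ... | yes i≤s = ≤-trans (*-monoʳ-≤ N (small-product (suc i) j)) (≤-reflexive (cong (N ^_) (sym (+-∸-assoc 1 i≤s))))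
      ... | no i≰s = ≤-trans (≤-reflexive (*-identityˡ _)) (≤-trans (small-product (suc i) j) (N^ (∸-monoʳ-≤ (suc s) (n≤1+n i))))

      primeProduct-mono : ∀ {a b} → a ≤ b → primeProduct 0 a ≤ primeProduct 0 b
      primeProduct-mono {a} {b} a≤b = subst (λ c → primeProduct 0 a ≤ primeProduct 0 c) (m+[n∸m]≡n a≤b) (go (b ∸ a))
        where
        go : ∀ d → primeProduct 0 a ≤ primeProduct 0 (a + d)
        go zero = ≤-reflexive (cong (primeProduct 0) (sym (+-identityʳ a)))
        go (suc d) = ≤-trans (go d) (≤-trans (m≤m*n _ (pp (suc (a + d))) {{>-nonZero (1≤pp (suc (a + d)))}}) (≤-reflexive (cong (primeProduct 0) (sym (+-suc a d)))))

      -- The factor on the left holds the primes already passed, so that the induction telescopes.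
      middle-product : ∀ a j → product-from w₂ (suc a) j * primeProduct 0 (a ⊓ t) ≤ primeProduct 0 t
      middle-product a zero = ≤-trans (≤-reflexive (+-identityʳ _)) (primeProduct-mono (m⊓n≤n a t))
      middle-product a (suc j) = ≤-trans (≤-reflexive (trans (l (w₂ (suc a)) (product-from w₂ (suc (suc a)) j) (primeProduct 0 (a ⊓ t))) (cong (product-from w₂ (suc (suc a)) j *_) (absorb (suc a ≤? t)))))
        (middle-product (suc a) j)
        where
        l : ∀ w x y → w * x * y ≡ x * (y * w)
        l = solve-∀
        absorb : (d : Dec (suc a ≤ t)) → primeProduct 0 (a ⊓ t) * choose d (pp (suc a)) ≡ primeProduct 0 (suc a ⊓ t)
        absorb (yes a<t) = trans (cong (λ m → primeProduct 0 m * pp (suc a)) (m≤n⇒m⊓n≡m (<⇒≤ a<t))) (cong (primeProduct 0) (sym (m≤n⇒m⊓n≡m a<t)))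
        absorb (no a≮t) = trans (*-identityʳ _) (cong (primeProduct 0) (trans (m≥n⇒m⊓n≡n (≮⇒≥ a≮t)) (sym (m≥n⇒m⊓n≡n (≤-trans (≮⇒≥ a≮t) (n≤1+n a))))))

      large-product : ∀ i j → product-from w₃ i j ≡ N ^ count (inUpperHalf? n) i j
      large-product i zero = refl
      large-product i (suc j) with inUpperHalf? n i
      ... | yes _ = cong (N *_) (large-product (suc i) j)
      ... | no _ = trans (*-identityˡ _) (large-product (suc i) j)

      central-power≤ : ∀ m p e → Prime p → p ^ e ∣ central (suc m) → p ^ e ≤ suc m + suc m
      central-power≤ m p e pr div = prime-power∣binom {p} {e} (m + suc m) m pr (m≤m+n m (suc m)) div

      power≤N : ∀ p e → Prime p → p ^ e ∣ central n → p ^ e ≤ N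
      power≤N p e pr div = go n refl
        where
        go : ∀ m → m ≡ n → p ^ e ≤ N
        go zero refl = ⊥-elim (<⇒≱ 3≤n z≤n)
        go (suc m) refl = central-power≤ m p e pr div

      above-root : ∀ p e → Prime p → s < p → p ^ e ≤ N → e ≤ 1
      above-root p zero pr s<p le = z≤n
      above-root p (suc zero) pr s<p le = ≤-refl
      above-root p (suc (suc e)) pr s<p le = ⊥-elim (<⇒≱ s²< (≤-trans (*-mono-≤ s<p s<p) (≤-trans (*-monoʳ-≤ p (m≤m*n p (p ^ e) {{m^n≢0 p e {{prime⇒nonZero pr}}}})) le)))

      power≤w : ∀ p e → Prime p → p ^ e ∣ central n → p ^ e ≤ w p
      power≤w p e pr div = by-size (p ≤? s) (p ≤? t) (n <? p)
        where
        le : p ^ e ≤ N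
        le = power≤N p e pr div
        1≤p : 1 ≤ p
        1≤p = >-nonZero⁻¹ p {{prime⇒nonZero pr}}
        by-size : Dec (p ≤ s) → Dec (p ≤ t) → Dec (n < p) → p ^ e ≤ w p
        by-size (yes p≤s) _ _ = ≤-trans le (≤-trans (≤-reflexive (sym (choose-yes (p ≤? s) p≤s))) (m≤m*n (w₁ p) (w₂ p * w₃ p) {{>-nonZero (*-mono-≤ (1≤w₂ p) (1≤w₃ p))}}))
        by-size (no _) _ (yes n<p) = ≤-trans le (≤-trans (≤-reflexive (sym (choose-yes (inUpperHalf? n p) (n<p , pr)))) (≤-trans (m≤n*m (w₃ p) (w₂ p) {{>-nonZero (1≤w₂ p)}}) (m≤n*m (w₂ p * w₃ p) (w₁ p) {{>-nonZero (1≤w₁ p)}})))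
        by-size (no p≰s) (yes p≤t) _ = ≤-trans (at-most-one e (above-root p e pr (≰⇒> p≰s) le)) (≤-trans (≤-reflexive (sym (trans (choose-yes (p ≤? t) p≤t) (pp-yes pr))))
            (≤-trans (m≤m*n (w₂ p) (w₃ p) {{>-nonZero (1≤w₃ p)}}) (m≤n*m (w₂ p * w₃ p) (w₁ p) {{>-nonZero (1≤w₁ p)}})))
          where
          at-most-one : ∀ e → e ≤ 1 → p ^ e ≤ p
          at-most-one zero _ = 1≤p
          at-most-one (suc zero) _ = ≤-reflexive (*-identityʳ p)
          at-most-one (suc (suc _)) (s≤s ())
        by-size (no p≰s) (no p≰t) (no n≮p) = vanish e div
          where
          N<3p : N < 3 * p
          N<3p = <-≤-trans (subst (_< 3 * suc t) (sym (m≡m%n+[m/n]*n N 3)) (<-≤-trans (+-monoˡ-< (t * 3) (m%n<n N 3)) (≤-reflexive (l t)))) (*-monoʳ-≤ 3 (≰⇒> p≰t))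
            where
            l : ∀ t → 3 + t * 3 ≡ 3 * suc t
            l = solve-∀
          2<p : 2 < p
          2<p = ≰⇒> λ p≤2 → <⇒≱ N<3p (≤-trans (*-monoʳ-≤ 3 p≤2) (+-mono-≤ 3≤n 3≤n))
          vanish : ∀ e → p ^ e ∣ central n → p ^ e ≤ w p
          vanish zero _ = 1≤w p
          vanish (suc e) div = ⊥-elim (∤central pr 2<p n (≮⇒≥ n≮p) N<3p (∣-trans (m∣m*n (p ^ e)) div))

      P : ℕ
      P = count (inUpperHalf? n) 1 N

      central≤ : central n ≤ N ^ s * (4 ^ t * N ^ P)
      central≤ = ≤-trans (strip w 1≤w N (N ∸ 1) 2 (central n) {{binom≢0 N n (m≤m+n n n)}} ≤-refl (cong suc (m+[n∸m]≡n 1≤N)) 2-rough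
          (λ p pr p∣ → subst (_≤ N) (*-identityʳ p) (power≤N p 1 pr (subst (_∣ central n) (sym (*-identityʳ p)) p∣))) power≤w)
        (≤-trans (≤-reflexive (trans (product-from-* w₁ (λ i → w₂ i * w₃ i) 2 (N ∸ 1)) (cong (product-from w₁ 2 (N ∸ 1) *_) (product-from-* w₂ w₃ 2 (N ∸ 1)))))
          (*-mono-≤ (≤-trans (small-product 2 (N ∸ 1)) (N^ (m∸n≤m s 1))) (*-mono-≤
            (≤-trans (m≤m*n (product-from w₂ 2 (N ∸ 1)) (primeProduct 0 (1 ⊓ t)) {{>-nonZero (1≤primeProduct (1 ⊓ t))}}) (≤-trans (middle-product 1 (N ∸ 1)) (primorial≤ t)))
            (≤-trans (m≤n*m (product-from w₃ 2 (N ∸ 1)) (w₃ 1) {{>-nonZero (1≤w₃ 1)}}) (≤-reflexive (trans (cong (product-from w₃ 1) (m+[n∸m]≡n 1≤N)) (large-product 1 N)))))))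
        where
        1≤primeProduct : ∀ k → 1 ≤ primeProduct 0 k
        1≤primeProduct zero = ≤-refl
        1≤primeProduct (suc k) = *-mono-≤ (1≤primeProduct k) (1≤pp (suc k))

      -- The base 2 logarithm of `4 ^ n ≤ N * central n`, with each `N` bounded by `2 ^ κ`.
      exponents : 2 * n ≤ κ * (1 + s + P) + 2 * t
      exponents = ≮⇒≥ λ lt → <⇒≱ (^-monoʳ-< 2 ≤-refl lt) (≤-trans (≤-reflexive (sym (^-*-assoc 2 2 n))) (≤-trans (4^n≤central n (≤-trans (s≤s z≤n) 3≤n))
        (≤-trans (*-monoʳ-≤ N central≤) (≤-trans (≤-reflexive (trans (l N (N ^ s) (4 ^ t) (N ^ P)) (cong (_* 4 ^ t) (trans (cong (N *_) (sym (^-distribˡ-+-* N s P))) refl))))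
          (≤-trans (*-mono-≤ (^-monoˡ-≤ (suc (s + P)) κ-large) (≤-reflexive (^-*-assoc 2 2 t)))
            (≤-reflexive (trans (cong (_* 2 ^ (2 * t)) (^-*-assoc 2 κ (suc (s + P)))) (sym (^-distribˡ-+-* 2 (κ * (1 + s + P)) (2 * t))))))))))
        where
        l : ∀ N a b c → N * (a * (b * c)) ≡ N * (a * c) * b
        l = solve-∀

    -- As `t ≤ 2n/3`, the term `2 t` absorbs two thirds of the exponent `2n`; the remaining third
    -- must come from the primes above `n` and the square root term.
    chebyshev : n + n ≤ 3 * (κ * (1 + s + count (inUpperHalf? n) 1 (n + n)))
    chebyshev = +-cancelʳ-≤ (2 * (n + n)) (n + n) _ (≤-trans (≤-reflexive (l n)) (≤-trans (*-monoʳ-≤ 3 exponents)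
      (≤-trans (≤-reflexive (l₂ (κ * (1 + s + P)) t)) (+-monoʳ-≤ (3 * (κ * (1 + s + P))) (*-monoʳ-≤ 2 (m/n*n≤m N 3))))))
      where
      l : ∀ n → n + n + 2 * (n + n) ≡ 3 * (2 * n)
      l = solve-∀
      l₂ : ∀ a t → 3 * (a + 2 * t) ≡ 3 * a + 2 * (t * 3)
      l₂ = solve-∀

-- Residues as integers in [0, q).

module Residues where

  open import Data.Nat as ℕ using (ℕ; zero; suc; _≤_; _<_; s≤s)
  import Data.Nat.Properties as ℕP
  open import Data.Integer using (ℤ; +_; 0ℤ; 1ℤ)
  import Data.Integer as ℤ
  open import Data.List using (List; upTo; applyUpTo; length)
  open import Data.List.Membership.Propositional using (_∈_)
  open import Data.List.Membership.Propositional.Properties using (∈-applyUpTo⁻)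
  open import Data.Product using (_×_; _,_; proj₁; proj₂)
  open import Function using (_∘_)
  open import Relation.Nullary using (Dec; yes; no)
  open import Relation.Binary.PropositionalEquality
  open Int using (_+_; _*_)
  open Sums
  open Field
  open PrimeField
  open Energy
  open Sieve using (range; ∈-range⁻; mult-upTo)

  ∈-upTo⁻ : ∀ {n x} → x ∈ upTo n → x < n
  ∈-upTo⁻ x∈ with ∈-applyUpTo⁻ (λ i → i) x∈
  ... | i , i<n , refl = i<n

  ∑-applyUpTo : ∀ (h : ℕ → ℕ) n (f : ℕ → ℤ) → ∑ (applyUpTo h n) f ≡ ∑ (upTo n) (f ∘ h)
  ∑-applyUpTo h zero f = refl
  ∑-applyUpTo h (suc n) f = cong (_+_ (f (h 0))) (trans (∑-applyUpTo (h ∘ suc) n f) (sym (∑-applyUpTo suc n (f ∘ h))))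

  ∑-range-extend : ∀ m n (f : ℕ → ℤ) → m ≤ n → (∀ x → m < x → f x ≡ 0ℤ) → ∑ (range n) f ≡ ∑ (range m) f
  ∑-range-extend zero n f _ out = trans (∑-cong-∈ (range n) (λ x x∈ → out x (proj₁ (∈-range⁻ x∈)))) (∑-0 (range n))
  ∑-range-extend (suc m) (suc n) f (s≤s m≤n) out = cong (_+_ (f 1)) (trans (∑-applyUpTo (suc ∘ suc) n f)
    (trans (sym (∑-applyUpTo suc n (f ∘ suc))) (trans (∑-range-extend m n (f ∘ suc) m≤n (λ x m<x → out (suc x) (s≤s m<x)))
      (trans (∑-applyUpTo suc m (f ∘ suc)) (sym (∑-applyUpTo (suc ∘ suc) m f))))))

  ∑-upTo-suc : ∀ n (f : ℕ → ℤ) → f 0 ≡ 0ℤ → ∑ (upTo (suc n)) f ≡ ∑ (range n) f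
  ∑-upTo-suc n f f0 = trans (cong (_+ ∑ (range n) f) f0) (Int.+-identityˡ _)

  module ℕMult = Multiplicity ℕP._≟_

  interval-count : ∀ (xs : List ℕ) → ℕMult.Simple xs → {Q : ℕ → Set} (Q? : ∀ x → Dec (Q x)) → ∀ a l → (∀ x → x ∈ xs → Q x → a ≤ x × x < a ℕ.+ l) → ∑ xs (λ x → 𝟙 (Q? x)) ℤ.≤ + l
  interval-count xs simple Q? a l inside = Int.≤-trans (∑-mono-∈ xs at) (Int.≤-trans (Int.≤-reflexive (∑-swap xs (upTo l) _))
    (Int.≤-trans (∑-≤-const (upTo l) 1ℤ (λ i _ → simple (a ℕ.+ i))) (Int.≤-reflexive (trans (Int.*-identityʳ _) (cong +_ length-upTo′)))))
    where
    length-upTo′ : length (upTo l) ≡ l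
    length-upTo′ = Data.List.Properties.length-upTo l
      where import Data.List.Properties
    at : ∀ x → x ∈ xs → 𝟙 (Q? x) ℤ.≤ ∑ (upTo l) (λ i → 𝟙 (x ℕP.≟ a ℕ.+ i))
    at x x∈ = go (Q? x)
      where
      go : (d : Dec _) → 𝟙 d ℤ.≤ ∑ (upTo l) (λ i → 𝟙 (x ℕP.≟ a ℕ.+ i))
      go (no _) = ∑-nonneg (upTo l) (λ i → 0≤𝟙 (x ℕP.≟ a ℕ.+ i))
      go (yes Qx) = Int.≤-reflexive (sym (trans (∑-cong (upTo l) (λ i → 𝟙-cong (x ℕP.≟ a ℕ.+ i) (i ℕP.≟ (x ℕ.∸ a)) (λ e → sym (trans (cong (ℕ._∸ a) e) (ℕP.m+n∸m≡n a i))) (λ e → sym (trans (cong (a ℕ.+_) e) (ℕP.m+[n∸m]≡n a≤x)))))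
        (mult-upTo l (x ℕ.∸ a) (ℕP.+-cancelˡ-< a _ _ (subst (_< a ℕ.+ l) (sym (ℕP.m+[n∸m]≡n a≤x)) (proj₂ (inside x x∈ Qx)))))))
        where
        a≤x : a ≤ x
        a≤x = proj₁ (inside x x∈ Qx)

  upTo-simple : ∀ n → ℕMult.Simple (upTo n)
  upTo-simple n x = go (x ℕP.<? n)
    where
    go : Dec (x < n) → ℕMult.mult (upTo n) x ℤ.≤ 1ℤ
    go (yes x<n) = Int.≤-reflexive (mult-upTo n x x<n)
    go (no x≮n) = subst (ℤ._≤ 1ℤ) (sym (ℕMult.mult-∉ (upTo n) x (λ y y∈ eq → x≮n (subst (_< n) eq (∈-upTo⁻ y∈))))) Int.0≤+ₙ

  module Residues {q : ℕ} (𝔽 : ResidueField q) where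
    open ResidueField 𝔽
    open FieldTheory field′ hiding (q)
    open EnergyBound 𝔽 using (↑; ↑-+; ↑-inj)

    rep : F → ℕ
    rep t = proj₁ (ι-surj t)

    rep<q : ∀ t → rep t < q
    rep<q t = proj₁ (proj₂ (ι-surj t))

    ↑-rep : ∀ t → ↑ (rep t) ≡ t
    ↑-rep t = sym (proj₂ (proj₂ (ι-surj t)))

    rep-↑ : ∀ x → x < q → rep (↑ x) ≡ x
    rep-↑ x x<q = ↑-inj (rep (↑ x)) x (rep<q (↑ x)) x<q (↑-rep (↑ x))

    ∑F-upTo : ∀ (f : F → ℤ) → ∑F f ≡ ∑ (upTo q) (λ x → f (↑ x))
    ∑F-upTo f = trans (∑-cong elems (λ t → trans (sym (Int.*-identityˡ _)) (trans (cong (λ s → 1ℤ * f s) (sym (↑-rep t))) refl)))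
      (trans (ℕMult.∑-fibre elems (λ _ → 1ℤ) rep (upTo q) (λ x → f (↑ x)) (λ t _ → trans (Int.*-identityˡ _) (mult-upTo q (rep t) (rep<q t))))
        (∑-cong-∈ (upTo q) (λ x x∈ → trans (cong (f (↑ x) *_) (trans (∑-cong elems (λ t → trans (Int.*-identityˡ _) (𝟙-cong (x ℕP.≟ rep t) (t ≟ ↑ x)
            (λ e → trans (sym (↑-rep t)) (cong ↑ (sym e))) (λ e → sym (trans (cong rep e) (rep-↑ x (∈-upTo⁻ x∈))))))) (enum (↑ x)))) (Int.*-identityʳ _))))

    indicator : {Q : ℕ → Set} → (∀ x → Dec (Q x)) → F → ℤ
    indicator Q? t = 𝟙 (Q? (rep t))

    indicator-idem : ∀ {Q : ℕ → Set} (Q? : ∀ x → Dec (Q x)) t → indicator Q? t * indicator Q? t ≡ indicator Q? t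
    indicator-idem Q? t = 𝟙-sq (Q? (rep t))

    indicator-↑ : ∀ {Q : ℕ → Set} (Q? : ∀ x → Dec (Q x)) x → x < q → indicator Q? (↑ x) ≡ 𝟙 (Q? x)
    indicator-↑ Q? x x<q = cong (λ y → 𝟙 (Q? y)) (rep-↑ x x<q)

    ∑-indicator : ∀ {Q : ℕ → Set} (Q? : ∀ x → Dec (Q x)) (f : F → ℤ) → ∑F (λ t → indicator Q? t * f t) ≡ ∑ (upTo q) (λ x → 𝟙 (Q? x) * f (↑ x))
    ∑-indicator Q? f = trans (∑F-upTo _) (∑-cong-∈ (upTo q) (λ x x∈ → cong (_* f (↑ x)) (indicator-↑ Q? x (∈-upTo⁻ x∈))))

    ↑-∸ : ∀ m k → k ≤ m → ↑ m ⊖ ↑ k ≡ ↑ (m ℕ.∸ k)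
    ↑-∸ m k k≤m = trans (cong (_⊖ ↑ k) (trans (cong ↑ (sym (ℕP.m∸n+n≡m k≤m))) (↑-+ (m ℕ.∸ k) k))) (a⊕b⊖b _ _)

    ↑q : ↑ q ≡ 𝟎
    ↑q = trans (ι-∣⇒≡ (+ q) 0ℤ (subst (+ q ∣_) (sym (ℤP.+-identityʳ (+ q))) ℕ∣.∣-refl)) ι-0
      where
      open import Data.Integer.Divisibility using (_∣_)
      import Data.Integer.Properties as ℤP
      import Data.Nat.Divisibility as ℕ∣

    rep-⊖ : ∀ m k → m < q → k ≤ m → rep (↑ m ⊖ ↑ k) ≡ m ℕ.∸ k
    rep-⊖ m k m<q k≤m = trans (cong rep (↑-∸ m k k≤m)) (rep-↑ (m ℕ.∸ k) (ℕP.≤-<-trans (ℕP.m∸n≤m m k) m<q))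

    rep-⊖-wrap : ∀ m k → m < k → k < q → rep (↑ m ⊖ ↑ k) ≡ m ℕ.+ q ℕ.∸ k
    rep-⊖-wrap m k m<k k<q = trans (cong rep (trans (cong (_⊖ ↑ k) (sym (trans (↑-+ m q) (trans (cong (↑ m ⊕_) ↑q) (⊕-identityʳ _))))) (↑-∸ (m ℕ.+ q) k (ℕP.≤-trans (ℕP.<⇒≤ k<q) (ℕP.m≤n+m q m)))))
      (rep-↑ (m ℕ.+ q ℕ.∸ k) (ℕP.+-cancelʳ-< k _ _ (subst (_< q ℕ.+ k) (sym (ℕP.m∸n+n≡m (ℕP.≤-trans (ℕP.<⇒≤ k<q) (ℕP.m≤n+m q m)))) (subst (m ℕ.+ q <_) (ℕP.+-comm k q) (ℕP.+-monoˡ-< q m<k)))))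

-- The smoothed weight and its splitting into progressions.

module Weights where

  open import Data.Nat as ℕ using (ℕ; suc; _≤_; _<_; s≤s; z≤n; NonZero)
  import Data.Nat.Properties as ℕP
  import Data.Nat.DivMod as ℕD
  open import Data.Nat.Primality
  open import Data.Nat.Tactic.RingSolver using () renaming (solve-∀ to solve-∀ℕ)
  open import Data.Integer using (ℤ; +_; 0ℤ; 1ℤ)
  import Data.Integer as ℤ
  open import Data.Integer.Tactic.RingSolver using (solve-∀)
  open import Data.List using (upTo; length)
  open import Data.List.Membership.Propositional using (_∈_)
  open import Data.Product using (_×_; _,_)
  open import Relation.Nullary using (Dec; yes; no; ¬_)
  open import Relation.Nullary.Decidable using (_×-dec_)
  open import Relation.Binary.PropositionalEquality
  open Int using (_+_; _*_; -_; _-_; arith)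
  open Sums
  open Field
  open Correlation using (module Correlations)
  open TypeI using (module TypeISums)
  open PrimeField
  open Energy
  open Sieve
  open Chebyshev using (InUpperHalf; inUpperHalf?)
  open Residues

  -- Every index is `a + d * k` with a unique remainder `a < d`; values of `k` that overshoot `q`
  -- meet only zeros of `G`.
  ∑-divide : ∀ q d .{{_ : NonZero d}} (G : ℕ → ℤ) → (∀ k → q ≤ k → G k ≡ 0ℤ) →
    ∑ (upTo q) G ≡ ∑ (upTo d) (λ a → ∑ (upTo q) (λ k → G (a ℕ.+ d ℕ.* k)))
  ∑-divide q d G out = sym (trans (∑-cong (upTo d) (λ a → trans (∑-cong (upTo q) (λ k → spread (a ℕ.+ d ℕ.* k))) (∑-swap (upTo q) (upTo q) _)))
    (trans (∑-swap (upTo d) (upTo q) _) (∑-cong-∈ (upTo q) collect)))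
    where
    spread : ∀ x → G x ≡ ∑ (upTo q) (λ κ → 𝟙 (κ ℕP.≟ x) * G κ)
    spread x = go (x ℕP.<? q)
      where
      go : Dec (x < q) → G x ≡ ∑ (upTo q) (λ κ → 𝟙 (κ ℕP.≟ x) * G κ)
      go (yes x<q) = sym (trans (ℕMult.∑-δ (upTo q) x G) (trans (cong (_* G x) (mult-upTo q x x<q)) (Int.*-identityˡ _)))
      go (no x≮q) = trans (out x (ℕP.≮⇒≥ x≮q)) (sym (trans (ℕMult.∑-δ (upTo q) x G) (trans (cong (ℕMult.mult (upTo q) x *_) (out x (ℕP.≮⇒≥ x≮q))) (Int.*-zeroʳ _))))
    collect : ∀ κ → κ ∈ upTo q → ∑ (upTo d) (λ a → ∑ (upTo q) (λ k → 𝟙 (κ ℕP.≟ a ℕ.+ d ℕ.* k) * G κ)) ≡ G κ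
    collect κ κ∈ = trans (∑-cong-∈ (upTo d) (λ a a∈ → trans (∑-cong (upTo q) (λ k → cong (_* G κ) (split a (∈-upTo⁻ a∈) k)))
        (∑-*ʳ (upTo q) (G κ) _))) (trans (∑-*ʳ (upTo d) (G κ) _) (trans (cong (_* G κ) one) (Int.*-identityˡ _)))
      where
      split : ∀ a → a < d → ∀ k → 𝟙 (κ ℕP.≟ a ℕ.+ d ℕ.* k) ≡ 𝟙 (a ℕP.≟ κ ℕ.% d) * 𝟙 (k ℕP.≟ κ ℕ./ d)
      split a a<d k = 𝟙-× (κ ℕP.≟ a ℕ.+ d ℕ.* k) (a ℕP.≟ κ ℕ.% d) (k ℕP.≟ κ ℕ./ d)
        (λ { refl → sym (trans (cong (λ t → (a ℕ.+ t) ℕ.% d) (ℕP.*-comm d k)) (trans (ℕD.[m+kn]%n≡m%n a k d) (ℕD.m<n⇒m%n≡m a<d))) ,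
               sym (trans (cong (λ t → (a ℕ.+ t) ℕ./ d) (ℕP.*-comm d k)) (trans (ℕD.+-distrib-/-∣ʳ a (Data.Nat.Divisibility.n∣m*n k)) (cong₂ ℕ._+_ (ℕD.m<n⇒m/n≡0 a<d) (ℕD.m*n/n≡m k d)))) })
        (λ { refl refl → trans (ℕD.m≡m%n+[m/n]*n κ d) (cong (κ ℕ.% d ℕ.+_) (ℕP.*-comm (κ ℕ./ d) d)) })
        where import Data.Nat.Divisibility
      one : ∑ (upTo d) (λ a → ∑ (upTo q) (λ k → 𝟙 (a ℕP.≟ κ ℕ.% d) * 𝟙 (k ℕP.≟ κ ℕ./ d))) ≡ 1ℤ
      one = trans (sym (∑-* (upTo d) (upTo q) _ _)) (trans (cong₂ _*_ (mult-upTo d (κ ℕ.% d) (ℕD.m%n<n κ d)) (mult-upTo q (κ ℕ./ d) (ℕP.≤-<-trans (ℕD.m/n≤m κ d) (∈-upTo⁻ κ∈)))) (Int.*-identityˡ 1ℤ))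

  module Setup {q : ℕ} (𝔽 : ResidueField q) (N h : ℕ) (2N<q : N ℕ.+ N < q) (h≤N : h ≤ N) (1≤N : 1 ≤ N)
    (c : FiniteField.F (ResidueField.field′ 𝔽)) (c≢0 : c ≢ FiniteField.𝟎 (ResidueField.field′ 𝔽)) where
    open ResidueField 𝔽
    open FieldTheory field′ hiding (q)
    open EnergyBound 𝔽 using (↑; ↑≢0; ↑-*)
    open Residues.Residues 𝔽
    open Correlations field′
    open TypeISums field′

    X : ℕ
    X = N ℕ.+ N

    -- The interval (N + k, 2N - h + k], written without subtraction; for `k < h` it stays inside
    -- (N, 2N].
    Window : ℕ → ℕ → Set
    Window k x = N ℕ.+ k < x × x ℕ.+ h ≤ X ℕ.+ k

    window? : ∀ k x → Dec (Window k x)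
    window? k x = (N ℕ.+ k ℕP.<? x) ×-dec (x ℕ.+ h ℕP.≤? X ℕ.+ k)

    PrimeHere : ℕ → Set
    PrimeHere x = InUpperHalf N x × x ≤ X

    primeHere? : ∀ x → Dec (PrimeHere x)
    primeHere? x = inUpperHalf? N x ×-dec (x ℕP.≤? X)

    start? : ∀ a d k → Dec (a ℕ.+ d ℕ.* k < h)
    start? a d k = a ℕ.+ d ℕ.* k ℕP.<? h

    -- At the multiples `d y` a translation is written `a + d k`, and `d (y - k)` is compared with
    -- the window shifted by `a`; so the variables become `k` and `y - k`. The case `a = 0`, `d = 1`
    -- is the original smoothing.
    χ₁ χ₂ : ℕ → ℕ → F → ℤ
    χ₁ a d = indicator (start? a d)
    χ₂ a d = indicator (λ j → window? a (d ℕ.* j))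

    χₐ : F → ℤ
    χₐ = indicator primeHere?

    size′ P : ℤ
    size′ = + length elems
    P = ∑F χₐ

    R : F → ℤ
    R t = size′ * χₐ t - P

    mean : ∑F R ≡ 0ℤ
    mean = trans (∑-- elems _ _) (trans (cong₂ _-_ (∑-*ˡ elems size′ χₐ) (∑F-const P)) (Int.a-a _))

    -- The exact value is `q² P - q P²`.
    norm²R : norm² R ℤ.≤ size′ * size′ * P
    norm²R = Int.≤-trans (Int.≤-reflexive (trans (norm²-def R) (trans (∑-cong elems expand) (trans (∑-+ elems _ _) (trans (cong₂ _+_ (∑-*ˡ elems _ χₐ) (∑F-const (P * P))) (collect size′ P))))))
      (Int.≤-by (Int.0≤* Int.0≤+ₙ (Int.0≤sq P)) (drop size′ P))
      where
      opaque
        unfolding arith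
        e₁ : ∀ q χ P → (q * χ - P) * (q * χ - P) ≡ q * q * (χ * χ) + - (q * P + q * P) * χ + P * P
        e₁ = solve-∀
        e₂ : ∀ q χ P → q * q * χ + - (q * P + q * P) * χ + P * P ≡ (q * q - (q * P + q * P)) * χ + P * P
        e₂ = solve-∀
        collect : ∀ q P → (q * q - (q * P + q * P)) * P + q * (P * P) ≡ q * q * P - q * (P * P)
        collect = solve-∀
        drop : ∀ q P → q * q * P - (q * q * P - q * (P * P)) ≡ q * (P * P)
        drop = solve-∀
      expand : ∀ t → R t * R t ≡ (size′ * size′ - (size′ * P + size′ * P)) * χₐ t + P * P
      expand t = trans (e₁ size′ (χₐ t) P) (trans (cong (λ s → size′ * size′ * s + - (size′ * P + size′ * P) * χₐ t + P * P) (indicator-idem primeHere? t)) (e₂ size′ (χₐ t) P))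

    weight : F → ℤ
    weight z = ∑F (λ k → ∑F (λ t → χ₁ 0 1 k * χₐ t * (χ₂ 0 1 (z ⊖ k) * R (c ⊗ z ⁻¹ ⊖ z ⊖ t))))

    V : F → ℤ
    V z = ∑F (λ t → χₐ t * R (c ⊗ z ⁻¹ ⊖ z ⊖ t))

    Ω : ℕ → ℤ
    Ω x = ∑ (upTo q) (λ k → 𝟙 (k ℕP.<? h) * 𝟙 (window? k x))

    h<q : h < q
    h<q = ℕP.≤-<-trans (ℕP.≤-trans h≤N (ℕP.m≤m+n N N)) 2N<q

    -- The point is the wrap-around modulo `q`. If `k > y`, the residue of `y - k` is represented by
    -- `y + q - k`, too large for the window because `a + k < h` and `2N < q`; on the right `d y` is
    -- below `d k`, hence too small.
    window-shift : ∀ a d .{{_ : NonZero d}} y k → y < q → a ℕ.+ d ℕ.* k < h → χ₂ a d (↑ y ⊖ ↑ k) ≡ 𝟙 (window? (a ℕ.+ d ℕ.* k) (d ℕ.* y))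
    window-shift a d y k y<q start = go (k ℕP.≤? y)
      where
      k≤dk : k ≤ d ℕ.* k
      k≤dk = ℕP.m≤n*m k d
      k<q : k < q
      k<q = ℕP.≤-<-trans k≤dk (ℕP.≤-<-trans (ℕP.m≤n+m (d ℕ.* k) a) (ℕP.<-trans start h<q))
      go : Dec (k ≤ y) → χ₂ a d (↑ y ⊖ ↑ k) ≡ 𝟙 (window? (a ℕ.+ d ℕ.* k) (d ℕ.* y))
      go (yes k≤y) = trans (cong (λ j → 𝟙 (window? a (d ℕ.* j))) (rep-⊖ y k y<q k≤y)) (𝟙-cong (window? a (d ℕ.* (y ℕ.∸ k))) (window? (a ℕ.+ d ℕ.* k) (d ℕ.* y))
          (λ (p , r) → subst₂ _<_ (l₁ N a (d ℕ.* k)) sum≡ (ℕP.+-monoˡ-< (d ℕ.* k) p) , subst₂ _≤_ (trans (l₂ (d ℕ.* (y ℕ.∸ k)) h (d ℕ.* k)) (cong (ℕ._+ h) sum≡)) (l₁ X a (d ℕ.* k)) (ℕP.+-monoˡ-≤ (d ℕ.* k) r))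
          (λ (p , r) → ℕP.+-cancelʳ-< (d ℕ.* k) _ _ (subst₂ _<_ (sym (l₁ N a (d ℕ.* k))) (sym sum≡) p) ,
            ℕP.+-cancelʳ-≤ (d ℕ.* k) _ _ (subst₂ _≤_ (sym (trans (l₂ (d ℕ.* (y ℕ.∸ k)) h (d ℕ.* k)) (cong (ℕ._+ h) sum≡))) (sym (l₁ X a (d ℕ.* k))) r)))
        where
        sum≡ : d ℕ.* (y ℕ.∸ k) ℕ.+ d ℕ.* k ≡ d ℕ.* y
        sum≡ = trans (sym (ℕP.*-distribˡ-+ d (y ℕ.∸ k) k)) (cong (d ℕ.*_) (ℕP.m∸n+n≡m k≤y))
        l₁ : ∀ N a k → N ℕ.+ a ℕ.+ k ≡ N ℕ.+ (a ℕ.+ k)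
        l₁ = ℕP.+-assoc
        l₂ : ∀ a h k → a ℕ.+ h ℕ.+ k ≡ a ℕ.+ k ℕ.+ h
        l₂ = solve-∀ℕ
      go (no k≰y) = trans (cong (λ j → 𝟙 (window? a (d ℕ.* j))) (rep-⊖-wrap y k (ℕP.≰⇒> k≰y) k<q)) (trans (𝟙-no (window? a (d ℕ.* w)) too-large)
          (sym (𝟙-no (window? (a ℕ.+ d ℕ.* k) (d ℕ.* y)) too-small)))
        where
        w : ℕ
        w = y ℕ.+ q ℕ.∸ k
        w+k : w ℕ.+ k ≡ y ℕ.+ q
        w+k = ℕP.m∸n+n≡m (ℕP.≤-trans (ℕP.<⇒≤ k<q) (ℕP.m≤n+m q y))
        too-large : ¬ Window a (d ℕ.* w)
        too-large (_ , r) = ℕP.<⇒≱ 2N<q (ℕP.+-cancelʳ-≤ a q X (ℕP.≤-trans (ℕP.+-monoˡ-≤ a (ℕP.≤-trans (ℕP.m≤n+m q y) (ℕP.≤-reflexive (sym w+k))))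
          (ℕP.≤-trans (ℕP.≤-reflexive (l w k a)) (ℕP.≤-trans (ℕP.+-mono-≤ (ℕP.m≤n*m w d) (ℕP.≤-trans (ℕP.+-monoʳ-≤ a k≤dk) (ℕP.<⇒≤ start))) r))))
          where
          l : ∀ w k a → w ℕ.+ k ℕ.+ a ≡ w ℕ.+ (a ℕ.+ k)
          l = solve-∀ℕ
        too-small : ¬ Window (a ℕ.+ d ℕ.* k) (d ℕ.* y)
        too-small (p , _) = ℕP.<⇒≱ p (ℕP.≤-trans (ℕP.*-monoʳ-≤ d (ℕP.<⇒≤ (ℕP.≰⇒> k≰y))) (ℕP.≤-trans (ℕP.m≤n+m (d ℕ.* k) a) (ℕP.m≤n+m (a ℕ.+ d ℕ.* k) N)))

    windowed : ∀ a d .{{_ : NonZero d}} y → y < q → ∀ k → 𝟙 (start? a d k) * χ₂ a d (↑ y ⊖ ↑ k) ≡ 𝟙 (start? a d k) * 𝟙 (window? (a ℕ.+ d ℕ.* k) (d ℕ.* y))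
    windowed a d y y<q k = go (start? a d k)
      where
      go : (s : Dec (a ℕ.+ d ℕ.* k < h)) → 𝟙 s * χ₂ a d (↑ y ⊖ ↑ k) ≡ 𝟙 s * 𝟙 (window? (a ℕ.+ d ℕ.* k) (d ℕ.* y))
      go (yes s) = cong (1ℤ *_) (window-shift a d y k y<q s)
      go (no _) = trans (Int.*-zeroˡ _) (sym (Int.*-zeroˡ _))

    weight-↑ : ∀ x → x < q → weight (↑ x) ≡ Ω x * V (↑ x)
    weight-↑ x x<q = trans (∑-cong elems (λ k → ∑-cong elems (λ t → l (χ₁ 0 1 k) (χₐ t) (χ₂ 0 1 (↑ x ⊖ k)) (R (c ⊗ ↑ x ⁻¹ ⊖ ↑ x ⊖ t)))))
      (trans (sym (∑-* elems elems _ _)) (cong (_* V (↑ x)) (trans (∑-indicator (start? 0 1) (λ k → χ₂ 0 1 (↑ x ⊖ k)))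
        (∑-cong (upTo q) (λ k → trans (windowed 0 1 x x<q k) (cong₂ (λ s t → 𝟙 (s ℕP.<? h) * 𝟙 (window? s t)) (ℕP.+-identityʳ k) (ℕP.+-identityʳ x)))))))
      where
      opaque
        unfolding arith
        l : ∀ a b c d → a * b * (c * d) ≡ (a * c) * (b * d)
        l = solve-∀

    -- Cut off to [1, 2N], since the residue of a larger product `d * y` may fall into the window by
    -- accident.
    Wx : ℕ → ℤ
    Wx x = 𝟙 ((1 ℕP.≤? x) ×-dec (x ℕP.≤? X)) * weight (↑ x)

    Wx-0 : ∀ x → ¬ (1 ≤ x × x ≤ X) → Wx x ≡ 0ℤ
    Wx-0 x out = trans (cong (_* weight (↑ x)) (𝟙-no ((1 ℕP.≤? x) ×-dec (x ℕP.≤? X)) out)) (Int.*-zeroˡ _)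

    window⇒ : ∀ {k x} → k < h → Window k x → 1 ≤ x × x ≤ X
    window⇒ {k} {x} k<h (p , r) = ℕP.≤-trans (s≤s z≤n) p , ℕP.+-cancelʳ-≤ h x X (ℕP.≤-trans r (ℕP.+-monoʳ-≤ X (ℕP.<⇒≤ k<h)))

    Ω-out : ∀ x → ¬ (1 ≤ x × x ≤ X) → Ω x ≡ 0ℤ
    Ω-out x out = ∑-zero (upTo q) (λ k → trans (sym (𝟙-× ((k ℕP.<? h) ×-dec window? k x) (k ℕP.<? h) (window? k x) (λ p → p) _,_))
      (𝟙-no ((k ℕP.<? h) ×-dec window? k x) (λ (k<h , w) → out (window⇒ k<h w))))

    Wx-ΩV : ∀ x → Wx x ≡ Ω x * V (↑ x)
    Wx-ΩV x = go ((1 ℕP.≤? x) ×-dec (x ℕP.≤? X))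
      where
      go : Dec (1 ≤ x × x ≤ X) → Wx x ≡ Ω x * V (↑ x)
      go (yes (a , b)) = trans (cong (_* weight (↑ x)) (𝟙-yes ((1 ℕP.≤? x) ×-dec (x ℕP.≤? X)) (a , b))) (trans (Int.*-identityˡ _) (weight-↑ x (ℕP.≤-<-trans b 2N<q)))
      go (no out) = trans (Wx-0 x out) (sym (trans (cong (_* V (↑ x)) (Ω-out x out)) (Int.*-zeroˡ _)))

    module _ (d : ℕ) .{{_ : NonZero d}} (d<q : d < q) where
      private
        ↑d≢0 : ↑ d ≢ 𝟎
        ↑d≢0 = ↑≢0 d (ℕ.>-nonZero⁻¹ d) d<q

        c′ : F
        c′ = c ⊗ ↑ d ⁻¹

      c′≢0 : c ⊗ ↑ d ⁻¹ ≢ 𝟎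
      c′≢0 = ⊗-≢0 c≢0 (⁻¹-≢0 ↑d≢0)

      progression-sum : ℕ → ℤ
      progression-sum a = hyperbolaSum (χ₁ a d) χₐ (χ₂ a d) R mean (indicator-idem (start? a d)) (indicator-idem primeHere?) (indicator-idem (λ j → window? a (d ℕ.* j))) (c ⊗ ↑ d ⁻¹) (↑ d) c′≢0

      private
        D : ℕ → ℕ → ℕ → ℤ
        D a k l = 𝟙 (start? a d k) * 𝟙 (window? (a ℕ.+ d ℕ.* k) (d ℕ.* l)) * V (↑ (d ℕ.* l))

        V′ : F → ℤ
        V′ l = ∑F (λ t → χₐ t * R (c′ ⊗ l ⁻¹ ⊖ ↑ d ⊗ l ⊖ t))

        V′≡V : ∀ l → ↑ l ≢ 𝟎 → V′ (↑ l) ≡ V (↑ (d ℕ.* l))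
        V′≡V l l≢0 = ∑-cong elems (λ t → cong (λ s → χₐ t * R (s ⊖ t)) (cong₂ _⊖_ (trans (⊗-assoc c (↑ d ⁻¹) (↑ l ⁻¹)) (cong (c ⊗_) (trans (sym (⁻¹-⊗ ↑d≢0 l≢0)) (cong _⁻¹ (sym (↑-* d l)))))) (sym (↑-* d l))))

        inner : ∀ a k l → l < q → 𝟙 (start? a d k) * (nz (↑ l) * (χ₂ a d (↑ l ⊖ ↑ k) * V′ (↑ l))) ≡ D a k l
        inner a k l l<q = trans (e (𝟙 (start? a d k)) (nz (↑ l)) (χ₂ a d (↑ l ⊖ ↑ k)) (V′ (↑ l))) (trans (cong (_* (nz (↑ l) * V′ (↑ l))) (windowed a d l l<q k)) (go (window? (a ℕ.+ d ℕ.* k) (d ℕ.* l))))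
          where
          opaque
            unfolding arith
            e : ∀ s n x v → s * (n * (x * v)) ≡ s * x * (n * v)
            e = solve-∀
          go : (w : Dec (Window (a ℕ.+ d ℕ.* k) (d ℕ.* l))) → 𝟙 (start? a d k) * 𝟙 w * (nz (↑ l) * V′ (↑ l)) ≡ 𝟙 (start? a d k) * 𝟙 w * V (↑ (d ℕ.* l))
          go (no _) = trans (zero* _) (sym (zero* _))
            where
            zero* : ∀ v → 𝟙 (start? a d k) * 0ℤ * v ≡ 0ℤ
            zero* v = trans (cong (_* v) (Int.*-zeroʳ _)) (Int.*-zeroˡ v)
          go (yes (p , _)) = cong (𝟙 (start? a d k) * 1ℤ *_) (trans (cong (_* V′ (↑ l)) (nz-1 l≢0)) (trans (Int.*-identityˡ _) (V′≡V l l≢0)))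
            where
            l≢0 : ↑ l ≢ 𝟎
            l≢0 = ↑≢0 l (ℕP.n≢0⇒n>0 (λ { refl → ℕP.<⇒≱ p (ℕP.≤-trans (ℕP.≤-reflexive (ℕP.*-zeroʳ d)) z≤n) })) l<q

        progression-expand : ∀ a → progression-sum a ≡ ∑ (upTo q) (λ k → ∑ (upTo q) (λ l → D a k l))
        progression-expand a = trans (∑-cong elems (λ k → trans (∑-cong elems (λ t → trans (Int.*-assoc (χ₁ a d k) (χₐ t) _) (cong (χ₁ a d k *_) (trans (sym (∑-*ˡ elems (χₐ t) _)) refl))))
              (trans (∑-*ˡ elems (χ₁ a d k) _) (cong (χ₁ a d k *_) (trans (∑-swap elems elems _) (∑-cong elems (λ l → trans (∑-cong elems (λ t → e (χₐ t) (nz l) (χ₂ a d (l ⊖ k)) _)) (trans (∑-*ˡ elems (nz l * χ₂ a d (l ⊖ k)) _) (Int.*-assoc _ _ _)))))))))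
            (trans (∑-indicator (start? a d) _) (∑-cong (upTo q) (λ k → trans (sym (∑-*ˡ elems _ _)) (trans (∑F-upTo _) (∑-cong-∈ (upTo q) (λ l l∈ → inner a k l (∈-upTo⁻ l∈)))))))
          where
          opaque
            unfolding arith
            e : ∀ χ n x r → χ * (n * (x * r)) ≡ n * x * (χ * r)
            e = solve-∀

      -- The translations are sorted by their remainder `a` modulo `d`; each class is a hyperbola
      -- sum with `c / d` and `d` in place of `c` and 1.
      ∑Wx-progressions : ∑ (range X) (λ y → Wx (d ℕ.* y)) ≡ ∑ (upTo d) progression-sum
      ∑Wx-progressions = trans (∑-cong (range X) (λ y → trans (Wx-ΩV (d ℕ.* y)) (trans (sym (∑-*ʳ (upTo q) (V (↑ (d ℕ.* y))) _)) (∑-divide q d (G y) (G-out y)))))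
        (trans (∑-swap (range X) (upTo d) _) (∑-cong (upTo d) (λ a → sym (trans (progression-expand a) (trans (∑-cong (upTo q) (λ k → to-range a k)) (∑-swap (upTo q) (range X) _))))))
        where
        G : ℕ → ℕ → ℤ
        G y k = 𝟙 (k ℕP.<? h) * 𝟙 (window? k (d ℕ.* y)) * V (↑ (d ℕ.* y))
        G-out : ∀ y k → q ≤ k → G y k ≡ 0ℤ
        G-out y k q≤k = trans (cong (_* V (↑ (d ℕ.* y))) (trans (cong (_* 𝟙 (window? k (d ℕ.* y))) (𝟙-no (k ℕP.<? h) (λ k<h → ℕP.<⇒≱ (ℕP.<-trans k<h h<q) q≤k))) (Int.*-zeroˡ _))) (Int.*-zeroˡ _)
        to-range : ∀ a k → ∑ (upTo q) (λ l → D a k l) ≡ ∑ (range X) (λ l → D a k l)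
        to-range a k = go q 2N<q
          where
          D-out : ∀ l → ¬ (1 ≤ d ℕ.* l × d ℕ.* l ≤ X) → D a k l ≡ 0ℤ
          D-out l out = trans (cong (_* V (↑ (d ℕ.* l))) (trans (sym (𝟙-× (start? a d k ×-dec window? (a ℕ.+ d ℕ.* k) (d ℕ.* l)) (start? a d k) (window? (a ℕ.+ d ℕ.* k) (d ℕ.* l)) (λ p → p) _,_))
            (𝟙-no (start? a d k ×-dec window? (a ℕ.+ d ℕ.* k) (d ℕ.* l)) (λ (s , w) → out (window⇒ s w))))) (Int.*-zeroˡ _)
          go : ∀ q′ → X < q′ → ∑ (upTo q′) (λ l → D a k l) ≡ ∑ (range X) (λ l → D a k l)
          go (suc q′) (s≤s X≤q′) = trans (∑-upTo-suc q′ (D a k) (D-out 0 (λ (p , _) → ℕP.<⇒≱ p (ℕP.≤-reflexive (ℕP.*-zeroʳ d)))))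
            (∑-range-extend X q′ (D a k) X≤q′ (λ l X<l → D-out l (λ (_ , r) → ℕP.<⇒≱ X<l (ℕP.≤-trans (ℕP.m≤n*m l d) r))))

-- The main term in the absence of solutions.

module MainTerm where

  open import Data.Nat as ℕ using (ℕ; zero; suc; _≤_; _<_; s≤s; z≤n; NonZero)
  import Data.Nat.Properties as ℕP
  import Data.Nat.DivMod as ℕD
  open import Data.Nat.Primality
  open import Data.Nat.Tactic.RingSolver using () renaming (solve-∀ to solve-∀ℕ)
  open import Data.Integer using (ℤ; +_; 0ℤ; 1ℤ)
  import Data.Integer as ℤ
  open import Data.Integer.Tactic.RingSolver using (solve-∀)
  open import Data.List using (upTo; applyUpTo)
  open import Data.List.Properties using (length-upTo)
  open import Data.List.Membership.Propositional using (_∈_)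
  open import Data.Product using (_×_; _,_; proj₁; proj₂)
  open import Relation.Nullary using (Dec; yes; no; ¬_)
  open import Relation.Nullary.Decidable using (_×-dec_)
  open import Relation.Binary.PropositionalEquality
  open Int using (_+_; _*_; -_; _-_; arith)
  open Sums
  open Field
  open PrimeField
  open Energy
  open Sieve
  open Chebyshev using (inUpperHalf?; count)
  open Residues
  open Weights

  count-below : ∀ q h → h ≤ q → + h ℤ.≤ ∑ (upTo q) (λ k → 𝟙 (k ℕP.<? h))
  count-below q h h≤q = Int.≤-trans (Int.≤-reflexive (sym (trans (∑-const (upTo h) 1ℤ) (trans (Int.*-identityʳ _) (cong +_ (length-upTo h))))))
    (Int.≤-trans (Int.≤-reflexive (trans (∑-cong-∈ (upTo h) (λ i i∈ → sym (mult-upTo q i (ℕP.<-≤-trans (∈-upTo⁻ i∈) h≤q)))) (∑-swap (upTo h) (upTo q) _)))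
      (∑-mono (upTo q) (λ x → at x (x ℕP.<? h))))
    where
    at : ∀ x → (d : Dec (x < h)) → ∑ (upTo h) (λ i → 𝟙 (x ℕP.≟ i)) ℤ.≤ 𝟙 d
    at x (yes _) = Int.≤-trans (Int.≤-reflexive (∑-cong (upTo h) (λ i → 𝟙-cong (x ℕP.≟ i) (i ℕP.≟ x) sym sym))) (upTo-simple h x)
    at x (no x≮h) = Int.≤-reflexive (trans (∑-cong-∈ (upTo h) (λ i i∈ → 𝟙-no (x ℕP.≟ i) (λ { refl → x≮h (∈-upTo⁻ i∈) }))) (∑-0 (upTo h)))

  ∑-count : ∀ {Q : ℕ → Set} (Q? : ∀ i → Dec (Q i)) i j → ∑ (applyUpTo (i ℕ.+_) j) (λ x → 𝟙 (Q? x)) ≡ + count Q? i j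
  ∑-count Q? i zero = refl
  ∑-count Q? i (suc j) = trans (cong₂ _+_ (cong (λ x → 𝟙 (Q? x)) (ℕP.+-identityʳ i)) (trans (∑-applyUpTo (λ k → i ℕ.+ suc k) j _) (trans (∑-cong (upTo j) (λ k → cong (λ x → 𝟙 (Q? x)) (ℕP.+-suc i k)))
      (trans (sym (∑-applyUpTo (suc i ℕ.+_) j _)) (∑-count Q? (suc i) j))))) (head (Q? i) refl)
    where
    head : ∀ d → Q? i ≡ d → 𝟙 d + + count Q? (suc i) j ≡ + count Q? i (suc j)
    head (yes _) eq rewrite eq = sym (Int.pos-+ 1 _)
    head (no _) eq rewrite eq = Int.+-identityˡ _

  module MainTerms {q : ℕ} (𝔽 : ResidueField q) (N h : ℕ) (2N<q : N ℕ.+ N < q) (h≤N : h ≤ N) (1≤N : 1 ≤ N)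
    (c : FiniteField.F (ResidueField.field′ 𝔽)) (c≢0 : c ≢ FiniteField.𝟎 (ResidueField.field′ 𝔽)) where
    open ResidueField 𝔽
    open FieldTheory field′ hiding (q)
    open EnergyBound 𝔽 using (↑)
    open Residues.Residues 𝔽
    open Setup 𝔽 N h 2N<q h≤N 1≤N c c≢0

    P-range : P ≡ ∑ (range X) (λ y → 𝟙 (primeHere? y))
    P-range = trans (∑F-upTo χₐ) (trans (∑-cong-∈ (upTo q) (λ x x∈ → indicator-↑ primeHere? x (∈-upTo⁻ x∈))) (go q 2N<q))
      where
      go : ∀ q′ → X < q′ → ∑ (upTo q′) (λ y → 𝟙 (primeHere? y)) ≡ ∑ (range X) (λ y → 𝟙 (primeHere? y))
      go (suc q′) (s≤s X≤) = trans (∑-upTo-suc q′ _ (𝟙-no (primeHere? 0) (λ { ((() , _) , _) }))) (∑-range-extend X q′ _ X≤ (λ x X<x → 𝟙-no (primeHere? x) (λ (_ , x≤X) → ℕP.<⇒≱ X<x x≤X)))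

    P-count : P ≡ + count (inUpperHalf? N) 1 X
    P-count = trans P-range (trans (∑-cong-∈ (range X) (λ y y∈ → 𝟙-cong (primeHere? y) (inUpperHalf? N y) proj₁ (λ p → p , proj₂ (∈-range⁻ y∈)))) (∑-count (inUpperHalf? N) 1 X))

    0≤P : 0ℤ ℤ.≤ P
    0≤P = subst (0ℤ ℤ.≤_) (sym P-count) Int.0≤+ₙ

    ∑χ₁ : ∀ a d .{{_ : NonZero d}} → ∑F (χ₁ a d) ℤ.≤ + suc (h ℕ./ d)
    ∑χ₁ a d = Int.≤-trans (Int.≤-reflexive (trans (∑F-upTo _) (∑-cong-∈ (upTo q) (λ x x∈ → indicator-↑ (start? a d) x (∈-upTo⁻ x∈)))))
      (interval-count (upTo q) (upTo-simple q) (start? a d) 0 (suc (h ℕ./ d)) (λ x _ s → z≤n , s≤s (subst (_≤ h ℕ./ d) (ℕD.m*n/n≡m x d) (ℕD./-monoˡ-≤ d (ℕP.≤-trans (ℕP.≤-reflexive (ℕP.*-comm x d)) (ℕP.≤-trans (ℕP.m≤n+m (d ℕ.* x) a) (ℕP.<⇒≤ s)))))))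

    -- The window has length at most `N`; the 2 allows for rounding both its length and its starting
    -- point.
    ∑χ₂ : ∀ a d .{{_ : NonZero d}} → ∑F (χ₂ a d) ℤ.≤ + (N ℕ./ d ℕ.+ 2)
    ∑χ₂ a d = Int.≤-trans (Int.≤-reflexive (trans (∑F-upTo _) (∑-cong-∈ (upTo q) (λ x x∈ → indicator-↑ (λ j → window? a (d ℕ.* j)) x (∈-upTo⁻ x∈)))))
      (interval-count (upTo q) (upTo-simple q) (λ j → window? a (d ℕ.* j)) k₀ (N ℕ./ d ℕ.+ 2) inside)
      where
      k₀ : ℕ
      k₀ = (N ℕ.+ a) ℕ./ d
      inside : ∀ x → x ∈ upTo q → Window a (d ℕ.* x) → k₀ ≤ x × x < k₀ ℕ.+ (N ℕ./ d ℕ.+ 2)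
      inside x _ (p , r) = ℕP.≤-trans (ℕD./-monoˡ-≤ d (ℕP.<⇒≤ p)) (ℕP.≤-reflexive (trans (cong (ℕ._/ d) (ℕP.*-comm d x)) (ℕD.m*n/n≡m x d))) ,
        ℕP.*-cancelʳ-< d x _ (ℕP.≤-<-trans (ℕP.≤-trans (ℕP.≤-reflexive (ℕP.*-comm x d)) (ℕP.≤-trans (ℕP.m≤m+n (d ℕ.* x) h) (ℕP.≤-trans r (ℕP.≤-reflexive (ℕP.+-assoc N N a))))) bound)
        where
        below : ∀ m → m < suc (m ℕ./ d) ℕ.* d
        below m = subst (_< suc (m ℕ./ d) ℕ.* d) (sym (ℕD.m≡m%n+[m/n]*n m d)) (ℕP.+-monoˡ-< (m ℕ./ d ℕ.* d) (ℕD.m%n<n m d))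
        l : ∀ a b d → suc a ℕ.* d ℕ.+ suc b ℕ.* d ≡ (b ℕ.+ (a ℕ.+ 2)) ℕ.* d
        l = solve-∀ℕ
        bound : N ℕ.+ (N ℕ.+ a) < (k₀ ℕ.+ (N ℕ./ d ℕ.+ 2)) ℕ.* d
        bound = ℕP.<-≤-trans (ℕP.+-mono-< (below N) (below (N ℕ.+ a))) (ℕP.≤-reflexive (l (N ℕ./ d) k₀ d))

    module _ (Z : ℕ) (Z≤N : Z ≤ N) (q<Z² : q < suc Z ℕ.* suc Z)
      (none : ∀ y → PrimeHere y → ∀ t → χₐ t * χₐ (c ⊗ ↑ y ⁻¹ ⊖ ↑ y ⊖ t) ≡ 0ℤ) where

      Pω : ℤ
      Pω = ∑ (range X) (λ y → 𝟙 (rough? (suc Z) y) * Ω y)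

      -- Without solutions the product of the two prime indicators vanishes, so only the constant
      -- part `- P` of `R` contributes.
      V-none : ∀ y → PrimeHere y → V (↑ y) ≡ - (P * P)
      V-none y here = trans (∑-cong elems at) (trans (∑-neg elems _) (cong -_ (∑-*ʳ elems P χₐ)))
        where
        opaque
          unfolding arith
          e : ∀ a q b P → a * (q * b - P) ≡ q * (a * b) - a * P
          e = solve-∀
          e₀ : ∀ q x → q * 0ℤ - x ≡ - x
          e₀ = solve-∀
        at : ∀ t → χₐ t * R (c ⊗ ↑ y ⁻¹ ⊖ ↑ y ⊖ t) ≡ - (χₐ t * P)
        at t = trans (e (χₐ t) size′ _ P) (trans (cong (λ s → size′ * s - χₐ t * P) (none y here t)) (e₀ size′ (χₐ t * P)))

      rough⇒prime : ∀ y → N < y → y ≤ X → suc Z Rough y → Prime y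
      rough⇒prime y N<y y≤X r = rough∧square>⇒prime {{ℕ.n>1⇒nonTrivial (ℕP.≤-trans (s≤s 1≤N) N<y)}} r (ℕP.≤-<-trans y≤X (ℕP.<-trans 2N<q q<Z²))

      sifted-main : ∑ (range X) (λ y → 𝟙 (rough? (suc Z) y) * Wx (1 ℕ.* y)) ≡ - (P * P) * Pω
      sifted-main = trans (∑-cong-∈ (range X) (λ y y∈ → at y (proj₂ (∈-range⁻ y∈)) (rough? (suc Z) y) (N ℕP.<? y))) (∑-*ˡ (range X) (- (P * P)) _)
        where
        opaque
          unfolding arith
          e : ∀ r o v → r * (o * v) ≡ v * (r * o)
          e = solve-∀
        Ω-small : ∀ y → ¬ (N < y) → Ω y ≡ 0ℤ
        Ω-small y N≮y = ∑-zero (upTo q) (λ k → trans (cong (𝟙 (k ℕP.<? h) *_) (𝟙-no (window? k y) (λ (p , _) → N≮y (ℕP.≤-<-trans (ℕP.m≤m+n N k) p)))) (Int.*-zeroʳ _))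
        at : ∀ y → y ≤ X → (r : Dec (suc Z Rough y)) → Dec (N < y) → 𝟙 r * Wx (1 ℕ.* y) ≡ - (P * P) * (𝟙 r * Ω y)
        at y y≤X (no _) _ = trans (Int.*-zeroˡ _) (sym (trans (cong (- (P * P) *_) (Int.*-zeroˡ _)) (Int.*-zeroʳ _)))
        at y y≤X (yes r) (yes N<y) = trans (cong (1ℤ *_) (trans (cong Wx (ℕP.*-identityˡ y)) (trans (Wx-ΩV y) (cong (Ω y *_) (V-none y ((N<y , rough⇒prime y N<y y≤X r) , y≤X)))))) (e 1ℤ (Ω y) (- (P * P)))
        at y y≤X (yes r) (no N≮y) = trans (cong (1ℤ *_) (trans (cong Wx (ℕP.*-identityˡ y)) (trans (Wx-ΩV y) (trans (cong (_* V (↑ y)) (Ω-small y N≮y)) (Int.*-zeroˡ _)))))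
          (trans (Int.*-zeroʳ 1ℤ) (sym (trans (cong (λ s → - (P * P) * (1ℤ * s)) (Ω-small y N≮y)) (trans (cong (- (P * P) *_) (Int.*-zeroʳ 1ℤ)) (Int.*-zeroʳ _)))))

      -- Each of the `h` windows misses at most `h` primes: at most `k` in (N, N + k] and at most
      -- `h - k` in (2N + k - h, 2N].
      Pω-lower : + h ℤ.≤ P → + h * (P - + h) ℤ.≤ Pω
      Pω-lower h≤P = Int.≤-trans (Int.*-monoʳ (Int.0≤-diff h≤P) (count-below q h (ℕP.<⇒≤ h<q)))
        (Int.≤-trans (Int.≤-reflexive (sym (∑-*ʳ (upTo q) (P - + h) _))) (Int.≤-trans (∑-mono (upTo q) (λ k → by-k k (k ℕP.<? h)))
          (Int.≤-reflexive (sym (trans (∑-cong (range X) (λ y → trans (sym (∑-*ˡ (upTo q) _ _)) (∑-cong (upTo q) (λ k → Correlation.swap-middle (𝟙 (rough? (suc Z) y)) (𝟙 (k ℕP.<? h)) (𝟙 (window? k y))))))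
            (trans (∑-swap (range X) (upTo q) _) (∑-cong (upTo q) (λ k → ∑-*ˡ (range X) (𝟙 (k ℕP.<? h)) _))))))))
        where
        S : ℕ → ℤ
        S k = ∑ (range X) (λ y → 𝟙 (rough? (suc Z) y) * 𝟙 (window? k y))
        opaque
          unfolding arith
          rearrange : ∀ S h P → S - (P - h) ≡ S + h - P
          rearrange = solve-∀
        low? : ∀ k y → Dec (N < y × y ≤ N ℕ.+ k)
        low? k y = (N ℕP.<? y) ×-dec (y ℕP.≤? N ℕ.+ k)
        high? : ∀ k y → Dec (X ℕ.+ k < y ℕ.+ h × y ≤ X)
        high? k y = (X ℕ.+ k ℕP.<? y ℕ.+ h) ×-dec (y ℕP.≤? X)
        cover : ∀ k y → 𝟙 (primeHere? y) ℤ.≤ 𝟙 (rough? (suc Z) y) * 𝟙 (window? k y) + (𝟙 (low? k y) + 𝟙 (high? k y))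
        cover k y = go (primeHere? y)
          where
          0≤rest : 0ℤ ℤ.≤ 𝟙 (low? k y) + 𝟙 (high? k y)
          0≤rest = Int.0≤+ (0≤𝟙 (low? k y)) (0≤𝟙 (high? k y))
          0≤rw : 0ℤ ℤ.≤ 𝟙 (rough? (suc Z) y) * 𝟙 (window? k y)
          0≤rw = Int.0≤* (0≤𝟙 (rough? (suc Z) y)) (0≤𝟙 (window? k y))
          go : (d : Dec (PrimeHere y)) → 𝟙 d ℤ.≤ 𝟙 (rough? (suc Z) y) * 𝟙 (window? k y) + (𝟙 (low? k y) + 𝟙 (high? k y))
          go (no _) = Int.0≤+ 0≤rw 0≤rest
          go (yes ((N<y , pr) , y≤X)) = pick (y ℕP.≤? N ℕ.+ k) (y ℕ.+ h ℕP.≤? X ℕ.+ k)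
            where
            rough : suc Z Rough y
            rough = rough-≤ (ℕP.≤-trans (s≤s Z≤N) N<y) (prime⇒rough pr)
            pick : Dec (y ≤ N ℕ.+ k) → Dec (y ℕ.+ h ≤ X ℕ.+ k) → 1ℤ ℤ.≤ 𝟙 (rough? (suc Z) y) * 𝟙 (window? k y) + (𝟙 (low? k y) + 𝟙 (high? k y))
            pick (yes low) _ = Int.≤-trans (Int.≤-reflexive (sym (trans (Int.+-identityˡ _) (Int.+-identityʳ 1ℤ)))) (Int.+-mono-≤ 0≤rw (Int.+-mono-≤ (Int.≤-reflexive (sym (𝟙-yes (low? k y) (N<y , low)))) (0≤𝟙 (high? k y))))
            pick (no _) (no ¬r) = Int.≤-trans (Int.≤-reflexive (sym (trans (Int.+-identityˡ _) (Int.+-identityˡ 1ℤ)))) (Int.+-mono-≤ 0≤rw (Int.+-mono-≤ (0≤𝟙 (low? k y)) (Int.≤-reflexive (sym (𝟙-yes (high? k y) (ℕP.≰⇒> ¬r , y≤X))))))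
            pick (no ¬low) (yes r) = Int.≤-trans (Int.≤-reflexive (sym (trans (Int.+-identityʳ _) (Int.*-identityˡ 1ℤ)))) (Int.+-mono-≤ (Int.≤-reflexive (sym (cong₂ _*_ (𝟙-yes (rough? (suc Z) y) rough) (𝟙-yes (window? k y) (ℕP.≰⇒> ¬low , r))))) 0≤rest)
        S-lower : ∀ k → k < h → P - + h ℤ.≤ S k
        S-lower k k<h = Int.≤-by (Int.0≤-diff (Int.≤-trans (Int.≤-reflexive P-range) (Int.≤-trans (∑-mono (range X) (cover k))
            (Int.≤-trans (Int.≤-reflexive (trans (∑-+ (range X) _ _) (cong (_+_ (S k)) (∑-+ (range X) _ _)))) (Int.+-monoʳ
              (Int.≤-trans (Int.+-mono-≤ (interval-count (range X) (range-simple X) (low? k) (suc N) k (λ y _ (p , r) → p , s≤s r))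
                  (interval-count (range X) (range-simple X) (high? k) (suc (X ℕ.+ k) ℕ.∸ h) (h ℕ.∸ k) (λ y _ (p , r) → ℕP.m≤n+o⇒m∸n≤o (suc (X ℕ.+ k)) h (subst (suc (X ℕ.+ k) ≤_) (ℕP.+-comm y h) p) , ℕP.<-≤-trans (s≤s r) (ℕP.≤-reflexive (sym high≡)))))
                (Int.≤-reflexive (trans (sym (Int.pos-+ k (h ℕ.∸ k))) (cong +_ (ℕP.m+[n∸m]≡n (ℕP.<⇒≤ k<h)))))))))))
          (rearrange (S k) (+ h) P)
          where
          h≤X : h ≤ X
          h≤X = ℕP.≤-trans h≤N (ℕP.m≤m+n N N)
          high≡ : suc (X ℕ.+ k) ℕ.∸ h ℕ.+ (h ℕ.∸ k) ≡ suc X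
          high≡ = ℕP.+-cancelʳ-≡ k _ _ (trans (ℕP.+-assoc (suc (X ℕ.+ k) ℕ.∸ h) (h ℕ.∸ k) k) (trans (cong (suc (X ℕ.+ k) ℕ.∸ h ℕ.+_) (ℕP.m∸n+n≡m (ℕP.<⇒≤ k<h))) (ℕP.m∸n+n≡m (ℕP.≤-trans h≤X (ℕP.≤-trans (ℕP.m≤m+n X k) (ℕP.n≤1+n _))))))
        by-k : ∀ k (d : Dec (k < h)) → 𝟙 d * (P - + h) ℤ.≤ 𝟙 d * S k
        by-k k (yes k<h) = Int.*-monoˡ Int.0≤+ₙ (S-lower k k<h)
        by-k k (no _) = Int.≤-reflexive (trans (Int.*-zeroˡ _) (sym (Int.*-zeroˡ _)))

-- Dyadic blocks.

module Dyadic where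

  open import Data.Nat as ℕ using (ℕ; zero; suc; _≤_; _<_; NonZero; _^_)
  import Data.Nat.Properties as ℕP
  open import Data.Integer using (ℤ; +_; 0ℤ)
  import Data.Integer as ℤ
  import Data.Integer.Properties as ℤP
  open import Data.Integer.Tactic.RingSolver using (solve-∀)
  open import Data.List using (List; upTo; applyUpTo; length)
  open import Data.List.Properties using (length-upTo; length-applyUpTo)
  open import Data.List.Membership.Propositional using (_∈_)
  open import Data.List.Membership.Propositional.Properties using (∈-applyUpTo⁻)
  open import Data.Product using (_×_; _,_; proj₁)
  open import Data.Sum using (_⊎_; inj₁; inj₂)
  open import Relation.Nullary using (Dec; yes; no)
  open import Relation.Binary.PropositionalEquality
  open Int using (_+_; _*_; arith; pow4; 0≤pow4; *-monoˡ; *-monoʳ; 0≤*; 0≤+ₙ; ≤-trans; ≤-reflexive)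
  open Sums
  open Sieve using (range)
  open Residues using (∑-applyUpTo; ∑-range-extend)

  block : ℕ → List ℕ
  block k = applyUpTo (2 ^ k ℕ.+_) (2 ^ k)

  length-block : ∀ k → length (block k) ≡ 2 ^ k
  length-block k = length-applyUpTo (2 ^ k ℕ.+_) (2 ^ k)

  ∈-block⁻ : ∀ {k d} → d ∈ block k → 2 ^ k ≤ d × d < 2 ^ k ℕ.+ 2 ^ k
  ∈-block⁻ {k} d∈ with ∈-applyUpTo⁻ (2 ^ k ℕ.+_) d∈
  ... | i , i< , refl = ℕP.m≤m+n (2 ^ k) i , ℕP.+-monoʳ-< (2 ^ k) i<

  ∑-range-+ : ∀ m n (f : ℕ → ℤ) → ∑ (range (m ℕ.+ n)) f ≡ ∑ (range m) f + ∑ (upTo n) (λ i → f (suc m ℕ.+ i))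
  ∑-range-+ zero n f = trans (∑-applyUpTo suc n f) (sym (Int.+-identityˡ _))
  ∑-range-+ (suc m) n f = trans (cong (_+_ (f 1)) (trans (shift (m ℕ.+ n)) (trans (∑-range-+ m n (λ x → f (suc x))) (cong (_+ ∑ (upTo n) (λ i → f (suc (suc m) ℕ.+ i))) (sym (shift m))))))
    (sym (Int.+-assoc (f 1) _ _))
    where
    shift : ∀ m → ∑ (applyUpTo (λ x → suc (suc x)) m) f ≡ ∑ (range m) (λ x → f (suc x))
    shift m = trans (∑-applyUpTo (λ x → suc (suc x)) m f) (sym (∑-applyUpTo suc m (λ x → f (suc x))))

  ∑-blocks : ∀ K (f : ℕ → ℤ) → ∑ (range (2 ^ K ℕ.∸ 1)) f ≡ ∑ (upTo K) (λ k → ∑ (block k) f)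
  ∑-blocks K f = go K
    where
    snoc : ∀ n (g : ℕ → ℤ) → ∑ (upTo (suc n)) g ≡ ∑ (upTo n) g + g n
    snoc zero g = Int.+-comm (g 0) 0ℤ
    snoc (suc n) g = trans (cong (_+_ (g 0)) (trans (∑-applyUpTo suc (suc n) g) (trans (snoc n (λ i → g (suc i))) (cong (_+ g (suc n)) (sym (∑-applyUpTo suc n g))))))
      (sym (Int.+-assoc (g 0) _ _))
    1≤2^ : ∀ k → 1 ≤ 2 ^ k
    1≤2^ k = ℕP.m^n>0 2 k
    go : ∀ K → ∑ (range (2 ^ K ℕ.∸ 1)) f ≡ ∑ (upTo K) (λ k → ∑ (block k) f)
    go zero = refl
    go (suc K) = trans (cong (λ n → ∑ (range n) f) split) (trans (∑-range-+ (2 ^ K ℕ.∸ 1) (2 ^ K) f)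
      (trans (cong₂ _+_ (go K) (trans (∑-cong (upTo (2 ^ K)) (λ i → cong (λ n → f (n ℕ.+ i)) (ℕP.m+[n∸m]≡n (1≤2^ K)))) (sym (∑-applyUpTo (2 ^ K ℕ.+_) (2 ^ K) f)))) (sym (snoc K _))))
      where
      split : 2 ^ suc K ℕ.∸ 1 ≡ 2 ^ K ℕ.∸ 1 ℕ.+ 2 ^ K
      split = trans (cong (λ n → 2 ^ K ℕ.+ n ℕ.∸ 1) (ℕP.+-identityʳ (2 ^ K))) (ℕP.+-∸-comm (2 ^ K) (1≤2^ K))

  ∑-dyadic : ∀ K Z (f : ℕ → ℤ) → Z < 2 ^ K → (∀ d → Z < d → f d ≡ 0ℤ) → ∑ (range Z) f ≡ ∑ (upTo K) (λ k → ∑ (block k) f)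
  ∑-dyadic K Z f Z<2^K out = trans (sym (∑-range-extend Z (2 ^ K ℕ.∸ 1) f (ℕP.<⇒≤pred Z<2^K ∙ ℕP.≤-reflexive refl) out)) (∑-blocks K f)
    where
    infixr 4 _∙_
    _∙_ : ∀ {a b c : ℕ} → a ≤ b → b ≤ c → a ≤ c
    _∙_ = ℕP.≤-trans

  cube : ℤ → ℤ
  cube a = a * a * a

  0≤cube : ∀ {a} → 0ℤ ℤ.≤ a → 0ℤ ℤ.≤ cube a
  0≤cube {a} p = 0≤* (Int.0≤sq a) p

  opaque
    unfolding arith
    cube-* : ∀ a b → cube a * (a * b) ≡ pow4 a * b
    cube-* = λ a b → lem a b
      where
      lem : ∀ a b → a * a * a * (a * b) ≡ a * a * (a * a) * b
      lem = solve-∀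
    move-factor : ∀ c m s → m * (c * s) ≡ c * (m * s)
    move-factor = solve-∀

  *-cancelˡ-≤ : ∀ n .{{_ : NonZero n}} {a b} → + n * a ℤ.≤ + n * b → a ℤ.≤ b
  *-cancelˡ-≤ n@(suc _) {a} {b} p = ℤP.*-cancelˡ-≤-pos a b (+ n) (subst₂ ℤ._≤_ (Int.*-def (+ n) a) (Int.*-def (+ n) b) p)

  -- A dyadic block contributes at most D ^ (3/4) C ^ (1/4).
  module _ (K Z D : ℕ) (C : ℤ) (0≤C : 0ℤ ℤ.≤ C) (Z<2^K : Z < 2 ^ K) (f : ℕ → ℤ) (out : ∀ d → Z < d → f d ≡ 0ℤ)
    (bound : ∀ d → f d ≡ 0ℤ ⊎ (d < D × + d * pow4 (f d) ℤ.≤ C)) where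

    private
      at : ∀ k d → 2 ^ k ≤ d → + (2 ^ k) * pow4 (f d) ℤ.≤ C
      at k d 2^k≤d = go (bound d)
        where
        go : f d ≡ 0ℤ ⊎ (d < D × + d * pow4 (f d) ℤ.≤ C) → + (2 ^ k) * pow4 (f d) ℤ.≤ C
        go (inj₁ eq) = ≤-trans (≤-reflexive (trans (cong (λ t → + (2 ^ k) * pow4 t) eq) (trans (cong (+ (2 ^ k) *_) (trans (cong (_* (0ℤ * 0ℤ)) (Int.*-zeroˡ 0ℤ)) (Int.*-zeroˡ _))) (Int.*-zeroʳ _)))) 0≤C
        go (inj₂ (_ , le)) = ≤-trans (*-monoʳ (0≤pow4 (f d)) (ℤ.+≤+ 2^k≤d)) le

      block-sum : ℕ → ℤ
      block-sum k = ∑ (block k) f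

      block-bound : ∀ k → pow4 (block-sum k) ℤ.≤ cube (+ D) * C
      block-bound k = go (2 ^ k ℕP.<? D)
        where
        instance
          2^k≢0 : NonZero (2 ^ k)
          2^k≢0 = ℕP.m^n≢0 2 k
        go : Dec (2 ^ k < D) → pow4 (block-sum k) ℤ.≤ cube (+ D) * C
        go (yes 2^k<D) = ≤-trans (*-cancelˡ-≤ (2 ^ k) (≤-trans (*-monoˡ 0≤+ₙ (∑-pow4-≤ (block k) f))
            (≤-trans (≤-reflexive (trans (cong (λ n → + (2 ^ k) * (cube (+ n) * ∑ (block k) (λ d → pow4 (f d)))) (length-block k)) (trans (move-factor (cube (+ (2 ^ k))) (+ (2 ^ k)) _) (cong (cube (+ (2 ^ k)) *_) (sym (∑-*ˡ (block k) _ _))))))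
              (≤-trans (*-monoˡ (0≤cube 0≤+ₙ) (≤-trans (∑-≤-const (block k) C (λ d d∈ → at k d (proj₁ (∈-block⁻ {k} d∈)))) (≤-reflexive (cong (λ n → + n * C) (length-block k)))))
                (≤-reflexive (move-factor (+ (2 ^ k)) (cube (+ (2 ^ k))) C ))))))
          (*-monoʳ 0≤C (Int.*-mono-nonneg (Int.0≤sq (+ (2 ^ k))) (Int.sq-mono 0≤+ₙ le) 0≤+ₙ le))
          where
          le : + (2 ^ k) ℤ.≤ + D
          le = ℤ.+≤+ (ℕP.<⇒≤ 2^k<D)
        go (no ≥D) = ≤-trans (≤-reflexive (trans (cong pow4 (trans (∑-cong-∈ (block k) (λ d d∈ → vanish d (proj₁ (∈-block⁻ {k} d∈)) (bound d))) (∑-0 (block k)))) (trans (cong (_* (0ℤ * 0ℤ)) (Int.*-zeroˡ 0ℤ)) (Int.*-zeroˡ _)))) (0≤* (0≤cube 0≤+ₙ) 0≤C)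
          where
          vanish : ∀ d → 2 ^ k ≤ d → f d ≡ 0ℤ ⊎ (d < D × + d * pow4 (f d) ℤ.≤ C) → f d ≡ 0ℤ
          vanish d _ (inj₁ eq) = eq
          vanish d 2^k≤d (inj₂ (d<D , _)) with () ← ≥D (ℕP.≤-<-trans 2^k≤d d<D)

    dyadic-bound : pow4 (∑ (range Z) f) ℤ.≤ pow4 (+ K) * (cube (+ D) * C)
    dyadic-bound = ≤-trans (≤-reflexive (cong pow4 (∑-dyadic K Z f Z<2^K out))) (≤-trans (∑-pow4-≤ (upTo K) block-sum)
      (≤-trans (*-monoˡ (0≤cube 0≤+ₙ) (∑-≤-const (upTo K) _ (λ k _ → block-bound k)))
        (≤-reflexive (trans (cong (λ n → cube (+ n) * (+ n * (cube (+ D) * C))) (length-upTo K)) (cube-* (+ K) _)))))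

-- The bound for the type I sum.

module TypeIEstimate where

  open import Data.Nat as ℕ using (ℕ; suc; _≤_; _<_; NonZero; _^_)
  import Data.Nat.Properties as ℕP
  import Data.Nat.DivMod as ℕD
  open import Data.Integer using (ℤ; +_; 0ℤ; 1ℤ)
  import Data.Integer as ℤ
  open import Data.Integer.Tactic.RingSolver using (solve-∀)
  open import Data.Nat.Tactic.RingSolver using () renaming (solve-∀ to solve-∀ℕ)
  open import Data.List using (upTo)
  open import Data.List.Properties using (length-upTo)
  open import Data.Product using (_×_; _,_)
  open import Data.Sum using (_⊎_; inj₁; inj₂)
  open import Relation.Binary.PropositionalEquality
  open Int using (_+_; _*_; arith; abs; pow4; pow4-mono; *-monoˡ; *-monoʳ; *-mono-nonneg; 0≤*; 0≤+ₙ; ≤-trans; ≤-reflexive)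
  open Sums
  open Field
  open Correlation using (module Correlations)
  open TypeI using (module TypeISums)
  open PrimeField
  open Energy
  open Sieve
  open Residues
  open Weights
  open MainTerm
  open Dyadic

  opaque
    unfolding arith
    five : ∀ d x P K i → (d * (d * d * d)) * (d * ((x * P) * (x * P) * (K * (i * i * i)))) ≡ ((d * x) * P) * ((d * x) * P) * (K * ((d * i) * (d * i) * (d * i)))
    five = solve-∀
    four-one : ∀ d S → d * (d * (d * d * d * S)) ≡ (d * (d * d * d)) * (d * S)
    four-one = solve-∀

  module TypeIEstimates {q : ℕ} (𝔽 : ResidueField q) (N h : ℕ) (2N<q : N ℕ.+ N < q) (h≤N : h ≤ N) (1≤N : 1 ≤ N)
    (c : FiniteField.F (ResidueField.field′ 𝔽)) (c≢0 : c ≢ FiniteField.𝟎 (ResidueField.field′ 𝔽)) where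
    open ResidueField 𝔽
    open FieldTheory field′ hiding (q)
    open Correlations field′
    open TypeISums field′
    open Setup 𝔽 N h 2N<q h≤N 1≤N c c≢0
    open MainTerms 𝔽 N h 2N<q h≤N 1≤N c c≢0
    open Residues.Residues 𝔽

    Ψ : ℤ
    Ψ = norm² R

    C₁ : ℤ
    C₁ = (+ (2 ℕ.* h) * P) * (+ (2 ℕ.* h) * P) * (+ 6 * (size′ * size′ * (Ψ * Ψ)) * (+ (3 ℕ.* N) * + (3 ℕ.* N) * + (3 ℕ.* N)))

    0≤C₁ : 0ℤ ℤ.≤ C₁
    0≤C₁ = 0≤* (Int.0≤sq _) (0≤* (0≤* 0≤+ₙ (0≤* (0≤* 0≤+ₙ 0≤+ₙ) (Int.0≤sq Ψ))) (0≤* (0≤* 0≤+ₙ 0≤+ₙ) 0≤+ₙ))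

    -- Hölder over the `d` classes costs `d³` and adding them up one more `d`; in each class the two
    -- lengths save `d² · d³`, as `d (h / d + 1) ≤ 2 h` and `d (N / d + 2) ≤ 3 N`. One factor `d` is
    -- won, as the dyadic summation requires.
    progression-bound : ∀ d .{{_ : NonZero d}} (d<q : d < q) → d ≤ h → + d * pow4 (∑ (range X) (λ y → Wx (d ℕ.* y))) ℤ.≤ C₁
    progression-bound d d<q d≤h = *-cancelˡ-≤ d (≤-trans (*-monoˡ 0≤+ₙ (*-monoˡ 0≤+ₙ (≤-trans (≤-reflexive (cong pow4 (∑Wx-progressions d d<q))) (∑-pow4-≤ (upTo d) (progression-sum d d<q)))))
      (≤-trans (≤-reflexive (trans (cong (λ n → + d * (+ d * (+ n * + n * + n * ∑ (upTo d) (λ a → pow4 (progression-sum d d<q a))))) (length-upTo d)) (trans (four-one (+ d) _) (trans (cong (+ d * (+ d * + d * + d) *_) (sym (∑-*ˡ (upTo d) (+ d) _))) (sym (∑-*ˡ (upTo d) _ _))))))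
        (≤-trans (∑-≤-const (upTo d) C₁ (λ a _ → each a)) (≤-reflexive (cong (λ n → + n * C₁) (length-upTo d))))))
      where
      each : ∀ a → (+ d * (+ d * + d * + d)) * (+ d * pow4 (progression-sum d d<q a)) ℤ.≤ C₁
      each a = ≤-trans (*-monoˡ (0≤* 0≤+ₙ (0≤* (0≤* 0≤+ₙ 0≤+ₙ) 0≤+ₙ)) (*-monoˡ 0≤+ₙ
          (hyperbolaSum-bound (χ₁ a d) χₐ (χ₂ a d) R mean (indicator-idem (start? a d)) (indicator-idem primeHere?) (indicator-idem (λ j → window? a (d ℕ.* j))) (c ⊗ _ ⁻¹) _ (c′≢0 d d<q))))
        (≤-trans (≤-reflexive (five (+ d) x P (+ 6 * (size′ * size′ * (Ψ * Ψ))) i))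
          (*-mono-nonneg (Int.0≤sq _) (Int.sq-mono (0≤* 0≤dx 0≤P) (*-monoʳ 0≤P dx≤)) (0≤* 0≤mid 0≤cube-i)
            (*-monoˡ 0≤mid (*-mono-nonneg (0≤* 0≤di 0≤di) (Int.sq-mono 0≤di di≤) 0≤di di≤))))
        where
        x i : ℤ
        x = ∑F (χ₁ a d)
        i = ∑F (χ₂ a d)
        0≤x : 0ℤ ℤ.≤ x
        0≤x = ∑-nonneg elems (λ t → 0≤𝟙 (start? a d (rep t)))
        0≤i : 0ℤ ℤ.≤ i
        0≤i = ∑-nonneg elems (λ t → 0≤𝟙 (window? a (d ℕ.* rep t)))
        0≤dx : 0ℤ ℤ.≤ + d * x
        0≤dx = 0≤* 0≤+ₙ 0≤x
        0≤di : 0ℤ ℤ.≤ + d * i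
        0≤di = 0≤* 0≤+ₙ 0≤i
        0≤cube-i : 0ℤ ℤ.≤ (+ d * i) * (+ d * i) * (+ d * i)
        0≤cube-i = 0≤* (0≤* 0≤di 0≤di) 0≤di
        0≤mid : 0ℤ ℤ.≤ + 6 * (size′ * size′ * (Ψ * Ψ))
        0≤mid = 0≤* 0≤+ₙ (0≤* (0≤* 0≤+ₙ 0≤+ₙ) (Int.0≤sq Ψ))
        d*quot : ∀ m → d ℕ.* (m ℕ./ d) ≤ m
        d*quot m = ℕP.≤-trans (ℕP.≤-reflexive (ℕP.*-comm d (m ℕ./ d))) (ℕD.m/n*n≤m m d)
        dx≤ : + d * x ℤ.≤ + (2 ℕ.* h)
        dx≤ = ≤-trans (*-monoˡ 0≤+ₙ (∑χ₁ a d)) (≤-trans (≤-reflexive (sym (Int.pos-* d (suc (h ℕ./ d))))) (ℤ.+≤+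
          (ℕP.≤-trans (ℕP.≤-reflexive (ℕP.*-suc d (h ℕ./ d))) (ℕP.≤-trans (ℕP.+-mono-≤ d≤h (d*quot h)) (ℕP.≤-reflexive (cong (h ℕ.+_) (sym (ℕP.+-identityʳ h))))))))
        di≤ : + d * i ℤ.≤ + (3 ℕ.* N)
        di≤ = ≤-trans (*-monoˡ 0≤+ₙ (∑χ₂ a d)) (≤-trans (≤-reflexive (sym (Int.pos-* d (N ℕ./ d ℕ.+ 2)))) (ℤ.+≤+
          (ℕP.≤-trans (ℕP.≤-reflexive (l d (N ℕ./ d))) (ℕP.≤-trans (ℕP.+-mono-≤ (d*quot N) (ℕP.+-mono-≤ d≤N d≤N)) (ℕP.≤-reflexive (l₂ N))))))
          where
          d≤N : d ≤ N
          d≤N = ℕP.≤-trans d≤h h≤N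
          l : ∀ d m → d ℕ.* (m ℕ.+ 2) ≡ d ℕ.* m ℕ.+ (d ℕ.+ d)
          l = solve-∀ℕ
          l₂ : ∀ N → N ℕ.+ (N ℕ.+ N) ≡ 3 ℕ.* N
          l₂ = solve-∀ℕ

    typeI-bound : ∀ K D Z → Z < 2 ^ K → D ≤ h → (a : ℕ → ℤ) → (∀ d → Z < d → a d ≡ 0ℤ) → (∀ d → a d ≡ 0ℤ ⊎ (abs (a d) ℤ.≤ 1ℤ × 1 ≤ d × d < D)) →
      pow4 (∑ (range Z) (λ d → a d * ∑ (range X) (λ y → Wx (d ℕ.* y)))) ℤ.≤ pow4 (+ K) * (cube (+ D) * C₁)
    typeI-bound K D Z Z<2^K D≤h a out ok = dyadic-bound K Z D C₁ 0≤C₁ Z<2^K (λ d → a d * E d) (λ d Z<d → trans (cong (_* E d) (out d Z<d)) (Int.*-zeroˡ _)) (λ d → go d (ok d))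
      where
      E : ℕ → ℤ
      E d = ∑ (range X) (λ y → Wx (d ℕ.* y))
      go : ∀ d → a d ≡ 0ℤ ⊎ (abs (a d) ℤ.≤ 1ℤ × 1 ≤ d × d < D) → a d * E d ≡ 0ℤ ⊎ (d < D × + d * pow4 (a d * E d) ℤ.≤ C₁)
      go d (inj₁ eq) = inj₁ (trans (cong (_* E d) eq) (Int.*-zeroˡ _))
      go d (inj₂ (le , 1≤d , d<D)) = inj₂ (d<D , ≤-trans (*-monoˡ 0≤+ₙ shrink) (progression-bound d {{ℕ.>-nonZero 1≤d}} (ℕP.<-≤-trans d<D (ℕP.≤-trans D≤h (ℕP.<⇒≤ h<q))) (ℕP.≤-trans (ℕP.<⇒≤ d<D) D≤h)))
        where
        shrink : pow4 (a d * E d) ℤ.≤ pow4 (E d)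
        shrink = ≤-trans (≤-reflexive (cong (λ s → s * s) (sym (Int.abs-sq (a d * E d))))) (≤-trans (pow4-mono (Int.0≤abs _)
          (≤-trans (≤-reflexive (Int.abs-* (a d) (E d))) (≤-trans (*-monoʳ (Int.0≤abs _) le) (≤-reflexive (Int.*-identityˡ _)))))
          (≤-reflexive (cong (λ s → s * s) (Int.abs-sq (E d)))))

-- Comparison of integers by binary digits.

module Labels where

  open import Data.Nat as ℕ using (ℕ; zero; suc; _≤_; _<_; s≤s; z≤n; _/_; _%_; _^_)
  import Data.Nat.Properties as ℕP
  open import Data.Nat.DivMod
  open import Data.Integer using (ℤ; +_; 0ℤ; 1ℤ)
  open import Data.List using (upTo)
  open import Data.Product using (_×_; _,_)
  open import Relation.Binary.PropositionalEquality
  open import Relation.Binary.Definitions using (tri<; tri≈; tri>)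
  open Int using (_+_; _*_)
  open Sums
  open Residues using (∑-applyUpTo)

  -- `x` without its last `j` binary digits; its parity is the digit under inspection, and half of
  -- it is the part above that digit.
  prefix : ℕ → ℕ → ℕ
  prefix zero x = x
  prefix (suc j) x = prefix j (x / 2)

  even odd : ℕ → ℤ
  even x = 𝟙 (x % 2 ℕP.≟ 0)
  odd x = 𝟙 (x % 2 ℕP.≟ 1)

  prefix≤ : ∀ j x → prefix j x ≤ x
  prefix≤ zero x = ℕP.≤-refl
  prefix≤ (suc j) x = ℕP.≤-trans (prefix≤ j (x / 2)) (m/n≤m x 2)

  -- a < b is decided by the highest binary digit in which a and b differ: above it they have the same digits.
  compare-step : ∀ a b → 𝟙 (a ℕP.<? b) ≡ even a * odd b * 𝟙 (a / 2 ℕP.≟ b / 2) + 𝟙 (a / 2 ℕP.<? b / 2)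
  compare-step a b = go (ℕP.<-cmp (a / 2) (b / 2))
    where
    a≡ : a ≡ a % 2 ℕ.+ a / 2 ℕ.* 2
    a≡ = m≡m%n+[m/n]*n a 2
    b≡ : b ≡ b % 2 ℕ.+ b / 2 ℕ.* 2
    b≡ = m≡m%n+[m/n]*n b 2
    go : _ → 𝟙 (a ℕP.<? b) ≡ even a * odd b * 𝟙 (a / 2 ℕP.≟ b / 2) + 𝟙 (a / 2 ℕP.<? b / 2)
    go (tri< lt ne _) = trans (𝟙-yes (a ℕP.<? b) (ℕP.≰⇒> λ b≤a → ℕP.<⇒≱ lt (/-monoˡ-≤ 2 b≤a)))
      (sym (trans (cong₂ (λ s t → even a * odd b * s + t) (𝟙-no (a / 2 ℕP.≟ b / 2) ne) (𝟙-yes (a / 2 ℕP.<? b / 2) lt)) (trans (cong (_+ 1ℤ) (Int.*-zeroʳ _)) (Int.+-identityˡ 1ℤ))))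
    go (tri> ¬lt ne gt) = trans (𝟙-no (a ℕP.<? b) (λ a<b → ℕP.<⇒≱ gt (/-monoˡ-≤ 2 (ℕP.<⇒≤ a<b))))
      (sym (trans (cong₂ (λ s t → even a * odd b * s + t) (𝟙-no (a / 2 ℕP.≟ b / 2) ne) (𝟙-no (a / 2 ℕP.<? b / 2) ¬lt)) (trans (cong (_+ 0ℤ) (Int.*-zeroʳ _)) (Int.+-identityˡ 0ℤ))))
    go (tri≈ ¬lt eq _) = trans (𝟙-× (a ℕP.<? b) (a % 2 ℕP.≟ 0) (b % 2 ℕP.≟ 1) to from)
      (sym (trans (cong₂ (λ s t → even a * odd b * s + t) (𝟙-yes (a / 2 ℕP.≟ b / 2) eq) (𝟙-no (a / 2 ℕP.<? b / 2) ¬lt)) (trans (Int.+-identityʳ _) (Int.*-identityʳ _))))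
      where
      digits : a ℕ.< b → a % 2 ℕ.< b % 2
      digits a<b = ℕP.+-cancelʳ-< (a / 2 ℕ.* 2) (a % 2) (b % 2) (subst₂ _<_ a≡ (trans b≡ (cong (λ t → b % 2 ℕ.+ t ℕ.* 2) (sym eq))) a<b)
      to : a < b → a % 2 ≡ 0 × b % 2 ≡ 1
      to a<b = ℕP.n≤0⇒n≡0 (ℕP.≤-pred (ℕP.<-≤-trans (digits a<b) b%2≤1)) , ℕP.≤-antisym b%2≤1 (ℕP.≤-trans (s≤s z≤n) (digits a<b))
        where
        b%2≤1 : b % 2 ≤ 1
        b%2≤1 = ℕP.≤-pred (m%n<n b 2)
      from : a % 2 ≡ 0 → b % 2 ≡ 1 → a < b
      from e₀ e₁ = ℕP.≤-reflexive (trans (cong suc (trans a≡ (cong₂ (λ s t → s ℕ.+ t ℕ.* 2) e₀ eq))) (sym (trans b≡ (cong (ℕ._+ b / 2 ℕ.* 2) e₁))))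

  -- When `a < b`, exactly one position decides. The indicator thus becomes a sum of products of a
  -- function of `a`, a function of `b` and an equality of prefixes, which is the form the bilinear
  -- bound accepts.
  compare-digits : ∀ K a b → a < 2 ^ K → b < 2 ^ K →
    𝟙 (a ℕP.<? b) ≡ ∑ (upTo K) (λ j → even (prefix j a) * odd (prefix j b) * 𝟙 (prefix j a / 2 ℕP.≟ prefix j b / 2))
  compare-digits zero a b a<1 b<1 = 𝟙-no (a ℕP.<? b) (λ a<b → ℕP.<⇒≱ a<b (ℕP.≤-trans (ℕP.≤-pred b<1) z≤n))
  compare-digits (suc K) a b a< b< = trans (compare-step a b) (cong (_+_ (even a * odd b * 𝟙 (a / 2 ℕP.≟ b / 2)))
    (trans (compare-digits K (a / 2) (b / 2) (half a a<) (half b b<)) (sym (∑-applyUpTo suc K _))))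
    where
    half : ∀ x → x < 2 ^ suc K → x / 2 < 2 ^ K
    half x x< = m<n*o⇒m/o<n (subst (x <_) (ℕP.*-comm 2 (2 ^ K)) x<)

-- The bound for the type II sum on a dyadic block.

module TypeIIEstimate where

  open import Data.Nat as ℕ using (ℕ; zero; suc; _≤_; _<_; s≤s; z≤n; NonZero; _^_)
  import Data.Nat.Properties as ℕP
  import Data.Nat.DivMod as ℕD
  open import Data.Integer using (ℤ; +_; 0ℤ; 1ℤ)
  import Data.Integer as ℤ
  open import Data.Integer.Tactic.RingSolver using (solve-∀)
  open import Data.List using (List; upTo; length; cartesianProduct)
  open import Data.List.Properties using (length-upTo)
  open import Data.List.Membership.Propositional using (_∈_)
  open import Data.Product using (∃; _×_; _,_; proj₁; proj₂)
  open import Data.Product.Properties using (≡-dec)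
  open import Data.Sum using (_⊎_; inj₁; inj₂)
  open import Relation.Nullary using (Dec; ¬?)
  open import Relation.Nullary.Decidable using (_×-dec_)
  open import Relation.Binary.Definitions using (DecidableEquality)
  open import Relation.Binary.PropositionalEquality
  open Int using (_+_; _*_; -_; _-_; arith; abs; pow4; 0≤pow4; pow4-mono; *-monoˡ; *-monoʳ; *-mono-nonneg; 0≤*; 0≤+ₙ; ≤-trans; ≤-reflexive; ≤-refl)
  open Sums
  open Field
  open Correlation using (module Correlations)
  open TypeII using (module TypeIISums)
  open PrimeField
  open Energy
  open Sieve
  open Residues
  open Weights
  open MainTerm
  open Dyadic
  open Labels

  opaque
    unfolding arith
    reorder : ∀ b e o e′ o′ δ δ′ w → b * ((e * o * δ) * ((e′ * o′ * δ′) * w)) ≡ (b * e * o′) * (o * e′) * (δ * δ′) * w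
    reorder = solve-∀
    pow4-product : ∀ a b → pow4 (a * b) ≡ pow4 a * pow4 b
    pow4-product = λ a b → lem a b
      where
      lem : ∀ a b → (a * b) * (a * b) * ((a * b) * (a * b)) ≡ a * a * (a * a) * (b * b * (b * b))
      lem = solve-∀
    pow4-gap : ∀ a b → + 8 * (pow4 a + pow4 b) - pow4 (a + b) ≡ (a - b) * (a - b) * (+ 7 * (a * a) + + 10 * (a * b) + + 7 * (b * b))
    pow4-gap = λ a b → lem a b
      where
      lem : ∀ a b → + 8 * (a * a * (a * a) + b * b * (b * b)) - (a + b) * (a + b) * ((a + b) * (a + b)) ≡ (a - b) * (a - b) * (+ 7 * (a * a) + + 10 * (a * b) + + 7 * (b * b))
      lem = solve-∀

  pow4-+ : ∀ {a b} → 0ℤ ℤ.≤ a → 0ℤ ℤ.≤ b → pow4 (a + b) ℤ.≤ + 8 * (pow4 a + pow4 b)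
  pow4-+ {a} {b} 0≤a 0≤b = Int.≤-by (0≤* (Int.0≤sq (a - b)) (Int.0≤+ (Int.0≤+ (0≤* 0≤+ₙ (Int.0≤sq a)) (0≤* 0≤+ₙ (0≤* 0≤a 0≤b))) (0≤* 0≤+ₙ (Int.0≤sq b)))) (pow4-gap a b)

  _≟Λ_ : DecidableEquality (ℕ × ℕ)
  _≟Λ_ = ≡-dec ℕP._≟_ ℕP._≟_

  module TypeIIEstimates {q : ℕ} (𝔽 : ResidueField q) (N h : ℕ) (2N<q : N ℕ.+ N < q) (h≤N : h ≤ N) (1≤N : 1 ≤ N)
    (c : FiniteField.F (ResidueField.field′ 𝔽)) (c≢0 : c ≢ FiniteField.𝟎 (ResidueField.field′ 𝔽)) where
    open ResidueField 𝔽
    open FieldTheory field′ hiding (q)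
    open EnergyBound 𝔽 using (↑; ↑≢0; ↑-+; ↑-*; ↑-inj)
    open Correlations field′
    open TypeIISums field′ using (module Bilinear)
    open Setup 𝔽 N h 2N<q h≤N 1≤N c c≢0
    open MainTerms 𝔽 N h 2N<q h≤N 1≤N c c≢0
    open Residues.Residues 𝔽

    Wx-small : ∀ x → x ≤ N → Wx x ≡ 0ℤ
    Wx-small x x≤N = trans (Wx-ΩV x) (trans (cong (_* V (↑ x)) (∑-zero (upTo q) (λ k → trans (cong (𝟙 (k ℕP.<? h) *_)
      (𝟙-no (window? k x) (λ (p , _) → ℕP.<⇒≱ p (ℕP.≤-trans x≤N (ℕP.m≤m+n N k))))) (Int.*-zeroʳ _)))) (Int.*-zeroˡ _))

    module Pieces (K : ℕ) (q<2^K : q < 2 ^ K) (3<q : 3 ℕ.+ 1 < q) (k : ℕ) (1≤k : 1 ≤ k)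
      (b : ℕ → ℤ) (b-ok : ∀ d → b d ≡ 0ℤ ⊎ (abs (b d) ℤ.≤ 1ℤ × 2 ≤ d × d ≤ N)) (M-small : 2 ^ k ℕ.+ 2 ^ k < q) where

      M L : ℕ
      M = 2 ^ k
      instance
        M≢0 : NonZero M
        M≢0 = ℕP.m^n≢0 2 k
      L = X ℕ./ M

      -- d n ≤ X means n < cut d.
      cut : ℕ → ℕ
      cut zero = 0
      cut d@(suc _) = suc (X ℕ./ d)

      private
        ds ns vs : List ℕ
        ds = block k
        ns = range L
        vs = upTo (L ℕ.+ L)

        ls : List (ℕ × ℕ)
        ls = cartesianProduct (upTo (2 ^ K)) (upTo (2 ^ K))

      -- The comparisons `leastFactor d < suc (leastFactor n)` and `n < cut d` are decided at the
      -- digits `j₁` and `j₂`; the label is the pair of prefixes that have to agree.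
      label : ℕ → ℕ → ℕ × ℕ → ℕ × ℕ
      label j₁ j₂ (x , y) = prefix j₁ x ℕ./ 2 , prefix j₂ y ℕ./ 2

      λd κ : ℕ → ℕ → ℕ → ℕ × ℕ
      λd j₁ j₂ d = label j₁ j₂ (leastFactor d , cut d)
      κ j₁ j₂ n = label j₁ j₂ (suc (leastFactor n) , n)

      bb aa : ℕ → ℕ → ℕ → ℤ
      bb j₁ j₂ d = b d * even (prefix j₁ (leastFactor d)) * odd (prefix j₂ (cut d))
      aa j₁ j₂ n = odd (prefix j₁ (suc (leastFactor n))) * even (prefix j₂ n)

      piece : ℕ → ℕ → ℤ
      piece j₁ j₂ = ∑ ds (λ d → ∑ ns (λ n → bb j₁ j₂ d * aa j₁ j₂ n * 𝟙 (λd j₁ j₂ d ≟Λ κ j₁ j₂ n) * weight (↑ d ⊗ ↑ n)))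

      private
        M≤d : ∀ {d} → d ∈ ds → M ≤ d
        M≤d d∈ = proj₁ (∈-block⁻ {k} d∈)

        d<q : ∀ {d} → d ∈ ds → d < q
        d<q d∈ = ℕP.<-trans (proj₂ (∈-block⁻ {k} d∈)) M-small

        1≤d : ∀ {d} → d ∈ ds → 1 ≤ d
        1≤d d∈ = ℕP.≤-trans (ℕP.m^n>0 2 k) (M≤d d∈)

        L≤N : L ≤ N
        L≤N = ℕP.≤-trans (ℕD./-monoʳ-≤ X {M} {2} (ℕP.^-monoʳ-≤ 2 1≤k)) (ℕP.≤-reflexive (trans (cong (ℕ._/ 2) (trans (cong (N ℕ.+_) (sym (ℕP.+-identityʳ N))) (ℕP.*-comm 2 N))) (ℕD.m*n/n≡m N 2)))

        2L<q : L ℕ.+ L < q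
        2L<q = ℕP.≤-<-trans (ℕP.+-mono-≤ L≤N L≤N) 2N<q

        n≤L : ∀ {n} → n ∈ ns → n ≤ L
        n≤L n∈ = proj₂ (∈-range⁻ n∈)

        1≤n : ∀ {n} → n ∈ ns → 1 ≤ n
        1≤n n∈ = proj₁ (∈-range⁻ n∈)

        n<q : ∀ {n} → n ∈ ns → n < q
        n<q n∈ = ℕP.≤-<-trans (n≤L n∈) (ℕP.≤-<-trans (ℕP.m≤m+n L L) 2L<q)

        leastFactor-small : ∀ n → 1 ≤ n → n < q → suc (leastFactor n) < 2 ^ K
        -- Here `leastFactor 1` is 3, which explains the hypothesis `3 + 1 < q`.
        leastFactor-small (suc zero) _ _ = ℕP.<-trans 3<q q<2^K
        leastFactor-small n@(suc (suc _)) _ n<q = ℕP.≤-<-trans (ℕP.≤-trans (s≤s (proj₂ (proj₂ (proj₂ (leastFactor-spec n (s≤s (s≤s z≤n))))))) n<q) q<2^K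

        cut-< : ∀ d n → 1 ≤ d → 1 ≤ n → 𝟙 (n ℕP.<? cut d) ≡ 𝟙 ((1 ℕP.≤? d ℕ.* n) ×-dec (d ℕ.* n ℕP.≤? X))
        cut-< d@(suc _) n 1≤d 1≤n = 𝟙-cong (n ℕP.<? cut d) ((1 ℕP.≤? d ℕ.* n) ×-dec (d ℕ.* n ℕP.≤? X))
          (λ { (s≤s n≤) → ℕP.*-mono-≤ 1≤d 1≤n , ℕP.≤-trans (ℕP.*-monoʳ-≤ d n≤) (ℕP.≤-trans (ℕP.≤-reflexive (ℕP.*-comm d (X ℕ./ d))) (ℕD.m/n*n≤m X d)) })
          (λ (_ , r) → s≤s (subst (_≤ X ℕ./ d) (ℕD.m*n/n≡m n d) (ℕD./-monoˡ-≤ d (ℕP.≤-trans (ℕP.≤-reflexive (ℕP.*-comm n d)) r))))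

        cut-small : ∀ d → 1 ≤ d → cut d < 2 ^ K
        cut-small d@(suc _) _ = ℕP.≤-<-trans (ℕP.≤-trans (s≤s (ℕD.m/n≤m X d)) 2N<q) q<2^K

        term : ℕ → ℕ → ℤ
        term d n = ∑ (upTo K) (λ j₁ → ∑ (upTo K) (λ j₂ → bb j₁ j₂ d * aa j₁ j₂ n * 𝟙 (λd j₁ j₂ d ≟Λ κ j₁ j₂ n) * weight (↑ d ⊗ ↑ n)))

        b-zero : ∀ d n → b d ≡ 0ℤ → term d n ≡ 0ℤ
        b-zero d n eq = ∑-zero (upTo K) (λ j₁ → ∑-zero (upTo K) (λ j₂ → vanish j₁ j₂))
          where
          vanish : ∀ j₁ j₂ → bb j₁ j₂ d * aa j₁ j₂ n * 𝟙 (λd j₁ j₂ d ≟Λ κ j₁ j₂ n) * weight (↑ d ⊗ ↑ n) ≡ 0ℤ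
          vanish j₁ j₂ = trans (cong (λ s → s * even (prefix j₁ (leastFactor d)) * odd (prefix j₂ (cut d)) * aa j₁ j₂ n * 𝟙 (λd j₁ j₂ d ≟Λ κ j₁ j₂ n) * weight (↑ d ⊗ ↑ n)) eq)
            (trans (cong (λ s → s * odd (prefix j₂ (cut d)) * aa j₁ j₂ n * 𝟙 (λd j₁ j₂ d ≟Λ κ j₁ j₂ n) * weight (↑ d ⊗ ↑ n)) (Int.*-zeroˡ _))
            (trans (cong (λ s → s * aa j₁ j₂ n * 𝟙 (λd j₁ j₂ d ≟Λ κ j₁ j₂ n) * weight (↑ d ⊗ ↑ n)) (Int.*-zeroˡ _))
            (trans (cong (λ s → s * 𝟙 (λd j₁ j₂ d ≟Λ κ j₁ j₂ n) * weight (↑ d ⊗ ↑ n)) (Int.*-zeroˡ _))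
            (trans (cong (_* weight (↑ d ⊗ ↑ n)) (Int.*-zeroˡ _)) (Int.*-zeroˡ _)))))

        digits : ∀ d n → d ∈ ds → n ∈ ns → 2 ≤ d → term d n ≡ b d * (𝟙 (leastFactor d ℕP.<? suc (leastFactor n)) * Wx (d ℕ.* n))
        digits d n d∈ n∈ 2≤d = sym (trans (cong (b d *_) (cong₂ _*_ (compare-digits K (leastFactor d) (suc (leastFactor n))
                (ℕP.<-trans (ℕP.n<1+n _) (leastFactor-small d (1≤d d∈) (d<q d∈))) (leastFactor-small n (1≤n n∈) (n<q n∈)))
              (cong₂ _*_ (trans (sym (cut-< d n (1≤d d∈) (1≤n n∈))) (compare-digits K n (cut d) (ℕP.<-trans (n<q n∈) q<2^K) (cut-small d (1≤d d∈)))) (cong weight (↑-* d n)))))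
          (trans (cong (b d *_) (trans (sym (∑-*ʳ (upTo K) _ _)) (∑-cong (upTo K) (λ j₁ → trans (cong (A j₁ *_) (sym (∑-*ʳ (upTo K) (weight (↑ d ⊗ ↑ n)) B))) (sym (∑-*ˡ (upTo K) (A j₁) _))))))
            (trans (sym (∑-*ˡ (upTo K) (b d) _)) (∑-cong (upTo K) (λ j₁ → trans (sym (∑-*ˡ (upTo K) (b d) _)) (∑-cong (upTo K) (λ j₂ →
              trans (reorder (b d) (even (prefix j₁ (leastFactor d))) (odd (prefix j₁ (suc (leastFactor n)))) (even (prefix j₂ n)) (odd (prefix j₂ (cut d))) _ _ (weight (↑ d ⊗ ↑ n)))
                (cong (λ s → bb j₁ j₂ d * aa j₁ j₂ n * s * weight (↑ d ⊗ ↑ n)) (sym (same-label j₁ j₂))))))))))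
          where
          A B : ℕ → ℤ
          A j = even (prefix j (leastFactor d)) * odd (prefix j (suc (leastFactor n))) * 𝟙 (prefix j (leastFactor d) ℕ./ 2 ℕP.≟ prefix j (suc (leastFactor n)) ℕ./ 2)
          B j = even (prefix j n) * odd (prefix j (cut d)) * 𝟙 (prefix j n ℕ./ 2 ℕP.≟ prefix j (cut d) ℕ./ 2)
          same-label : ∀ j₁ j₂ → 𝟙 (λd j₁ j₂ d ≟Λ κ j₁ j₂ n) ≡
            𝟙 (prefix j₁ (leastFactor d) ℕ./ 2 ℕP.≟ prefix j₁ (suc (leastFactor n)) ℕ./ 2) * 𝟙 (prefix j₂ n ℕ./ 2 ℕP.≟ prefix j₂ (cut d) ℕ./ 2)
          same-label j₁ j₂ = 𝟙-× (λd j₁ j₂ d ≟Λ κ j₁ j₂ n) (prefix j₁ (leastFactor d) ℕ./ 2 ℕP.≟ prefix j₁ (suc (leastFactor n)) ℕ./ 2) (prefix j₂ n ℕ./ 2 ℕP.≟ prefix j₂ (cut d) ℕ./ 2)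
            (λ e → cong proj₁ e , sym (cong proj₂ e)) (λ e e′ → cong₂ _,_ e (sym e′))

        sifted-term : ∀ d n → d ∈ ds → n ∈ ns → b d * (𝟙 (rough? (leastFactor d) n) * Wx (d ℕ.* n)) ≡ term d n
        sifted-term d n d∈ n∈ = go (b-ok d)
          where
          go : b d ≡ 0ℤ ⊎ (abs (b d) ℤ.≤ 1ℤ × 2 ≤ d × d ≤ N) → b d * (𝟙 (rough? (leastFactor d) n) * Wx (d ℕ.* n)) ≡ term d n
          go (inj₁ eq) = trans (trans (cong (_* (𝟙 (rough? (leastFactor d) n) * Wx (d ℕ.* n))) eq) (Int.*-zeroˡ _)) (sym (b-zero d n eq))
          go (inj₂ (_ , 2≤d , d≤N)) = trans (cong (b d *_) (same n (1≤n n∈))) (sym (digits d n d∈ n∈ 2≤d))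
            where
            same : ∀ n → 1 ≤ n → 𝟙 (rough? (leastFactor d) n) * Wx (d ℕ.* n) ≡ 𝟙 (leastFactor d ℕP.<? suc (leastFactor n)) * Wx (d ℕ.* n)
            -- At `n = 1` the value of `leastFactor` has no meaning, but the weight vanishes at
            -- `d ≤ N`.
            same (suc zero) _ = trans (trans (cong (𝟙 (rough? (leastFactor d) 1) *_) zero′) (Int.*-zeroʳ _)) (sym (trans (cong (𝟙 (leastFactor d ℕP.<? suc (leastFactor 1)) *_) zero′) (Int.*-zeroʳ _)))
              where
              zero′ : Wx (d ℕ.* 1) ≡ 0ℤ
              zero′ = Wx-small (d ℕ.* 1) (subst (_≤ N) (sym (ℕP.*-identityʳ d)) d≤N)
            same n@(suc (suc _)) _ = cong (_* Wx (d ℕ.* n)) (trans (rough⇔≤leastFactor (leastFactor d) n (s≤s (s≤s z≤n)))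
              (𝟙-cong (leastFactor d ℕP.≤? leastFactor n) (leastFactor d ℕP.<? suc (leastFactor n)) s≤s ℕP.≤-pred))

      -- The range of `n` may be cut at `L = 2N / M`, since `d ≥ M`; the exact condition `d n ≤ 2N`
      -- is kept by `cut`.
      block-pieces : ∑ (block k) (λ d → b d * ∑ (range X) (λ y → 𝟙 (rough? (leastFactor d) y) * Wx (d ℕ.* y))) ≡ ∑ (upTo K) (λ j₁ → ∑ (upTo K) (λ j₂ → piece j₁ j₂))
      block-pieces = trans (∑-cong-∈ ds (λ d d∈ → trans (cong (b d *_) (∑-range-extend L X _ (ℕD.m/n≤m X M) (λ y L<y →
              trans (cong (𝟙 (rough? (leastFactor d) y) *_) (Wx-0 (d ℕ.* y) (λ (_ , r) → ℕP.<⇒≱ (beyond d y (M≤d d∈) L<y) r))) (Int.*-zeroʳ _))))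
            (trans (sym (∑-*ˡ ns (b d) _)) (∑-cong-∈ ns (λ n n∈ → sifted-term d n d∈ n∈)))))
          (trans (∑-cong ds (λ d → trans (∑-swap ns (upTo K) _) (∑-cong (upTo K) (λ j₁ → ∑-swap ns (upTo K) _))))
            (trans (∑-swap ds (upTo K) _) (∑-cong (upTo K) (λ j₁ → ∑-swap ds (upTo K) _))))
        where
        beyond : ∀ d y → M ≤ d → L < y → X < d ℕ.* y
        beyond d y M≤d L<y = ℕP.<-≤-trans (subst (_< M ℕ.* suc L) (sym (ℕD.m≡m%n+[m/n]*n X M)) (ℕP.<-≤-trans (ℕP.+-monoˡ-< (L ℕ.* M) (ℕD.m%n<n X M)) (ℕP.≤-reflexive (trans (cong (M ℕ.+_) (ℕP.*-comm L M)) (sym (ℕP.*-suc M L)))))) (ℕP.*-mono-≤ M≤d L<y)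

      module Bound (V T τ : ℕ) .{{_ : NonZero V}} (V<q : V < q) (4M<q : (M ℕ.+ M) ℕ.+ (M ℕ.+ M) < q)
        (T-large : (q ℕ./ V) ℕ.* ((M ℕ.+ M) ℕ.* (M ℕ.+ M)) ℕ.+ V ℕ.* ((M ℕ.+ M) ℕ.+ (M ℕ.+ M)) ≤ T ℕ.* q)
        (cover : ∀ n → NonZero n → n ≤ q ℕ.* (T ℕ.* q) ℕ.+ V ℕ.* V → ∃ λ xs → Divisors.CoversDivisors n xs × length xs ≤ τ) (1≤h : 1 ≤ h) where

        private
          ds-simple : ℕMult.Simple ds
          ds-simple x = ≤-trans (≤-reflexive (∑-applyUpTo (M ℕ.+_) M _)) (≤-trans (∑-mono (upTo M) (λ i → 𝟙-mono (M ℕ.+ i ℕP.≟ x) (i ℕP.≟ x ℕ.∸ M) (λ e → trans (sym (ℕP.m+n∸m≡n M i)) (cong (ℕ._∸ M) e)))) (upTo-simple M (x ℕ.∸ M)))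

          module E = EnergyBound 𝔽
          ν : ℕ
          ν = (T ℕ.+ suc T) ℕ.* (τ ℕ.+ τ)

          energy≤ : ∑ ds (λ d₁ → ∑ ds (λ d₂ → ∑ ds (λ d₃ → ∑ ds (λ d₄ →
            𝟙 ((↑ d₄ ⁻¹ ⊖ ↑ d₃ ⁻¹) ⊖ (↑ d₂ ⁻¹ ⊖ ↑ d₁ ⁻¹) ≟ 𝟎))))) ℤ.≤ + (M ℕ.* (M ℕ.* ν))
          energy≤ = ≤-trans (E.energy-bound V (M ℕ.+ M) T τ V<q 4M<q T-large cover ds ds-simple (λ d d∈ → 1≤d d∈ , ℕP.<⇒≤ (proj₂ (∈-block⁻ {k} d∈))))
            (≤-reflexive (cong (λ m → + (m ℕ.* (m ℕ.* ν))) (length-block k)))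

          -- The difference `n - m` shifted by `L`, which keeps it a natural number below `L + L`;
          -- the shift is undone in the field.
          gap : ℕ → ℕ → ℕ
          gap m n = n ℕ.+ L ℕ.∸ m

          m≤n+L : ∀ {m} n → m ∈ ns → m ≤ n ℕ.+ L
          m≤n+L n m∈ = ℕP.≤-trans (n≤L m∈) (ℕP.m≤n+m L n)

          gap-↑ : ∀ m n → m ∈ ns → n ∈ ns → ↑ (gap m n) ⊖ ↑ L ≡ ↑ n ⊖ ↑ m
          gap-↑ m n m∈ n∈ = trans (cong (_⊖ ↑ L) (trans (sym (↑-∸ (n ℕ.+ L) m (m≤n+L n m∈))) (cong (_⊖ ↑ m) (↑-+ n L))))
            (solve 3 (λ n L m → n :+ L :- m :- L := n :- m) refl (↑ n) (↑ L) (↑ m))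

          gap-mult : ∀ m n → m ∈ ns → n ∈ ns → ℕMult.mult vs (gap m n) ≡ 1ℤ
          gap-mult m n m∈ n∈ = mult-upTo (L ℕ.+ L) (gap m n) (ℕP.<-≤-trans (ℕP.∸-monoʳ-< {n ℕ.+ L} {m} {0} (1≤n m∈) (m≤n+L n m∈)) (ℕP.+-monoˡ-≤ L (n≤L n∈)))

          sum≢0 : ∀ m n → m ∈ ns → n ∈ ns → ↑ m ⊕ ↑ n ≢ 𝟎
          sum≢0 m n m∈ n∈ eq = ↑≢0 (m ℕ.+ n) (ℕP.≤-trans (1≤n m∈) (ℕP.m≤m+n m n)) (ℕP.≤-<-trans (ℕP.+-mono-≤ (n≤L m∈) (n≤L n∈)) 2L<q) (trans (↑-+ m n) eq)

          κ-mult : ∀ j₁ j₂ n → n ∈ ns → Multiplicity.mult _≟Λ_ ls (κ j₁ j₂ n) ≡ 1ℤ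
          κ-mult j₁ j₂ n n∈ = trans (mult-cartesian ℕP._≟_ ℕP._≟_ (upTo (2 ^ K)) (upTo (2 ^ K)) _ _) (trans (cong₂ _*_
            (mult-upTo (2 ^ K) _ (ℕP.≤-<-trans (ℕP.≤-trans (ℕD.m/n≤m (prefix j₁ (suc (leastFactor n))) 2) (prefix≤ j₁ (suc (leastFactor n)))) (leastFactor-small n (1≤n n∈) (n<q n∈))))
            (mult-upTo (2 ^ K) _ (ℕP.≤-<-trans (ℕP.≤-trans (ℕD.m/n≤m (prefix j₂ n) 2) (prefix≤ j₂ n)) (ℕP.<-trans (n<q n∈) q<2^K)))) (Int.*-identityˡ 1ℤ))

          𝟙-abs : ∀ {A : Set} (d : Dec A) → abs (𝟙 d) ℤ.≤ 1ℤ
          𝟙-abs d = ≤-trans (≤-reflexive (Int.abs-nonneg (0≤𝟙 d))) (𝟙≤1 d)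

          abs-*≤1 : ∀ {x y} → abs x ℤ.≤ 1ℤ → abs y ℤ.≤ 1ℤ → abs (x * y) ℤ.≤ 1ℤ
          abs-*≤1 {x} {y} p r = ≤-trans (≤-reflexive (Int.abs-* x y)) (≤-trans (*-mono-nonneg (Int.0≤abs x) p (Int.0≤abs y) r) (≤-reflexive (Int.*-identityˡ 1ℤ)))

          b≤1 : ∀ d → abs (b d) ℤ.≤ 1ℤ
          b≤1 d = go (b-ok d)
            where
            go : b d ≡ 0ℤ ⊎ (abs (b d) ℤ.≤ 1ℤ × 2 ≤ d × d ≤ N) → abs (b d) ℤ.≤ 1ℤ
            go (inj₁ eq) = ≤-trans (≤-reflexive (trans (cong abs eq) (Int.abs-nonneg ≤-refl))) 0≤+ₙ
            go (inj₂ (le , _)) = le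

          module Bi (j₁ j₂ : ℕ) = Bilinear (χ₁ 0 1) χₐ (χ₂ 0 1) R mean (indicator-idem (start? 0 1)) (indicator-idem primeHere?) (indicator-idem (λ j → window? 0 (1 ℕ.* j)))
            c c≢0 ℕP._≟_ ℕP._≟_ _≟Λ_ ds ns vs ls ↑ ↑ (λ v → ↑ v ⊖ ↑ L) (λ d d∈ → ↑≢0 d (1≤d d∈) (d<q d∈)) (λ n n∈ → ↑≢0 n (1≤n n∈) (n<q n∈))
            (range-simple L) (λ m n m∈ n∈ → ↑-inj m n (n<q m∈) (n<q n∈)) sum≢0 gap gap-↑ gap-mult (λd j₁ j₂) (κ j₁ j₂) (κ-mult j₁ j₂)
            (simple-cartesian ℕP._≟_ ℕP._≟_ (upTo (2 ^ K)) (upTo (2 ^ K)) (upTo-simple (2 ^ K)) (upTo-simple (2 ^ K)))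
            (bb j₁ j₂) (aa j₁ j₂) (λ d → abs-*≤1 (abs-*≤1 (b≤1 d) (𝟙-abs (prefix j₁ (leastFactor d) ℕ.% 2 ℕP.≟ 0))) (𝟙-abs (prefix j₂ (cut d) ℕ.% 2 ℕP.≟ 1)))
            (λ n → abs-*≤1 (𝟙-abs (prefix j₁ (suc (leastFactor n)) ℕ.% 2 ℕP.≟ 1)) (𝟙-abs (prefix j₂ n ℕ.% 2 ℕP.≟ 0)))

        Ψ I : ℤ
        Ψ = norm² R
        I = + (3 ℕ.* N)

        -- A bound for an eighth power: the squared piece is raised to the fourth power, to match
        -- the fourth-power bound for the off-diagonal part.
        C₂ : ℤ
        C₂ = pow4 (+ M * (+ (2 ℕ.* h) * P)) * (+ 8 * (pow4 (+ L * (+ M * (I * Ψ))) +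
          (+ L * + L) * (+ L * + L) * (+ L * + L) * (Ψ * Ψ * Ψ * (+ (L ℕ.+ L) * (+ (M ℕ.* (M ℕ.* ((T ℕ.+ suc T) ℕ.* (τ ℕ.+ τ)))) * (I * I * (I * I) * (size′ * Ψ)))))))

        piece-bound : ∀ j₁ j₂ → pow4 (piece j₁ j₂ * piece j₁ j₂) ℤ.≤ C₂
        piece-bound j₁ j₂ = ≤-trans (pow4-mono (Int.0≤sq (piece j₁ j₂)) (≤-trans (Bi.bilinear² j₁ j₂) (*-monoʳ 0≤do A≤)))
          (≤-trans (≤-reflexive (pow4-product _ _)) (*-monoˡ (0≤pow4 _) (≤-trans (pow4-+ 0≤diag 0≤off) (*-monoˡ 0≤+ₙ (Int.+-mono-≤ diag⁴ off⁴)))))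
          where
          i : ℤ
          i = ∑F (χ₂ 0 1)
          0≤Ψ : 0ℤ ℤ.≤ Ψ
          0≤Ψ = 0≤norm² R
          0≤i : 0ℤ ℤ.≤ i
          0≤i = ∑-nonneg elems (λ t → 0≤𝟙 (window? 0 (1 ℕ.* rep t)))
          i≤I : i ℤ.≤ I
          i≤I = ≤-trans (∑χ₂ 0 1) (ℤ.+≤+ (ℕP.≤-trans (ℕP.≤-reflexive (cong (ℕ._+ 2) (ℕD.n/1≡n N))) (ℕP.+-monoʳ-≤ N (ℕP.+-mono-≤ 1≤N (ℕP.≤-trans 1≤N (ℕP.≤-reflexive (sym (ℕP.+-identityʳ N))))))))
          χ₁≤ : ∑F (χ₁ 0 1) ℤ.≤ + (2 ℕ.* h)
          χ₁≤ = ≤-trans (∑χ₁ 0 1) (ℤ.+≤+ (ℕP.≤-trans (ℕP.≤-reflexive (cong suc (ℕD.n/1≡n h))) (ℕP.+-mono-≤ 1≤h (ℕP.≤-reflexive (sym (ℕP.+-identityʳ h))))))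
          A≤ : + length ds * (∑F (χ₁ 0 1) * ∑F χₐ) ℤ.≤ + M * (+ (2 ℕ.* h) * P)
          A≤ = ≤-trans (≤-reflexive (cong (λ n → + n * (∑F (χ₁ 0 1) * ∑F χₐ)) (length-block k))) (*-monoˡ 0≤+ₙ (*-monoʳ 0≤P χ₁≤))
          0≤diag : 0ℤ ℤ.≤ Bi.diagonal j₁ j₂
          0≤diag = 0≤* 0≤+ₙ (0≤* 0≤+ₙ (0≤* 0≤i 0≤Ψ))
          0≤off : 0ℤ ℤ.≤ Bi.offDiagonal j₁ j₂
          0≤off = ∑-nonneg ns (λ n → ∑-nonneg ns (λ n′ → 0≤* (0≤𝟙 (¬? (n ℕP.≟ n′))) (Int.0≤abs _)))
          0≤do : 0ℤ ℤ.≤ Bi.diagonal j₁ j₂ + Bi.offDiagonal j₁ j₂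
          0≤do = Int.0≤+ 0≤diag 0≤off
          diag⁴ : pow4 (Bi.diagonal j₁ j₂) ℤ.≤ pow4 (+ L * (+ M * (I * Ψ)))
          diag⁴ = pow4-mono 0≤diag (≤-trans (≤-reflexive (cong₂ (λ l m → + l * (+ m * (i * Ψ))) (length-range L) (length-block k))) (*-monoˡ 0≤+ₙ (*-monoˡ 0≤+ₙ (*-monoʳ 0≤Ψ i≤I))))
          off⁴ : pow4 (Bi.offDiagonal j₁ j₂) ℤ.≤ (+ L * + L) * (+ L * + L) * (+ L * + L) * (Ψ * Ψ * Ψ * (+ (L ℕ.+ L) * (+ (M ℕ.* (M ℕ.* ((T ℕ.+ suc T) ℕ.* (τ ℕ.+ τ)))) * (I * I * (I * I) * (size′ * Ψ)))))
          off⁴ = ≤-trans (Bi.offDiagonal⁴ j₁ j₂) (≤-trans (≤-reflexive (cong₂ (λ l v → (+ l * + l) * (+ l * + l) * (+ l * + l) * (Ψ * Ψ * Ψ * (+ v * (Bi.energy j₁ j₂ * (i * i * (i * i) * (size′ * Ψ)))))) (length-range L) (length-upTo (L ℕ.+ L))))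
            (*-monoˡ (0≤* (0≤* (Int.0≤sq (+ L)) (Int.0≤sq (+ L))) (Int.0≤sq (+ L))) (*-monoˡ (0≤* (Int.0≤sq Ψ) 0≤Ψ) (*-monoˡ 0≤+ₙ
              (*-mono-nonneg (∑-nonneg ds (λ _ → ∑-nonneg ds (λ _ → ∑-nonneg ds (λ _ → ∑-nonneg ds (λ _ → 0≤𝟙 (_ ≟ 𝟎)))))) energy≤
                (0≤* (Int.0≤sq (i * i)) (0≤* 0≤+ₙ 0≤Ψ)) (*-monoʳ (0≤* 0≤+ₙ 0≤Ψ) (Int.sq-mono (Int.0≤sq i) (Int.sq-mono 0≤i i≤I))))))))

-- Monomials and their exponent vectors.

module Mono where

  open import Data.Nat
  open import Data.Nat.Properties
  open import Data.Nat.Tactic.RingSolver using (solve-∀)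
  open import Data.Fin using (Fin; zero; suc)
  open import Data.Fin.Patterns using (1F; 2F; 3F; 4F; 5F; 6F)
  open import Data.Vec using (Vec; []; _∷_; lookup; zipWith; map; replicate)
  open import Relation.Binary.PropositionalEquality
  open NatPow

  -- Monomials are compared through exponent vectors, since multiplying out powers with exponents
  -- in the hundreds is infeasible.
  infixl 7 _⊙_
  infixr 8 _⇑_

  data Mon (n : ℕ) : Set where
    var : Fin n → Mon n
    _⊙_ : Mon n → Mon n → Mon n
    _⇑_ : Mon n → ℕ → Mon n

  ⟦_⟧ : ∀ {n} → Mon n → Vec ℕ n → ℕ
  ⟦ var i ⟧ ρ = lookup ρ i
  ⟦ a ⊙ b ⟧ ρ = ⟦ a ⟧ ρ * ⟦ b ⟧ ρ
  ⟦ a ⇑ k ⟧ ρ = ⟦ a ⟧ ρ ^ k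

  unit : ∀ {n} → Fin n → Vec ℕ n
  unit zero = 1 ∷ replicate _ 0
  unit (suc i) = 0 ∷ unit i

  exponents : ∀ {n} → Mon n → Vec ℕ n
  exponents (var i) = unit i
  exponents (a ⊙ b) = zipWith _+_ (exponents a) (exponents b)
  exponents (a ⇑ k) = map (_* k) (exponents a)

  value : ∀ {n} → Vec ℕ n → Vec ℕ n → ℕ
  value [] [] = 1
  value (e ∷ es) (x ∷ ρ) = x ^ e * value es ρ

  value-0 : ∀ {n} (ρ : Vec ℕ n) → value (replicate n 0) ρ ≡ 1
  value-0 [] = refl
  value-0 (x ∷ ρ) = trans (*-identityˡ _) (value-0 ρ)

  value-unit : ∀ {n} (i : Fin n) ρ → value (unit i) ρ ≡ lookup ρ i
  value-unit zero (x ∷ ρ) = trans (cong₂ _*_ (*-identityʳ x) (value-0 ρ)) (*-identityʳ x)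
  value-unit (suc i) (x ∷ ρ) = trans (*-identityˡ _) (value-unit i ρ)

  value-* : ∀ {n} (d e ρ : Vec ℕ n) → value (zipWith _+_ d e) ρ ≡ value d ρ * value e ρ
  value-* [] [] [] = refl
  value-* (d ∷ ds) (e ∷ es) (x ∷ ρ) = trans (cong₂ _*_ (^-distribˡ-+-* x d e) (value-* ds es ρ)) (lem (x ^ d) (x ^ e) (value ds ρ) (value es ρ))
    where
    lem : ∀ a b c d → a * b * (c * d) ≡ a * c * (b * d)
    lem = solve-∀

  value-^ : ∀ {n} (e : Vec ℕ n) k ρ → value (map (_* k) e) ρ ≡ value e ρ ^ k
  value-^ [] k [] = sym (^-zeroˡ k)
  value-^ (e ∷ es) k (x ∷ ρ) = trans (cong₂ _*_ (sym (^-*-assoc x e k)) (value-^ es k ρ)) (sym (*-^ (x ^ e) (value es ρ) k))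

  value-exponents : ∀ {n} (a : Mon n) ρ → ⟦ a ⟧ ρ ≡ value (exponents a) ρ
  value-exponents (var i) ρ = sym (value-unit i ρ)
  value-exponents (a ⊙ b) ρ = trans (cong₂ _*_ (value-exponents a ρ) (value-exponents b ρ)) (sym (value-* (exponents a) (exponents b) ρ))
  value-exponents (a ⇑ k) ρ = trans (cong (_^ k) (value-exponents a ρ)) (sym (value-^ (exponents a) k ρ))

  monomials : ∀ {n} (ρ : Vec ℕ n) (a b : Mon n) → exponents a ≡ exponents b → ⟦ a ⟧ ρ ≡ ⟦ b ⟧ ρ
  monomials ρ a b eq = trans (value-exponents a ρ) (trans (cong (λ e → value e ρ) eq) (sym (value-exponents b ρ)))

  monomials-≤ : ∀ {n} (ρ : Vec ℕ n) (a b : Mon n) → exponents a ≡ exponents b → ⟦ a ⟧ ρ ≤ ⟦ b ⟧ ρ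
  monomials-≤ ρ a b eq = ≤-reflexive (monomials ρ a b eq)

  v₀ : ∀ {n} → Mon (suc n)
  v₀ = var zero
  v₁ : ∀ {n} → Mon (suc (suc n))
  v₁ = var 1F
  v₂ : ∀ {n} → Mon (suc (suc (suc n)))
  v₂ = var 2F
  v₃ : ∀ {n} → Mon (suc (suc (suc (suc n))))
  v₃ = var 3F
  v₄ : ∀ {n} → Mon (suc (suc (suc (suc (suc n)))))
  v₄ = var 4F
  v₅ : ∀ {n} → Mon (suc (suc (suc (suc (suc (suc n))))))
  v₅ = var 5F
  v₆ : ∀ {n} → Mon (suc (suc (suc (suc (suc (suc (suc n)))))))
  v₆ = var 6F

-- Numerical consequences of the two bounds.

module Numerics where

  open import Data.Nat
  open import Data.Nat.Properties
  open import Data.Bool using (T)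
  open import Data.Vec using ([]; _∷_)
  open import Relation.Binary.PropositionalEquality
  open Mono

  sq4 : ℕ → ℕ
  sq4 a = a * a * (a * a)

  boundI : ℕ → ℕ → ℕ → ℕ → ℕ
  boundI h p m N = (2 * h * p) * (2 * h * p) * (6 * m * (3 * N * (3 * N) * (3 * N)))

  boundII : (M L N h p ν ψ q : ℕ) → ℕ
  boundII M L N h p ν ψ q = sq4 (M * (2 * h * p)) * (8 * (sq4 (L * (M * (3 * N * ψ))) +
    (L * L) * (L * L) * (L * L) * (ψ * ψ * ψ * ((L + L) * (M * (M * ν) * (3 * N * (3 * N) * (3 * N * (3 * N)) * (q * ψ)))))))

  sq4-mono : ∀ {a b} → a ≤ b → sq4 a ≤ sq4 b
  sq4-mono p = *-mono-≤ (*-mono-≤ p p) (*-mono-≤ p p)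

  module _ {K g M L N q p h ν : ℕ} (16≤g : 16 ≤ g) (K≤g : K ≤ g) (LM≤2N : L * M ≤ 2 * N) (N≤gp : N ≤ g * p) (N≤4gh : N ≤ 4 * (g * h))
    (0<M : 0 < M) (0<N : 0 < N) where

    private
      small : ∀ c {_ : T (c ≤ᵇ 16)} → c ≤ g
      small c {e} = ≤-trans (≤ᵇ⇒≤ c 16 e) 16≤g

      instance
        g≢0 : NonZero g
        g≢0 = >-nonZero (≤-trans (s≤s z≤n) 16≤g)
        M≢0 : NonZero M
        M≢0 = >-nonZero 0<M
        N≢0 : NonZero N
        N≢0 = >-nonZero 0<N

      3N≤ : 3 * N ≤ g * N
      3N≤ = *-monoˡ-≤ N (small 3)

      2hp≤ : 2 * h * p ≤ g * h * p
      2hp≤ = *-monoˡ-≤ p (*-monoˡ-≤ h (small 2))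

      LM≤gN : L * M ≤ g * N
      LM≤gN = ≤-trans LM≤2N (*-monoˡ-≤ N (small 2))

      N≤ggh : N ≤ g * (g * h)
      N≤ggh = ≤-trans N≤4gh (*-monoˡ-≤ (g * h) (small 4))

      double : ∀ x → x + x ≤ g * x
      double x = ≤-trans (≤-reflexive (cong (x +_) (sym (+-identityʳ x)))) (*-monoˡ-≤ x (small 2))

      A B : ℕ
      A = g ^ 8 * (N ^ 8 * q ^ 8 * p ^ 4)
      B = g ^ 5 * (L ^ 7 * M ^ 2) * ν * (N ^ 4 * q ^ 9 * p ^ 4)

      boundII≤ : boundII M L N h p ν (q * q * p) q ≤ sq4 (M * (g * h * p)) * (g * (A + B))
      boundII≤ = *-mono-≤ (sq4-mono (*-monoʳ-≤ M 2hp≤)) (*-mono-≤ (small 8) (+-mono-≤ first second))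
        where
        first : sq4 (L * (M * (3 * N * (q * q * p)))) ≤ A
        first = ≤-trans (sq4-mono (≤-trans (≤-reflexive (sym (*-assoc L M _))) (*-mono-≤ LM≤gN (*-monoˡ-≤ (q * q * p) 3N≤))))
          (monomials-≤ (g ∷ N ∷ q ∷ p ∷ []) (sq4′ (v₀ ⊙ v₁ ⊙ (v₀ ⊙ v₁ ⊙ (v₂ ⊙ v₂ ⊙ v₃)))) (v₀ ⇑ 8 ⊙ (v₁ ⇑ 8 ⊙ v₂ ⇑ 8 ⊙ v₃ ⇑ 4)) refl)
          where
          sq4′ : ∀ {n} → Mon n → Mon n
          sq4′ a = a ⊙ a ⊙ (a ⊙ a)
        ψ : ∀ {n} → Mon n → Mon n → Mon n
        ψ q p = q ⊙ q ⊙ p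
        second : (L * L) * (L * L) * (L * L) * (q * q * p * (q * q * p) * (q * q * p) * ((L + L) * (M * (M * ν) * (3 * N * (3 * N) * (3 * N * (3 * N)) * (q * (q * q * p)))))) ≤ B
        second = ≤-trans (*-monoʳ-≤ ((L * L) * (L * L) * (L * L)) (*-monoʳ-≤ (q * q * p * (q * q * p) * (q * q * p)) (*-mono-≤ (double L) (*-monoʳ-≤ (M * (M * ν)) (*-monoˡ-≤ (q * (q * q * p)) (sq4-mono 3N≤))))))
          (monomials-≤ (L ∷ g ∷ M ∷ N ∷ q ∷ p ∷ ν ∷ [])
            ((v₀ ⊙ v₀) ⊙ (v₀ ⊙ v₀) ⊙ (v₀ ⊙ v₀) ⊙ (ψ v₄ v₅ ⊙ ψ v₄ v₅ ⊙ ψ v₄ v₅ ⊙ (v₁ ⊙ v₀ ⊙ (v₂ ⊙ (v₂ ⊙ v₆) ⊙ ((v₁ ⊙ v₃) ⊙ (v₁ ⊙ v₃) ⊙ ((v₁ ⊙ v₃) ⊙ (v₁ ⊙ v₃)) ⊙ (v₄ ⊙ ψ v₄ v₅))))))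
            (v₁ ⇑ 5 ⊙ (v₀ ⇑ 7 ⊙ v₂ ⇑ 2) ⊙ v₆ ⊙ (v₃ ⇑ 4 ⊙ v₄ ⇑ 9 ⊙ v₅ ⇑ 4)) refl)

      N²⁰≤ : N ^ 20 ≤ g ^ 32 * (p ^ 8 * h ^ 12)
      N²⁰≤ = ≤-trans (≤-reflexive (^-distribˡ-+-* N 8 12)) (≤-trans (*-mono-≤ (^-monoˡ-≤ 8 N≤gp) (^-monoˡ-≤ 12 N≤ggh))
        (monomials-≤ (g ∷ p ∷ h ∷ []) ((v₀ ⊙ v₁) ⇑ 8 ⊙ (v₀ ⊙ (v₀ ⊙ v₂)) ⇑ 12) (v₀ ⇑ 32 ⊙ (v₁ ⇑ 8 ⊙ v₂ ⇑ 12)) refl))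

      N¹⁰≤ : N ^ 10 ≤ g ^ 16 * (p ^ 4 * h ^ 6)
      N¹⁰≤ = ≤-trans (≤-reflexive (^-distribˡ-+-* N 4 6)) (≤-trans (*-mono-≤ (^-monoˡ-≤ 4 N≤gp) (^-monoˡ-≤ 6 N≤ggh))
        (monomials-≤ (g ∷ p ∷ h ∷ []) ((v₀ ⊙ v₁) ⇑ 4 ⊙ (v₀ ⊙ (v₀ ⊙ v₂)) ⇑ 6) (v₀ ⇑ 16 ⊙ (v₁ ⇑ 4 ⊙ v₂ ⇑ 6)) refl))

    -- The two hypotheses serve the diagonal and the off-diagonal part. The exponent 82 collects the
    -- losses of the second: 70 from the prefactors, 5 from its own constants and 7 from
    -- `L M ≤ g N`; the first loses only 78.
    typeII-numeric : g ^ 82 * (M ^ 4 * q ^ 8) ≤ N ^ 12 → g ^ 82 * (ν * q ^ 9) ≤ M * N ^ 9 →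
      (2 * (K * K * K)) ^ 8 * boundII M L N h p ν (q * q * p) q ≤ (p * p * (h * h)) ^ 8
    -- The extra `M` lets `L` and `M` enter the second term as `(L M) ^ 7`; the extra `g ^ 33` pays
    -- for a factor 2 and for replacing `N ^ 20` by powers of `p` and `h`.
    typeII-numeric i ii = *-cancelˡ-≤ (M * (g * g ^ 32)) {{m*n≢0 M (g * g ^ 32) {{M≢0}} {{m*n≢0 g (g ^ 32) {{g≢0}} {{m^n≢0 g 32}}}}}}
      (≤-trans (*-monoʳ-≤ (M * (g * g ^ 32)) (*-mono-≤ (^-monoˡ-≤ 8 (*-mono-≤ (small 2) (*-mono-≤ (*-mono-≤ K≤g K≤g) K≤g))) boundII≤))
        (≤-trans (≤-reflexive (monomials (g ∷ M ∷ h ∷ p ∷ A + B ∷ []) (v₁ ⊙ (v₀ ⊙ v₀ ⇑ 32) ⊙ ((v₀ ⊙ (v₀ ⊙ v₀ ⊙ v₀)) ⇑ 8 ⊙ (sq4′ (v₁ ⊙ (v₀ ⊙ v₂ ⊙ v₃)) ⊙ (v₀ ⊙ v₄))))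
            (v₂ ⇑ 4 ⊙ v₃ ⇑ 4 ⊙ v₀ ⇑ 70 ⊙ v₁ ⇑ 5 ⊙ v₄) refl))
          (≤-trans (≤-reflexive (*-distribˡ-+ (h ^ 4 * p ^ 4 * g ^ 70 * M ^ 5) A B)) (≤-trans (+-mono-≤ first second) (≤-trans (double (h ^ 4 * p ^ 8 * (M * N ^ 20)))
            (≤-trans (*-monoʳ-≤ g (*-monoʳ-≤ (h ^ 4 * p ^ 8) (*-monoʳ-≤ M N²⁰≤)))
              (monomials-≤ (g ∷ M ∷ h ∷ p ∷ []) (v₀ ⊙ (v₂ ⇑ 4 ⊙ v₃ ⇑ 8 ⊙ (v₁ ⊙ (v₀ ⇑ 32 ⊙ (v₃ ⇑ 8 ⊙ v₂ ⇑ 12))))) (v₁ ⊙ (v₀ ⊙ v₀ ⇑ 32) ⊙ (v₃ ⊙ v₃ ⊙ (v₂ ⊙ v₂)) ⇑ 8) refl)))))))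
      where
      sq4′ : ∀ {n} → Mon n → Mon n
      sq4′ a = a ⊙ a ⊙ (a ⊙ a)
      up : ∀ {m n x} → g ^ 82 * x ≤ n → m ≤ 82 → g ^ m * x ≤ n
      up {m} {n} {x} p m≤ = ≤-trans (*-monoˡ-≤ x (^-monoʳ-≤ g m≤)) p
      first : h ^ 4 * p ^ 4 * g ^ 70 * M ^ 5 * A ≤ h ^ 4 * p ^ 8 * (M * N ^ 20)
      first = ≤-trans (≤-reflexive (monomials (g ∷ M ∷ h ∷ p ∷ N ∷ q ∷ []) (v₂ ⇑ 4 ⊙ v₃ ⇑ 4 ⊙ v₀ ⇑ 70 ⊙ v₁ ⇑ 5 ⊙ (v₀ ⇑ 8 ⊙ (v₄ ⇑ 8 ⊙ v₅ ⇑ 8 ⊙ v₃ ⇑ 4))) (v₂ ⇑ 4 ⊙ v₃ ⇑ 8 ⊙ (v₁ ⊙ v₄ ⇑ 8) ⊙ (v₀ ⇑ 78 ⊙ (v₁ ⇑ 4 ⊙ v₅ ⇑ 8))) refl))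
        (≤-trans (*-monoʳ-≤ (h ^ 4 * p ^ 8 * (M * N ^ 8)) (up {78} i (m≤m+n 78 4)))
          (monomials-≤ (M ∷ h ∷ p ∷ N ∷ []) (v₁ ⇑ 4 ⊙ v₂ ⇑ 8 ⊙ (v₀ ⊙ v₃ ⇑ 8) ⊙ v₃ ⇑ 12) (v₁ ⇑ 4 ⊙ v₂ ⇑ 8 ⊙ (v₀ ⊙ v₃ ⇑ 20)) refl))
      second : h ^ 4 * p ^ 4 * g ^ 70 * M ^ 5 * B ≤ h ^ 4 * p ^ 8 * (M * N ^ 20)
      second = ≤-trans (≤-reflexive (monomials (g ∷ M ∷ h ∷ p ∷ L ∷ ν ∷ N ^ 4 * q ^ 9 ∷ []) (v₂ ⇑ 4 ⊙ v₃ ⇑ 4 ⊙ v₀ ⇑ 70 ⊙ v₁ ⇑ 5 ⊙ (v₀ ⇑ 5 ⊙ (v₄ ⇑ 7 ⊙ v₁ ⇑ 2) ⊙ v₅ ⊙ (v₆ ⊙ v₃ ⇑ 4)))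
          (v₂ ⇑ 4 ⊙ v₃ ⇑ 8 ⊙ (v₀ ⇑ 75 ⊙ (v₄ ⊙ v₁) ⇑ 7 ⊙ (v₅ ⊙ v₆)) ) refl))
        (≤-trans (*-monoʳ-≤ (h ^ 4 * p ^ 8) (*-monoˡ-≤ (ν * (N ^ 4 * q ^ 9)) (*-monoʳ-≤ (g ^ 75) (^-monoˡ-≤ 7 LM≤gN))))
          (≤-trans (≤-reflexive (monomials (g ∷ h ^ 4 * p ^ 8 ∷ N ∷ ν ∷ q ∷ []) (v₁ ⊙ (v₀ ⇑ 75 ⊙ (v₀ ⊙ v₂) ⇑ 7 ⊙ (v₃ ⊙ (v₂ ⇑ 4 ⊙ v₄ ⇑ 9)))) (v₁ ⊙ v₂ ⇑ 11 ⊙ (v₀ ⇑ 82 ⊙ (v₃ ⊙ v₄ ⇑ 9))) refl))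
            (≤-trans (*-monoʳ-≤ (h ^ 4 * p ^ 8 * N ^ 11) ii)
              (monomials-≤ (h ^ 4 * p ^ 8 ∷ N ∷ M ∷ []) (v₀ ⊙ v₁ ⇑ 11 ⊙ (v₂ ⊙ v₁ ⇑ 9)) (v₀ ⊙ (v₂ ⊙ v₁ ⇑ 20)) refl))))

    -- The 16 is `2 ^ 4`: twice the sum is compared with the main term in fourth powers.
    typeI-numeric : ∀ {D} → 0 < p → 0 < h → g ^ 27 * (D ^ 3 * q ^ 6) < N ^ 7 →
      16 * (sq4 K * (D * D * D * boundI h p (q * q * ((q * q * p) * (q * q * p))) N)) < sq4 (p * p * (h * h))
    typeI-numeric {D} 0<p 0<h smaller = *-cancelˡ-< (g ^ 16) _ _ (<-≤-trans (≤-<-trans (*-monoʳ-≤ (g ^ 16) left)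
        (≤-<-trans (≤-reflexive (monomials (g ∷ D ∷ h ∷ p ∷ q ∷ N ∷ [])
            (v₀ ⇑ 16 ⊙ (v₀ ⊙ (sq4′ v₀ ⊙ (v₁ ⊙ v₁ ⊙ v₁ ⊙ ((v₀ ⊙ v₂ ⊙ v₃) ⊙ (v₀ ⊙ v₂ ⊙ v₃) ⊙ (v₀ ⊙ (v₄ ⊙ v₄ ⊙ ((v₄ ⊙ v₄ ⊙ v₃) ⊙ (v₄ ⊙ v₄ ⊙ v₃))) ⊙ ((v₀ ⊙ v₅) ⊙ (v₀ ⊙ v₅) ⊙ (v₀ ⊙ v₅))))))))
            (v₂ ⇑ 2 ⊙ v₃ ⇑ 4 ⊙ v₅ ⇑ 3 ⊙ (v₀ ⇑ 27 ⊙ (v₁ ⇑ 3 ⊙ v₄ ⇑ 6))) refl))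
          (*-monoʳ-< (h ^ 2 * p ^ 4 * N ^ 3) {{m*n≢0 (h ^ 2 * p ^ 4) (N ^ 3) {{m*n≢0 (h ^ 2) (p ^ 4) {{m^n≢0 h 2 {{>-nonZero 0<h}}}} {{m^n≢0 p 4 {{>-nonZero 0<p}}}}}} {{m^n≢0 N 3}}}} smaller)))
        (≤-trans (≤-reflexive (monomials (h ^ 2 * p ^ 4 ∷ N ∷ []) (v₀ ⊙ v₁ ⇑ 3 ⊙ v₁ ⇑ 7) (v₀ ⊙ v₁ ⇑ 10) refl))
          (≤-trans (*-monoʳ-≤ (h ^ 2 * p ^ 4) N¹⁰≤)
            (monomials-≤ (g ∷ h ∷ p ∷ []) (v₁ ⇑ 2 ⊙ v₂ ⇑ 4 ⊙ (v₀ ⇑ 16 ⊙ (v₂ ⇑ 4 ⊙ v₁ ⇑ 6))) (v₀ ⇑ 16 ⊙ sq4′ (v₂ ⊙ v₂ ⊙ (v₁ ⊙ v₁))) refl))))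
      where
      sq4′ : ∀ {n} → Mon n → Mon n
      sq4′ a = a ⊙ a ⊙ (a ⊙ a)
      m : ℕ
      m = q * q * ((q * q * p) * (q * q * p))
      left : 16 * (sq4 K * (D * D * D * boundI h p m N)) ≤ g * (sq4 g * (D * D * D * ((g * h * p) * (g * h * p) * (g * m * (g * N * (g * N) * (g * N))))))
      left = *-mono-≤ 16≤g (*-mono-≤ (sq4-mono K≤g) (*-monoʳ-≤ (D * D * D) (*-mono-≤ (*-mono-≤ 2hp≤ 2hp≤) (*-mono-≤ (*-monoˡ-≤ m (small 6)) (*-mono-≤ (*-mono-≤ 3N≤ 3N≤) 3N≤)))))

-- The conditions on the sizes of the blocks.

module Scales where

  open import Data.Nat
  open import Data.Nat.Properties
  open import Data.Nat.DivMod using (m/n*n≤m; m≡m%n+[m/n]*n; m%n<n; m/n≤m)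
  open import Data.Nat.Tactic.RingSolver using (solve-∀)
  open import Data.Product using (∃; _×_; _,_)
  open import Data.Vec using ([]; _∷_)
  open import Data.Sum using (inj₁; inj₂)
  open import Relation.Nullary using (yes; no)
  open import Relation.Binary.PropositionalEquality
  open NatPow
  open Mono

  square-root : ∀ n → ∃ λ s → s * s ≤ n × n < suc s * suc s
  square-root zero = 0 , z≤n , s≤s z≤n
  square-root (suc n) = step (square-root n)
    where
    step : (∃ λ s → s * s ≤ n × n < suc s * suc s) → ∃ λ s → s * s ≤ suc n × suc n < suc s * suc s
    step (s , s²≤n , n<) with suc s * suc s ≤? suc n
    ... | no ≰n = s , ≤-trans s²≤n (n≤1+n n) , ≰⇒> ≰n
    ... | yes ≤n = suc s , ≤n , <-≤-trans (s≤s n<) (*-mono-< {suc s} {suc (suc s)} ≤-refl ≤-refl)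

  module _ {g q N : ℕ} (16≤g : 16 ≤ g) (N<q : N < q) (0<N : 0 < N) (master : g ^ 344 * q ^ 35 ≤ N ^ 36) where

    private
      instance
        g≢0 : NonZero g
        g≢0 = >-nonZero (≤-trans (s≤s z≤n) 16≤g)
        q≢0 : NonZero q
        q≢0 = >-nonZero (≤-trans (s≤s z≤n) N<q)
        N≢0 : NonZero N
        N≢0 = >-nonZero 0<N

      2≤g : 2 ≤ g
      2≤g = ≤-trans (s≤s (s≤s z≤n)) 16≤g

      weaken : ∀ m n {_ : m ≤ 344} {_ : n ≤ 35} → g ^ m * q ^ n ≤ N ^ 36
      weaken m n {m≤} {n≤} = ≤-trans (*-mono-≤ (^-monoʳ-≤ g m≤) (^-monoʳ-≤ q n≤)) master

    -- In fourth powers, `D ≤ q^(1/4)` leaves `q ^ 27` against `N ^ 28`; multiplying by `q ^ 8`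
    -- reaches the exponent 35, and `N ^ 8 ≤ q ^ 8` turns `N ^ 36` back.
    typeI-scale : ∀ {D} → D ^ 4 ≤ q → g ^ 27 * (D ^ 3 * q ^ 6) < N ^ 7
    typeI-scale {D} D⁴≤q = ^-cancelˡ-< 4 (*-cancelʳ-< (q ^ 8) _ _ (≤-<-trans
        (≤-trans (≤-reflexive (monomials (g ∷ q ∷ D ∷ []) ((v₀ ⇑ 27 ⊙ (v₂ ⇑ 3 ⊙ v₁ ⇑ 6)) ⇑ 4 ⊙ v₁ ⇑ 8) (v₀ ⇑ 108 ⊙ v₁ ⇑ 32 ⊙ (v₂ ⇑ 4) ⇑ 3) refl))
          (≤-trans (*-monoʳ-≤ (g ^ 108 * q ^ 32) (^-monoˡ-≤ 3 D⁴≤q)) (monomials-≤ (g ∷ q ∷ []) (v₀ ⇑ 108 ⊙ v₁ ⇑ 32 ⊙ v₁ ⇑ 3) (v₀ ⇑ 108 ⊙ v₁ ⇑ 35) refl)))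
        (<-≤-trans (*-monoˡ-< (q ^ 35) {{m^n≢0 q 35}} (^-monoʳ-< g 2≤g {108} {344} (m≤m+n 109 235)))
          (≤-trans master (≤-trans (≤-reflexive (monomials (N ∷ []) (v₀ ⇑ 36) ((v₀ ⇑ 7) ⇑ 4 ⊙ v₀ ⇑ 8) refl)) (*-monoʳ-≤ ((N ^ 7) ^ 4) (^-monoˡ-≤ 8 (<⇒≤ N<q))))))))

    module _ {M ν : ℕ} (M²≤q : M * M ≤ q) (q≤M⁴ : q ≤ g ^ 2 * M ^ 4) (ν≤ : q * (ν * ν) ≤ g ^ 6 * (q + M ^ 3)) where

      typeII-scale₁ : g ^ 82 * (M ^ 4 * q ^ 8) ≤ N ^ 12
      typeII-scale₁ = ^-cancelˡ-≤ 3 (≤-trans (≤-reflexive (monomials (g ∷ M ∷ q ∷ []) ((v₀ ⇑ 82 ⊙ (v₁ ⇑ 4 ⊙ v₂ ⇑ 8)) ⇑ 3) (v₀ ⇑ 246 ⊙ v₂ ⇑ 24 ⊙ (v₁ ⊙ v₁) ⇑ 6) refl))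
        (≤-trans (*-monoʳ-≤ (g ^ 246 * q ^ 24) (^-monoˡ-≤ 6 M²≤q)) (≤-trans (monomials-≤ (g ∷ q ∷ []) (v₀ ⇑ 246 ⊙ v₁ ⇑ 24 ⊙ v₁ ⇑ 6) (v₀ ⇑ 246 ⊙ v₁ ⇑ 30) refl)
          (≤-trans (weaken 246 30 {m≤m+n 246 98} {m≤m+n 30 5}) (monomials-≤ (N ∷ []) (v₀ ⇑ 36) ((v₀ ⇑ 12) ⇑ 3) refl)))))

      private
        diagonal : g ^ 171 * q ^ 18 ≤ M ^ 2 * N ^ 18
        diagonal = ^-cancelˡ-≤ 2 (≤-trans (≤-reflexive (monomials (g ∷ q ∷ []) ((v₀ ⇑ 171 ⊙ v₁ ⇑ 18) ⇑ 2) (v₀ ⇑ 342 ⊙ v₁ ⇑ 35 ⊙ v₁) refl))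
          (≤-trans (*-monoʳ-≤ (g ^ 342 * q ^ 35) q≤M⁴) (≤-trans (≤-reflexive (monomials (g ∷ q ∷ M ∷ []) (v₀ ⇑ 342 ⊙ v₁ ⇑ 35 ⊙ (v₀ ⇑ 2 ⊙ v₂ ⇑ 4)) (v₂ ⇑ 4 ⊙ (v₀ ⇑ 344 ⊙ v₁ ⇑ 35)) refl))
            (≤-trans (*-monoʳ-≤ (M ^ 4) master) (monomials-≤ (M ∷ N ∷ []) (v₀ ⇑ 4 ⊙ v₁ ⇑ 36) ((v₀ ⇑ 2 ⊙ v₁ ⇑ 18) ⇑ 2) refl)))))
        off-diagonal : g ^ 171 * q ^ 17 * M ≤ N ^ 18
        off-diagonal = ^-cancelˡ-≤ 2 (≤-trans (≤-reflexive (monomials (g ∷ q ∷ M ∷ []) ((v₀ ⇑ 171 ⊙ v₁ ⇑ 17 ⊙ v₂) ⇑ 2) (v₀ ⇑ 342 ⊙ v₁ ⇑ 34 ⊙ (v₂ ⊙ v₂)) refl))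
          (≤-trans (*-monoʳ-≤ (g ^ 342 * q ^ 34) M²≤q) (≤-trans (monomials-≤ (g ∷ q ∷ []) (v₀ ⇑ 342 ⊙ v₁ ⇑ 34 ⊙ v₁) (v₀ ⇑ 342 ⊙ v₁ ⇑ 35) refl)
            (≤-trans (weaken 342 35 {m≤m+n 342 2} {≤-refl}) (monomials-≤ (N ∷ []) (v₀ ⇑ 36) ((v₀ ⇑ 18) ⇑ 2) refl)))))

      -- The two terms in the bound for `ν²` are worst at opposite ends: the constant one uses that
      -- `M` is at least `q^(1/4)` up to a power of `g`, the one growing with `M` uses
      -- `M ≤ q^(1/2)`. The first fixes the exponent `344 = 2 (2 · 82 + 6 + 1) + 2`.
      typeII-scale₂ : g ^ 82 * (ν * q ^ 9) ≤ M * N ^ 9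
      typeII-scale₂ = ^-cancelˡ-≤ 2 (*-cancelˡ-≤ q (≤-trans (≤-reflexive (monomials (g ∷ q ∷ ν ∷ []) (v₁ ⊙ (v₀ ⇑ 82 ⊙ (v₂ ⊙ v₁ ⇑ 9)) ⇑ 2) (v₀ ⇑ 164 ⊙ v₁ ⇑ 18 ⊙ (v₁ ⊙ (v₂ ⊙ v₂))) refl))
        (≤-trans (*-monoʳ-≤ (g ^ 164 * q ^ 18) ν≤) (≤-trans (≤-reflexive (monomials (g ∷ q ∷ q + M ^ 3 ∷ []) (v₀ ⇑ 164 ⊙ v₁ ⇑ 18 ⊙ (v₀ ⇑ 6 ⊙ v₂)) (v₀ ⇑ 170 ⊙ v₁ ⇑ 18 ⊙ v₂) refl)) halves))))
        where
        half₁ : g * (g ^ 170 * q ^ 18 * q) ≤ q * (M * N ^ 9) ^ 2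
        half₁ = ≤-trans (≤-reflexive (monomials (g ∷ q ∷ []) (v₀ ⊙ (v₀ ⇑ 170 ⊙ v₁ ⇑ 18 ⊙ v₁)) (v₁ ⊙ (v₀ ⇑ 171 ⊙ v₁ ⇑ 18)) refl))
          (≤-trans (*-monoʳ-≤ q diagonal) (monomials-≤ (q ∷ M ∷ N ∷ []) (v₀ ⊙ (v₁ ⇑ 2 ⊙ v₂ ⇑ 18)) (v₀ ⊙ (v₁ ⊙ v₂ ⇑ 9) ⇑ 2) refl))
        half₂ : g * (g ^ 170 * q ^ 18 * M ^ 3) ≤ q * (M * N ^ 9) ^ 2
        half₂ = ≤-trans (≤-reflexive (monomials (g ∷ q ∷ M ∷ []) (v₀ ⊙ (v₀ ⇑ 170 ⊙ v₁ ⇑ 18 ⊙ v₂ ⇑ 3)) (v₁ ⊙ v₂ ⇑ 2 ⊙ (v₀ ⇑ 171 ⊙ v₁ ⇑ 17 ⊙ v₂)) refl))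
          (≤-trans (*-monoʳ-≤ (q * M ^ 2) off-diagonal) (monomials-≤ (q ∷ M ∷ N ∷ []) (v₀ ⊙ v₁ ⇑ 2 ⊙ v₂ ⇑ 18) (v₀ ⊙ (v₁ ⊙ v₂ ⇑ 9) ⇑ 2) refl))
        halves : g ^ 170 * q ^ 18 * (q + M ^ 3) ≤ q * (M * N ^ 9) ^ 2
        halves = *-cancelˡ-≤ g (≤-trans (≤-reflexive (trans (cong (g *_) (*-distribˡ-+ (g ^ 170 * q ^ 18) q (M ^ 3))) (*-distribˡ-+ g _ _)))
          (≤-trans (+-mono-≤ half₁ half₂) (≤-trans (≤-reflexive (cong (q * (M * N ^ 9) ^ 2 +_) (sym (+-identityʳ _)))) (*-monoˡ-≤ (q * (M * N ^ 9) ^ 2) 2≤g))))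

  -- The energy bound needs T with q T ≥ s; the choice V ≈ √(q M) balances both terms of s.
  module EnergyScale {g q M V : ℕ} (16≤g : 16 ≤ g) (4M<q : (M + M) + (M + M) < q) (V²≤ : V * V ≤ q * M) (V²> : q * M < suc V * suc V) (1≤M : 1 ≤ M) where

    instance
      q≢0 : NonZero q
      q≢0 = >-nonZero (≤-trans (s≤s z≤n) 4M<q)

    M<q : M < q
    M<q = ≤-<-trans (≤-trans (m≤m+n M M) (m≤m+n (M + M) (M + M))) 4M<q

    V<q : V < q
    V<q = ≰⇒> λ q≤V → <⇒≱ (*-monoʳ-< q M<q) (≤-trans (*-mono-≤ q≤V q≤V) V²≤)

    1≤V : 1 ≤ V
    1≤V = n≢0⇒n>0 λ { refl → <⇒≱ V²> (*-mono-≤ (≤-trans 1≤M (<⇒≤ M<q)) 1≤M) }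

    instance
      V≢0 : NonZero V
      V≢0 = >-nonZero 1≤V

    r s t T ν : ℕ
    r = q / V
    s = r * ((M + M) * (M + M)) + V * ((M + M) + (M + M))
    t = s / q
    T = suc t
    ν = (T + suc T) * (g + g)

    T-large : s ≤ T * q
    T-large = ≤-trans (≤-reflexive (m≡m%n+[m/n]*n s q)) (+-monoˡ-≤ (t * q) (<⇒≤ (m%n<n s q)))

    private
      r²M≤ : r * r * M ≤ 4 * q
      r²M≤ = *-cancelˡ-≤ q (≤-trans (≤-reflexive (l₁ q r M)) (≤-trans (*-monoʳ-≤ (r * r) (≤-trans (<⇒≤ V²>) (*-mono-≤ V+1≤ V+1≤))) (≤-trans (≤-reflexive (l₂ r V)) (≤-trans (*-monoʳ-≤ 4 (*-mono-≤ (m/n*n≤m q V) (m/n*n≤m q V))) (≤-reflexive (l₃ q))))))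
        where
        V+1≤ : suc V ≤ V + V
        V+1≤ = +-monoˡ-≤ V 1≤V
        l₁ : ∀ q r M → q * (r * r * M) ≡ r * r * (q * M)
        l₁ = solve-∀
        l₂ : ∀ r V → r * r * ((V + V) * (V + V)) ≡ 4 * ((r * V) * (r * V))
        l₂ = solve-∀
        l₃ : ∀ q → 4 * (q * q) ≡ q * (4 * q)
        l₃ = solve-∀

      am-gm : ∀ a b → (a + b) * (a + b) ≤ 2 * (a * a + b * b)
      am-gm a b with ≤-total a b
      ... | inj₁ a≤b = go a b a≤b
        where
        go : ∀ a b → a ≤ b → (a + b) * (a + b) ≤ 2 * (a * a + b * b)
        go a b a≤b = subst (λ b → (a + b) * (a + b) ≤ 2 * (a * a + b * b)) (m+[n∸m]≡n a≤b) (≤-trans (m≤m+n _ ((b ∸ a) * (b ∸ a))) (≤-reflexive (l a (b ∸ a))))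
          where
          l : ∀ a d → (a + (a + d)) * (a + (a + d)) + d * d ≡ 2 * (a * a + (a + d) * (a + d))
          l = solve-∀
      ... | inj₂ b≤a = subst (λ a → (a + b) * (a + b) ≤ 2 * (a * a + b * b)) (m+[n∸m]≡n b≤a) (≤-trans (m≤m+n _ ((a ∸ b) * (a ∸ b))) (≤-reflexive (l b (a ∸ b))))
          where
          l : ∀ a d → ((a + d) + a) * ((a + d) + a) + d * d ≡ 2 * ((a + d) * (a + d) + a * a)
          l = solve-∀

      -- Both terms of `s` have a square of order `q M³`; 160 is `32 · 4 + 32`.
      t²≤ : q * (t * t) ≤ 160 * (M * M * M)
      t²≤ = *-cancelˡ-≤ q (≤-trans (≤-reflexive (l₁ q t)) (≤-trans (*-mono-≤ (m/n*n≤m s q) (m/n*n≤m s q)) (≤-trans (am-gm (r * ((M + M) * (M + M))) (V * ((M + M) + (M + M))))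
        (≤-trans (≤-reflexive (l₂ r M V)) (≤-trans (+-mono-≤ (*-monoˡ-≤ (M * M * M) (*-monoʳ-≤ 32 r²M≤)) (*-monoˡ-≤ (M * M) (*-monoʳ-≤ 32 V²≤))) (≤-reflexive (l₃ q M)))))))
        where
        l₁ : ∀ q t → q * (q * (t * t)) ≡ (t * q) * (t * q)
        l₁ = solve-∀
        l₂ : ∀ r M V → 2 * (r * ((M + M) * (M + M)) * (r * ((M + M) * (M + M))) + V * ((M + M) + (M + M)) * (V * ((M + M) + (M + M)))) ≡ 32 * (r * r * M) * (M * M * M) + 32 * (V * V) * (M * M)
        l₂ = solve-∀
        l₃ : ∀ q M → 32 * (4 * q) * (M * M * M) + 32 * (q * M) * (M * M) ≡ q * (160 * (M * M * M))
        l₃ = solve-∀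

    ν≤ : q * (ν * ν) ≤ g ^ 6 * (q + M ^ 3)
    ν≤ = ≤-trans (≤-reflexive (l₁ q t g)) (≤-trans (*-monoʳ-≤ (g * g) (≤-trans (*-monoʳ-≤ (4 * q) (am-gm (2 * t) 3)) (≤-trans (≤-reflexive (l₂ q t)) (≤-trans (+-monoˡ-≤ (72 * q) (*-monoʳ-≤ 32 t²≤))
        (≤-trans (≤-reflexive (cong (_+ 72 * q) (sym (*-assoc 32 160 (M * M * M))))) (≤-trans (+-mono-≤ (*-monoˡ-≤ (M * M * M) (≤-trans (≤ᵇ⇒≤ 5120 (16 ^ 4) _) 16⁴≤)) (*-monoˡ-≤ q (≤-trans (≤ᵇ⇒≤ 72 (16 ^ 4) _) 16⁴≤)))
          (≤-reflexive (sym (*-distribˡ-+ (g ^ 4) (M * M * M) q)))))))))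
      (≤-trans (≤-reflexive (sym (*-assoc (g * g) (g ^ 4) _))) (≤-reflexive (cong₂ _*_ (monomials (g ∷ []) (v₀ ⊙ v₀ ⊙ v₀ ⇑ 4) (v₀ ⇑ 6) refl) (trans (+-comm _ q) (cong (q +_) (monomials (M ∷ []) (v₀ ⊙ v₀ ⊙ v₀) (v₀ ⇑ 3) refl)))))))
      where
      16⁴≤ : 16 ^ 4 ≤ g ^ 4
      16⁴≤ = ^-monoˡ-≤ 4 16≤g
      l₁ : ∀ q t g → q * ((suc t + suc (suc t)) * (g + g) * ((suc t + suc (suc t)) * (g + g))) ≡ g * g * (4 * q * ((2 * t + 3) * (2 * t + 3)))
      l₁ = solve-∀
      l₂ : ∀ q t → 4 * q * (2 * (2 * t * (2 * t) + 9)) ≡ 32 * (q * (t * t)) + 72 * q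
      l₂ = solve-∀

    2≤q : 2 ≤ q
    2≤q = ≤-trans (s≤s (≤-trans 1≤M (≤-trans (m≤m+n M M) (m≤m+n (M + M) (M + M))))) 4M<q

    -- Every integer whose divisors are counted is at most `q ^ 6`, the range in which `g` bounds
    -- the number of divisors.
    size-bound : q * (T * q) + V * V ≤ q ^ 6
    size-bound = ≤-trans (+-mono-≤ (*-monoʳ-≤ q Tq≤) (*-mono-≤ V≤q V≤q)) (≤-trans (+-mono-≤ (≤-reflexive (l₁ q)) (≤-trans (*-monoʳ-≤ q q≤qqq) (≤-reflexive (*-comm q (q * q * q))))) (≤-trans (≤-reflexive (l₂ (q * q * q * q))) (≤-trans (*-monoˡ-≤ _ (*-mono-≤ 2≤q 2≤q)) (≤-reflexive (monomials (q ∷ []) (v₀ ⊙ v₀ ⊙ (v₀ ⊙ v₀ ⊙ v₀ ⊙ v₀)) (v₀ ⇑ 6) refl)))))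
      where
      V≤q : V ≤ q
      V≤q = <⇒≤ V<q
      2M≤q : M + M ≤ q
      2M≤q = ≤-trans (m≤m+n (M + M) (M + M)) (<⇒≤ 4M<q)
      q≤qq : q ≤ q * q
      q≤qq = m≤m*n q q
      q≤qqq : q ≤ q * q * q
      q≤qqq = ≤-trans q≤qq (m≤m*n (q * q) q)
      Tq≤ : T * q ≤ q * q * q + (q * q * q + q * q * q)
      Tq≤ = ≤-trans (+-monoʳ-≤ q (m/n*n≤m s q)) (+-mono-≤ q≤qqq (+-mono-≤ (≤-trans (*-mono-≤ (m/n≤m q V) (*-mono-≤ 2M≤q 2M≤q)) (≤-reflexive (sym (*-assoc q q q)))) (≤-trans (*-mono-≤ V≤q (<⇒≤ 4M<q)) (m≤m*n (q * q) q))))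
      l₁ : ∀ q → q * (q * q * q + (q * q * q + q * q * q)) ≡ 3 * (q * q * q * q)
      l₁ = solve-∀
      l₂ : ∀ x → 3 * x + x ≡ 2 * 2 * x
      l₂ = solve-∀

-- From integer bounds to natural numbers.

module Bridge where

  open import Data.Nat as ℕ using (ℕ)
  import Data.Nat.Properties as ℕP
  open import Data.Integer using (ℤ; +_; ∣_∣)
  import Data.Integer as ℤ
  import Data.Integer.Properties as ℤP
  open import Data.List using (List; length)
  open import Data.List.Membership.Propositional using (_∈_)
  open import Relation.Binary.PropositionalEquality
  open Int using (_+_; _*_; abs; pow4; ≤-trans; ≤-reflexive)
  open Sums
  open Numerics using (sq4; sq4-mono; boundI; boundII)

  pos-* : ∀ {a b m n} → a ≡ + m → b ≡ + n → a * b ≡ + (m ℕ.* n)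
  pos-* {m = m} {n} refl refl = sym (Int.pos-* m n)

  pos-+ : ∀ {a b m n} → a ≡ + m → b ≡ + n → a + b ≡ + (m ℕ.+ n)
  pos-+ {m = m} {n} refl refl = Int.+-def (+ m) (+ n)

  pos-sq : ∀ {a m} → a ≡ + m → a * a ≡ + (m ℕ.* m)
  pos-sq p = pos-* p p

  pos-pow4 : ∀ {a m} → a ≡ + m → pow4 a ≡ + sq4 m
  pos-pow4 p = pos-sq (pos-sq p)

  abs-sq : ∀ a → a * a ≡ + (∣ a ∣ ℕ.* ∣ a ∣)
  abs-sq a = trans (sym (Int.abs-sq a)) (pos-sq (Int.abs-def a))

  pow4-abs : ∀ a → pow4 a ≡ + sq4 ∣ a ∣
  pow4-abs a = pos-sq (abs-sq a)

  pow4-≤ : ∀ {a n} → pow4 a ℤ.≤ + n → sq4 ∣ a ∣ ℕ.≤ n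
  pow4-≤ {a} {n} p = ℤP.drop‿+≤+ (≤-trans (≤-reflexive (sym (pow4-abs a))) p)

  pow8-≤ : ∀ {a n} → pow4 (a * a) ℤ.≤ + n → sq4 (∣ a ∣ ℕ.* ∣ a ∣) ℕ.≤ n
  pow8-≤ {a} {n} p = ℤP.drop‿+≤+ (≤-trans (≤-reflexive (sym (pos-pow4 (abs-sq a)))) p)

  ∣∑∣-≤ : ∀ {A : Set} (xs : List A) (f : A → ℤ) w c → (∀ x → x ∈ xs → w ℕ.* ∣ f x ∣ ℕ.≤ c) → w ℕ.* ∣ ∑ xs f ∣ ℕ.≤ length xs ℕ.* c
  ∣∑∣-≤ xs f w c bound = ℤP.drop‿+≤+ (≤-trans (≤-reflexive (sym (weighted (∑ xs f)))) (≤-trans (Int.*-monoˡ Int.0≤+ₙ (∑-abs xs f))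
    (≤-trans (≤-reflexive (sym (∑-*ˡ xs (+ w) _))) (≤-trans (∑-≤-const xs (+ c) (λ x x∈ → ≤-trans (≤-reflexive (weighted (f x))) (ℤ.+≤+ (bound x x∈)))) (≤-reflexive (pos-* refl refl))))))
    where
    weighted : ∀ z → + w * abs z ≡ + (w ℕ.* ∣ z ∣)
    weighted z = pos-* refl (Int.abs-def z)

  module _ {P Q Ψ : ℤ} {p q ψ : ℕ} (P≡ : P ≡ + p) (Q≡ : Q ≡ + q) (Ψ≡ : Ψ ≡ + ψ) where

    pos-boundI : ∀ K D h N → pow4 (+ K) * (+ D * + D * + D * ((+ (2 ℕ.* h) * P) * (+ (2 ℕ.* h) * P) * (+ 6 * (Q * Q * (Ψ * Ψ)) * (+ (3 ℕ.* N) * + (3 ℕ.* N) * + (3 ℕ.* N)))))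
      ≡ + (sq4 K ℕ.* (D ℕ.* D ℕ.* D ℕ.* boundI h p (q ℕ.* q ℕ.* (ψ ℕ.* ψ)) N))
    pos-boundI K D h N = pos-* (pos-pow4 refl) (pos-* (pos-* (pos-sq refl) refl) (pos-* (pos-sq 2hp) (pos-* (pos-* refl (pos-* (pos-sq Q≡) (pos-sq Ψ≡))) (pos-* (pos-sq refl) refl))))
      where
      2hp : + (2 ℕ.* h) * P ≡ + (2 ℕ.* h ℕ.* p)
      2hp = pos-* refl P≡

    pos-boundII : ∀ M L N h ν → pow4 (+ M * (+ (2 ℕ.* h) * P)) * (+ 8 * (pow4 (+ L * (+ M * (+ (3 ℕ.* N) * Ψ))) +
        (+ L * + L) * (+ L * + L) * (+ L * + L) * (Ψ * Ψ * Ψ * (+ (L ℕ.+ L) * (+ (M ℕ.* (M ℕ.* ν)) * (+ (3 ℕ.* N) * + (3 ℕ.* N) * (+ (3 ℕ.* N) * + (3 ℕ.* N)) * (Q * Ψ)))))))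
      ≡ + boundII M L N h p ν ψ q
    pos-boundII M L N h ν = pos-* (pos-pow4 (pos-* refl (pos-* refl P≡))) (pos-* refl (pos-+ (pos-pow4 (pos-* refl (pos-* refl (pos-* refl Ψ≡))))
      (pos-* (pos-* (pos-* (pos-sq refl) (pos-sq refl)) (pos-sq refl)) (pos-* (pos-* (pos-sq Ψ≡) Ψ≡) (pos-* refl (pos-* refl (pos-* (pos-sq (pos-sq refl)) (pos-* Q≡ Ψ≡))))))))

  boundI-mono : ∀ h p {m m′} N → m ℕ.≤ m′ → boundI h p m N ℕ.≤ boundI h p m′ N
  boundI-mono h p N le = ℕP.*-monoʳ-≤ (2 ℕ.* h ℕ.* p ℕ.* (2 ℕ.* h ℕ.* p)) (ℕP.*-monoˡ-≤ _ (ℕP.*-monoʳ-≤ 6 le))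

  boundII-mono : ∀ M L N h p ν {ψ ψ′} q → ψ ℕ.≤ ψ′ → boundII M L N h p ν ψ q ℕ.≤ boundII M L N h p ν ψ′ q
  boundII-mono M L N h p ν q le = ℕP.*-monoʳ-≤ (sq4 (M ℕ.* (2 ℕ.* h ℕ.* p))) (ℕP.*-monoʳ-≤ 8 (ℕP.+-mono-≤ (sq4-mono (ℕP.*-monoʳ-≤ L (ℕP.*-monoʳ-≤ M (ℕP.*-monoʳ-≤ (3 ℕ.* N) le))))
    (ℕP.*-monoʳ-≤ ((L ℕ.* L) ℕ.* (L ℕ.* L) ℕ.* (L ℕ.* L)) (ℕP.*-mono-≤ (ℕP.*-mono-≤ (ℕP.*-mono-≤ le le) le) (ℕP.*-monoʳ-≤ (L ℕ.+ L) (ℕP.*-monoʳ-≤ (M ℕ.* (M ℕ.* ν)) (ℕP.*-monoʳ-≤ (3 ℕ.* N ℕ.* (3 ℕ.* N) ℕ.* (3 ℕ.* N ℕ.* (3 ℕ.* N))) (ℕP.*-monoʳ-≤ q le))))))))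

-- The contradiction: the main term against both sums.

module Core where

  open import Data.Nat as ℕ using (ℕ; suc; _≤_; _<_; s≤s; z≤n; NonZero; _^_)
  import Data.Nat.Properties as ℕP
  import Data.Nat.DivMod as ℕD
  open import Data.Nat.Primality using (2-rough)
  open import Data.Nat.Tactic.RingSolver using () renaming (solve-∀ to solve-∀ℕ)
  open import Data.Integer using (ℤ; +_; 0ℤ; 1ℤ; ∣_∣)
  import Data.Integer as ℤ
  import Data.Integer.Properties as ℤP
  open import Data.Integer.Tactic.RingSolver using (solve-∀)
  open import Data.List using (upTo; length)
  open import Data.List.Properties using (length-upTo)
  open import Data.List.Membership.Propositional using (_∈_)
  open import Data.Product using (∃; _×_; _,_; proj₁; proj₂)
  open import Data.Sum using (_⊎_; inj₁; inj₂)
  open import Data.Empty using (⊥; ⊥-elim)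
  open import Data.Vec using ([]; _∷_)
  open import Relation.Nullary using (Dec; yes; no)
  open import Relation.Binary.PropositionalEquality
  open Int using (_+_; _*_; -_; _-_; arith; abs; ≤-trans; ≤-reflexive)
  open Sums
  open Field
  open Correlation using (module Correlations)
  open PrimeField
  open Energy using (module EnergyBound)
  open Sieve
  open Chebyshev using (inUpperHalf?; count)
  open Weights
  open MainTerm
  open Dyadic
  open TypeIEstimate
  open TypeIIEstimate
  open NatPow
  open Mono using (monomials; v₀; _⊙_; _⇑_)
  open Numerics
  open Scales
  open Bridge

  opaque
    unfolding arith
    flip-main : ∀ P o → P * P * o ≡ - (- (P * P) * o)
    flip-main = solve-∀

  square-mono : ∀ {a b} → a ≤ b → a ℕ.* a ≤ b ℕ.* b
  square-mono p = ℕP.*-mono-≤ p p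

  module CoreArgument {q : ℕ} (𝔽 : ResidueField q) (N h p Z D g K : ℕ) (2N<q : N ℕ.+ N < q) (h≤N : h ≤ N) (1≤N : 1 ≤ N)
    (c : FiniteField.F (ResidueField.field′ 𝔽)) (c≢0 : c ≢ FiniteField.𝟎 (ResidueField.field′ 𝔽))
    (p-count : p ≡ count (inUpperHalf? N) 1 (N ℕ.+ N)) (2h≤p : h ℕ.+ h ≤ p) (0<h : 0 < h)
    (2≤D : 2 ≤ D) (D²≤Z : D ℕ.* D ≤ Z) (Z<D² : Z < suc D ℕ.* suc D) (5≤Z : 5 ≤ Z) (Z²≤q : Z ℕ.* Z ≤ q) (q<Z² : q < suc Z ℕ.* suc Z)
    (Z≤N : Z ≤ N) (D≤h : D ≤ h) (q<2^K : q < 2 ^ K)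
    (16≤g : 16 ≤ g) (K≤g : K ≤ g) (N≤gp : N ≤ g ℕ.* p) (N≤4gh : N ≤ 4 ℕ.* (g ℕ.* h))
    (master : g ^ 344 ℕ.* q ^ 35 ≤ N ^ 36)
    (cover : ∀ n → NonZero n → n ≤ q ^ 6 → ∃ λ xs → Divisors.CoversDivisors n xs × length xs ≤ g) where

    open ResidueField 𝔽
    open FieldTheory field′ hiding (q)
    open Correlations field′ using (norm²; 0≤norm²)
    open Setup 𝔽 N h 2N<q h≤N 1≤N c c≢0 using (X; Wx; Wx-0; χₐ; size′; P; R; norm²R; PrimeHere)
    open MainTerms 𝔽 N h 2N<q h≤N 1≤N c c≢0 using (P-count; Pω; sifted-main; Pω-lower)
    open EnergyBound 𝔽 using (↑)
    module TI = TypeIEstimates 𝔽 N h 2N<q h≤N 1≤N c c≢0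
    module TII = TypeIIEstimates 𝔽 N h 2N<q h≤N 1≤N c c≢0

    N<q : N < q
    N<q = ℕP.≤-<-trans (ℕP.m≤m+n N N) 2N<q

    P≡p : P ≡ + p
    P≡p = trans P-count (cong +_ (sym p-count))

    size≡q : size′ ≡ + q
    size≡q = cong +_ size

    ψ : ℕ
    ψ = ∣ norm² R ∣

    Ψ≡ψ : norm² R ≡ + ψ
    Ψ≡ψ = trans (sym (Int.abs-nonneg (0≤norm² R))) (Int.abs-def _)

    ψ≤ : ψ ≤ q ℕ.* q ℕ.* p
    ψ≤ = ℤP.drop‿+≤+ (≤-trans (≤-reflexive (sym Ψ≡ψ)) (≤-trans norm²R (≤-reflexive (pos-* (pos-sq size≡q) P≡p))))

    0<p : 0 < p
    0<p = ℕP.≤-trans 0<h (ℕP.≤-trans (ℕP.m≤m+n h h) 2h≤p)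

    -- The main term is at least the product of P² and h², and each error term is at most half of it.
    G : ℕ
    G = p ℕ.* p ℕ.* (h ℕ.* h)

    Z<2^K : Z < 2 ^ K
    Z<2^K = ℕP.≤-<-trans (ℕP.≤-trans Z≤N (ℕP.<⇒≤ N<q)) q<2^K

    1≤K : 1 ≤ K
    1≤K = ℕP.n≢0⇒n>0 λ { refl → ℕP.<⇒≱ Z<2^K (ℕP.≤-trans (s≤s z≤n) 5≤Z) }

    instance
      K≢0 : NonZero K
      K≢0 = ℕ.>-nonZero 1≤K

    D⁴≤q : D ^ 4 ≤ q
    D⁴≤q = ℕP.≤-trans (ℕP.≤-reflexive (monomials (D ∷ []) (v₀ ⇑ 4) ((v₀ ⊙ v₀) ⊙ (v₀ ⊙ v₀)) refl)) (ℕP.≤-trans (square-mono D²≤Z) Z²≤q)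

    module TypeISum (a : ℕ → ℤ) (out : ∀ d → Z < d → a d ≡ 0ℤ) (ok : ∀ d → a d ≡ 0ℤ ⊎ (abs (a d) ℤ.≤ 1ℤ × 1 ≤ d × d < D)) where
      S : ℤ
      S = ∑ (range Z) (λ d → a d * ∑ (range X) (λ y → Wx (d ℕ.* y)))

      S⁴≤ : sq4 ∣ S ∣ ≤ sq4 K ℕ.* (D ℕ.* D ℕ.* D ℕ.* boundI h p (q ℕ.* q ℕ.* (q ℕ.* q ℕ.* p ℕ.* (q ℕ.* q ℕ.* p))) N)
      S⁴≤ = ℕP.≤-trans (pow4-≤ {S} (≤-trans (TI.typeI-bound K D Z Z<2^K D≤h a out ok) (≤-reflexive (pos-boundI P≡p size≡q Ψ≡ψ K D h N))))
        (ℕP.*-monoʳ-≤ (sq4 K) (ℕP.*-monoʳ-≤ (D ℕ.* D ℕ.* D) (boundI-mono h p N (ℕP.*-monoʳ-≤ (q ℕ.* q) (square-mono ψ≤)))))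

      -- Strict, so that the two sums together fall short of the main term.
      2S<G : ∣ S ∣ ℕ.+ ∣ S ∣ < G
      2S<G = ^-cancelˡ-< 4 (subst₂ _<_ (fourth (∣ S ∣ ℕ.+ ∣ S ∣)) (fourth G) (ℕP.≤-<-trans (ℕP.≤-trans (ℕP.≤-reflexive (l ∣ S ∣)) (ℕP.*-monoʳ-≤ 16 S⁴≤))
        (typeI-numeric {K} {g} {1} {0} {N} {q} {p} {h} {0} 16≤g K≤g z≤n N≤gp N≤4gh (s≤s z≤n) 1≤N {D} 0<p 0<h (typeI-scale 16≤g N<q 1≤N master {D} D⁴≤q))))
        where
        fourth : ∀ x → sq4 x ≡ x ^ 4
        fourth x = monomials (x ∷ []) ((v₀ ⊙ v₀) ⊙ (v₀ ⊙ v₀)) (v₀ ⇑ 4) refl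
        l : ∀ s → (s ℕ.+ s) ℕ.* (s ℕ.+ s) ℕ.* ((s ℕ.+ s) ℕ.* (s ℕ.+ s)) ≡ 16 ℕ.* (s ℕ.* s ℕ.* (s ℕ.* s))
        l = solve-∀ℕ

    module TypeIISum (b : ℕ → ℤ) (b-ok : ∀ d → b d ≡ 0ℤ ⊎ (abs (b d) ℤ.≤ 1ℤ × D ≤ d × d ≤ Z)) where
      term : ℕ → ℤ
      term d = b d * ∑ (range X) (λ y → 𝟙 (rough? (leastFactor d) y) * Wx (d ℕ.* y))

      term-0 : ∀ d → b d ≡ 0ℤ → term d ≡ 0ℤ
      term-0 d eq = trans (cong (_* ∑ (range X) (λ y → 𝟙 (rough? (leastFactor d) y) * Wx (d ℕ.* y))) eq) (Int.*-zeroˡ _)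

      -- There are `K` blocks of `K²` pieces each; if every piece is at most `G / w`, the whole sum
      -- is at most `G / 2`.
      w : ℕ
      w = 2 ℕ.* (K ℕ.* K ℕ.* K)

      -- Only blocks that meet [D, Z] matter: `D < 2 M` makes `M` at least of order `q^(1/4)`, and
      -- `M ≤ Z` makes it at most `q^(1/2)`.
      module Block (k : ℕ) (D<2M : D < 2 ^ k ℕ.+ 2 ^ k) (M≤Z : 2 ^ k ≤ Z) where
        M L : ℕ
        M = 2 ^ k
        instance
          M≢0 : NonZero M
          M≢0 = ℕP.m^n≢0 2 k
        L = X ℕ./ M

        1≤M : 1 ≤ M
        1≤M = ℕP.m^n>0 2 k

        1≤k : 1 ≤ k
        1≤k = ℕP.n≢0⇒n>0 λ { refl → ℕP.<⇒≱ D<2M 2≤D }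

        M²≤q : M ℕ.* M ≤ q
        M²≤q = ℕP.≤-trans (square-mono M≤Z) Z²≤q

        4M<q : (M ℕ.+ M) ℕ.+ (M ℕ.+ M) < q
        4M<q = ℕP.<-≤-trans (ℕP.≤-<-trans (ℕP.≤-trans (ℕP.+-mono-≤ (ℕP.+-mono-≤ M≤Z M≤Z) (ℕP.+-mono-≤ M≤Z M≤Z)) (ℕP.≤-reflexive (l Z)))
          (ℕP.*-monoˡ-< Z {{ℕ.>-nonZero (ℕP.≤-trans (s≤s z≤n) 5≤Z)}} {4} {Z} 5≤Z)) Z²≤q
          where
          l : ∀ z → (z ℕ.+ z) ℕ.+ (z ℕ.+ z) ≡ 4 ℕ.* z
          l = solve-∀ℕ

        2M<q : M ℕ.+ M < q
        2M<q = ℕP.≤-<-trans (ℕP.m≤m+n (M ℕ.+ M) (M ℕ.+ M)) 4M<q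

        4<q : 4 < q
        4<q = ℕP.≤-trans 5≤Z (ℕP.≤-trans Z≤N (ℕP.<⇒≤ N<q))

        q≤M⁴ : q ≤ g ^ 2 ℕ.* M ^ 4
        q≤M⁴ = ℕP.≤-trans (ℕP.<⇒≤ q<Z²) (ℕP.≤-trans (square-mono (ℕP.≤-trans Z<D² (square-mono D<2M)))
          (ℕP.≤-trans (ℕP.≤-reflexive (l M)) (ℕP.≤-trans (ℕP.*-monoˡ-≤ _ (ℕP.≤-trans 16≤g (ℕP.m≤m*n g (g ^ 1) {{ℕP.m^n≢0 g 1 {{g≢0}}}})))
            (ℕP.≤-reflexive (cong (g ^ 2 ℕ.*_) (monomials (M ∷ []) (v₀ ⊙ v₀ ⊙ v₀ ⊙ v₀) (v₀ ⇑ 4) refl))))))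
          where
          g≢0 : NonZero g
          g≢0 = ℕ.>-nonZero (ℕP.≤-trans (s≤s z≤n) 16≤g)
          l : ∀ m → (m ℕ.+ m) ℕ.* (m ℕ.+ m) ℕ.* ((m ℕ.+ m) ℕ.* (m ℕ.+ m)) ≡ 16 ℕ.* (m ℕ.* m ℕ.* m ℕ.* m)
          l = solve-∀ℕ

        LM≤2N : L ℕ.* M ≤ 2 ℕ.* N
        LM≤2N = ℕP.≤-trans (ℕD.m/n*n≤m X M) (ℕP.≤-reflexive (cong (N ℕ.+_) (sym (ℕP.+-identityʳ N))))

        root : ∃ λ V → V ℕ.* V ≤ q ℕ.* M × q ℕ.* M < suc V ℕ.* suc V
        root = square-root (q ℕ.* M)

        V : ℕ
        V = proj₁ root

        weaken : ∀ d → b d ≡ 0ℤ ⊎ (abs (b d) ℤ.≤ 1ℤ × D ≤ d × d ≤ Z) → b d ≡ 0ℤ ⊎ (abs (b d) ℤ.≤ 1ℤ × 2 ≤ d × d ≤ N)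
        weaken d (inj₁ e) = inj₁ e
        weaken d (inj₂ (le , D≤d , d≤Z)) = inj₂ (le , ℕP.≤-trans 2≤D D≤d , ℕP.≤-trans d≤Z Z≤N)

        module ES = EnergyScale {g} {q} {M} {V} 16≤g 4M<q (proj₁ (proj₂ root)) (proj₂ (proj₂ root)) 1≤M
        module Pc = TII.Pieces K q<2^K 4<q k 1≤k b (λ d → weaken d (b-ok d)) 2M<q
        module Bd = Pc.Bound V ES.T g {{ES.V≢0}} ES.V<q 4M<q ES.T-large (λ n n≢0 n≤ → cover n n≢0 (ℕP.≤-trans n≤ ES.size-bound)) 0<h

        piece-small : ∀ j₁ j₂ → w ℕ.* ∣ Pc.piece j₁ j₂ ∣ ≤ G
        piece-small j₁ j₂ = ^-cancelˡ-≤ 8 (ℕP.≤-trans (ℕP.≤-reflexive (trans (*-^ w y 8) (cong (w ^ 8 ℕ.*_) (monomials (y ∷ []) (v₀ ⇑ 8) ((v₀ ⊙ v₀ ⊙ (v₀ ⊙ v₀)) ⊙ (v₀ ⊙ v₀ ⊙ (v₀ ⊙ v₀))) refl))))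
          (ℕP.≤-trans (ℕP.*-monoʳ-≤ (w ^ 8) (ℕP.≤-trans (ℕP.≤-reflexive (l y)) (ℕP.≤-trans (pow8-≤ {Pc.piece j₁ j₂} (≤-trans (Bd.piece-bound j₁ j₂) (≤-reflexive (pos-boundII P≡p size≡q Ψ≡ψ M L N h ES.ν))))
              (boundII-mono M L N h p ES.ν q ψ≤))))
            (typeII-numeric {K} {g} {M} {L} {N} {q} {p} {h} {ES.ν} 16≤g K≤g LM≤2N N≤gp N≤4gh 1≤M 1≤N
              (typeII-scale₁ 16≤g N<q 1≤N master {M} {ES.ν} M²≤q q≤M⁴ ES.ν≤) (typeII-scale₂ 16≤g N<q 1≤N master {M} {ES.ν} M²≤q q≤M⁴ ES.ν≤))))
          where
          y : ℕ
          y = ∣ Pc.piece j₁ j₂ ∣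
          l : ∀ y → (y ℕ.* y ℕ.* (y ℕ.* y)) ℕ.* (y ℕ.* y ℕ.* (y ℕ.* y)) ≡ y ℕ.* y ℕ.* (y ℕ.* y) ℕ.* (y ℕ.* y ℕ.* (y ℕ.* y))
          l _ = refl

        block-small : w ℕ.* ∣ ∑ (block k) term ∣ ≤ K ℕ.* (K ℕ.* G)
        block-small = subst (λ z → w ℕ.* ∣ z ∣ ≤ K ℕ.* (K ℕ.* G)) (sym Pc.block-pieces)
          (subst (λ l → w ℕ.* ∣ S ∣ ≤ l ℕ.* (K ℕ.* G)) (length-upTo K) (∣∑∣-≤ (upTo K) (λ j₁ → ∑ (upTo K) (λ j₂ → Pc.piece j₁ j₂)) w (K ℕ.* G) (λ j₁ _ →
            subst (λ l → w ℕ.* ∣ ∑ (upTo K) (λ j₂ → Pc.piece j₁ j₂) ∣ ≤ l ℕ.* G) (length-upTo K) (∣∑∣-≤ (upTo K) (Pc.piece j₁) w G (λ j₂ _ → piece-small j₁ j₂)))))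
          where
          S : ℤ
          S = ∑ (upTo K) (λ j₁ → ∑ (upTo K) (λ j₂ → Pc.piece j₁ j₂))

      vanish : ∀ k → (∀ d → d ∈ block k → b d ≡ 0ℤ) → w ℕ.* ∣ ∑ (block k) term ∣ ≤ K ℕ.* (K ℕ.* G)
      vanish k 0b = subst (λ z → w ℕ.* ∣ z ∣ ≤ K ℕ.* (K ℕ.* G)) (sym (trans (∑-cong-∈ (block k) (λ d d∈ → term-0 d (0b d d∈))) (∑-0 (block k))))
        (ℕP.≤-trans (ℕP.≤-reflexive (ℕP.*-zeroʳ w)) z≤n)

      block-bound : ∀ k → w ℕ.* ∣ ∑ (block k) term ∣ ≤ K ℕ.* (K ℕ.* G)
      block-bound k = go (2 ^ k ℕ.+ 2 ^ k ℕP.≤? D) (2 ^ k ℕP.≤? Z)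
        where
        go : Dec (2 ^ k ℕ.+ 2 ^ k ≤ D) → Dec (2 ^ k ≤ Z) → w ℕ.* ∣ ∑ (block k) term ∣ ≤ K ℕ.* (K ℕ.* G)
        go (yes ≤D) _ = vanish k λ d d∈ → at d d∈ (b-ok d)
          where
          at : ∀ d → d ∈ block k → b d ≡ 0ℤ ⊎ (abs (b d) ℤ.≤ 1ℤ × D ≤ d × d ≤ Z) → b d ≡ 0ℤ
          at d d∈ (inj₁ e) = e
          at d d∈ (inj₂ (_ , D≤d , _)) = ⊥-elim (ℕP.<⇒≱ (proj₂ (∈-block⁻ {k} d∈)) (ℕP.≤-trans ≤D D≤d))
        go (no _) (no ≰Z) = vanish k λ d d∈ → at d d∈ (b-ok d)
          where
          at : ∀ d → d ∈ block k → b d ≡ 0ℤ ⊎ (abs (b d) ℤ.≤ 1ℤ × D ≤ d × d ≤ Z) → b d ≡ 0ℤ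
          at d d∈ (inj₁ e) = e
          at d d∈ (inj₂ (_ , _ , d≤Z)) = ⊥-elim (≰Z (ℕP.≤-trans (proj₁ (∈-block⁻ {k} d∈)) d≤Z))
        go (no ≰D) (yes ≤Z) = Block.block-small k (ℕP.≰⇒> ≰D) ≤Z

      S : ℤ
      S = ∑ (range Z) term

      2S≤G : ∣ S ∣ ℕ.+ ∣ S ∣ ≤ G
      2S≤G = ℕP.*-cancelˡ-≤ (K ℕ.* K ℕ.* K) {{ℕP.m*n≢0 (K ℕ.* K) K {{ℕP.m*n≢0 K K}}}} (ℕP.≤-trans (ℕP.≤-reflexive (l₁ (K ℕ.* K ℕ.* K) ∣ S ∣))
        (ℕP.≤-trans (subst (λ z → w ℕ.* ∣ z ∣ ≤ K ℕ.* (K ℕ.* (K ℕ.* G))) (sym dyadic)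
            (subst (λ l → w ℕ.* ∣ ∑ (upTo K) (λ k → ∑ (block k) term) ∣ ≤ l ℕ.* (K ℕ.* (K ℕ.* G))) (length-upTo K) (∣∑∣-≤ (upTo K) (λ k → ∑ (block k) term) w (K ℕ.* (K ℕ.* G)) (λ k _ → block-bound k))))
          (ℕP.≤-reflexive (l₂ K G))))
        where
        dyadic : S ≡ ∑ (upTo K) (λ k → ∑ (block k) term)
        dyadic = ∑-dyadic K Z term Z<2^K (λ d Z<d → term-0 d (at d Z<d (b-ok d)))
          where
          at : ∀ d → Z < d → b d ≡ 0ℤ ⊎ (abs (b d) ℤ.≤ 1ℤ × D ≤ d × d ≤ Z) → b d ≡ 0ℤ
          at d Z<d (inj₁ e) = e
          at d Z<d (inj₂ (_ , _ , d≤Z)) = ⊥-elim (ℕP.<⇒≱ Z<d d≤Z)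
        l₁ : ∀ k s → k ℕ.* (s ℕ.+ s) ≡ 2 ℕ.* k ℕ.* s
        l₁ = solve-∀ℕ
        l₂ : ∀ K G → K ℕ.* (K ℕ.* (K ℕ.* G)) ≡ K ℕ.* K ℕ.* K ℕ.* G
        l₂ = solve-∀ℕ

    module _ (none : ∀ y → PrimeHere y → ∀ t → χₐ t * χₐ (c ⊗ ↑ y ⁻¹ ⊖ ↑ y ⊖ t) ≡ 0ℤ) where
      private
        Dec′ : Decomposition X D Z 2≤D D²≤Z Wx Wx-0 2
        Dec′ = sieve-decomposition X D Z 2≤D D²≤Z Wx Wx-0
        module De = Decomposition Dec′

        ok : ∀ d → De.a d ≡ 0ℤ ⊎ (abs (De.a d) ℤ.≤ 1ℤ × 1 ≤ d × d < D)
        ok d with De.a-ok d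
        ... | inj₁ e = inj₁ e
        ... | inj₂ (le , 1≤d , d<D , _) = inj₂ (le , 1≤d , d<D)

        out : ∀ d → Z < d → De.a d ≡ 0ℤ
        out d Z<d with ok d
        ... | inj₁ e = e
        ... | inj₂ (_ , _ , d<D) = ⊥-elim (ℕP.<⇒≱ (ℕP.<-≤-trans d<D (ℕP.≤-trans (ℕP.m≤m*n D D {{ℕ.>-nonZero (ℕP.≤-trans (s≤s z≤n) 2≤D)}}) D²≤Z)) (ℕP.<⇒≤ Z<d))

        ok′ : ∀ d → De.b d ≡ 0ℤ ⊎ (abs (De.b d) ℤ.≤ 1ℤ × D ≤ d × d ≤ Z)
        ok′ d with De.b-ok d
        ... | inj₁ e = inj₁ e
        ... | inj₂ (le , D≤d , d≤Z , _) = inj₂ (le , D≤d , d≤Z)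

        module Ⅰ = TypeISum De.a out ok
        module Ⅱ = TypeIISum De.b ok′

        Pω′ : ℤ
        Pω′ = Pω Z Z≤N q<Z² none

        identity : - (P * P) * Pω′ ≡ Ⅰ.S + Ⅱ.S
        identity = trans (sym (sifted-main Z Z≤N q<Z² none)) (trans De.identity (cong (_+ Ⅱ.S) (∑-cong (range Z) (λ d → cong (De.a d *_)
          (∑-cong (range X) (λ y → trans (cong (_* Wx (d ℕ.* y)) (𝟙-yes (rough? 2 y) 2-rough)) (Int.*-identityˡ _)))))))

        h≤P-h : + h ℤ.≤ P - + h
        h≤P-h = Int.≤-by {+ h} {P - + h} {+ p - + (h ℕ.+ h)} (Int.0≤-diff (ℤ.+≤+ 2h≤p)) (trans (cong (λ P → P - + h - + h) P≡p) (trans (l (+ p) (+ h)) (cong (λ z → + p - z) (pos-+ refl refl))))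
          where
          opaque
            unfolding arith
            l : ∀ p h → p - h - h ≡ p - (h + h)
            l = solve-∀

        h²≤Pω : + (h ℕ.* h) ℤ.≤ Pω′
        h²≤Pω = ≤-trans (≤-reflexive (sym (pos-* refl refl))) (≤-trans (Int.*-monoˡ Int.0≤+ₙ h≤P-h)
          (Pω-lower Z Z≤N q<Z² none (≤-trans (ℤ.+≤+ (ℕP.≤-trans (ℕP.m≤m+n h h) 2h≤p)) (≤-reflexive (sym P≡p)))))

        main-large : G ≤ ∣ - (P * P) * Pω′ ∣
        main-large = ℤP.drop‿+≤+ (≤-trans (≤-reflexive (sym (pos-* (pos-sq P≡p) refl))) (≤-trans (Int.*-monoˡ (Int.0≤sq P) h²≤Pω)
          (≤-trans (≤-reflexive (flip-main P Pω′)) (≤-trans (Int.-≤abs _) (≤-reflexive (Int.abs-def _))))))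

      contradiction : ⊥
      contradiction = ℕP.<⇒≱ (ℕP.+-mono-<-≤ Ⅰ.2S<G Ⅱ.2S≤G) (ℕP.≤-trans (ℕP.+-mono-≤ G≤ G≤) (ℕP.≤-reflexive (l ∣ Ⅰ.S ∣ ∣ Ⅱ.S ∣)))
        where
        G≤ : G ≤ ∣ Ⅰ.S ∣ ℕ.+ ∣ Ⅱ.S ∣
        G≤ = ℕP.≤-trans main-large (ℕP.≤-trans (ℕP.≤-reflexive (cong ∣_∣ (trans identity (Int.+-def _ _)))) (ℤP.∣i+j∣≤∣i∣+∣j∣ Ⅰ.S Ⅱ.S))
        l : ∀ a b → a ℕ.+ b ℕ.+ (a ℕ.+ b) ≡ a ℕ.+ a ℕ.+ (b ℕ.+ b)
        l = solve-∀ℕ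

-- The choice of `g` and `K` for large q.

module Asymptotics where

  open import Data.Nat
  open import Data.Nat.Properties
  open import Data.Nat.DivMod using (m/n*n≤m; m≡m%n+[m/n]*n; m%n<n)
  open import Data.Nat.Tactic.RingSolver using (solve-∀)
  open import Data.List using (length)
  open import Data.Product using (∃; _×_; _,_; proj₁; proj₂)
  open import Data.Vec using ([]; _∷_)
  open import Relation.Nullary using (yes; no)
  open import Relation.Binary.PropositionalEquality
  open NatPow
  open Mono
  open Scales using (square-root)
  open Chebyshev using (inUpperHalf?; count; chebyshev)
  open Divisors using (CoversDivisors; divisor-bound)

  integer-root : ∀ e .{{_ : NonZero e}} n → ∃ λ g → g ^ e ≤ n × n < suc g ^ e
  integer-root e@(suc _) zero = 0 , z≤n , m^n>0 1 e
  integer-root e@(suc _) (suc n) = step (integer-root e n)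
    where
    step : (∃ λ g → g ^ e ≤ n × n < suc g ^ e) → ∃ λ g → g ^ e ≤ suc n × suc n < suc g ^ e
    step (g , g^e≤ , n<) with suc g ^ e ≤? suc n
    ... | no ≰n = g , ≤-trans g^e≤ (n≤1+n n) , ≰⇒> ≰n
    ... | yes ≤n = suc g , ≤n , ≤-<-trans n< (^-monoˡ-< e (n<1+n (suc g)))

  bit-length : ∀ n → ∃ λ K → 2 ^ K ≤ suc n + suc n × suc n < 2 ^ K
  bit-length zero = 1 , ≤-refl , ≤-refl
  bit-length (suc n) = step (bit-length n)
    where
    step : (∃ λ K → 2 ^ K ≤ suc n + suc n × suc n < 2 ^ K) → ∃ λ K → 2 ^ K ≤ suc (suc n) + suc (suc n) × suc (suc n) < 2 ^ K
    step (K , ≤2n , n<) with 2 ^ K ≤? suc (suc n)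
    ... | no ≰n = K , ≤-trans ≤2n (+-mono-≤ (n≤1+n (suc n)) (n≤1+n (suc n))) , ≰⇒> ≰n
    ... | yes ≤n = suc K , double≤ , ≤-<-trans n< (≤-<-trans (≤-reflexive (sym (+-identityʳ (2 ^ K)))) (+-monoˡ-< (2 ^ K + 0) (m^n>0 2 K)))
      where
      double≤ : 2 ^ suc K ≤ suc (suc n) + suc (suc n)
      double≤ = ≤-trans (≤-reflexive (cong (2 ^ K +_) (+-identityʳ (2 ^ K)))) (+-mono-≤ ≤n ≤n)

  bit-length′ : ∀ n → 1 ≤ n → ∃ λ K → 2 ^ K ≤ n + n × n < 2 ^ K
  bit-length′ (suc n) _ = bit-length n

  -- With `u = K / (2m)` one has `K ≤ 2m · 2^u`, so `(7K)^(2m)` is at most `(14m)^(2m) · 2^K`, and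
  -- `2^K ≤ 2q`; for large `q` this is at most `q²`.
  polylog-≤ : ∀ m .{{_ : NonZero m}} q K → 2 ^ K ≤ q + q → 2 * (14 * m) ^ (2 * m) ≤ q → (7 * K) ^ m ≤ q
  polylog-≤ m q K 2^K≤ large = ^-cancelˡ-≤ 2 (≤-trans (^-monoˡ-≤ 2 (^-monoˡ-≤ m 7K≤)) (≤-trans (≤-reflexive expand) (≤-trans (*-monoʳ-≤ ((14 * m) ^ (2 * m)) (≤-trans (^-monoʳ-≤ 2 (m/n*n≤m K (2 * m))) 2^K≤))
    (≤-trans (≤-reflexive (l ((14 * m) ^ (2 * m)) q)) (≤-trans (*-monoˡ-≤ q large) (≤-reflexive (cong (q *_) (sym (*-identityʳ q)))))))))
    where
    instance
      2m≢0 : NonZero (2 * m)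
      2m≢0 = m*n≢0 2 m
    u : ℕ
    u = K / (2 * m)
    K≤ : K ≤ suc u * (2 * m)
    K≤ = ≤-trans (≤-reflexive (m≡m%n+[m/n]*n K (2 * m))) (+-monoˡ-≤ (u * (2 * m)) (<⇒≤ (m%n<n K (2 * m))))
    7K≤ : 7 * K ≤ 14 * m * 2 ^ u
    7K≤ = ≤-trans (*-monoʳ-≤ 7 (≤-trans K≤ (*-monoˡ-≤ (2 * m) (n<2^n u)))) (≤-reflexive (l₁ (2 ^ u) m))
      where
      l₁ : ∀ x m → 7 * (x * (2 * m)) ≡ 14 * m * x
      l₁ = solve-∀
    expand : ((14 * m * 2 ^ u) ^ m) ^ 2 ≡ (14 * m) ^ (2 * m) * 2 ^ (u * (2 * m))
    expand = trans (^-*-assoc (14 * m * 2 ^ u) m 2) (trans (cong ((14 * m * 2 ^ u) ^_) (*-comm m 2)) (trans (*-^ (14 * m) (2 ^ u) (2 * m)) (cong ((14 * m) ^ (2 * m) *_) (^-*-assoc 2 u (2 * m)))))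
    l : ∀ a q → a * (q + q) ≡ 2 * a * q
    l = solve-∀

  Scale : ℕ → ℕ → ℕ → Set
  Scale q g K = 16 ≤ g × 7 * K ≤ g × q < 2 ^ K × (∀ n → NonZero n → n ≤ q ^ 6 → ∃ λ xs → CoversDivisors n xs × length xs ≤ g)

  scale : ∀ E .{{_ : NonZero E}} → ∃ λ q₀ → ∀ q → q₀ ≤ q → ∃ λ g → ∃ λ K → g ^ E ≤ q × Scale q g K
  scale E = q₀ , find-scale
    where
    k m q₀ : ℕ
    -- A number up to `q ^ 6` has at most `(q · q ^ 6) ^ (1/k)` divisors, one `q` covering the
    -- logarithms; `k = 7 E` makes this `q ^ (1/E)`.
    k = 7 * E
    m = k * 2 ^ k
    instance
      k≢0 : NonZero k
      k≢0 = m*n≢0 7 E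
      m≢0 : NonZero m
      m≢0 = m*n≢0 k (2 ^ k) {{k≢0}} {{m^n≢0 2 k}}
    q₀ = 2 * (14 * m) ^ (2 * m) + 16 ^ E
    E≤m : E ≤ m
    E≤m = ≤-trans (m≤n*m E 7) (m≤m*n k (2 ^ k) {{m^n≢0 2 k}})
    find-scale : ∀ q → q₀ ≤ q → ∃ λ g → ∃ λ K → g ^ E ≤ q × Scale q g K
    find-scale q q₀≤ = g , K , proj₁ (proj₂ root) , below-root (≤-trans (m≤n+m (16 ^ E) (2 * (14 * m) ^ (2 * m))) q₀≤) ,
      below-root (≤-trans (^-monoʳ-≤ (7 * K) {{m*n≢0 7 K}} E≤m) polylog) , q<2^K , cover
      where
      1≤q : 1 ≤ q
      1≤q = ≤-trans (m^n>0 16 E) (≤-trans (m≤n+m (16 ^ E) (2 * (14 * m) ^ (2 * m))) q₀≤)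
      root : ∃ λ g → g ^ E ≤ q × q < suc g ^ E
      root = integer-root E q
      g : ℕ
      g = proj₁ root
      bits : ∃ λ K → 2 ^ K ≤ q + q × q < 2 ^ K
      bits = bit-length′ q 1≤q
      K : ℕ
      K = proj₁ bits
      q<2^K : q < 2 ^ K
      q<2^K = proj₂ (proj₂ bits)
      instance
        K≢0 : NonZero K
        K≢0 = ≢-nonZero λ K≡0 → <⇒≱ (subst (λ K → q < 2 ^ K) K≡0 q<2^K) 1≤q
      below-root : ∀ {x} → x ^ E ≤ q → x ≤ g
      below-root x^E≤ = ≤-pred (^-cancelˡ-< E (≤-<-trans x^E≤ (proj₂ (proj₂ root))))
      polylog : (7 * K) ^ m ≤ q
      polylog = polylog-≤ m q K (proj₁ (proj₂ bits)) (≤-trans (m≤m+n (2 * (14 * m) ^ (2 * m)) (16 ^ E)) q₀≤)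
      cover : ∀ n → NonZero n → n ≤ q ^ 6 → ∃ λ xs → CoversDivisors n xs × length xs ≤ g
      cover n n≢0 n≤ = pick (divisor-bound k (K * 6) n {{n≢0}} (≤-trans n≤ (≤-trans (^-monoˡ-≤ 6 (<⇒≤ q<2^K)) (≤-reflexive (^-*-assoc 2 K 6)))))
        where
        pick : (∃ λ xs → CoversDivisors n xs × length xs ^ k ≤ suc (K * 6) ^ m * n) → ∃ λ xs → CoversDivisors n xs × length xs ≤ g
        pick (xs , covers , len) = xs , covers , below-root (^-cancelˡ-≤ 7 (≤-trans (≤-reflexive (trans (^-*-assoc (length xs) E 7) (cong (length xs ^_) (*-comm E 7))))
          (≤-trans len (*-mono-≤ (≤-trans (^-monoˡ-≤ m 6K+1≤7K) polylog) n≤))))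
          where
          6K+1≤7K : suc (K * 6) ≤ 7 * K
          6K+1≤7K = ≤-trans (+-monoˡ-≤ (K * 6) (>-nonZero⁻¹ K)) (≤-reflexive (l K))
            where
            l : ∀ K → K + K * 6 ≡ 7 * K
            l = solve-∀

  module _ {g q N : ℕ} (16≤g : 16 ≤ g) where

    private
      instance
        g≢0 : NonZero g
        g≢0 = >-nonZero (≤-trans (s≤s z≤n) 16≤g)

    -- The power 19 is taken because `36 · 19 = 38 · 18` and `35 · 19 = 37 · 18 - 1`: the single `q`
    -- left over pays for `g ^ 380`. Passing from `M`, which will be `N + 1`, to `N` costs `g ^ 36`,
    -- and `380 - 36 = 344`.
    master-inequality : ∀ {M} → M ≤ g * N → (g ^ 380) ^ 19 ≤ q → q ^ 37 ≤ M ^ 38 → g ^ 344 * q ^ 35 ≤ N ^ 36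
    master-inequality {M} M≤gN g^E≤q lower = *-cancelˡ-≤ (g ^ 36) {{m^n≢0 g 36}} (≤-trans (≤-reflexive (monomials (g ∷ q ∷ []) (v₀ ⇑ 36 ⊙ (v₀ ⇑ 344 ⊙ v₁ ⇑ 35)) (v₀ ⇑ 380 ⊙ v₁ ⇑ 35) refl))
      (≤-trans (^-cancelˡ-≤ 19 {g ^ 380 * q ^ 35} {M ^ 36} (nineteenth (g ^ 380) M g^E≤q lower)) (≤-trans (^-monoˡ-≤ 36 M≤gN) (≤-reflexive (*-^ g N 36)))))
      where
      nineteenth : ∀ B M → B ^ 19 ≤ q → q ^ 37 ≤ M ^ 38 → (B * q ^ 35) ^ 19 ≤ (M ^ 36) ^ 19
      nineteenth B M le le′ = ≤-trans (≤-reflexive (*-^ B (q ^ 35) 19)) (≤-trans (*-monoˡ-≤ ((q ^ 35) ^ 19) le) (≤-trans (≤-reflexive regroup) (≤-trans (^-monoˡ-≤ 18 {q ^ 37} {M ^ 38} le′) (≤-reflexive regroup′))))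
        where
        regroup : q * (q ^ 35) ^ 19 ≡ (q ^ 37) ^ 18
        regroup = trans (cong (q *_) (^-*-assoc q 35 19)) (sym (^-*-assoc q 37 18))
        regroup′ : (M ^ 38) ^ 18 ≡ (M ^ 36) ^ 19
        regroup′ = trans (^-*-assoc M 38 18) (sym (^-*-assoc M 36 19))

    -- In Chebyshev's bound for `2N` the square root term is at most `N` because `g³ ≤ N`; the other
    -- `N` is left for the primes, with `3 K ≤ g`.
    many-primes : ∀ {K} → g ^ 344 * q ^ 35 ≤ N ^ 36 → 1 ≤ N → N + N < q → 7 * K ≤ g → q < 2 ^ K → N ≤ g * count (inUpperHalf? N) 1 (N + N)
    many-primes {K} master 1≤N 2N<q 7K≤g q<2^K = +-cancelˡ-≤ N _ _ (≤-trans (chebyshev N s K 3≤N s²≤ s²> (<⇒≤ (<-trans 2N<q q<2^K)))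
      (≤-trans (≤-reflexive (l K (1 + s) p)) (+-mono-≤ (≤-trans (*-monoˡ-≤ (1 + s) 3K≤g) few) (*-monoˡ-≤ p 3K≤g))))
      where
      p : ℕ
      p = count (inUpperHalf? N) 1 (N + N)
      root : ∃ λ s → s * s ≤ N + N × N + N < suc s * suc s
      root = square-root (N + N)
      s : ℕ
      s = proj₁ root
      s²≤ : s * s ≤ N + N
      s²≤ = proj₁ (proj₂ root)
      s²> : N + N < suc s * suc s
      s²> = proj₂ (proj₂ root)
      1≤s : 1 ≤ s
      1≤s = n≢0⇒n>0 λ s≡0 → <⇒≱ (subst (λ s → N + N < suc s * suc s) s≡0 s²>) (≤-trans 1≤N (m≤m+n N N))
      instance
        q≢0 : NonZero q
        q≢0 = >-nonZero (≤-trans (s≤s z≤n) 2N<q)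
      g³≤N : g ^ 3 ≤ N
      g³≤N = ^-cancelˡ-≤ 36 (≤-trans (≤-reflexive (^-*-assoc g 3 36)) (≤-trans (^-monoʳ-≤ g {108} {344} (m≤m+n 108 236)) (≤-trans (m≤m*n (g ^ 344) (q ^ 35) {{m^n≢0 q 35}}) master)))
      3≤N : 3 ≤ N
      3≤N = ≤-trans (≤-trans (m≤m+n 3 13) 16≤g) (≤-trans (m≤m*n g (g ^ 2) {{m^n≢0 g 2}}) g³≤N)
      3K≤g : 3 * K ≤ g
      3K≤g = ≤-trans (*-monoˡ-≤ K (m≤m+n 3 4)) 7K≤g
      few : g * (1 + s) ≤ N
      few = ^-cancelˡ-≤ 2 (≤-trans (≤-reflexive (*-^ g (1 + s) 2)) (≤-trans (*-monoʳ-≤ (g ^ 2) (≤-trans (^-monoˡ-≤ 2 (+-monoˡ-≤ s 1≤s)) (≤-trans (≤-reflexive (l₁ s)) (*-monoʳ-≤ 4 s²≤))))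
        (≤-trans (≤-reflexive (l₂ (g ^ 2) N)) (≤-trans (*-monoˡ-≤ N (≤-trans (*-monoˡ-≤ (g ^ 2) (≤-trans (m≤m+n 8 8) 16≤g)) g³≤N)) (≤-reflexive (cong (N *_) (sym (*-identityʳ N))))))))
        where
        l₁ : ∀ s → (s + s) * ((s + s) * 1) ≡ 4 * (s * s)
        l₁ = solve-∀
        l₂ : ∀ x N → x * (4 * (N + N)) ≡ 8 * x * N
        l₂ = solve-∀
      l : ∀ K a p → 3 * (K * (a + p)) ≡ 3 * K * a + 3 * K * p
      l = solve-∀

-- The choice of the sieve levels and of h, and a solution in the field.

module Existence where

  open import Data.Nat as ℕ using (ℕ; zero; suc; _≤_; _<_; s≤s; z≤n; NonZero; _^_)
  import Data.Nat.Properties as ℕP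
  import Data.Nat.DivMod as ℕD
  open import Data.Nat.Tactic.RingSolver using () renaming (solve-∀ to solve-∀ℕ)
  open import Data.Integer using (+_; 0ℤ)
  open import Data.List using (length)
  open import Data.Product using (∃; _×_; _,_; proj₁; proj₂)
  open import Data.Empty using (⊥; ⊥-elim)
  open import Data.Vec using ([]; _∷_)
  open import Relation.Nullary using (Dec; yes; no; ¬_)
  open import Relation.Nullary.Decidable using (_×-dec_)
  open import Relation.Binary.PropositionalEquality
  open Int using (_*_)
  open Sums using (𝟙)
  open Field
  open PrimeField
  open Energy using (module EnergyBound)
  open Chebyshev using (InUpperHalf; inUpperHalf?; count)
  open Weights using (module Setup)
  open NatPow
  open Mono
  open Scales using (square-root)
  open Core

  count≤ : ∀ {Q : ℕ → Set} (Q? : ∀ i → Dec (Q i)) i j → count Q? i j ≤ j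
  count≤ Q? i zero = z≤n
  count≤ Q? i (suc j) with Q? i
  ... | yes _ = s≤s (count≤ Q? (suc i) j)
  ... | no _ = ℕP.m≤n⇒m≤1+n (count≤ Q? (suc i) j)

  module _ {q : ℕ} (𝔽 : ResidueField q) (N g K : ℕ) (2N<q : N ℕ.+ N < q) (1≤N : 1 ≤ N)
    (c : FiniteField.F (ResidueField.field′ 𝔽)) (c≢0 : c ≢ FiniteField.𝟎 (ResidueField.field′ 𝔽))
    (q<2^K : q < 2 ^ K) (16≤g : 16 ≤ g) (K≤g : K ≤ g) (N≤gp : N ≤ g ℕ.* count (inUpperHalf? N) 1 (N ℕ.+ N))
    (master : g ^ 344 ℕ.* q ^ 35 ≤ N ^ 36)
    (cover : ∀ n → NonZero n → n ≤ q ^ 6 → ∃ λ xs → Divisors.CoversDivisors n xs × length xs ≤ g) where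

    open ResidueField 𝔽
    open FieldTheory field′ hiding (q)
    open EnergyBound 𝔽 using (↑)

    private
      X p h : ℕ
      X = N ℕ.+ N
      p = count (inUpperHalf? N) 1 X
      h = p ℕ./ 2

      PrimeHere : ℕ → Set
      PrimeHere x = InUpperHalf N x × x ≤ X

      Solution : ℕ → ℕ → ℕ → Set
      Solution y a b = PrimeHere y × PrimeHere a × PrimeHere b × c ⊗ ↑ y ⁻¹ ⊖ ↑ y ⊖ ↑ a ≡ ↑ b

      instance
        g≢0 : NonZero g
        g≢0 = ℕ.>-nonZero (ℕP.≤-trans (s≤s z≤n) 16≤g)
        q≢0 : NonZero q
        q≢0 = ℕ.>-nonZero (ℕP.≤-trans (s≤s z≤n) 2N<q)

      4≤g : 4 ≤ g
      4≤g = ℕP.≤-trans (ℕP.m≤m+n 4 12) 16≤g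

      weaken : ∀ m n → m ≤ 344 → n ≤ 35 → g ^ m ℕ.* q ^ n ≤ N ^ 36
      weaken m n m≤ n≤ = ℕP.≤-trans (ℕP.*-mono-≤ (ℕP.^-monoʳ-≤ g m≤) (ℕP.^-monoʳ-≤ q n≤)) master

      g²<q : g ^ 2 < q
      g²<q = ℕP.≰⇒> λ q≤ → ℕP.<⇒≱ (ℕP.^-monoˡ-< 36 (ℕP.≤-<-trans (ℕP.m≤m+n N N) 2N<q))
        (ℕP.≤-trans (ℕP.≤-reflexive (monomials (q ∷ []) (v₀ ⇑ 36) (v₀ ⊙ v₀ ⇑ 35) refl))
          (ℕP.≤-trans (ℕP.*-monoˡ-≤ (q ^ 35) q≤) (weaken 2 35 (ℕP.m≤m+n 2 342) ℕP.≤-refl)))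

      Z-root : ∃ λ Z → Z ℕ.* Z ≤ q × q < suc Z ℕ.* suc Z
      Z-root = square-root q

      Z : ℕ
      Z = proj₁ Z-root

      Z²≤q : Z ℕ.* Z ≤ q
      Z²≤q = proj₁ (proj₂ Z-root)

      q<Z² : q < suc Z ℕ.* suc Z
      q<Z² = proj₂ (proj₂ Z-root)

      D-root : ∃ λ D → D ℕ.* D ≤ Z × Z < suc D ℕ.* suc D
      D-root = square-root Z

      D : ℕ
      D = proj₁ D-root

      D²≤Z : D ℕ.* D ≤ Z
      D²≤Z = proj₁ (proj₂ D-root)

      Z<D² : Z < suc D ℕ.* suc D
      Z<D² = proj₂ (proj₂ D-root)

      5≤Z : 5 ≤ Z
      5≤Z = ℕP.≰⇒> λ Z≤4 → ℕP.<⇒≱ q<Z² (ℕP.≤-trans (ℕP.*-mono-≤ (s≤s Z≤4) (s≤s Z≤4)) (ℕP.≤-trans (ℕP.≤ᵇ⇒≤ 25 (16 ^ 2) _) (ℕP.≤-trans (ℕP.^-monoˡ-≤ 2 16≤g) (ℕP.<⇒≤ g²<q))))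

      2≤D : 2 ≤ D
      2≤D = ℕP.≰⇒> λ D≤1 → ℕP.<⇒≱ Z<D² (ℕP.≤-trans (ℕP.*-mono-≤ (s≤s D≤1) (s≤s D≤1)) (ℕP.≤-trans (ℕP.m≤m+n 4 1) 5≤Z))

      Z≤N : Z ≤ N
      Z≤N = ^-cancelˡ-≤ 36 (ℕP.≤-trans (ℕP.≤-reflexive (monomials (Z ∷ []) (v₀ ⇑ 36) ((v₀ ⊙ v₀) ⇑ 18) refl)) (ℕP.≤-trans (ℕP.^-monoˡ-≤ 18 Z²≤q)
        (ℕP.≤-trans (ℕP.≤-reflexive (sym (ℕP.*-identityˡ (q ^ 18)))) (weaken 0 18 z≤n (ℕP.m≤m+n 18 17)))))

      -- Prepares `D ≤ h`: `h` is about `p / 2`, and `p` is at least `N / g`.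
      ggD≤N : g ℕ.* (g ℕ.* D) ≤ N
      ggD≤N = ^-cancelˡ-≤ 36 (ℕP.≤-trans (ℕP.≤-reflexive (monomials (g ∷ D ∷ []) ((v₀ ⊙ (v₀ ⊙ v₁)) ⇑ 36) (v₀ ⇑ 72 ⊙ ((v₁ ⊙ v₁) ⊙ (v₁ ⊙ v₁)) ⇑ 9) refl))
        (ℕP.≤-trans (ℕP.*-monoʳ-≤ (g ^ 72) (ℕP.^-monoˡ-≤ 9 (ℕP.≤-trans (square-mono D²≤Z) Z²≤q))) (weaken 72 9 (ℕP.m≤m+n 72 272) (ℕP.m≤m+n 9 26))))

      4D≤p : 4 ℕ.* D ≤ p
      4D≤p = ℕP.≤-trans (ℕP.*-monoˡ-≤ D 4≤g) (ℕP.*-cancelˡ-≤ g (ℕP.≤-trans ggD≤N N≤gp))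

      p≤2h+1 : p ≤ suc (h ℕ.+ h)
      p≤2h+1 = ℕP.≤-trans (ℕP.≤-reflexive (ℕD.m≡m%n+[m/n]*n p 2)) (ℕP.+-mono-≤ (ℕP.≤-pred (ℕD.m%n<n p 2)) (ℕP.≤-reflexive (l h)))
        where
        l : ∀ h → h ℕ.* 2 ≡ h ℕ.+ h
        l = solve-∀ℕ

      2h≤p : h ℕ.+ h ≤ p
      2h≤p = ℕP.≤-trans (ℕP.≤-reflexive (l h)) (ℕD.m/n*n≤m p 2)
        where
        l : ∀ h → h ℕ.+ h ≡ h ℕ.* 2
        l = solve-∀ℕ

      0<h : 0 < h
      0<h = ℕP.n≢0⇒n>0 λ h≡0 → ℕP.<⇒≱ {1} {8} (ℕP.m≤m+n 2 6) (ℕP.≤-trans (ℕP.*-monoʳ-≤ 4 2≤D) (ℕP.≤-trans 4D≤p (ℕP.≤-trans p≤2h+1 (ℕP.≤-reflexive (cong (λ h → suc (h ℕ.+ h)) h≡0)))))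

      p≤4h : p ≤ 4 ℕ.* h
      p≤4h = ℕP.≤-trans p≤2h+1 (ℕP.≤-trans (ℕP.+-monoˡ-≤ (h ℕ.+ h) 0<h) (ℕP.≤-trans (ℕP.m≤m+n _ h) (ℕP.≤-reflexive (l h))))
        where
        l : ∀ h → h ℕ.+ (h ℕ.+ h) ℕ.+ h ≡ 4 ℕ.* h
        l = solve-∀ℕ

      N≤4gh : N ≤ 4 ℕ.* (g ℕ.* h)
      N≤4gh = ℕP.≤-trans N≤gp (ℕP.≤-trans (ℕP.*-monoʳ-≤ g p≤4h) (ℕP.≤-reflexive (l g h)))
        where
        l : ∀ g h → g ℕ.* (4 ℕ.* h) ≡ 4 ℕ.* (g ℕ.* h)
        l = solve-∀ℕ

      D≤h : D ≤ h
      D≤h = ℕP.*-cancelˡ-≤ 4 (ℕP.≤-trans 4D≤p p≤4h)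

      h≤N : h ≤ N
      h≤N = ℕP.≮⇒≥ λ N<h → ℕP.<⇒≱ (ℕP.+-mono-< N<h N<h) (ℕP.≤-trans 2h≤p (count≤ (inUpperHalf? N) 1 X))

      module S = Setup 𝔽 N h 2N<q h≤N 1≤N c c≢0
      module R = Residues.Residues 𝔽

      absurd : ¬ (∃ λ y → y < suc X × ∃ λ a → a < suc X × ∃ λ b → b < suc X × Solution y a b) → ⊥
      absurd no-solution = CoreArgument.contradiction 𝔽 N h p Z D g K 2N<q h≤N 1≤N c c≢0 refl 2h≤p 0<h 2≤D D²≤Z Z<D² 5≤Z Z²≤q q<Z² Z≤N D≤h q<2^K 16≤g K≤g N≤gp N≤4gh master cover none
        where
        none : ∀ y → PrimeHere y → ∀ t → S.χₐ t * S.χₐ (c ⊗ ↑ y ⁻¹ ⊖ ↑ y ⊖ t) ≡ 0ℤ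
        none y here t = go (S.primeHere? (R.rep t)) (S.primeHere? (R.rep u))
          where
          u : F
          u = c ⊗ ↑ y ⁻¹ ⊖ ↑ y ⊖ t
          go : (d : Dec (PrimeHere (R.rep t))) (e : Dec (PrimeHere (R.rep u))) → 𝟙 d * 𝟙 e ≡ 0ℤ
          go (no _) _ = Int.*-zeroˡ _
          go (yes _) (no _) = Int.*-zeroʳ _
          go (yes t-here) (yes u-here) = ⊥-elim (no-solution (y , s≤s (proj₂ here) , R.rep t , s≤s (proj₂ t-here) , R.rep u , s≤s (proj₂ u-here) ,
            here , t-here , u-here , trans (cong (c ⊗ ↑ y ⁻¹ ⊖ ↑ y ⊖_) (R.↑-rep t)) (sym (R.↑-rep u))))

      -- The candidates are bounded, so existence is decidable and the argument by contradiction
      -- yields actual primes.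
      search : Dec (∃ λ y → y < suc X × ∃ λ a → a < suc X × ∃ λ b → b < suc X × Solution y a b)
      search = ℕP.anyUpTo? (λ y → ℕP.anyUpTo? (λ a → ℕP.anyUpTo? (λ b →
        S.primeHere? y ×-dec S.primeHere? a ×-dec S.primeHere? b ×-dec (c ⊗ ↑ y ⁻¹ ⊖ ↑ y ⊖ ↑ a ≟ ↑ b)) (suc X)) (suc X)) (suc X)

    solution : ∃ λ y → ∃ λ a → ∃ λ b → PrimeHere y × PrimeHere a × PrimeHere b × c ⊗ ↑ y ⁻¹ ⊖ ↑ y ⊖ ↑ a ≡ ↑ b
    solution = go search
      where
      go : Dec (∃ λ y → y < suc X × ∃ λ a → a < suc X × ∃ λ b → b < suc X × Solution y a b) → ∃ λ y → ∃ λ a → ∃ λ b → Solution y a b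
      go (yes (y , _ , a , _ , b , _ , s)) = y , a , b , s
      go (no none) = ⊥-elim (absurd none)

-- Back to the congruence and to an interval with rational end points.

module Congruence where

  open import Data.Nat as ℕ using (ℕ; suc; _≤_; _<_; z≤n; NonZero; _^_)
  import Data.Nat.Properties as ℕP
  import Data.Nat.DivMod as ℕD
  import Data.Nat.Divisibility as ℕ∣
  open import Data.Nat.Primality using (Prime; prime⇒irreducible)
  open import Data.Nat.Coprimality using (Coprime)
  open import Data.Nat.Tactic.RingSolver using () renaming (solve-∀ to solve-∀ℕ)
  open import Data.Integer as ℤ using (ℤ; +_; 0ℤ; ∣_∣)
  import Data.Integer.Properties as ℤP
  open import Data.Integer.Divisibility using (_∣_)
  open import Data.Product using (∃; _×_; _,_; proj₁; proj₂)
  open import Data.Sum using (_⊎_; inj₁; inj₂)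
  open import Relation.Nullary using (¬_)
  open import Relation.Binary.PropositionalEquality
  open import Defs
  open Field
  open PrimeField
  open Energy using (module EnergyBound)
  open Chebyshev using (InUpperHalf)
  open NatPow
  open Asymptotics
  open Existence

  -- The saving g is chosen with g ^ E ≤ q; E is opaque to keep this power from being unfolded.
  opaque
    E : ℕ
    E = 380 ℕ.* 19

    E-def : ∀ g → (g ^ 380) ^ 19 ≡ g ^ E
    E-def g = ℕP.^-*-assoc g 380 19

    E≢0 : NonZero E
    E≢0 = _

  lower-power : ∀ {a b q c d M} → 0 < b → 0 < d → 0 < q → c ≤ M ℕ.* d → LowerBound a b q c d → q ^ 37 ≤ M ^ 38
  lower-power {a} {b} {q} {c} {d} {M} 0<b 0<d 0<q c≤ lower = ^-cancelˡ-≤ b {{ℕ.>-nonZero 0<b}} (subst₂ _≤_ (sym (ℕP.^-*-assoc q 37 b)) (sym (ℕP.^-*-assoc M 38 b))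
    (ℕP.≤-trans (ℕP.^-monoʳ-≤ q {{ℕ.>-nonZero 0<q}} (ℕP.m≤m+n (37 ℕ.* b) (38 ℕ.* a)))
      (ℕP.*-cancelʳ-≤ _ _ (d ^ (38 ℕ.* b)) {{ℕP.m^n≢0 d (38 ℕ.* b) {{ℕ.>-nonZero 0<d}}}}
        (ℕP.≤-trans lower (ℕP.≤-trans (ℕP.^-monoˡ-≤ (38 ℕ.* b) c≤) (ℕP.≤-reflexive (*-^ M d (38 ℕ.* b))))))))

  module Lifting {q : ℕ} (q-prime : Prime q) (m : ℤ) (m⊥q : Coprime ∣ m ∣ q) where

    𝔽 : ResidueField q
    𝔽 = residueField q q-prime

    open ResidueField 𝔽
    open FieldTheory field′ hiding (q) public
    open EnergyBound 𝔽 using (↑; ↑≢0)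

    unit-residue : 1 < q → ι m ≢ 𝟎
    unit-residue 1<q ιm≡0 = ℕP.<⇒≢ 1<q (sym (m⊥q (subst (q ℕ∣.∣_) (cong ∣_∣ (ℤP.+-identityʳ m)) (ι-≡⇒∣ m 0ℤ (trans ιm≡0 (sym ι-0))) , ℕ∣.∣-refl)))

    lift-solution : ∀ y a b → 0 < y → y < q → ι m ⊗ ↑ y ⁻¹ ⊖ ↑ y ⊖ ↑ a ≡ ↑ b → + q ∣ + y ℤ.* (+ y ℤ.+ + a ℤ.+ + b) ℤ.- m
    lift-solution y a b 0<y y<q eq = ι-≡⇒∣ _ m (trans (ι-* (+ y) _) (trans (cong (↑ y ⊗_) (trans (ι-+ (+ y ℤ.+ + a) (+ b)) (trans (cong₂ _⊕_ (ι-+ (+ y) (+ a)) (sym eq)) (l₁ (↑ y) (↑ a) (ι m ⊗ ↑ y ⁻¹)))))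
      (trans (l₂ (↑ y) (ι m) (↑ y ⁻¹)) (trans (cong (ι m ⊗_) (⊗-inverseʳ (↑ y) (↑≢0 y 0<y y<q))) (⊗-identityʳ (ι m))))))
      where
      l₁ : ∀ y a u → y ⊕ a ⊕ (u ⊖ y ⊖ a) ≡ u
      l₁ y a u = solve 3 (λ y a u → y :+ a :+ (u :- y :- a) := u) refl y a u
      l₂ : ∀ y m i → y ⊗ (m ⊗ i) ≡ m ⊗ (y ⊗ i)
      l₂ y m i = solve 3 (λ y m i → y :* (m :* i) := m :* (y :* i)) refl y m i

  -- A prime above 2 is odd, so equality is impossible; this keeps the residues up to `2N` distinct
  -- from one another and from zero.
  twice<prime : ∀ {q n} → Prime q → 2 < q → n ℕ.+ n ≤ q → n ℕ.+ n < q
  twice<prime {q} {n} q-prime 2<q 2n≤q = ℕP.≤∧≢⇒< 2n≤q λ 2n≡q → even (prime⇒irreducible q-prime (ℕ∣.divides n (trans (sym 2n≡q) (l n))))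
    where
    l : ∀ n → n ℕ.+ n ≡ n ℕ.* 2
    l = solve-∀ℕ
    even : ¬ (2 ≡ 1 ⊎ 2 ≡ q)
    even (inj₁ ())
    even (inj₂ 2≡q) = ℕP.<⇒≢ 2<q 2≡q

  SolvableIn : (q : ℕ) (m : ℤ) (c d : ℕ) → Set
  SolvableIn q m c d = ∃ λ p₁ → ∃ λ p₂ → ∃ λ p₃ → Prime p₁ × Prime p₂ × Prime p₃ ×
    InDyadic c d p₁ × InDyadic c d p₂ × InDyadic c d p₃ × + q ∣ + p₁ ℤ.* (+ p₁ ℤ.+ + p₂ ℤ.+ + p₃) ℤ.- m

  solvable : ∀ {a b q g K} → 0 < b → 2 < q → Prime q → g ^ E ≤ q → Scale q g K → (m : ℤ) → Coprime ∣ m ∣ q →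
    (c d : ℕ) → 0 < d → LowerBound a b q c d → UpperBound q c d → SolvableIn q m c d
  solvable {a} {b} {q} {g} {K} 0<b 2<q q-prime g^E≤q (16≤g , 7K≤g , q<2^K , cover) m m⊥q c d 0<d lower upper =
    report (solution L.𝔽 N g K 2N<q 1≤N (L.ι m) (L.unit-residue (ℕP.<-trans (ℕP.n<1+n 1) 2<q)) q<2^K 16≤g
      (ℕP.≤-trans (ℕP.m≤n*m K 7) 7K≤g) (many-primes {g} {q} {N} 16≤g {K} master 1≤N 2N<q 7K≤g q<2^K) master cover)
    where
    instance
      d≢0 : NonZero d
      d≢0 = ℕ.>-nonZero 0<d
    module L = Lifting q-prime m m⊥q
    -- With `N` the integer part of `c / d`, an integer in (N, 2N] exceeds `c / d` and is at most
    -- `2 c / d`.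
    N : ℕ
    N = c ℕ./ d
    0<q : 0 < q
    0<q = ℕP.≤-trans (ℕP.m≤m+n 1 2) 2<q
    c<Nd+d : c < suc N ℕ.* d
    c<Nd+d = ℕP.≤-<-trans (ℕP.≤-reflexive (ℕD.m≡m%n+[m/n]*n c d)) (ℕP.+-monoˡ-< (N ℕ.* d) (ℕD.m%n<n c d))
    2Nd≤2c : (N ℕ.+ N) ℕ.* d ≤ 2 ℕ.* c
    2Nd≤2c = ℕP.≤-trans (ℕP.≤-reflexive (l N d)) (ℕP.*-monoʳ-≤ 2 (ℕD.m/n*n≤m c d))
      where
      l : ∀ N d → (N ℕ.+ N) ℕ.* d ≡ 2 ℕ.* (N ℕ.* d)
      l = solve-∀ℕ
    2N<q : N ℕ.+ N < q
    2N<q = twice<prime {q} {N} q-prime 2<q (ℕP.*-cancelʳ-≤ (N ℕ.+ N) q d (ℕP.≤-trans 2Nd≤2c upper))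
    lower′ : ∀ M → M ≡ suc N → q ^ 37 ≤ M ^ 38
    lower′ M eq = lower-power {a} {b} {q} {c} {d} {M} 0<b 0<d 0<q (ℕP.≤-trans (ℕP.<⇒≤ c<Nd+d) (ℕP.≤-reflexive (cong (ℕ._* d) (sym eq)))) lower
    1≤N : 1 ≤ N
    1≤N = ℕP.n≢0⇒n>0 λ N≡0 → ℕP.<⇒≱ {1} {q ^ 37} (ℕP.<-≤-trans (ℕP.<-trans (ℕP.n<1+n 1) 2<q) (ℕP.m≤m*n q (q ^ 36) {{ℕP.m^n≢0 q 36 {{ℕ.>-nonZero 0<q}}}}))
      (ℕP.≤-trans (lower′ 1 (cong suc (sym N≡0))) (ℕP.≤-reflexive (ℕP.^-zeroˡ 38)))
    in-dyadic : ∀ {x} → InUpperHalf N x × x ≤ N ℕ.+ N → InDyadic c d x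
    in-dyadic ((N<x , _) , x≤2N) = ℕP.<-≤-trans c<Nd+d (ℕP.*-monoˡ-≤ d N<x) , ℕP.≤-trans (ℕP.*-monoˡ-≤ d x≤2N) 2Nd≤2c
    master : g ^ 344 ℕ.* q ^ 35 ≤ N ^ 36
    master = master-inequality {g} {q} {N} 16≤g {suc N} (ℕP.≤-trans (ℕP.+-monoˡ-≤ N 1≤N) (ℕP.≤-trans (ℕP.≤-reflexive (cong (N ℕ.+_) (sym (ℕP.+-identityʳ N)))) (ℕP.*-monoˡ-≤ N (ℕP.≤-trans (ℕP.m≤m+n 2 14) 16≤g))))
      (ℕP.≤-trans (ℕP.≤-reflexive (E-def g)) g^E≤q) (lower′ (suc N) refl)
    report : _ → SolvableIn q m c d
    report (y , s , t , y-here , s-here , t-here , eq) = y , s , t , proj₂ (proj₁ y-here) , proj₂ (proj₁ s-here) , proj₂ (proj₁ t-here) ,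
      in-dyadic y-here , in-dyadic s-here , in-dyadic t-here ,
      L.lift-solution y s t (ℕP.≤-<-trans z≤n (proj₁ (proj₁ y-here))) (ℕP.≤-<-trans (proj₂ y-here) 2N<q) eq

open import Defs
open import Data.Nat using (ℕ; _≤_; _<_)
open import Data.Nat.Primality using (Prime)
open import Data.Nat.Coprimality using (Coprime)
open import Data.Integer using (ℤ; +_; _-_; ∣_∣) renaming (_*_ to _*ℤ_; _+_ to _+ℤ_)
open import Data.Integer.Divisibility using (_∣_)
open import Data.Product using (Σ; ∃; _×_; _,_; proj₁; proj₂)
import Data.Nat as ℕ
import Data.Nat.Properties as ℕP
open Asymptotics using (scale)
open Congruence using (E; E≢0; solvable)

theorem2 : (a b : ℕ) → EpsOK a b →
  ∃ λ (q₀ : ℕ) → (q : ℕ) → q₀ ≤ q → Prime q →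
    (m : ℤ) → Coprime ∣ m ∣ q →
    (c d : ℕ) → 0 < d → LowerBound a b q c d → UpperBound q c d →
    Σ ℕ λ p₁ → Σ ℕ λ p₂ → Σ ℕ λ p₃ →
      Prime p₁ × Prime p₂ × Prime p₃ ×
      InDyadic c d p₁ × InDyadic c d p₂ × InDyadic c d p₃ ×
      (+ q) ∣ ((+ p₁) *ℤ ((+ p₁) +ℤ (+ p₂) +ℤ (+ p₃)) - m)
-- The 3 ensures `q > 2`, so that `q` is odd.
theorem2 a b (_ , 100a<b) = 3 ℕ.+ proj₁ scales , λ q large q-prime →
  let g , K , g^E≤q , sc = proj₂ scales q (ℕP.≤-trans (ℕP.m≤n+m (proj₁ scales) 3) large)
  in solvable {a} {b} {q} {g} {K} (ℕP.≤-<-trans ℕ.z≤n 100a<b) (ℕP.≤-trans (ℕP.m≤m+n 3 (proj₁ scales)) large) q-prime g^E≤q sc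
  where
  scales = scale E {{E≢0}}
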